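{- Let $a,b,c$ be nonnegative integers with $a\ge b$ such that $(a,b,1^c)$ is a partition (so $b\ge1$ or $c=0$), and let $N=a+b+c\ge 1$. For a partition $\lambda\vdash N$ with $p=\ell(\lambda)$ parts, let $\mathcal{T}_\lambda$ be the set of column-strict tableaux of shape $(a,b,1^c)$ and type $\lambda$, where entry $p-i+1$ occurs $\lambda_i$ times. For $T\in\mathcal{T}_\lambda$ and $1\le i\le p$, let $a_i$, $b_i$, $c_i$ be the numbers of entries equal to $p-i+1$ in the first row, in the second row, and in the first column below the second row, respectively, and set $\overline{a}_i=a-\sum_{j=1}^i a_j$, $\overline{b}_i=b-\sum_{j=1}^i b_j$, $\overline{c}_i=c-\sum_{j=1}^i c_j$ (so $\overline a_0=a$, etc.). Write \[ W(T)=\prod_{i=1}^{p}\left\langle {\overline{a}_{i-1}-\overline{b}_{i-1}\atop a_i}\right\rangle\left[ {\overline{a}_{i-1}-\overline{b}_{i}\atop b_i}\right] R\big(\overline{a}_{i},\overline{a}_{i-1},\overline{b}_{i},\overline{b}_{i-1},\overline{c}_{i-1}\big)^{c_i}. \] Then \[ Q_{(a,b,1^c)}=\frac{\binom{2a-2b}{a-b}}{4^{a-b}(1+c)}\sum_{\lambda\vdash N} m_\lambda\sum_{T\in\mathcal{T}_\lambda}W(T),\qquad P_{(a,b,1^c)}=f(a,b,c)\sum_{\lambda\vdash N} m_\lambda\sum_{T\in\mathcal{T}_\lambda}W(T), \] where $f(a,b,c)=\dfrac{(2a+c+1)(2b+c)}{(2a+c)(2b+c-1)\left[ {a-1\atop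 b-1}\right]}$ if $b\neq 0$ and $f(a,b,c)=1$ if $b=0$.
   Context: $m_\lambda$ is the monomial symmetric function. For a partition $\lambda$ and a box $s$ of its Young diagram, $a(s)$ (arm length) and $l(s)$ (leg length) are the numbers of boxes to the east and to the south of $s$. Let $Z_\lambda$ be the zonal polynomial, i.e. the integral-form Jack symmetric function $J_\lambda(x;\alpha)$ at $\alpha=2$. Set $c_\lambda=\prod_{s\in\lambda}(2a(s)+l(s)+1)$, $c'_\lambda=\prod_{s\in\lambda}(2(1+a(s))+l(s))$, $P_\lambda=Z_\lambda/c_\lambda$ and $Q_\lambda=Z_\lambda/c'_\lambda$ (the Jack $P$ and $Q$ functions at $\alpha=2$). For integers $x,y$: $\left\langle {x\atop y}\right\rangle=\binom{x}{y}^2/\binom{2x}{2y}$ and $\left[ {x\atop y}\right]=\binom{x}{y}^2/\binom{2x+1}{2y}$ if $0\le y\le x$, and $0$ otherwise. $R(x,y,z,t,w)=\dfrac{(2x+w)(2y+w)(2z+w-1)(2t+w-1)}{(2x+w-1)(2y+w+1)(2z+w-2)(2t+w)}$, with a factor raised to the power $0$ taken to be $1$. -}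

module Defs where

open import Data.Nat as ℕ using (ℕ; zero; suc; _≤ᵇ_; _<ᵇ_; _≡ᵇ_; _∸_; _^_)
open import Data.Nat.Combinatorics using (_C_)
open import Data.Nat using (_!)
open import Data.Integer as ℤ using (ℤ; +_; -[1+_]; _⊖_)
open import Data.Rational as ℚ using (ℚ; 0ℚ; 1ℚ; _/_; ↥_; ↧_)
open import Data.Nat.ListAction as NL using ()
open import Data.List as L using (List; []; _∷_; length; map; filterᵇ; replicate; upTo; foldr; concatMap; take; _++_)
open import Data.Bool using (Bool; true; false; _∧_; if_then_else_; not)
open import Data.Product using (_×_; _,_)
open import Relation.Binary.PropositionalEquality using (_≡_)

lists : ℕ → List ℕ → List (List ℕ)
lists zero    xs = [] ∷ []
lists (suc n) xs = concatMap (λ x → map (x ∷_) (lists n xs)) xs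

allB : {A : Set} → (A → Bool) → List A → Bool
allB p xs = foldr (λ x acc → p x ∧ acc) true xs

range1 : ℕ → List ℕ
range1 p = map suc (upTo p)

at : List ℕ → ℕ → ℕ
at []       _       = 0
at (x ∷ _)  zero    = x
at (_ ∷ xs) (suc i) = at xs i

cnt : ℕ → List ℕ → ℕ
cnt v xs = length (filterᵇ (λ x → x ≡ᵇ v) xs)

listEq : List ℕ → List ℕ → Bool
listEq []       []       = true
listEq (x ∷ xs) (y ∷ ys) = (x ≡ᵇ y) ∧ listEq xs ys
listEq _        _        = false

weaklyDec : List ℕ → Bool
weaklyDec (x ∷ y ∷ xs) = (y ≤ᵇ x) ∧ weaklyDec (y ∷ xs)
weaklyDec _            = true

weaklyInc : List ℕ → Bool
weaklyInc (x ∷ y ∷ xs) = (x ≤ᵇ y) ∧ weaklyInc (y ∷ xs)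
weaklyInc _            = true

strictlyInc : List ℕ → Bool
strictlyInc (x ∷ y ∷ xs) = (x <ᵇ y) ∧ strictlyInc (y ∷ xs)
strictlyInc _            = true

ℕtoℚ : ℕ → ℚ
ℕtoℚ n = + n / 1

-- n / d for integers, with the (never used) convention x/0 = 0
divZ : ℤ → ℤ → ℚ
divZ n (+ zero)   = 0ℚ
divZ n (+ suc k)  = n / suc k
divZ n -[1+ k ]   = (ℤ.- n) / suc k

-- p / q for rationals, with the (never used) convention x/0 = 0
divQ : ℚ → ℚ → ℚ
divQ p q = p ℚ.* divZ (↧ q) (↥ q)

sumQ : {A : Set} → List A → (A → ℚ) → ℚ
sumQ xs f = foldr (λ x acc → f x ℚ.+ acc) 0ℚ xs

prodQ : {A : Set} → List A → (A → ℚ) → ℚ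
prodQ xs f = foldr (λ x acc → f x ℚ.* acc) 1ℚ xs

powQ : ℚ → ℕ → ℚ
powQ r zero    = 1ℚ
powQ r (suc k) = r ℚ.* powQ r k

isPar : ℕ → List ℕ → Bool
isPar N μ = weaklyDec μ ∧ allB (λ x → 1 ≤ᵇ x) μ ∧ (NL.sum μ ≡ᵇ N)

partitions : ℕ → List (List ℕ)
partitions N = filterᵇ (isPar N) (concatMap (λ k → lists k (upTo (suc N))) (upTo (suc N)))

dom : List ℕ → List ℕ → Bool
dom μ lam = allB (λ k → NL.sum (take k μ) ≤ᵇ NL.sum (take k lam)) (upTo (suc (NL.sum μ ℕ.+ NL.sum lam)))

sdom : List ℕ → List ℕ → Bool
sdom μ lam = dom μ lam ∧ not (listEq μ lam)

-- conjugate part λ'_(j+1) = #{ i : λ_i > j }  (0-indexed column j)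
conjAt : List ℕ → ℕ → ℕ
conjAt lam j = length (filterᵇ (λ x → j <ᵇ x) lam)

-- ∏_{s ∈ λ} g(a(s), l(s)) with a = arm, l = leg
hookProd : (ℕ → ℕ → ℕ) → List ℕ → ℕ
hookProd g lam =
  NL.product (map (λ i → NL.product (map (λ j → g (at lam i ∸ j ∸ 1) (conjAt lam j ∸ i ∸ 1))
                                       (upTo (at lam i))))
                 (upTo (length lam)))

cLam : List ℕ → ℕ
cLam = hookProd (λ a l → 2 ℕ.* a ℕ.+ l ℕ.+ 1)

c'Lam : List ℕ → ℕ
c'Lam = hookProd (λ a l → 2 ℕ.* (1 ℕ.+ a) ℕ.+ l)

fiberSum : List ℕ → List ℕ → ℕ → ℕ
fiberSum (r ∷ ρ) (x ∷ f) i = (if x ≡ᵇ i then r else 0) ℕ.+ fiberSum ρ f i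
fiberSum _       _       i = 0

-- coefficient of m_μ in p_ρ  (= coefficient of x^μ in ∏_j Σ_i x_i^{ρ_j})
pmCoeff : List ℕ → List ℕ → ℕ
pmCoeff ρ μ = length (filterᵇ (λ f → allB (λ i → fiberSum ρ f i ≡ᵇ at μ (i ∸ 1)) (range1 (length μ)))
                              (lists (length ρ) (range1 (length μ))))

zee : List ℕ → ℕ
zee ρ = NL.product (map (λ i → (i ^ cnt i ρ) ℕ.* (cnt i ρ) !) (range1 (NL.sum ρ)))

-- A symmetric function of degree N is given by its power-sum coordinates
-- q : (partition of N) → ℚ, i.e.  f = Σ_{ρ ⊢ N} q ρ p_ρ.
-- Its coefficient of m_μ:
mCoeff : ℕ → (List ℕ → ℚ) → List ℕ → ℚ
mCoeff N q μ = sumQ (partitions N) (λ ρ → q ρ ℚ.* ℕtoℚ (pmCoeff ρ μ))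

-- ⟨f, g⟩_α at α = 2:  ⟨p_ρ, p_σ⟩ = δ_{ρσ} z_ρ 2^{ℓ(ρ)}
inner2 : ℕ → (List ℕ → ℚ) → (List ℕ → ℚ) → ℚ
inner2 N q d = sumQ (partitions N) (λ ρ → q ρ ℚ.* d ρ ℚ.* ℕtoℚ (zee ρ ℕ.* 2 ^ length ρ))

-- Macdonald's characterisation of the Jack function P_λ (α = 2), lam ⊢ N:
--  (i)  P_λ = m_λ + Σ_{μ ◁ λ} u_{λμ} m_μ,
--  (ii) P_λ is orthogonal to every P_μ with μ ◁ λ, equivalently to every
--       element of span{ m_μ : μ ◁ lam }.
IsJackP2 : ℕ → List ℕ → (List ℕ → ℚ) → Set
IsJackP2 N lam q =
  (mCoeff N q lam ≡ 1ℚ)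
  × (∀ μ → isPar N μ ≡ true → dom μ lam ≡ false → mCoeff N q μ ≡ 0ℚ)
  × (∀ (d : List ℕ → ℚ) →
       (∀ ν → isPar N ν ≡ true → sdom ν lam ≡ false → mCoeff N d ν ≡ 0ℚ) →
       inner2 N q d ≡ 0ℚ)

shape : ℕ → ℕ → ℕ → List ℕ
shape a zero    c = a ∷ []
shape a (suc b) c = a ∷ suc b ∷ replicate c 1

angle : ℤ → ℤ → ℚ
angle (+ m) (+ n) = if n ≤ᵇ m then divZ (+ ((m C n) ℕ.* (m C n))) (+ ((2 ℕ.* m) C (2 ℕ.* n))) else 0ℚ
angle _     _     = 0ℚ

square : ℤ → ℤ → ℚ
square (+ m) (+ n) = if n ≤ᵇ m then divZ (+ ((m C n) ℕ.* (m C n))) (+ ((2 ℕ.* m ℕ.+ 1) C (2 ℕ.* n))) else 0ℚ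
square _     _     = 0ℚ

RR : ℤ → ℤ → ℤ → ℤ → ℤ → ℚ
RR x y z t w =
  divZ ((+ 2 ℤ.* x ℤ.+ w) ℤ.* (+ 2 ℤ.* y ℤ.+ w) ℤ.* (+ 2 ℤ.* z ℤ.+ w ℤ.- + 1) ℤ.* (+ 2 ℤ.* t ℤ.+ w ℤ.- + 1))
       ((+ 2 ℤ.* x ℤ.+ w ℤ.- + 1) ℤ.* (+ 2 ℤ.* y ℤ.+ w ℤ.+ + 1) ℤ.* (+ 2 ℤ.* z ℤ.+ w ℤ.- + 2) ℤ.* (+ 2 ℤ.* t ℤ.+ w))

-- A filling: (first row, second row, first column below the second row),
-- each read left-to-right / top-to-bottom.
Filling : Set
Filling = List ℕ × List ℕ × List ℕ

-- column-strict (rows weakly increasing, columns strictly increasing) of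
-- shape (a,b,1^c) and type μ (p = ℓ(μ); entry p-i+1 occurs μ_i times)
isTab : ℕ → ℕ → ℕ → List ℕ → Filling → Bool
isTab a b c μ (r1 , r2 , cl) =
  (length r1 ≡ᵇ a) ∧ (length r2 ≡ᵇ b) ∧ (length cl ≡ᵇ c)
  ∧ weaklyInc r1 ∧ weaklyInc r2
  ∧ allB (λ j → at r1 j <ᵇ at r2 j) (upTo b)
  ∧ strictlyInc (take 1 r1 ++ take 1 r2 ++ cl)
  ∧ allB (λ k → cnt k (r1 ++ r2 ++ cl) ≡ᵇ at μ (length μ ∸ k)) (range1 (length μ))

tableaux : ℕ → ℕ → ℕ → List ℕ → List Filling
tableaux a b c μ =
  filterᵇ (isTab a b c μ)
    (concatMap (λ r1 → concatMap (λ r2 → map (λ cl → (r1 , r2 , cl))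
                                              (lists c (range1 (length μ))))
                                 (lists b (range1 (length μ))))
               (lists a (range1 (length μ))))

weight : ℕ → ℕ → ℕ → List ℕ → Filling → ℚ
weight a b c μ (r1 , r2 , cl) = prodQ (range1 p) factor
  where
  p = length μ
  val : ℕ → ℕ
  val i = suc (p ∸ i)
  ai bi ci : ℕ → ℕ
  ai i = cnt (val i) r1
  bi i = cnt (val i) r2
  ci i = cnt (val i) cl
  partial : (ℕ → ℕ) → ℕ → ℕ
  partial g i = NL.sum (map g (range1 i))
  abar bbar cbar : ℕ → ℤ
  abar i = a ⊖ partial ai i
  bbar i = b ⊖ partial bi i
  cbar i = c ⊖ partial ci i
  factor : ℕ → ℚ
  factor i = angle (abar (i ∸ 1) ℤ.- bbar (i ∸ 1)) (+ ai i)
             ℚ.* square (abar (i ∸ 1) ℤ.- bbar i) (+ bi i)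
             ℚ.* powQ (RR (abar i) (abar (i ∸ 1)) (bbar i) (bbar (i ∸ 1)) (cbar (i ∸ 1))) (ci i)

tabSum : ℕ → ℕ → ℕ → List ℕ → ℚ
tabSum a b c μ = sumQ (tableaux a b c μ) (weight a b c μ)

qPref : ℕ → ℕ → ℕ → ℚ
qPref a b c = divZ (+ ((2 ℕ.* (a ∸ b)) C (a ∸ b))) (+ (4 ^ (a ∸ b) ℕ.* (1 ℕ.+ c)))

fPref : ℕ → ℕ → ℕ → ℚ
fPref a zero    c = 1ℚ
fPref a (suc b) c =
  divQ (divZ (+ ((2 ℕ.* a ℕ.+ c ℕ.+ 1) ℕ.* (2 ℕ.* suc b ℕ.+ c)))
             (+ ((2 ℕ.* a ℕ.+ c) ℕ.* (2 ℕ.* suc b ℕ.+ c ∸ 1))))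
       (square (+ (a ∸ 1)) (+ b))

-- coefficient of m_μ in Q_λ = (c_λ / c'_λ) P_λ, where P_λ has power-sum coordinates q
qCoeff : ℕ → List ℕ → (List ℕ → ℚ) → List ℕ → ℚ
qCoeff N lam q μ = divZ (+ cLam lam) (+ c'Lam lam) ℚ.* mCoeff N q μ

{-# OPTIONS --safe #-}

-- Remove the boxes holding the largest entry of a tableau: the tableau sums F of a shape (a , b , 1^c), recorded by its
-- size and (b , c), satisfy a branching recursion whose coefficients α are products of γ_n = binom(2n,n) / 4^n and the
-- factors R.  The same coefficients govern a Pieri rule for explicit polynomials S_(b,c)(u , v , w); its coefficient
-- identities come down to Adams' formula for products of Legendre polynomials and partial fractions.  Consequently
--   e_C g_A g_B = Σ_(b,c) [u^A v^B w^C] S_(b,c) · Σ_μ F_(b,c)(μ) m_μ,   Σ_n g_n t^n = ∏_i (1 - x_i t)^(-1/2).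
-- Inverting this triangular system, and expanding e_C in products of the g_n, writes the symmetric function with
-- coefficients F as a combination of g_ν with ν not strictly below (a , b , 1^c) in dominance order.  The g_ν are dual
-- to the m_ν (Cauchy identity), which is the required orthogonality.  The recursion also shows that F is triangular and
-- gives its leading coefficient 1/f, and the hook products turn f into the prefactor of Q.  Finally P is unique because
-- the inner product is positive definite.
module Submission where

open import Defs
open import Data.Nat as N using (ℕ; zero; suc; z≤n; s≤s; _∸_)
import Data.Nat.Properties as NP
import Data.Nat.Combinatorics as NC
import Data.Nat.DivMod as ND
open import Data.Nat.Induction using (<-rec)
open import Data.Integer as I using (ℤ; +_; -[1+_])
import Data.Integer.Properties as IP
import Data.Integer.Tactic.RingSolver as IR
import Data.Nat.Tactic.RingSolver as NR
open import Data.Rational as ℚ using (ℚ; 0ℚ; 1ℚ; _+_; _*_; _-_; -_; _/_)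
import Data.Rational.Properties as QP
import Data.Rational.Unnormalised as ℚᵘ
import Data.Rational.Unnormalised.Properties as ℚᵘP
open import Data.List using (List; []; _∷_; map; concatMap; filterᵇ; upTo; applyUpTo; _++_; length; replicate; take; drop)
import Data.List.Properties as LP
import Data.Nat.ListAction as NL
open import Data.List.Relation.Unary.All using (All; []; _∷_)
import Data.List.Relation.Binary.Permutation.Propositional as Perm
open Perm using (_↭_)
import Data.List.Relation.Binary.Permutation.Propositional.Properties as PermP
import Data.Nat.ListAction.Properties as NLP
import Data.Bool
import Data.Bool.Properties as BP
open import Data.Bool using (Bool; true; false; if_then_else_; _∧_; not)
open import Data.Product using (Σ; _×_; _,_; proj₁; proj₂)
open import Data.Sum using (_⊎_; inj₁; inj₂)
open import Data.Empty using (⊥; ⊥-elim)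
open import Data.Unit using (⊤; tt)
open import Function using (_∘_; id)
open import Relation.Binary.Definitions using (Tri; tri<; tri≈; tri>)
open import Relation.Nullary using (¬_; Dec; yes; no)
open import Relation.Nullary.Decidable using (dec⇒maybe)
open import Relation.Binary.PropositionalEquality using (_≡_; _≢_; refl; sym; trans; cong; cong₂; subst; module ≡-Reasoning)
open import Tactic.RingSolver using (solve-∀)
open import Tactic.RingSolver.Core.AlmostCommutativeRing using (AlmostCommutativeRing; fromCommutativeRing)
open import Level using (0ℓ)
open ≡-Reasoning

-- Rational arithmetic and finite sums

-- The substitution p_r -> u^r + v^r + 2 (-1)^(r-1) w^r turns the Cauchy kernel ∏ (1 - x_i
-- y_j)^(-1/2) into ∏_i (1 + x_i w) ((1 - x_i u) (1 - x_i v))^(-1/2), whose coefficients are the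
-- products e_C g_A g_B. The polynomials S are, up to scalars, what zonal polynomials of shape (a ,
-- b , 1^c) should become: two ordinary variables for the two rows and an odd one for the column.
-- They enter only as explicit formulas. Once w^c is split off they have degree at most 2 in w, with
-- the Legendre polynomials P_n(u , v) = Σ γ_i γ_(n-i) u^i v^(n-i) as building blocks, which is why
-- Adams' formula carries the Pieri rule. It settles the lowest power of w alone and the highest
-- after one cancellation; the two in between need identities of rational functions. The obstacle is
-- the one-row shapes: there the factor h(2b + c - 1) is h(-1) = 0, so it cannot be divided out,
-- although the same zero is what keeps a column from growing under an empty second row.

ring : AlmostCommutativeRing 0ℓ 0ℓ
ring = fromCommutativeRing QP.+-*-commutativeRing (λ x → dec⇒maybe (0ℚ ℚ.≟ x))

2ℚ 3ℚ : ℚ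
2ℚ = 1ℚ + 1ℚ
3ℚ = 2ℚ + 1ℚ

abstract
  -- Kept abstract so that fractions stay symbolic: only the homomorphism laws of `ι` and the
  -- inverse law `ρ-inv` are visible later.
  ι : ℤ → ℚ
  ι z = z / 1

  ι-ℕtoℚ : ∀ n → ℕtoℚ n ≡ ι (+ n)
  ι-ℕtoℚ n = refl

  private
    toℚᵘ-ι : ∀ z → ℚ.toℚᵘ (ι z) ℚᵘ.≃ ℚᵘ.mkℚᵘ z 0
    toℚᵘ-ι z = QP.toℚᵘ-fromℚᵘ (ℚᵘ.mkℚᵘ z 0)

  ι-+ : ∀ x y → ι (x I.+ y) ≡ ι x + ι y
  ι-+ x y = QP.toℚᵘ-injective
    (ℚᵘP.≃-trans (toℚᵘ-ι (x I.+ y))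
    (ℚᵘP.≃-trans (ℚᵘ.*≡* (cong₂ I._*_ (sym (cong₂ I._+_ (IP.*-identityʳ x) (IP.*-identityʳ y))) refl))
    (ℚᵘP.≃-sym (ℚᵘP.≃-trans (QP.toℚᵘ-homo-+ (ι x) (ι y))
                           (ℚᵘP.+-cong (toℚᵘ-ι x) (toℚᵘ-ι y))))))

  ι-* : ∀ x y → ι (x I.* y) ≡ ι x * ι y
  ι-* x y = QP.toℚᵘ-injective
    (ℚᵘP.≃-trans (toℚᵘ-ι (x I.* y))
    (ℚᵘP.≃-sym (ℚᵘP.≃-trans (QP.toℚᵘ-homo-* (ι x) (ι y))
                           (ℚᵘP.*-cong (toℚᵘ-ι x) (toℚᵘ-ι y)))))

  ι-0 : ι (+ 0) ≡ 0ℚ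
  ι-0 = refl

  ι-1 : ι (+ 1) ≡ 1ℚ
  ι-1 = refl

  -- ρ z is 1/z, with ρ 0 = 0.
  ρ : ℤ → ℚ
  ρ z = divZ (+ 1) z

  /-mul : ∀ n d .{{_ : N.NonZero d}} → (n / d) * ι (+ d) ≡ ι n
  /-mul n (suc d) = QP.toℚᵘ-injective
    (ℚᵘP.≃-trans (QP.toℚᵘ-homo-* (n / suc d) (ι (+ suc d)))
    (ℚᵘP.≃-trans (ℚᵘP.*-cong (QP.toℚᵘ-fromℚᵘ (ℚᵘ.mkℚᵘ n d)) (toℚᵘ-ι (+ suc d)))
    (ℚᵘP.≃-trans (ℚᵘ.*≡* (trans (IP.*-identityʳ _) (cong (λ k → n I.* + suc k) (sym (NP.*-identityʳ d)))))
                 (ℚᵘP.≃-sym (toℚᵘ-ι n)))))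

  ρ-inv : ∀ z → z ≢ + 0 → ι z * ρ z ≡ 1ℚ
  ρ-inv (+ zero) z≢0 = ⊥-elim (z≢0 refl)
  ρ-inv (+ suc n) _ = trans (QP.*-comm (ι (+ suc n)) _) (/-mul (+ 1) (suc n))
  ρ-inv -[1+ n ] _ = begin
    ι -[1+ n ] * ((I.- + 1) / suc n)               ≡⟨ cong (_* ((I.- + 1) / suc n)) (trans (cong ι (trans (sym (IP.-1*i≡-i (+ suc n))) (IP.*-comm (I.- + 1) (+ suc n)))) (ι-* (+ suc n) (I.- + 1))) ⟩
    (ι (+ suc n) * ι (I.- + 1)) * ((I.- + 1) / suc n) ≡⟨ shuffle (ι (+ suc n)) (ι (I.- + 1)) _ ⟩
    ι (I.- + 1) * (((I.- + 1) / suc n) * ι (+ suc n)) ≡⟨ cong (ι (I.- + 1) *_) (/-mul (I.- + 1) (suc n)) ⟩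
    ι (I.- + 1) * ι (I.- + 1) ∎
    where
    shuffle : ∀ x y z → (x * y) * z ≡ y * (z * x)
    shuffle = solve-∀ ring

  divZ-ρ : ∀ n d → divZ n d ≡ ι n * ρ d
  divZ-ρ n (+ zero) = sym (QP.*-zeroʳ (ι n))
  divZ-ρ n (+ suc d) = begin
    n / suc d                                    ≡⟨ sym (QP.*-identityʳ _) ⟩
    (n / suc d) * 1ℚ                             ≡⟨ cong ((n / suc d) *_) (sym (ρ-inv (+ suc d) λ ())) ⟩
    (n / suc d) * (ι (+ suc d) * ρ (+ suc d))    ≡⟨ sym (QP.*-assoc (n / suc d) _ _) ⟩
    (n / suc d) * ι (+ suc d) * ρ (+ suc d)      ≡⟨ cong (_* ρ (+ suc d)) (/-mul n (suc d)) ⟩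
    ι n * ρ (+ suc d) ∎
  divZ-ρ n -[1+ d ] = begin
    (I.- n) / suc d                              ≡⟨ divZ-ρ (I.- n) (+ suc d) ⟩
    ι (I.- n) * ρ (+ suc d)                      ≡⟨ cong (λ m → ι m * ρ (+ suc d)) (sym (IP.-1*i≡-i n)) ⟩
    ι ((I.- + 1) I.* n) * ρ (+ suc d)            ≡⟨ cong (_* ρ (+ suc d)) (ι-* (I.- + 1) n) ⟩
    ι (I.- + 1) * ι n * ρ (+ suc d)              ≡⟨ shuffle (ι (I.- + 1)) (ι n) _ ⟩
    ι n * (ι (I.- + 1) * ρ (+ suc d))            ≡⟨ cong (ι n *_) (sym (divZ-ρ (I.- + 1) (+ suc d))) ⟩
    ι n * ρ -[1+ d ] ∎
    where
    shuffle : ∀ x y z → x * y * z ≡ y * (x * z)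
    shuffle = solve-∀ ring

ι-neg : ∀ x → ι (I.- x) ≡ - ι x
ι-neg x = begin
  ι (I.- x)                   ≡⟨ lem (ι x) (ι (I.- x)) ⟩
  (ι x + ι (I.- x)) - ι x     ≡⟨ cong (_- ι x) (trans (sym (ι-+ x (I.- x))) (trans (cong ι (IP.+-inverseʳ x)) ι-0)) ⟩
  0ℚ - ι x                    ≡⟨ QP.+-identityˡ _ ⟩
  - ι x ∎
  where
  lem : ∀ x y → y ≡ (x + y) - x
  lem = solve-∀ ring

ι-sub : ∀ x y → ι (x I.- y) ≡ ι x - ι y
ι-sub x y = trans (ι-+ x (I.- y)) (cong (λ t → ι x + t) (ι-neg y))

ι-2* : ∀ x → ι (+ 2 I.* x) ≡ 2ℚ * ι x
ι-2* x = trans (ι-* (+ 2) x) (cong (_* ι x) (trans (ι-+ (+ 1) (+ 1)) (cong₂ _+_ ι-1 ι-1)))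

ι-suc : ∀ n → ι (+ suc n) ≡ ι (+ n) + 1ℚ
ι-suc n = trans (ι-+ (+ 1) (+ n)) (trans (cong (_+ ι (+ n)) ι-1) (QP.+-comm 1ℚ (ι (+ n))))

ι-cancel : ∀ z {x y} → z ≢ + 0 → ι z * x ≡ ι z * y → x ≡ y
ι-cancel z {x} {y} z≢0 e = begin
  x                   ≡⟨ back x ⟩
  ρ z * (ι z * x)     ≡⟨ cong (ρ z *_) e ⟩
  ρ z * (ι z * y)     ≡⟨ sym (back y) ⟩
  y ∎
  where
  assoc : ∀ a b c → (a * b) * c ≡ b * (a * c)
  assoc = solve-∀ ring
  back : ∀ w → w ≡ ρ z * (ι z * w)
  back w = trans (sym (QP.*-identityˡ w)) (trans (cong (_* w) (sym (ρ-inv z z≢0))) (assoc (ι z) (ρ z) w))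

-- Scheme for proofs by linear combination: `X` is written as `Y` plus multiples of differences
-- known to vanish. The ring solver checks the expansion, and `lc+`, `lc1` and `diff0` discharge the
-- remainder.
by-lc : ∀ {X Y e} → X ≡ Y + e → e ≡ 0ℚ → X ≡ Y
by-lc {X} {Y} p refl = trans p (QP.+-identityʳ Y)

diff0 : ∀ {x y} → x ≡ y → x - y ≡ 0ℚ
diff0 {x} refl = QP.+-inverseʳ x

lc1 : ∀ {c x} → x ≡ 0ℚ → c * x ≡ 0ℚ
lc1 {c} refl = QP.*-zeroʳ c

lc+ : ∀ {c x s} → x ≡ 0ℚ → s ≡ 0ℚ → c * x + s ≡ 0ℚ
lc+ {c} refl refl = trans (QP.+-identityʳ _) (QP.*-zeroʳ c)

∑ : ℕ → (ℕ → ℚ) → ℚ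
∑ zero    f = 0ℚ
∑ (suc n) f = f 0 + ∑ n (f ∘ suc)

∑-cong< : ∀ n {f g} → (∀ i → i N.< n → f i ≡ g i) → ∑ n f ≡ ∑ n g
∑-cong< zero    e = refl
∑-cong< (suc n) e = cong₂ _+_ (e 0 (s≤s z≤n)) (∑-cong< n (λ i i<n → e (suc i) (s≤s i<n)))

∑-cong : ∀ n {f g} → (∀ i → f i ≡ g i) → ∑ n f ≡ ∑ n g
∑-cong n e = ∑-cong< n (λ i _ → e i)

∑-0 : ∀ n {f} → (∀ i → i N.< n → f i ≡ 0ℚ) → ∑ n f ≡ 0ℚ
∑-0 zero    e = refl
∑-0 (suc n) e = trans (cong₂ _+_ (e 0 (s≤s z≤n)) (∑-0 n (λ i i<n → e (suc i) (s≤s i<n)))) (QP.+-identityˡ 0ℚ)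

interchange : ∀ a b c d → (a + b) + (c + d) ≡ (a + c) + (b + d)
interchange = solve-∀ ring

∑-+ : ∀ n {f g} → ∑ n (λ i → f i + g i) ≡ ∑ n f + ∑ n g
∑-+ zero    = sym (QP.+-identityˡ 0ℚ)
∑-+ (suc n) {f} {g} = trans (cong (λ t → f 0 + g 0 + t) (∑-+ n)) (interchange (f 0) (g 0) (∑ n (f ∘ suc)) (∑ n (g ∘ suc)))

∑-*ˡ : ∀ n c {f} → ∑ n (λ i → c * f i) ≡ c * ∑ n f
∑-*ˡ zero    c = sym (QP.*-zeroʳ c)
∑-*ˡ (suc n) c {f} = trans (cong (λ t → c * f 0 + t) (∑-*ˡ n c)) (sym (QP.*-distribˡ-+ c (f 0) _))

∑-*ʳ : ∀ n c {f} → ∑ n (λ i → f i * c) ≡ ∑ n f * c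
∑-*ʳ n c {f} = trans (∑-cong n (λ i → QP.*-comm (f i) c)) (trans (∑-*ˡ n c) (QP.*-comm c _))

∑-last : ∀ n {f} → ∑ (suc n) f ≡ ∑ n f + f n
∑-last zero    {f} = QP.+-comm (f 0) 0ℚ
∑-last (suc n) {f} = trans (cong (λ t → f 0 + t) (∑-last n {f ∘ suc})) (sym (QP.+-assoc (f 0) _ _))

∑-swap : ∀ m n {f : ℕ → ℕ → ℚ} → ∑ m (λ i → ∑ n (f i)) ≡ ∑ n (λ j → ∑ m (λ i → f i j))
∑-swap zero    n = sym (∑-0 n (λ _ _ → refl))
∑-swap (suc m) n {f} = trans (cong (λ t → ∑ n (f 0) + t) (∑-swap m n)) (sym (∑-+ n))

∑-extend : ∀ m k {f} → (∀ i → m N.≤ i → f i ≡ 0ℚ) → ∑ (m N.+ k) f ≡ ∑ m f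
∑-extend zero    k e = ∑-0 k (λ i _ → e i z≤n)
∑-extend (suc m) k {f} e = cong (λ t → f 0 + t) (∑-extend m k (λ i m≤i → e (suc i) (s≤s m≤i)))

∑-mono : ∀ {m n} {f} → m N.≤ n → (∀ i → m N.≤ i → f i ≡ 0ℚ) → ∑ n f ≡ ∑ m f
∑-mono {m} {n} {f} m≤n e = trans (cong (λ k → ∑ k f) (sym (NP.m+[n∸m]≡n m≤n))) (∑-extend m (n ∸ m) e)

∑-single : ∀ n k {f} → k N.< n → (∀ i → i N.< n → i ≢ k → f i ≡ 0ℚ) → ∑ n f ≡ f k
∑-single (suc n) zero    {f} _ e = trans (cong (λ t → f 0 + t) (∑-0 n (λ i i<n → e (suc i) (s≤s i<n) (λ ())))) (QP.+-identityʳ _)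
∑-single (suc n) (suc k) {f} (s≤s k<n) e =
  trans (cong₂ _+_ (e 0 (s≤s z≤n) (λ ())) (∑-single n k k<n (λ i i<n i≢k → e (suc i) (s≤s i<n) (λ p → i≢k (NP.suc-injective p))))) (QP.+-identityˡ _)

∑L : {A : Set} → List A → (A → ℚ) → ℚ
∑L []       f = 0ℚ
∑L (x ∷ xs) f = f x + ∑L xs f

sumQ-∑L : ∀ {A : Set} (xs : List A) (f : A → ℚ) → sumQ xs f ≡ ∑L xs f
sumQ-∑L []       f = refl
sumQ-∑L (x ∷ xs) f = cong (λ t → f x + t) (sumQ-∑L xs f)

∑L-cong : ∀ {A : Set} (xs : List A) {f g : A → ℚ} → (∀ x → f x ≡ g x) → ∑L xs f ≡ ∑L xs g
∑L-cong []       e = refl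
∑L-cong (x ∷ xs) e = cong₂ _+_ (e x) (∑L-cong xs e)

∑L-0 : ∀ {A : Set} (xs : List A) {f : A → ℚ} → (∀ x → f x ≡ 0ℚ) → ∑L xs f ≡ 0ℚ
∑L-0 []       e = refl
∑L-0 (x ∷ xs) e = trans (cong₂ _+_ (e x) (∑L-0 xs e)) (QP.+-identityˡ 0ℚ)

∑L-+ : ∀ {A : Set} (xs : List A) {f g : A → ℚ} → ∑L xs (λ x → f x + g x) ≡ ∑L xs f + ∑L xs g
∑L-+ []       = sym (QP.+-identityˡ 0ℚ)
∑L-+ (x ∷ xs) {f} {g} = trans (cong (λ t → f x + g x + t) (∑L-+ xs)) (interchange (f x) (g x) (∑L xs f) (∑L xs g))

∑L-*ˡ : ∀ {A : Set} (xs : List A) c {f : A → ℚ} → ∑L xs (λ x → c * f x) ≡ c * ∑L xs f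
∑L-*ˡ []       c = sym (QP.*-zeroʳ c)
∑L-*ˡ (x ∷ xs) c {f} = trans (cong (λ t → c * f x + t) (∑L-*ˡ xs c)) (sym (QP.*-distribˡ-+ c (f x) _))

∑L-++ : ∀ {A : Set} (xs ys : List A) {f : A → ℚ} → ∑L (xs ++ ys) f ≡ ∑L xs f + ∑L ys f
∑L-++ []       ys = sym (QP.+-identityˡ _)
∑L-++ (x ∷ xs) ys {f} = trans (cong (λ t → f x + t) (∑L-++ xs ys)) (sym (QP.+-assoc (f x) _ _))

∑L-map : ∀ {A B : Set} (h : A → B) (xs : List A) {f : B → ℚ} → ∑L (map h xs) f ≡ ∑L xs (f ∘ h)
∑L-map h []       = refl
∑L-map h (x ∷ xs) {f} = cong (λ t → f (h x) + t) (∑L-map h xs)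

∑L-concatMap : ∀ {A B : Set} (h : A → List B) (xs : List A) {f : B → ℚ} → ∑L (concatMap h xs) f ≡ ∑L xs (λ x → ∑L (h x) f)
∑L-concatMap h []       = refl
∑L-concatMap h (x ∷ xs) {f} = trans (∑L-++ (h x) (concatMap h xs)) (cong (λ t → ∑L (h x) f + t) (∑L-concatMap h xs))

[_]ᵇ : Bool → ℚ
[ b ]ᵇ = if b then 1ℚ else 0ℚ

∑L-filter : ∀ {A : Set} (p : A → Bool) (xs : List A) {f : A → ℚ} → ∑L (filterᵇ p xs) f ≡ ∑L xs (λ x → [ p x ]ᵇ * f x)
∑L-filter p []       = refl
∑L-filter p (x ∷ xs) {f} with p x
... | true  = cong₂ _+_ (sym (QP.*-identityˡ (f x))) (∑L-filter p xs)
... | false = trans (∑L-filter p xs) (trans (sym (QP.+-identityˡ _)) (cong (_+ ∑L xs _) (sym (QP.*-zeroˡ (f x)))))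

∑L-applyUpTo : ∀ n (h : ℕ → ℕ) {f : ℕ → ℚ} → ∑L (applyUpTo h n) f ≡ ∑ n (f ∘ h)
∑L-applyUpTo zero    h = refl
∑L-applyUpTo (suc n) h {f} = cong (λ t → f (h 0) + t) (∑L-applyUpTo n (h ∘ suc))

-- Central binomial coefficients

-- Parity: 2z = 1 has no integer solution. Hence 2z - 1 may be inverted for every integer z,
-- negative ones included.
odd≢0 : ∀ z → + 2 I.* z I.- + 1 ≢ + 0
odd≢0 z e = absurd z (trans (sym (lem z)) (cong (I._+ + 1) e))
  where
  lem : ∀ z → + 2 I.* z I.- + 1 I.+ + 1 ≡ + 2 I.* z
  lem = IR.solve-∀
  absurd : ∀ z → + 2 I.* z ≢ + 1
  absurd (+ zero) ()
  absurd (+ suc n) e with trans (sym (IP.+-injective e)) (cong suc (NP.+-suc n (n N.+ 0)))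
  ... | ()
  absurd -[1+ n ] ()

2+≢0 : ∀ n → + 2 I.* + suc n ≢ + 0
2+≢0 n ()

ι-odd : ∀ z → ι (+ 2 I.* z I.- + 1) ≡ 2ℚ * ι z - 1ℚ
ι-odd z = trans (ι-sub (+ 2 I.* z) (+ 1)) (cong₂ _-_ (ι-2* z) ι-1)

-- γℕ n = binom(2n,n) / 4^n is the coefficient of x^n in (1 - x)^(-1/2).
γℕ : ℕ → ℚ
γℕ zero    = 1ℚ
γℕ (suc n) = γℕ n * (ι (+ 2 I.* + suc n I.- + 1) * ρ (+ 2 I.* + suc n))

abstract
  γ : ℤ → ℚ
  γ (+ n)    = γℕ n
  γ -[1+ n ] = 0ℚ

  γ-0 : γ (+ 0) ≡ 1ℚ
  γ-0 = refl

  γ-+ : ∀ n → γ (+ n) ≡ γℕ n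
  γ-+ n = refl

  γ-neg : ∀ n → γ -[1+ n ] ≡ 0ℚ
  γ-neg n = refl

abstract
  -- A common factor of two consecutive values: γ(n) = (2n - 1) ξ(n) and γ(n - 1) = 2n ξ(n) for
  -- every integer n, also where γ vanishes. Recurrences between values of γ thereby become
  -- polynomial identities.
  ξ : ℤ → ℚ
  ξ n = γ n * ρ (+ 2 I.* n I.- + 1)

  ξ-def : ∀ n → ξ n ≡ γ n * ρ (+ 2 I.* n I.- + 1)
  ξ-def n = refl

*-left-comm : ∀ a b c → a * (b * c) ≡ b * (a * c)
*-left-comm = solve-∀ ring

γ-ξ : ∀ n → γ n ≡ (2ℚ * ι n - 1ℚ) * ξ n
γ-ξ n = begin
  γ n                                   ≡⟨ sym (QP.*-identityʳ (γ n)) ⟩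
  γ n * 1ℚ                              ≡⟨ cong (γ n *_) (sym (ρ-inv o (odd≢0 n))) ⟩
  γ n * (ι o * ρ o)                     ≡⟨ *-left-comm (γ n) (ι o) (ρ o) ⟩
  ι o * (γ n * ρ o)                     ≡⟨ cong₂ _*_ (ι-odd n) (sym (ξ-def n)) ⟩
  (2ℚ * ι n - 1ℚ) * ξ n ∎
  where
  o : ℤ
  o = + 2 I.* n I.- + 1

γ-suc : ∀ n → 2ℚ * ι (+ suc n) * ξ (+ suc n) ≡ γ (+ n)
γ-suc n = begin
  2ℚ * ι z * ξ z                            ≡⟨ cong (2ℚ * ι z *_) (ξ-def z) ⟩
  2ℚ * ι z * (γ z * ρ o)                    ≡⟨ cong (λ g → 2ℚ * ι z * (g * ρ o)) (γ-+ (suc n)) ⟩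
  2ℚ * ι z * (γℕ n * (ι o * ρ e) * ρ o)     ≡⟨ lem (2ℚ * ι z) (γℕ n) (ι o) (ρ e) (ρ o) ⟩
  γℕ n * (2ℚ * ι z * ρ e) * (ι o * ρ o)     ≡⟨ cong₂ (λ x y → γℕ n * x * y) (trans (cong (_* ρ e) (sym (ι-2* z))) (ρ-inv e (2+≢0 n))) (ρ-inv o (odd≢0 z)) ⟩
  γℕ n * 1ℚ * 1ℚ                            ≡⟨ trans (QP.*-identityʳ _) (QP.*-identityʳ _) ⟩
  γℕ n                                      ≡⟨ sym (γ-+ n) ⟩
  γ (+ n) ∎
  where
  z o e : ℤ
  z = + suc n
  o = + 2 I.* z I.- + 1
  e = + 2 I.* z
  lem : ∀ a b c d f → a * (b * (c * d) * f) ≡ b * (a * d) * (c * f)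
  lem = solve-∀ ring

γ-ξ⁻ : ∀ n → γ (n I.- + 1) ≡ 2ℚ * ι n * ξ n
γ-ξ⁻ (+ zero)  = trans (γ-neg 0) (sym (trans (cong (λ t → 2ℚ * t * ξ (+ 0)) ι-0) (QP.*-zeroˡ (ξ (+ 0)))))
γ-ξ⁻ -[1+ n ]  = trans (γ-neg (suc (n N.+ 0))) (sym (trans (cong (2ℚ * ι -[1+ n ] *_) (trans (ξ-def -[1+ n ]) (cong (_* ρ (+ 2 I.* -[1+ n ] I.- + 1)) (γ-neg n)))) (trans (cong (2ℚ * ι -[1+ n ] *_) (QP.*-zeroˡ (ρ (+ 2 I.* -[1+ n ] I.- + 1)))) (QP.*-zeroʳ (2ℚ * ι -[1+ n ])))))
γ-ξ⁻ (+ suc n) = sym (γ-suc n)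

γ-ξ⁺ : ∀ n → γ n ≡ 2ℚ * (ι n + 1ℚ) * ξ (n I.+ + 1)
γ-ξ⁺ n = trans (cong γ (lem n)) (trans (γ-ξ⁻ (n I.+ + 1)) (cong (λ t → 2ℚ * t * ξ (n I.+ + 1)) (trans (ι-+ n (+ 1)) (cong (λ t → ι n + t) ι-1))))
  where
  lem : ∀ n → n ≡ n I.+ + 1 I.- + 1
  lem = IR.solve-∀

γ-suc-ξ : ∀ n → γ (n I.+ + 1) ≡ (2ℚ * (ι n + 1ℚ) - 1ℚ) * ξ (n I.+ + 1)
γ-suc-ξ n = trans (γ-ξ (n I.+ + 1)) (cong (λ t → (2ℚ * t - 1ℚ) * ξ (n I.+ + 1)) (trans (ι-+ n (+ 1)) (cong (λ t → ι n + t) ι-1)))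

-- The reciprocal of (2n + 1) γ(n), see `γκ-inv`, given by its own recursion.
κℕ : ℕ → ℚ
κℕ zero    = 1ℚ
κℕ (suc n) = κℕ n * (ι (+ 2 I.* + suc n) * ρ (+ 2 I.* (+ suc n I.+ + 1) I.- + 1))

κ-odd : ∀ s → ι (+ 2 I.* (s I.+ + 1) I.- + 1) ≡ 2ℚ * ι s + 1ℚ
κ-odd s = trans (ι-odd (s I.+ + 1)) (trans (cong (λ t → 2ℚ * t - 1ℚ) (trans (ι-+ s (+ 1)) (cong (λ t → ι s + t) ι-1))) (lem (ι s)))
  where
  lem : ∀ s → 2ℚ * (s + 1ℚ) - 1ℚ ≡ 2ℚ * s + 1ℚ
  lem = solve-∀ ring

abstract
  κ : ℤ → ℚ
  κ (+ n)    = κℕ n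
  κ -[1+ n ] = 0ℚ

  κ-0 : κ (+ 0) ≡ 1ℚ
  κ-0 = refl

  κ-+ : ∀ n → κ (+ n) ≡ κℕ n
  κ-+ n = refl

  κ-neg : ∀ n → κ -[1+ n ] ≡ 0ℚ
  κ-neg n = refl

abstract
  -- Does for κ what `ξ` does for γ: κ(k + 1) and κ(k) are multiples of ζ(k) linear in k. The pair
  -- κ(0) = 1, κ(-1) = 0 falls outside this scheme and has to be treated apart.
  ζ : ℕ → ℚ
  ζ k = κ (+ k) * ρ (+ 2 I.* (+ suc k I.+ + 1) I.- + 1)

  ζ-def : ∀ k → ζ k ≡ κ (+ k) * ρ (+ 2 I.* (+ suc k I.+ + 1) I.- + 1)
  ζ-def k = refl

κ-ζ : ∀ k → κ (+ suc k) ≡ 2ℚ * ι (+ suc k) * ζ k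
κ-ζ k = begin
  κ (+ suc k)                                ≡⟨ κ-+ (suc k) ⟩
  κℕ k * (ι (+ 2 I.* + suc k) * ρ o)         ≡⟨ cong (_* (ι (+ 2 I.* + suc k) * ρ o)) (sym (κ-+ k)) ⟩
  κ (+ k) * (ι (+ 2 I.* + suc k) * ρ o)      ≡⟨ *-left-comm (κ (+ k)) (ι (+ 2 I.* + suc k)) (ρ o) ⟩
  ι (+ 2 I.* + suc k) * (κ (+ k) * ρ o)      ≡⟨ cong₂ _*_ (ι-2* (+ suc k)) (sym (ζ-def k)) ⟩
  2ℚ * ι (+ suc k) * ζ k ∎
  where
  o : ℤ
  o = + 2 I.* (+ suc k I.+ + 1) I.- + 1

κ-ζ⁻ : ∀ k → κ (+ k) ≡ (2ℚ * ι (+ suc k) + 1ℚ) * ζ k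
κ-ζ⁻ k = begin
  κ (+ k)                 ≡⟨ sym (QP.*-identityʳ _) ⟩
  κ (+ k) * 1ℚ            ≡⟨ cong (κ (+ k) *_) (sym (ρ-inv o (odd≢0 (+ suc k I.+ + 1)))) ⟩
  κ (+ k) * (ι o * ρ o)   ≡⟨ *-left-comm (κ (+ k)) (ι o) (ρ o) ⟩
  ι o * (κ (+ k) * ρ o)   ≡⟨ cong₂ _*_ (κ-odd (+ suc k)) (sym (ζ-def k)) ⟩
  (2ℚ * ι (+ suc k) + 1ℚ) * ζ k ∎
  where
  o : ℤ
  o = + 2 I.* (+ suc k I.+ + 1) I.- + 1

γκ-step : ∀ n → γ (+ suc n) * κ (+ suc n) * (2ℚ * ι (+ suc n) + 1ℚ) ≡ γ (+ n) * κ (+ n) * (2ℚ * ι (+ n) + 1ℚ)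
γκ-step n = begin
  γ (+ suc n) * κ (+ suc n) * (2ℚ * s + 1ℚ)
    ≡⟨ cong (_* (2ℚ * s + 1ℚ)) (cong₂ _*_ (γ-ξ (+ suc n)) (κ-ζ n)) ⟩
  (2ℚ * s - 1ℚ) * x * (2ℚ * s * z) * (2ℚ * s + 1ℚ)
    ≡⟨ lem s x z ⟩
  2ℚ * s * x * ((2ℚ * s + 1ℚ) * z) * (2ℚ * (s - 1ℚ) + 1ℚ)
    ≡⟨ cong₂ _*_ (cong₂ _*_ (sym (γ-ξ⁻ (+ suc n))) (sym (κ-ζ⁻ n))) (cong (λ t → 2ℚ * t + 1ℚ) (trans (cong (_- 1ℚ) (ι-suc n)) (lem′ (ι (+ n))))) ⟩
  γ (+ n) * κ (+ n) * (2ℚ * ι (+ n) + 1ℚ) ∎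
  where
  s = ι (+ suc n)
  x = ξ (+ suc n)
  z = ζ n
  lem : ∀ s x z → (2ℚ * s - 1ℚ) * x * (2ℚ * s * z) * (2ℚ * s + 1ℚ) ≡ 2ℚ * s * x * ((2ℚ * s + 1ℚ) * z) * (2ℚ * (s - 1ℚ) + 1ℚ)
  lem = solve-∀ ring
  lem′ : ∀ n → n + 1ℚ - 1ℚ ≡ n
  lem′ = solve-∀ ring

γκ-inv : ∀ n → γ (+ n) * κ (+ n) * (2ℚ * ι (+ n) + 1ℚ) ≡ 1ℚ
γκ-inv zero    = cong₂ _*_ (cong₂ _*_ γ-0 κ-0) (cong (λ t → 2ℚ * t + 1ℚ) ι-0)
γκ-inv (suc n) = trans (γκ-step n) (γκ-inv n)

-- Legendre's three-term recurrence 2m P_m = (2m - 1)(u + v) P_(m-1) - (2m - 2) u v P_(m-2), read at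
-- u^i v^j with m = i + j. The factors `ξ` reduce it to a polynomial identity.
γ-product-recurrence : ∀ i j → 2ℚ * (ι i + ι j) * (γ i * γ j)
  ≡ (2ℚ * (ι i + ι j) - 1ℚ) * (γ (i I.- + 1) * γ j + γ i * γ (j I.- + 1)) - (2ℚ * (ι i + ι j) - 2ℚ) * (γ (i I.- + 1) * γ (j I.- + 1))
γ-product-recurrence i j = use (ι i) (ι j) (ξ i) (ξ j) (γ-ξ i) (γ-ξ j) (γ-ξ⁻ i) (γ-ξ⁻ j)
  where
  lem : ∀ i j x y → 2ℚ * (i + j) * ((2ℚ * i - 1ℚ) * x * ((2ℚ * j - 1ℚ) * y))
    ≡ (2ℚ * (i + j) - 1ℚ) * (2ℚ * i * x * ((2ℚ * j - 1ℚ) * y) + (2ℚ * i - 1ℚ) * x * (2ℚ * j * y)) - (2ℚ * (i + j) - 2ℚ) * (2ℚ * i * x * (2ℚ * j * y))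
  lem = solve-∀ ring
  use : ∀ i j x y {p q p' q'} → p ≡ (2ℚ * i - 1ℚ) * x → q ≡ (2ℚ * j - 1ℚ) * y → p' ≡ 2ℚ * i * x → q' ≡ 2ℚ * j * y →
    2ℚ * (i + j) * (p * q) ≡ (2ℚ * (i + j) - 1ℚ) * (p' * q + p * q') - (2ℚ * (i + j) - 2ℚ) * (p' * q')
  use i j x y refl refl refl refl = lem i j x y

-- α(m - r, r, n - r) is Adams' coefficient of (uv)^r P_(m+n-2r) in P_m P_n, with 1/γ expressed
-- through κ. For a horizontal strip the three arguments are the boxes added to the first row, those
-- added to the second row, and the part of the old overhang that stays uncovered.
β α : ℤ → ℤ → ℤ → ℚ
β i r t = γ i * γ r * γ t * κ (i I.+ r I.+ t)
α i r t = β i r t * (2ℚ * (ι i + ι t) + 1ℚ)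

-- Since γ vanishes on negative integers, a nonzero product of the γ's forces x = y = z = 0, and
-- then the last factor is zero.
γ³-0 : ∀ x y z → x I.+ y I.+ z ≡ + 0 → γ x * γ y * γ z * (ι x + ι z) ≡ 0ℚ
γ³-0 -[1+ x ] y z e = trans (cong (λ g → g * γ y * γ z * (ι -[1+ x ] + ι z)) (γ-neg x)) (lem (γ y) (γ z) (ι -[1+ x ] + ι z))
  where
  lem : ∀ a b c → 0ℚ * a * b * c ≡ 0ℚ
  lem = solve-∀ ring
γ³-0 (+ x) -[1+ y ] z e = trans (cong (λ g → γ (+ x) * g * γ z * (ι (+ x) + ι z)) (γ-neg y)) (lem (γ (+ x)) (γ z) (ι (+ x) + ι z))
  where
  lem : ∀ a b c → a * 0ℚ * b * c ≡ 0ℚ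
  lem = solve-∀ ring
γ³-0 (+ x) (+ y) -[1+ z ] e = trans (cong (λ g → γ (+ x) * γ (+ y) * g * (ι (+ x) + ι -[1+ z ])) (γ-neg z)) (lem (γ (+ x)) (γ (+ y)) (ι (+ x) + ι -[1+ z ]))
  where
  lem : ∀ a b c → a * b * 0ℚ * c ≡ 0ℚ
  lem = solve-∀ ring
γ³-0 (+ zero) (+ y) (+ zero) e = trans (cong (λ g → γ (+ 0) * γ (+ y) * γ (+ 0) * (g + g)) ι-0) (QP.*-zeroʳ (γ (+ 0) * γ (+ y) * γ (+ 0)))
γ³-0 (+ zero) (+ y) (+ suc z) e with trans (sym (IP.+-injective e)) (NP.+-suc y z)
... | ()
γ³-0 (+ suc x) (+ y) (+ z) ()

shift-index : ∀ i r t → i I.+ (r I.- + 1) I.+ (t I.+ + 1) ≡ i I.+ r I.+ t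
shift-index = IR.solve-∀

pred-index : ∀ i r t → (i I.- + 1) I.+ r I.+ t ≡ i I.+ r I.+ t I.- + 1
pred-index = IR.solve-∀

pred-shift-index : ∀ i r t → (i I.- + 1) I.+ (r I.- + 1) I.+ (t I.+ + 1) ≡ i I.+ r I.+ t I.- + 1
pred-shift-index = IR.solve-∀

-- Counterpart of `γ-product-recurrence` for Adams' coefficients; summed over r it gives `Strip` the
-- recurrence of P_m in m. Only κ(s) and κ(s - 1) with s = i + r + t occur, so the cases are divided
-- by the sign of s.
β-recurrence : ∀ i r t → 2ℚ * (ι i + ι r) * (β i r t * (2ℚ * (ι i + ι t) + 1ℚ))
  ≡ (2ℚ * (ι i + ι r) - 1ℚ) * (β (i I.- + 1) r t * (2ℚ * (ι i + ι t)) + β i (r I.- + 1) (t I.+ + 1) * (2ℚ * (ι i + ι t) + 2ℚ))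
    - (2ℚ * (ι i + ι r) - 2ℚ) * (β (i I.- + 1) (r I.- + 1) (t I.+ + 1) * (2ℚ * (ι i + ι t) + 1ℚ))
β-recurrence i r t = trans (go (i I.+ r I.+ t) refl) (cong₂ (λ x y → (2ℚ * (I + R) - 1ℚ) * x - (2ℚ * (I + R) - 2ℚ) * y)
    (cong₂ (λ x y → γ (i I.- + 1) * γ r * γ t * x * (2ℚ * (I + W)) + γ i * γ (r I.- + 1) * γ (t I.+ + 1) * y * (2ℚ * (I + W) + 2ℚ))
       (cong κ (sym (pred-index i r t))) (cong κ (sym (shift-index i r t))))
    (cong (λ x → γ (i I.- + 1) * γ (r I.- + 1) * γ (t I.+ + 1) * x * (2ℚ * (I + W) + 1ℚ)) (cong κ (sym (pred-shift-index i r t)))))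
  where
  I R W : ℚ
  I = ι i
  R = ι r
  W = ι t
  Goal : (gi gr gt gi' gr' gt' k k' : ℚ) → Set
  Goal gi gr gt gi' gr' gt' k k' = 2ℚ * (I + R) * (gi * gr * gt * k * (2ℚ * (I + W) + 1ℚ))
    ≡ (2ℚ * (I + R) - 1ℚ) * (gi' * gr * gt * k' * (2ℚ * (I + W)) + gi * gr' * gt' * k * (2ℚ * (I + W) + 2ℚ))
    - (2ℚ * (I + R) - 2ℚ) * (gi' * gr' * gt' * k' * (2ℚ * (I + W) + 1ℚ))
  below : ∀ gi gr gt gi' gr' gt' {k k'} → k ≡ 0ℚ → k' ≡ 0ℚ → Goal gi gr gt gi' gr' gt' k k'
  below gi gr gt gi' gr' gt' refl refl = lem I R W (gi * gr * gt) (gi' * gr * gt) (gi * gr' * gt') (gi' * gr' * gt')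
    where
    lem : ∀ I R T a b c d → 2ℚ * (I + R) * (a * 0ℚ * (2ℚ * (I + T) + 1ℚ))
      ≡ (2ℚ * (I + R) - 1ℚ) * (b * 0ℚ * (2ℚ * (I + T)) + c * 0ℚ * (2ℚ * (I + T) + 2ℚ)) - (2ℚ * (I + R) - 2ℚ) * (d * 0ℚ * (2ℚ * (I + T) + 1ℚ))
    lem = solve-∀ ring
  at0 : ∀ gi gr gt gi' gr' gt' {k k'} → k ≡ 1ℚ → k' ≡ 0ℚ → gi * gt * gr * (I + R) ≡ 0ℚ → gi * gr' * gt' * (I + (W + 1ℚ)) ≡ 0ℚ →
    Goal gi gr gt gi' gr' gt' k k'
  at0 gi gr gt gi' gr' gt' refl refl e₁ e₂ =
    by-lc (lem I R W gi gr gt (gi' * gr * gt) gr' gt' (gi' * gr' * gt')) (lc+ {c = 2ℚ * (2ℚ * (I + W) + 1ℚ)} e₁ (lc1 {c = - ((2ℚ * (I + R) - 1ℚ) * 2ℚ)} e₂))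
    where
    lem : ∀ I R T a r t b r' t' d → 2ℚ * (I + R) * (a * r * t * 1ℚ * (2ℚ * (I + T) + 1ℚ))
      ≡ ((2ℚ * (I + R) - 1ℚ) * (b * 0ℚ * (2ℚ * (I + T)) + a * r' * t' * 1ℚ * (2ℚ * (I + T) + 2ℚ)) - (2ℚ * (I + R) - 2ℚ) * (d * 0ℚ * (2ℚ * (I + T) + 1ℚ)))
       + (2ℚ * (2ℚ * (I + T) + 1ℚ) * (a * t * r * (I + R)) + (- ((2ℚ * (I + R) - 1ℚ) * 2ℚ)) * (a * r' * t' * (I + (T + 1ℚ))))
    lem = solve-∀ ring
  generic : ∀ u v w z {gi gr gt gi' gr' gt' k k'} → gi ≡ (2ℚ * I - 1ℚ) * u → gr ≡ (2ℚ * R - 1ℚ) * v → gt ≡ 2ℚ * (W + 1ℚ) * w →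
    gi' ≡ 2ℚ * I * u → gr' ≡ 2ℚ * R * v → gt' ≡ (2ℚ * (W + 1ℚ) - 1ℚ) * w → k ≡ 2ℚ * (I + R + W) * z → k' ≡ (2ℚ * (I + R + W) + 1ℚ) * z →
    Goal gi gr gt gi' gr' gt' k k'
  generic u v w z refl refl refl refl refl refl refl refl =
    combine (2ℚ * (I + R)) (2ℚ * (I + R) - 1ℚ) (2ℚ * (I + R) - 2ℚ)
        (2ℚ * I * (2ℚ * R - 1ℚ) * (2ℚ * (W + 1ℚ)) * (2ℚ * (I + R + W) + 1ℚ) * (2ℚ * (I + W)))
        ((2ℚ * I - 1ℚ) * (2ℚ * R) * (2ℚ * (W + 1ℚ) - 1ℚ) * (2ℚ * (I + R + W)) * (2ℚ * (I + W) + 2ℚ))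
        (u * v * w * z) (poly I R W)
        (fact (2ℚ * I - 1ℚ) (2ℚ * R - 1ℚ) (2ℚ * (W + 1ℚ)) (2ℚ * (I + R + W)) (2ℚ * (I + W) + 1ℚ) u v w z)
        (fact (2ℚ * I) (2ℚ * R - 1ℚ) (2ℚ * (W + 1ℚ)) (2ℚ * (I + R + W) + 1ℚ) (2ℚ * (I + W)) u v w z)
        (fact (2ℚ * I - 1ℚ) (2ℚ * R) (2ℚ * (W + 1ℚ) - 1ℚ) (2ℚ * (I + R + W)) (2ℚ * (I + W) + 2ℚ) u v w z)
        (fact (2ℚ * I) (2ℚ * R) (2ℚ * (W + 1ℚ) - 1ℚ) (2ℚ * (I + R + W) + 1ℚ) (2ℚ * (I + W) + 1ℚ) u v w z)
    where
    poly : ∀ I R T → 2ℚ * (I + R) * ((2ℚ * I - 1ℚ) * (2ℚ * R - 1ℚ) * (2ℚ * (T + 1ℚ)) * (2ℚ * (I + R + T)) * (2ℚ * (I + T) + 1ℚ))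
      ≡ (2ℚ * (I + R) - 1ℚ) * (2ℚ * I * (2ℚ * R - 1ℚ) * (2ℚ * (T + 1ℚ)) * (2ℚ * (I + R + T) + 1ℚ) * (2ℚ * (I + T))
           + (2ℚ * I - 1ℚ) * (2ℚ * R) * (2ℚ * (T + 1ℚ) - 1ℚ) * (2ℚ * (I + R + T)) * (2ℚ * (I + T) + 2ℚ))
       - (2ℚ * (I + R) - 2ℚ) * (2ℚ * I * (2ℚ * R) * (2ℚ * (T + 1ℚ) - 1ℚ) * (2ℚ * (I + R + T) + 1ℚ) * (2ℚ * (I + T) + 1ℚ))
    poly = solve-∀ ring
    fact : ∀ a b c d e u v w z → a * u * (b * v) * (c * w) * (d * z) * e ≡ a * b * c * d * e * (u * v * w * z)
    fact = solve-∀ ring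
    dist : ∀ l n x₂ x₃ x₄ o → (l * (x₂ + x₃) - n * x₄) * o ≡ l * (x₂ * o + x₃ * o) - n * (x₄ * o)
    dist = solve-∀ ring
    combine : ∀ k l n x₂ x₃ o {x₁ x₄ y₁ y₂ y₃ y₄} → k * x₁ ≡ l * (x₂ + x₃) - n * x₄ →
      y₁ ≡ x₁ * o → y₂ ≡ x₂ * o → y₃ ≡ x₃ * o → y₄ ≡ x₄ * o → k * y₁ ≡ l * (y₂ + y₃) - n * y₄
    combine k l n x₂ x₃ o {x₁} {x₄} p refl refl refl refl =
      trans (sym (QP.*-assoc k x₁ o)) (trans (cong (_* o) p) (dist l n x₂ x₃ x₄ o))
  swap : ∀ i t r → i I.+ t I.+ r ≡ i I.+ r I.+ t
  swap = IR.solve-∀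
  go : ∀ s → i I.+ r I.+ t ≡ s →
    Goal (γ i) (γ r) (γ t) (γ (i I.- + 1)) (γ (r I.- + 1)) (γ (t I.+ + 1)) (κ s) (κ (s I.- + 1))
  go -[1+ k ] e = below (γ i) (γ r) (γ t) (γ (i I.- + 1)) (γ (r I.- + 1)) (γ (t I.+ + 1)) (κ-neg k) (κ-neg (suc (k N.+ 0)))
  -- At s = 0 the factorisation through `ζ` breaks down, as κ(0) = 1 and κ(-1) = 0. The two terms
  -- that keep κ(0) vanish by `γ³-0` instead.
  go (+ zero) e = at0 (γ i) (γ r) (γ t) (γ (i I.- + 1)) (γ (r I.- + 1)) (γ (t I.+ + 1)) κ-0 (κ-neg 0)
    (γ³-0 i t r (trans (swap i t r) e))
    (trans (cong (λ x → γ i * γ (r I.- + 1) * γ (t I.+ + 1) * (I + x)) (sym (trans (ι-+ t (+ 1)) (cong (λ x → W + x) ι-1))))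
           (γ³-0 i (r I.- + 1) (t I.+ + 1) (trans (shift-index i r t) e)))
  go (+ suc k) e = generic (ξ i) (ξ r) (ξ (t I.+ + 1)) (ζ k) (γ-ξ i) (γ-ξ r) (γ-ξ⁺ t) (γ-ξ⁻ i) (γ-ξ⁻ r) (γ-suc-ξ t)
    (trans (κ-ζ k) (cong (λ x → 2ℚ * x * ζ k) ι-s)) (trans (κ-ζ⁻ k) (cong (λ x → (2ℚ * x + 1ℚ) * ζ k) ι-s))
    where
    ι-s : ι (+ suc k) ≡ I + R + W
    ι-s = trans (cong ι (sym e)) (trans (ι-+ (i I.+ r) t) (cong (_+ W) (ι-+ i r)))

-- The two sides of Adams' formula and their recurrences

∑-shift : ∀ k (g G : ℤ → ℚ) → g -[1+ 0 ] ≡ 0ℚ → g (+ k) ≡ 0ℚ →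
  ∑ (suc k) (λ i → g (+ i I.- + 1) * G (+ i)) ≡ ∑ (suc k) (λ i → g (+ i) * G (+ suc i))
∑-shift k g G e₀ eₖ = begin
  g -[1+ 0 ] * G (+ 0) + ∑ k (λ i → g (+ i) * G (+ suc i))   ≡⟨ cong (λ x → x * G (+ 0) + S) e₀ ⟩
  0ℚ * G (+ 0) + S                                           ≡⟨ lem (G (+ 0)) S (G (+ suc k)) ⟩
  S + 0ℚ * G (+ suc k)                                       ≡⟨ cong (λ x → S + x * G (+ suc k)) (sym eₖ) ⟩
  S + g (+ k) * G (+ suc k)                                  ≡⟨ sym (∑-last k) ⟩
  ∑ (suc k) (λ i → g (+ i) * G (+ suc i)) ∎
  where
  S : ℚ
  S = ∑ k (λ i → g (+ i) * G (+ suc i))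
  lem : ∀ a s b → 0ℚ * a + s ≡ s + 0ℚ * b
  lem = solve-∀ ring

∑-lin : ∀ k a b c (u v : ℕ → ℚ) {f w : ℕ → ℚ} → (∀ r → a * f r ≡ b * (u r + v r) - c * w r) →
  a * ∑ k f ≡ b * (∑ k u + ∑ k v) - c * ∑ k w
∑-lin zero    a b c u v e = zero-case a b c
  where
  zero-case : ∀ a b c → a * 0ℚ ≡ b * (0ℚ + 0ℚ) - c * 0ℚ
  zero-case = solve-∀ ring
∑-lin (suc k) a b c u v {f} {w} e = step a b c (f 0) (u 0) (v 0) (w 0) (∑ k (f ∘ suc)) (∑ k (u ∘ suc)) (∑ k (v ∘ suc)) (∑ k (w ∘ suc)) (e 0) (∑-lin k a b c (u ∘ suc) (v ∘ suc) (e ∘ suc))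
  where
  dist : ∀ b c u v w U V W → (b * (u + v) - c * w) + (b * (U + V) - c * W) ≡ b * ((u + U) + (v + V)) - c * (w + W)
  dist = solve-∀ ring
  step : ∀ a b c f u v w F U V W → a * f ≡ b * (u + v) - c * w → a * F ≡ b * (U + V) - c * W →
    a * (f + F) ≡ b * ((u + U) + (v + V)) - c * (w + W)
  step a b c f u v w F U V W e₁ e₂ = trans (QP.*-distribˡ-+ a f F) (trans (cong₂ _+_ e₁ e₂) (dist b c u v w U V W))

-- Coefficient of u^p v^q in P_m P_n with n = p + q - m, summed up to a cut-off k.
Conv : ℕ → ℤ → ℤ → ℤ → ℚ
Conv k m p q = ∑ (suc k) (λ i → γ (+ i) * γ (m I.- + i) * (γ (p I.- + i) * γ (q I.- m I.+ + i)))

-- For p + q = m + n this is the coefficient of u^p v^q in Σ_r α(m - r, r, n - r) (uv)^r P_(m+n-2r).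
Strip : ℕ → ℤ → ℤ → ℤ → ℤ → ℚ
Strip k m n p q = ∑ (suc k) (λ r → α (m I.- + r) (+ r) (n I.- + r) * (γ (p I.- + r) * γ (q I.- + r)))

m-0 : ∀ m → m I.- + 0 ≡ m
m-0 m = IP.+-identityʳ m

sub-sub : ∀ m i → m I.- + 1 I.- i ≡ m I.- i I.- + 1
sub-sub = IR.solve-∀

sub-suc : ∀ m i → m I.- (+ 1 I.+ i) ≡ m I.- i I.- + 1
sub-suc = IR.solve-∀

sub-pred : ∀ m i → m I.- (i I.- + 1) ≡ m I.- i I.+ + 1
sub-pred = IR.solve-∀

γ-minus : ∀ {m k} → m N.< k → γ (+ m I.- + k) ≡ 0ℚ
γ-minus {m} {suc k} (s≤s m≤k) = trans (cong γ (trans (IP.m-n≡m⊖n m (suc k)) (trans (IP.⊖-< (s≤s m≤k)) (cong (λ x → I.- (+ x)) (NP.+-∸-assoc 1 m≤k))))) (γ-neg (k ∸ m))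

ι-split : ∀ m i → ι i + ι (m I.- i) ≡ ι m
ι-split m i = trans (sym (ι-+ i (m I.- i))) (cong ι (lem m i))
  where
  lem : ∀ m i → i I.+ (m I.- i) ≡ m
  lem = IR.solve-∀

*-distribute₃ : ∀ a b c d h u v {x w} → a * x ≡ b * (u + v) - c * w → x * h ≡ d → a * d ≡ b * (u * h + v * h) - c * (w * h)
*-distribute₃ a b c d h u v {x} {w} e refl = trans (sym (QP.*-assoc a x h)) (trans (cong (_* h) e) (dist b c u v w h))
  where
  dist : ∀ b c u v w h → (b * (u + v) - c * w) * h ≡ b * (u * h + v * h) - c * (w * h)
  dist = solve-∀ ring

-- The three-term recurrence is applied to the factor P_m. The two vanishing hypotheses are the
-- boundary terms left over when the summation index i is shifted by one.
Conv-recurrence : ∀ k m p q → γ (m I.- + suc k) ≡ 0ℚ → γ (m I.- + 1 I.- + suc k) ≡ 0ℚ →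
  2ℚ * ι m * Conv k m p q ≡ (2ℚ * ι m - 1ℚ) * (Conv k (m I.- + 1) (p I.- + 1) q + Conv k (m I.- + 1) p (q I.- + 1))
    - (2ℚ * ι m - 2ℚ) * Conv k (m I.- + 1 I.- + 1) (p I.- + 1) (q I.- + 1)
Conv-recurrence k m p q z₁ z₂ = trans (∑-lin (suc k) (2ℚ * ι m) (2ℚ * ι m - 1ℚ) (2ℚ * ι m - 2ℚ) (λ i → g₁ (+ i I.- + 1) * G (+ i)) (λ i → γ (+ i) * γ (m I.- + i I.- + 1) * G (+ i)) pointwise)
  (cong₂ (λ x y → (2ℚ * ι m - 1ℚ) * x - (2ℚ * ι m - 2ℚ) * y) (cong₂ _+_ first second) third)
  where
  G : ℤ → ℚ
  G x = γ (p I.- x) * γ (q I.- m I.+ x)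
  g₁ g₂ : ℤ → ℚ
  g₁ x = γ x * γ (m I.- + 1 I.- x)
  g₂ x = γ x * γ (m I.- + 1 I.- + 1 I.- x)
  idx₁ : ∀ m i → m I.- + 1 I.- (i I.- + 1) ≡ m I.- i
  idx₁ = IR.solve-∀
  idx₂ : ∀ m i → m I.- + 1 I.- + 1 I.- (i I.- + 1) ≡ m I.- i I.- + 1
  idx₂ = IR.solve-∀
  pointwise : ∀ i → 2ℚ * ι m * (γ (+ i) * γ (m I.- + i) * G (+ i)) ≡
    (2ℚ * ι m - 1ℚ) * (g₁ (+ i I.- + 1) * G (+ i) + γ (+ i) * γ (m I.- + i I.- + 1) * G (+ i)) - (2ℚ * ι m - 2ℚ) * (g₂ (+ i I.- + 1) * G (+ i))
  pointwise i = *-distribute₃ (2ℚ * ι m) (2ℚ * ι m - 1ℚ) (2ℚ * ι m - 2ℚ) (γ (+ i) * γ (m I.- + i) * G (+ i)) (G (+ i)) (g₁ (+ i I.- + 1)) (γ (+ i) * γ (m I.- + i I.- + 1)) base refl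
    where
    base : 2ℚ * ι m * (γ (+ i) * γ (m I.- + i)) ≡
      (2ℚ * ι m - 1ℚ) * (g₁ (+ i I.- + 1) + γ (+ i) * γ (m I.- + i I.- + 1)) - (2ℚ * ι m - 2ℚ) * g₂ (+ i I.- + 1)
    base = begin
      2ℚ * ι m * (γ (+ i) * γ (m I.- + i)) ≡⟨ cong (λ x → 2ℚ * x * (γ (+ i) * γ (m I.- + i))) (sym (ι-split m (+ i))) ⟩
      2ℚ * s * (γ (+ i) * γ (m I.- + i)) ≡⟨ γ-product-recurrence (+ i) (m I.- + i) ⟩
      (2ℚ * s - 1ℚ) * (γ (+ i I.- + 1) * γ (m I.- + i) + γ (+ i) * γ (m I.- + i I.- + 1)) - (2ℚ * s - 2ℚ) * (γ (+ i I.- + 1) * γ (m I.- + i I.- + 1))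
        ≡⟨ cong₂ (λ x y → (2ℚ * s - 1ℚ) * (γ (+ i I.- + 1) * x + γ (+ i) * γ (m I.- + i I.- + 1)) - (2ℚ * s - 2ℚ) * (γ (+ i I.- + 1) * y)) (cong γ (sym (idx₁ m (+ i)))) (cong γ (sym (idx₂ m (+ i)))) ⟩
      (2ℚ * s - 1ℚ) * (g₁ (+ i I.- + 1) + γ (+ i) * γ (m I.- + i I.- + 1)) - (2ℚ * s - 2ℚ) * g₂ (+ i I.- + 1)
        ≡⟨ cong (λ s → (2ℚ * s - 1ℚ) * (g₁ (+ i I.- + 1) + γ (+ i) * γ (m I.- + i I.- + 1)) - (2ℚ * s - 2ℚ) * g₂ (+ i I.- + 1)) (ι-split m (+ i)) ⟩
      (2ℚ * ι m - 1ℚ) * (g₁ (+ i I.- + 1) + γ (+ i) * γ (m I.- + i I.- + 1)) - (2ℚ * ι m - 2ℚ) * g₂ (+ i I.- + 1) ∎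
      where
      s : ℚ
      s = ι (+ i) + ι (m I.- + i)
  zero-at : ∀ {x y} → y ≡ 0ℚ → x * y ≡ 0ℚ
  zero-at {x} refl = QP.*-zeroʳ x
  zero-at′ : ∀ {x y} → x ≡ 0ℚ → x * y ≡ 0ℚ
  zero-at′ {y = y} refl = QP.*-zeroˡ y
  iq₁ : ∀ q m i → q I.- m I.+ (+ 1 I.+ i) ≡ q I.- (m I.- + 1) I.+ i
  iq₁ = IR.solve-∀
  iq₂ : ∀ q m i → q I.- m I.+ i ≡ q I.- + 1 I.- (m I.- + 1) I.+ i
  iq₂ = IR.solve-∀
  iq₃ : ∀ q m i → q I.- m I.+ (+ 1 I.+ i) ≡ q I.- + 1 I.- (m I.- + 1 I.- + 1) I.+ i
  iq₃ = IR.solve-∀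
  ip : ∀ p i → p I.- (+ 1 I.+ i) ≡ p I.- + 1 I.- i
  ip = IR.solve-∀
  first : ∑ (suc k) (λ i → g₁ (+ i I.- + 1) * G (+ i)) ≡ Conv k (m I.- + 1) (p I.- + 1) q
  first = trans (∑-shift k g₁ G (zero-at′ (γ-neg 0)) (zero-at {x = γ (+ k)} (trans (cong γ (trans (sub-sub m (+ k)) (sym (sub-suc m (+ k))))) z₁)))
    (∑-cong (suc k) (λ i → cong₂ (λ x y → g₁ (+ i) * (γ x * γ y)) (ip p (+ i)) (iq₁ q m (+ i))))
  second : ∑ (suc k) (λ i → γ (+ i) * γ (m I.- + i I.- + 1) * G (+ i)) ≡ Conv k (m I.- + 1) p (q I.- + 1)
  second = ∑-cong (suc k) (λ i → cong₂ (λ x y → γ (+ i) * γ x * (γ (p I.- + i) * γ y)) (sym (sub-sub m (+ i))) (iq₂ q m (+ i)))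
  third : ∑ (suc k) (λ i → g₂ (+ i I.- + 1) * G (+ i)) ≡ Conv k (m I.- + 1 I.- + 1) (p I.- + 1) (q I.- + 1)
  third = trans (∑-shift k g₂ G (zero-at′ (γ-neg 0)) (zero-at {x = γ (+ k)} (trans (cong γ (trans (sub-sub (m I.- + 1) (+ k)) (sym (sub-suc (m I.- + 1) (+ k))))) z₂)))
    (∑-cong (suc k) (λ i → cong₂ (λ x y → g₂ (+ i) * (γ x * γ y)) (ip p (+ i)) (iq₃ q m (+ i))))

zero-*ʳ : ∀ {x y} → y ≡ 0ℚ → x * y ≡ 0ℚ
zero-*ʳ {x} refl = QP.*-zeroʳ x

zero-*ˡ : ∀ {x y} → x ≡ 0ℚ → x * y ≡ 0ℚ
zero-*ˡ {y = y} refl = QP.*-zeroˡ y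

β-0ʳ : ∀ i {r} t → γ r ≡ 0ℚ → β i r t ≡ 0ℚ
β-0ʳ i t e = zero-*ˡ (zero-*ˡ (zero-*ʳ {x = γ i} e))

β-0ᵗ : ∀ i r {t} → γ t ≡ 0ℚ → β i r t ≡ 0ℚ
β-0ᵗ i r e = zero-*ˡ (zero-*ʳ {x = γ i * γ r} e)

β-0ⁱ : ∀ {i} r t → γ i ≡ 0ℚ → β i r t ≡ 0ℚ
β-0ⁱ r t e = zero-*ˡ (zero-*ˡ (zero-*ˡ e))

-- What `β-recurrence` contributes at r and what it contributes at r - 1 recombine into products (u
-- + v) P by the recurrence for P_(m+n-2r) itself, and this is where p + q = m + n enters. The
-- condition n < k removes the boundary term of the shift in r.
Strip-recurrence : ∀ k m n p q → n N.< k → p I.+ q ≡ m I.+ + n →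
  2ℚ * ι m * Strip k m (+ n) p q ≡ (2ℚ * ι m - 1ℚ) * (Strip k (m I.- + 1) (+ n) (p I.- + 1) q + Strip k (m I.- + 1) (+ n) p (q I.- + 1))
    - (2ℚ * ι m - 2ℚ) * Strip k (m I.- + 1 I.- + 1) (+ n) (p I.- + 1) (q I.- + 1)
Strip-recurrence k m n p q n<k pq = trans (∑-lin (suc k) (2ℚ * ι m) (2ℚ * ι m - 1ℚ) (2ℚ * ι m - 2ℚ) (λ r → A r * H (+ r)) (λ r → g₂ (+ r I.- + 1) * H (+ r)) pointwise)
  (cong₂ (λ x y → (2ℚ * ι m - 1ℚ) * x - (2ℚ * ι m - 2ℚ) * y) first third)
  where
  H : ℤ → ℚ
  H x = γ (p I.- x) * γ (q I.- x)
  L : ℤ → ℚ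
  L x = 2ℚ * (ι (m I.- x) + ι (+ n I.- x))
  A : ℕ → ℚ
  A r = β (m I.- + r I.- + 1) (+ r) (+ n I.- + r) * L (+ r)
  g₂ g₃ : ℤ → ℚ
  g₂ x = β (m I.- x I.- + 1) x (+ n I.- x) * (L x - 2ℚ)
  g₃ x = β (m I.- x I.- + 1 I.- + 1) x (+ n I.- x) * (L x - 3ℚ)
  i₁ : ∀ m r → m I.- (r I.- + 1) I.- + 1 ≡ m I.- r
  i₁ = IR.solve-∀
  ι-up : ∀ m r → ι (m I.- (r I.- + 1)) ≡ ι (m I.- r) + 1ℚ
  ι-up m r = trans (cong ι (sub-pred m r)) (trans (ι-+ (m I.- r) (+ 1)) (cong (λ x → ι (m I.- r) + x) ι-1))
  L-up : ∀ r → L (+ r I.- + 1) ≡ L (+ r) + 2ℚ + 2ℚ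
  L-up r = trans (cong₂ (λ x y → 2ℚ * (x + y)) (ι-up m (+ r)) (ι-up (+ n) (+ r))) (lem (ι (m I.- + r)) (ι (+ n I.- + r)))
    where
    lem : ∀ a b → 2ℚ * (a + 1ℚ + (b + 1ℚ)) ≡ 2ℚ * (a + b) + 2ℚ + 2ℚ
    lem = solve-∀ ring
  shift₂ : ∀ x → x + 2ℚ + 2ℚ - 2ℚ ≡ x + 2ℚ
  shift₂ = solve-∀ ring
  shift₃ : ∀ x → x + 2ℚ + 2ℚ - 3ℚ ≡ x + 1ℚ
  shift₃ = solve-∀ ring
  pointwise : ∀ r → 2ℚ * ι m * (α (m I.- + r) (+ r) (+ n I.- + r) * H (+ r)) ≡
    (2ℚ * ι m - 1ℚ) * (A r * H (+ r) + g₂ (+ r I.- + 1) * H (+ r)) - (2ℚ * ι m - 2ℚ) * (g₃ (+ r I.- + 1) * H (+ r))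
  pointwise r = *-distribute₃ (2ℚ * ι m) (2ℚ * ι m - 1ℚ) (2ℚ * ι m - 2ℚ) (α (m I.- + r) (+ r) (+ n I.- + r) * H (+ r)) (H (+ r)) (A r) (g₂ (+ r I.- + 1)) base refl
    where
    i t : ℤ
    i = m I.- + r
    t = + n I.- + r
    s : ℚ
    s = ι i + ι (+ r)
    s≡ : s ≡ ι m
    s≡ = trans (QP.+-comm (ι i) (ι (+ r))) (ι-split m (+ r))
    e₂ : β i (+ r I.- + 1) (t I.+ + 1) * (L (+ r) + 2ℚ) ≡ g₂ (+ r I.- + 1)
    e₂ = cong₂ _*_ (cong₂ (λ x y → β x (+ r I.- + 1) y) (sym (i₁ m (+ r))) (sym (sub-pred (+ n) (+ r)))) (sym (trans (cong (_- 2ℚ) (L-up r)) (shift₂ (L (+ r)))))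
    e₃ : β (i I.- + 1) (+ r I.- + 1) (t I.+ + 1) * (L (+ r) + 1ℚ) ≡ g₃ (+ r I.- + 1)
    e₃ = cong₂ _*_ (cong₂ (λ x y → β x (+ r I.- + 1) y) (cong (I._- + 1) (sym (i₁ m (+ r)))) (sym (sub-pred (+ n) (+ r)))) (sym (trans (cong (_- 3ℚ) (L-up r)) (shift₃ (L (+ r)))))
    base : 2ℚ * ι m * α i (+ r) t ≡ (2ℚ * ι m - 1ℚ) * (A r + g₂ (+ r I.- + 1)) - (2ℚ * ι m - 2ℚ) * g₃ (+ r I.- + 1)
    base = begin
      2ℚ * ι m * α i (+ r) t ≡⟨ cong (λ x → 2ℚ * x * α i (+ r) t) (sym s≡) ⟩
      2ℚ * s * α i (+ r) t   ≡⟨ β-recurrence i (+ r) t ⟩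
      (2ℚ * s - 1ℚ) * (A r + β i (+ r I.- + 1) (t I.+ + 1) * (L (+ r) + 2ℚ)) - (2ℚ * s - 2ℚ) * (β (i I.- + 1) (+ r I.- + 1) (t I.+ + 1) * (L (+ r) + 1ℚ))
        ≡⟨ cong₂ (λ x y → (2ℚ * s - 1ℚ) * (A r + x) - (2ℚ * s - 2ℚ) * y) e₂ e₃ ⟩
      (2ℚ * s - 1ℚ) * (A r + g₂ (+ r I.- + 1)) - (2ℚ * s - 2ℚ) * g₃ (+ r I.- + 1)
        ≡⟨ cong (λ s → (2ℚ * s - 1ℚ) * (A r + g₂ (+ r I.- + 1)) - (2ℚ * s - 2ℚ) * g₃ (+ r I.- + 1)) s≡ ⟩
      (2ℚ * ι m - 1ℚ) * (A r + g₂ (+ r I.- + 1)) - (2ℚ * ι m - 2ℚ) * g₃ (+ r I.- + 1) ∎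
  ι-down : ∀ x → ι (x I.- + 1) ≡ ι x - 1ℚ
  ι-down x = trans (ι-sub x (+ 1)) (cong (λ y → ι x - y) ι-1)
  α-down : ∀ r → α (m I.- + 1 I.- + r) (+ r) (+ n I.- + r) ≡ β (m I.- + r I.- + 1) (+ r) (+ n I.- + r) * (L (+ r) - 1ℚ)
  α-down r = trans (cong (λ x → α x (+ r) (+ n I.- + r)) (sub-sub m (+ r)))
    (cong (β (m I.- + r I.- + 1) (+ r) (+ n I.- + r) *_) (trans (cong (λ x → 2ℚ * (x + ι (+ n I.- + r)) + 1ℚ) (ι-down (m I.- + r))) (lem (ι (m I.- + r)) (ι (+ n I.- + r)))))
    where
    lem : ∀ a b → 2ℚ * (a - 1ℚ + b) + 1ℚ ≡ 2ℚ * (a + b) - 1ℚ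
    lem = solve-∀ ring
  α-down₂ : ∀ r → α (m I.- + 1 I.- + 1 I.- + r) (+ r) (+ n I.- + r) ≡ g₃ (+ r)
  α-down₂ r = trans (cong (λ x → α x (+ r) (+ n I.- + r)) (lem′ m (+ r)))
    (cong (β (m I.- + r I.- + 1 I.- + 1) (+ r) (+ n I.- + r) *_) (trans (cong (λ x → 2ℚ * (x + ι (+ n I.- + r)) + 1ℚ) (trans (ι-down (m I.- + r I.- + 1)) (cong (_- 1ℚ) (ι-down (m I.- + r))))) (lem (ι (m I.- + r)) (ι (+ n I.- + r)))))
    where
    lem : ∀ a b → 2ℚ * (a - 1ℚ - 1ℚ + b) + 1ℚ ≡ 2ℚ * (a + b) - 3ℚ
    lem = solve-∀ ring
    lem′ : ∀ m r → m I.- + 1 I.- + 1 I.- r ≡ m I.- r I.- + 1 I.- + 1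
    lem′ = IR.solve-∀
  L-pq : ∀ r → 2ℚ * (ι (p I.- + r) + ι (q I.- + r)) ≡ L (+ r)
  L-pq r = cong (2ℚ *_) (trans (sym (ι-+ (p I.- + r) (q I.- + r))) (trans (cong ι (trans (lem p q (+ r)) (trans (cong (λ x → x I.- + r I.- + r) pq) (sym (lem m (+ n) (+ r)))))) (ι-+ (m I.- + r) (+ n I.- + r))))
    where
    lem : ∀ p q r → (p I.- r) I.+ (q I.- r) ≡ p I.+ q I.- r I.- r
    lem = IR.solve-∀
  H-suc : ∀ r → H (+ suc r) ≡ γ (p I.- + r I.- + 1) * γ (q I.- + r I.- + 1)
  H-suc r = cong₂ (λ x y → γ x * γ y) (sub-suc p (+ r)) (sub-suc q (+ r))
  middle : ∀ r → α (m I.- + 1 I.- + r) (+ r) (+ n I.- + r) * (γ (p I.- + 1 I.- + r) * γ (q I.- + r)) + α (m I.- + 1 I.- + r) (+ r) (+ n I.- + r) * (γ (p I.- + r) * γ (q I.- + 1 I.- + r))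
    ≡ A r * H (+ r) + g₂ (+ r) * H (+ suc r)
  middle r = trans (cong₂ _+_ (cong₂ (λ x y → x * (γ y * γ (q I.- + r))) (α-down r) (sub-sub p (+ r))) (cong₂ (λ x y → x * (γ (p I.- + r) * γ y)) (α-down r) (sub-sub q (+ r))))
    (trans (combine (β (m I.- + r I.- + 1) (+ r) (+ n I.- + r)) (L (+ r)) _ _ (H (+ r)) (γ (p I.- + r I.- + 1) * γ (q I.- + r I.- + 1)) rec)
       (cong (λ x → A r * H (+ r) + g₂ (+ r) * x) (sym (H-suc r))))
    where
    rec : L (+ r) * H (+ r) ≡ (L (+ r) - 1ℚ) * (γ (p I.- + r I.- + 1) * γ (q I.- + r) + γ (p I.- + r) * γ (q I.- + r I.- + 1)) - (L (+ r) - 2ℚ) * (γ (p I.- + r I.- + 1) * γ (q I.- + r I.- + 1))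
    rec = subst (λ l → l * H (+ r) ≡ (l - 1ℚ) * (γ (p I.- + r I.- + 1) * γ (q I.- + r) + γ (p I.- + r) * γ (q I.- + r I.- + 1)) - (l - 2ℚ) * (γ (p I.- + r I.- + 1) * γ (q I.- + r I.- + 1)))
      (L-pq r) (γ-product-recurrence (p I.- + r) (q I.- + r))
    combine : ∀ b l x y h h' → l * h ≡ (l - 1ℚ) * (x + y) - (l - 2ℚ) * h' → b * (l - 1ℚ) * x + b * (l - 1ℚ) * y ≡ b * l * h + b * (l - 2ℚ) * h'
    combine b l x y h h' e = by-lc (lem b l x y h h') (lc1 {c = - b} (diff0 e))
      where
      lem : ∀ b l x y h h' → b * (l - 1ℚ) * x + b * (l - 1ℚ) * y ≡ b * l * h + b * (l - 2ℚ) * h' + (- b) * (l * h - ((l - 1ℚ) * (x + y) - (l - 2ℚ) * h'))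
      lem = solve-∀ ring
  first : ∑ (suc k) (λ r → A r * H (+ r)) + ∑ (suc k) (λ r → g₂ (+ r I.- + 1) * H (+ r)) ≡ Strip k (m I.- + 1) (+ n) (p I.- + 1) q + Strip k (m I.- + 1) (+ n) p (q I.- + 1)
  first = begin
    ∑ (suc k) (λ r → A r * H (+ r)) + ∑ (suc k) (λ r → g₂ (+ r I.- + 1) * H (+ r))
      ≡⟨ cong (λ x → ∑ (suc k) (λ r → A r * H (+ r)) + x) (∑-shift k g₂ H (zero-*ˡ (β-0ʳ (m I.- -[1+ 0 ] I.- + 1) (+ n I.- -[1+ 0 ]) (γ-neg 0))) (zero-*ˡ (β-0ᵗ (m I.- + k I.- + 1) (+ k) (γ-minus n<k)))) ⟩
    ∑ (suc k) (λ r → A r * H (+ r)) + ∑ (suc k) (λ r → g₂ (+ r) * H (+ suc r))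
      ≡⟨ sym (∑-+ (suc k) {λ r → A r * H (+ r)} {λ r → g₂ (+ r) * H (+ suc r)}) ⟩
    ∑ (suc k) (λ r → A r * H (+ r) + g₂ (+ r) * H (+ suc r))
      ≡⟨ sym (∑-cong (suc k) middle) ⟩
    ∑ (suc k) (λ r → F₁ r + F₂ r)
      ≡⟨ ∑-+ (suc k) {F₁} {F₂} ⟩
    Strip k (m I.- + 1) (+ n) (p I.- + 1) q + Strip k (m I.- + 1) (+ n) p (q I.- + 1) ∎
    where
    F₁ F₂ : ℕ → ℚ
    F₁ r = α (m I.- + 1 I.- + r) (+ r) (+ n I.- + r) * (γ (p I.- + 1 I.- + r) * γ (q I.- + r))
    F₂ r = α (m I.- + 1 I.- + r) (+ r) (+ n I.- + r) * (γ (p I.- + r) * γ (q I.- + 1 I.- + r))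
  third : ∑ (suc k) (λ r → g₃ (+ r I.- + 1) * H (+ r)) ≡ Strip k (m I.- + 1 I.- + 1) (+ n) (p I.- + 1) (q I.- + 1)
  third = trans (∑-shift k g₃ H (zero-*ˡ (β-0ʳ (m I.- -[1+ 0 ] I.- + 1 I.- + 1) (+ n I.- -[1+ 0 ]) (γ-neg 0))) (zero-*ˡ (β-0ᵗ (m I.- + k I.- + 1 I.- + 1) (+ k) (γ-minus n<k))))
    (∑-cong (suc k) (λ r → cong₂ _*_ (sym (α-down₂ r)) (trans (H-suc r) (cong₂ (λ x y → γ x * γ y) (sym (sub-sub p (+ r))) (sym (sub-sub q (+ r)))))))

∑-head : ∀ k f → (∀ i → f (suc i) ≡ 0ℚ) → ∑ (suc k) f ≡ f 0
∑-head k f e = trans (cong (λ x → f 0 + x) (∑-0 k (λ i _ → e i))) (QP.+-identityʳ (f 0))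

-- Only i = 0 and r = 0 survive, because γ is zero at negative arguments, and α(0, 0, n) = 1 by
-- `γκ-inv`.
adams-0 : ∀ k n p q → p I.+ q ≡ + 0 I.+ + n → Conv k (+ 0) p q ≡ Strip k (+ 0) (+ n) p q
adams-0 k n p q pq = trans (∑-head k c (λ i → zero-*ˡ (zero-*ʳ {x = γ (+ suc i)} (γ-neg i))))
  (trans (cong₂ _*_ lhs (cong₂ (λ x y → γ x * γ y) refl (lem q)))
    (sym (∑-head k s (λ r → zero-*ˡ (zero-*ˡ (β-0ⁱ (+ suc r) (+ n I.- + suc r) (γ-neg r)))))))
  where
  c s : ℕ → ℚ
  c i = γ (+ i) * γ (+ 0 I.- + i) * (γ (p I.- + i) * γ (q I.- + 0 I.+ + i))
  s r = α (+ 0 I.- + r) (+ r) (+ n I.- + r) * (γ (p I.- + r) * γ (q I.- + r))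
  lem : ∀ q → q I.- + 0 I.+ + 0 ≡ q I.- + 0
  lem = IR.solve-∀
  lem′ : ∀ g k l → 1ℚ * 1ℚ * g * k * (2ℚ * (0ℚ + l) + 1ℚ) ≡ g * k * (2ℚ * l + 1ℚ)
  lem′ = solve-∀ ring
  use : ∀ {g z g' k l} → g ≡ 1ℚ → z ≡ 0ℚ → g' ≡ γ (+ n) → k ≡ κ (+ n) → l ≡ ι (+ n) → g * g * g' * k * (2ℚ * (z + l) + 1ℚ) ≡ γ (+ n) * κ (+ n) * (2ℚ * ι (+ n) + 1ℚ)
  use refl refl refl refl refl = lem′ (γ (+ n)) (κ (+ n)) (ι (+ n))
  lhs : γ (+ 0) * γ (+ 0) ≡ α (+ 0) (+ 0) (+ n I.- + 0)
  lhs = trans (cong₂ _*_ γ-0 γ-0) (sym (trans (use γ-0 ι-0 (cong γ (m-0 (+ n))) (cong κ (trans (IP.+-identityˡ _) (m-0 (+ n)))) (cong ι (m-0 (+ n)))) (γκ-inv n)))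

-- The second hypothesis is premultiplied by 2(m + 1) - 2, so that at m = 0, where P_(-1) would
-- occur, it holds trivially.
adams-step : ∀ k m n p q → suc m N.≤ k → n N.< k → p I.+ q ≡ + suc m I.+ + n →
  (∀ p q → p I.+ q ≡ + m I.+ + n → Conv k (+ m) p q ≡ Strip k (+ m) (+ n) p q) →
  (2ℚ * ι (+ suc m) - 2ℚ) * Conv k (+ m I.- + 1) (p I.- + 1) (q I.- + 1) ≡ (2ℚ * ι (+ suc m) - 2ℚ) * Strip k (+ m I.- + 1) (+ n) (p I.- + 1) (q I.- + 1) →
  Conv k (+ suc m) p q ≡ Strip k (+ suc m) (+ n) p q
adams-step k m n p q m<k n<k pq ih₁ ih₂ = ι-cancel (+ 2 I.* + suc m) (2+≢0 m)
  (trans (cong (_* Conv k (+ suc m) p q) (ι-2* (+ suc m)))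
  (trans (Conv-recurrence k (+ suc m) p q (γ-minus (s≤s m<k)) (γ-minus (s≤s (NP.<⇒≤ m<k))))
  (trans (cong₂ (λ x y → (2ℚ * ι (+ suc m) - 1ℚ) * x - y) (cong₂ _+_ (ih₁ (p I.- + 1) q (trans (lem₁ p q) eq)) (ih₁ p (q I.- + 1) (trans (lem₂ p q) eq))) ih₂)
  (sym (trans (cong (_* Strip k (+ suc m) (+ n) p q) (ι-2* (+ suc m))) (Strip-recurrence k (+ suc m) n p q n<k pq))))))
  where
  lem₁ : ∀ p q → p I.- + 1 I.+ q ≡ p I.+ q I.- + 1
  lem₁ = IR.solve-∀
  lem₂ : ∀ p q → p I.+ (q I.- + 1) ≡ p I.+ q I.- + 1
  lem₂ = IR.solve-∀
  eq : p I.+ q I.- + 1 ≡ + m I.+ + n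
  eq = cong (I._- + 1) pq

-- Adams' formula for products of Legendre polynomials, in homogeneous coefficient form.
adams : ∀ k m n p q → m N.≤ k → n N.< k → p I.+ q ≡ + m I.+ + n → Conv k (+ m) p q ≡ Strip k (+ m) (+ n) p q
adams k zero          n p q m≤k n<k pq = adams-0 k n p q pq
adams k (suc zero)    n p q m≤k n<k pq = adams-step k 0 n p q m≤k n<k pq (λ p q → adams k 0 n p q z≤n n<k) (trans (zero-*ˡ c0) (sym (zero-*ˡ c0)))
  where
  c0 : 2ℚ * ι (+ 1) - 2ℚ ≡ 0ℚ
  c0 = cong (λ x → 2ℚ * x - 2ℚ) ι-1
adams k (suc (suc m)) n p q m≤k n<k pq = adams-step k (suc m) n p q m≤k n<k pq (λ p q → adams k (suc m) n p q (NP.<⇒≤ m≤k) n<k)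
  (cong (λ x → (2ℚ * ι (+ suc (suc m)) - 2ℚ) * x) (adams k m n (p I.- + 1) (q I.- + 1) (NP.<⇒≤ (NP.<⇒≤ m≤k)) n<k (trans (lem p q) (cong (λ x → x I.- + 1 I.- + 1) pq))))
  where
  lem : ∀ p q → p I.- + 1 I.+ (q I.- + 1) ≡ p I.+ q I.- + 1 I.- + 1
  lem = IR.solve-∀

-- Partial fractions

-- The e's are reciprocals of A, B, V = A + x and W = B + y. Two factors with a known gap collapse,
-- x (1 + e_A)(1 - e_V) = x + (x - 1)(e_A - e_V), and the mixed products that remain split after
-- multiplication by the four cross differences δ, τ, σ, q. The right side is therefore linear in
-- the reciprocals.
partial-fractions : ∀ eA eB eV eW x y δ τ σ q →
  x * (eA * eV) ≡ eA - eV → y * (eB * eW) ≡ eB - eW → δ * (eB * eA) ≡ eB - eA → τ * (eW * eA) ≡ eW - eA → σ * (eB * eV) ≡ eB - eV → q * (eW * eV) ≡ eW - eV →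
  δ * τ * σ * q * (x * y * ((1ℚ + eA) * (1ℚ + eB) * ((1ℚ - eV) * (1ℚ - eW))))
  ≡ δ * τ * σ * q * (x * y + y * (x - 1ℚ) * (eA - eV) + x * (y - 1ℚ) * (eB - eW))
    + (x - 1ℚ) * (y - 1ℚ) * (τ * σ * q * (eB - eA) - δ * σ * q * (eW - eA) - δ * τ * q * (eB - eV) + δ * τ * σ * (eW - eV))
partial-fractions eA eB eV eW x y δ τ σ q h₁ h₂ h₃ h₄ h₅ h₆ = begin
  δ * τ * σ * q * (x * y * ((1ℚ + eA) * (1ℚ + eB) * ((1ℚ - eV) * (1ℚ - eW))))
    ≡⟨ regroup (δ * τ * σ * q) x y eA eB eV eW ⟩
  δ * τ * σ * q * ((x + x * (eA - eV) - x * (eA * eV)) * (y + y * (eB - eW) - y * (eB * eW)))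
    ≡⟨ cong₂ (λ u v → δ * τ * σ * q * ((x + x * (eA - eV) - u) * (y + y * (eB - eW) - v))) h₁ h₂ ⟩
  δ * τ * σ * q * ((x + x * (eA - eV) - (eA - eV)) * (y + y * (eB - eW) - (eB - eW)))
    ≡⟨ expand δ τ σ q x y eA eB eV eW ⟩
  δ * τ * σ * q * (x * y + y * (x - 1ℚ) * (eA - eV) + x * (y - 1ℚ) * (eB - eW))
    + (x - 1ℚ) * (y - 1ℚ) * (τ * σ * q * (δ * (eB * eA)) - δ * σ * q * (τ * (eW * eA)) - δ * τ * q * (σ * (eB * eV)) + δ * τ * σ * (q * (eW * eV)))
    ≡⟨ cong (λ u → δ * τ * σ * q * (x * y + y * (x - 1ℚ) * (eA - eV) + x * (y - 1ℚ) * (eB - eW)) + (x - 1ℚ) * (y - 1ℚ) * u) inner ⟩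
  δ * τ * σ * q * (x * y + y * (x - 1ℚ) * (eA - eV) + x * (y - 1ℚ) * (eB - eW))
    + (x - 1ℚ) * (y - 1ℚ) * (τ * σ * q * (eB - eA) - δ * σ * q * (eW - eA) - δ * τ * q * (eB - eV) + δ * τ * σ * (eW - eV)) ∎
  where
  regroup : ∀ k x y eA eB eV eW → k * (x * y * ((1ℚ + eA) * (1ℚ + eB) * ((1ℚ - eV) * (1ℚ - eW))))
    ≡ k * ((x + x * (eA - eV) - x * (eA * eV)) * (y + y * (eB - eW) - y * (eB * eW)))
  regroup = solve-∀ ring
  expand : ∀ δ τ σ q x y eA eB eV eW → δ * τ * σ * q * ((x + x * (eA - eV) - (eA - eV)) * (y + y * (eB - eW) - (eB - eW)))
    ≡ δ * τ * σ * q * (x * y + y * (x - 1ℚ) * (eA - eV) + x * (y - 1ℚ) * (eB - eW))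
      + (x - 1ℚ) * (y - 1ℚ) * (τ * σ * q * (δ * (eB * eA)) - δ * σ * q * (τ * (eW * eA)) - δ * τ * q * (σ * (eB * eV)) + δ * τ * σ * (q * (eW * eV)))
  expand = solve-∀ ring
  inner : τ * σ * q * (δ * (eB * eA)) - δ * σ * q * (τ * (eW * eA)) - δ * τ * q * (σ * (eB * eV)) + δ * τ * σ * (q * (eW * eV))
    ≡ τ * σ * q * (eB - eA) - δ * σ * q * (eW - eA) - δ * τ * q * (eB - eV) + δ * τ * σ * (eW - eV)
  inner = cong₂ _+_ (cong₂ _-_ (cong₂ (λ u v → τ * σ * q * u - δ * σ * q * v) h₃ h₄) (cong (δ * τ * q *_) h₅)) (cong (δ * τ * σ *_) h₆)

reciprocal-difference : ∀ x e y f {d} → x * e ≡ 1ℚ → y * f ≡ 1ℚ → y - x ≡ d → d * (e * f) ≡ e - f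
reciprocal-difference x e y f xe yf refl = by-lc (lem x y e f) (lc+ {c = e} (diff0 yf) (lc1 {c = - f} (diff0 xe)))
  where
  lem : ∀ x y e f → (y - x) * (e * f) ≡ e - f + (e * (y * f - 1ℚ) + (- f) * (x * e - 1ℚ))
  lem = solve-∀ ring

-- `a₁` to `c₀` are the six values of α and β in the Pieri identities with the common factor `Ω` of
-- `Values` divided out. `b₄` and `b₅` come from β, since the odd factor of α cancels there against
-- a denominator of σ₁ or σ₂. `δ` and `q` are the differences A - B and V - W.
module Coefficients (I R T : ℚ) where
  Σ' q δ a₁ a₂ a₃ b₄ b₅ c₀ : ℚ
  Σ' = I + R + T
  q  = 2ℚ * (I + T) - 1ℚ
  δ  = 2ℚ * (T + R) - 1ℚ
  a₁ = (2ℚ * I - 1ℚ) * (2ℚ * R) * (2ℚ * T) * (2ℚ * Σ' - 1ℚ) * q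
  a₂ = 2ℚ * I * (2ℚ * R - 1ℚ) * (2ℚ * T - 1ℚ) * (2ℚ * Σ' - 2ℚ) * q
  a₃ = 2ℚ * I * (2ℚ * R) * (2ℚ * T - 1ℚ) * (2ℚ * Σ' - 1ℚ) * q
  b₄ = (2ℚ * I - 1ℚ) * (2ℚ * R) * (2ℚ * T - 1ℚ) * (2ℚ * Σ' - 2ℚ)
  b₅ = 2ℚ * I * (2ℚ * R - 1ℚ) * (2ℚ * T) * (2ℚ * Σ' - 1ℚ)
  c₀ = (2ℚ * I - 1ℚ) * (2ℚ * R - 1ℚ) * (2ℚ * T) * (2ℚ * Σ' - 2ℚ) * q

open Coefficients public

module _ (I R T : ℚ) where

  -- After the expansion in partial fractions everything is linear in the four reciprocals, so that
  -- each residue is a polynomial identity in I, R, T and the ring solver can decide it.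
  linear₁ : ∀ eA eB eV eW → (1ℚ + eA) * (δ I R T - 1ℚ) * a₁ I R T + (1ℚ + eB) * (δ I R T + 1ℚ) * a₂ I R T + δ I R T * a₃ I R T
    ≡ δ I R T * (1ℚ + eV) * (q I R T + 1ℚ) * b₄ I R T + δ I R T * (1ℚ + eW) * (q I R T - 1ℚ) * b₅ I R T
      + ((2ℚ * (T + R) - 1ℚ) * (2ℚ * T - 1ℚ) * (2ℚ * (I + R + T) - 1ℚ) * (2ℚ * (I + T) - 1ℚ) * ((2ℚ * I) * (2ℚ * R) + (2ℚ * R) * ((2ℚ * I) - 1ℚ) * (eA - eV) + (2ℚ * I) * ((2ℚ * R) - 1ℚ) * (eB - eW)) + ((2ℚ * I) - 1ℚ) * ((2ℚ * R) - 1ℚ) * ((2ℚ * T - 1ℚ) * (2ℚ * (I + R + T) - 1ℚ) * (2ℚ * (I + T) - 1ℚ) * (eB - eA) - (2ℚ * (T + R) - 1ℚ) * (2ℚ * (I + R + T) - 1ℚ) * (2ℚ * (I + T) - 1ℚ) * (eW - eA) - (2ℚ * (T + R) - 1ℚ) * (2ℚ * T - 1ℚ) * (2ℚ * (I + T) - 1ℚ) * (eB - eV) + (2ℚ * (T + R) - 1ℚ) * (2ℚ * T - 1ℚ) * (2ℚ * (I + R + T) - 1ℚ) * (eW - eV)))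
  linear₁ = lem I R T
    where
    lem : ∀ I R T eA eB eV eW → (1ℚ + eA) * ((2ℚ * (T + R) - 1ℚ) - 1ℚ) * ((2ℚ * I - 1ℚ) * (2ℚ * R) * (2ℚ * T) * (2ℚ * (I + R + T) - 1ℚ) * (2ℚ * (I + T) - 1ℚ)) + (1ℚ + eB) * ((2ℚ * (T + R) - 1ℚ) + 1ℚ) * (2ℚ * I * (2ℚ * R - 1ℚ) * (2ℚ * T - 1ℚ) * (2ℚ * (I + R + T) - 2ℚ) * (2ℚ * (I + T) - 1ℚ)) + (2ℚ * (T + R) - 1ℚ) * (2ℚ * I * (2ℚ * R) * (2ℚ * T - 1ℚ) * (2ℚ * (I + R + T) - 1ℚ) * (2ℚ * (I + T) - 1ℚ))
      ≡ (2ℚ * (T + R) - 1ℚ) * (1ℚ + eV) * ((2ℚ * (I + T) - 1ℚ) + 1ℚ) * ((2ℚ * I - 1ℚ) * (2ℚ * R) * (2ℚ * T - 1ℚ) * (2ℚ * (I + R + T) - 2ℚ)) + (2ℚ * (T + R) - 1ℚ) * (1ℚ + eW) * ((2ℚ * (I + T) - 1ℚ) - 1ℚ) * (2ℚ * I * (2ℚ * R - 1ℚ) * (2ℚ * T) * (2ℚ * (I + R + T) - 1ℚ))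
        + ((2ℚ * (T + R) - 1ℚ) * (2ℚ * T - 1ℚ) * (2ℚ * (I + R + T) - 1ℚ) * (2ℚ * (I + T) - 1ℚ) * ((2ℚ * I) * (2ℚ * R) + (2ℚ * R) * ((2ℚ * I) - 1ℚ) * (eA - eV) + (2ℚ * I) * ((2ℚ * R) - 1ℚ) * (eB - eW)) + ((2ℚ * I) - 1ℚ) * ((2ℚ * R) - 1ℚ) * ((2ℚ * T - 1ℚ) * (2ℚ * (I + R + T) - 1ℚ) * (2ℚ * (I + T) - 1ℚ) * (eB - eA) - (2ℚ * (T + R) - 1ℚ) * (2ℚ * (I + R + T) - 1ℚ) * (2ℚ * (I + T) - 1ℚ) * (eW - eA) - (2ℚ * (T + R) - 1ℚ) * (2ℚ * T - 1ℚ) * (2ℚ * (I + T) - 1ℚ) * (eB - eV) + (2ℚ * (T + R) - 1ℚ) * (2ℚ * T - 1ℚ) * (2ℚ * (I + R + T) - 1ℚ) * (eW - eV)))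
    lem = solve-∀ ring

  linear₂ : ∀ fA fB eV eW → (1ℚ - fB) * (δ I R T - 1ℚ) * a₁ I R T + (1ℚ - fA) * (δ I R T + 1ℚ) * a₂ I R T + δ I R T * c₀ I R T
    ≡ δ I R T * (1ℚ - eW) * (q I R T + 1ℚ) * b₄ I R T + δ I R T * (1ℚ - eV) * (q I R T - 1ℚ) * b₅ I R T
      + ((2ℚ * (I + T) - 1ℚ) * (2ℚ * (I + R + T) - 2ℚ) * (2ℚ * T) * (2ℚ * (T + R) - 1ℚ) * ((1ℚ - 2ℚ * I) * (1ℚ - 2ℚ * R) + (1ℚ - 2ℚ * R) * ((1ℚ - 2ℚ * I) - 1ℚ) * (eV - fA) + (1ℚ - 2ℚ * I) * ((1ℚ - 2ℚ * R) - 1ℚ) * (eW - fB)) + ((1ℚ - 2ℚ * I) - 1ℚ) * ((1ℚ - 2ℚ * R) - 1ℚ) * ((2ℚ * (I + R + T) - 2ℚ) * (2ℚ * T) * (2ℚ * (T + R) - 1ℚ) * (eW - eV) - (2ℚ * (I + T) - 1ℚ) * (2ℚ * T) * (2ℚ * (T + R) - 1ℚ) * (fB - eV) - (2ℚ * (I + T) - 1ℚ) * (2ℚ * (I + R + T) - 2ℚ) * (2ℚ * (T + R) - 1ℚ) * (eW - fA) + (2ℚ * (I + T) - 1ℚ) * (2ℚ * (I + R + T) - 2ℚ) * (2ℚ * T) * (fB - fA)))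
  linear₂ = lem I R T
    where
    lem : ∀ I R T fA fB eV eW → (1ℚ - fB) * ((2ℚ * (T + R) - 1ℚ) - 1ℚ) * ((2ℚ * I - 1ℚ) * (2ℚ * R) * (2ℚ * T) * (2ℚ * (I + R + T) - 1ℚ) * (2ℚ * (I + T) - 1ℚ)) + (1ℚ - fA) * ((2ℚ * (T + R) - 1ℚ) + 1ℚ) * (2ℚ * I * (2ℚ * R - 1ℚ) * (2ℚ * T - 1ℚ) * (2ℚ * (I + R + T) - 2ℚ) * (2ℚ * (I + T) - 1ℚ)) + (2ℚ * (T + R) - 1ℚ) * ((2ℚ * I - 1ℚ) * (2ℚ * R - 1ℚ) * (2ℚ * T) * (2ℚ * (I + R + T) - 2ℚ) * (2ℚ * (I + T) - 1ℚ))
      ≡ (2ℚ * (T + R) - 1ℚ) * (1ℚ - eW) * ((2ℚ * (I + T) - 1ℚ) + 1ℚ) * ((2ℚ * I - 1ℚ) * (2ℚ * R) * (2ℚ * T - 1ℚ) * (2ℚ * (I + R + T) - 2ℚ)) + (2ℚ * (T + R) - 1ℚ) * (1ℚ - eV) * ((2ℚ * (I + T) - 1ℚ) - 1ℚ) * (2ℚ * I * (2ℚ * R - 1ℚ) * (2ℚ * T) * (2ℚ * (I + R + T) - 1ℚ))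
        + ((2ℚ * (I + T) - 1ℚ) * (2ℚ * (I + R + T) - 2ℚ) * (2ℚ * T) * (2ℚ * (T + R) - 1ℚ) * ((1ℚ - 2ℚ * I) * (1ℚ - 2ℚ * R) + (1ℚ - 2ℚ * R) * ((1ℚ - 2ℚ * I) - 1ℚ) * (eV - fA) + (1ℚ - 2ℚ * I) * ((1ℚ - 2ℚ * R) - 1ℚ) * (eW - fB)) + ((1ℚ - 2ℚ * I) - 1ℚ) * ((1ℚ - 2ℚ * R) - 1ℚ) * ((2ℚ * (I + R + T) - 2ℚ) * (2ℚ * T) * (2ℚ * (T + R) - 1ℚ) * (eW - eV) - (2ℚ * (I + T) - 1ℚ) * (2ℚ * T) * (2ℚ * (T + R) - 1ℚ) * (fB - eV) - (2ℚ * (I + T) - 1ℚ) * (2ℚ * (I + R + T) - 2ℚ) * (2ℚ * (T + R) - 1ℚ) * (eW - fA) + (2ℚ * (I + T) - 1ℚ) * (2ℚ * (I + R + T) - 2ℚ) * (2ℚ * T) * (fB - fA)))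
    lem = solve-∀ ring

  residues₁ : ∀ A B V W {eA eB eV eW} → A * eA ≡ 1ℚ → B * eB ≡ 1ℚ → V * eV ≡ 1ℚ → W * eW ≡ 1ℚ →
    A ≡ B + δ I R T → V ≡ A + 2ℚ * I → W ≡ B + 2ℚ * R →
    (1ℚ + eA) * (δ I R T - 1ℚ) * a₁ I R T + (1ℚ + eB) * (δ I R T + 1ℚ) * a₂ I R T + δ I R T * a₃ I R T
    ≡ δ I R T * (1ℚ + eV) * (q I R T + 1ℚ) * b₄ I R T + δ I R T * (1ℚ + eW) * (q I R T - 1ℚ) * b₅ I R T
      + δ I R T * ((1ℚ + eA) * (1ℚ + eB) * ((1ℚ - eV) * (1ℚ - eW))) * a₃ I R T
  residues₁ A B V W {eA} {eB} {eV} {eW} hA hB hV hW refl refl refl =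
    trans (linear₁ eA eB eV eW)
      (cong (λ x → δ I R T * (1ℚ + eV) * (q I R T + 1ℚ) * b₄ I R T + δ I R T * (1ℚ + eW) * (q I R T - 1ℚ) * b₅ I R T + x)
        (trans (sym (partial-fractions eA eB eV eW (2ℚ * I) (2ℚ * R) (2ℚ * (T + R) - 1ℚ) (2ℚ * T - 1ℚ) (2ℚ * (I + R + T) - 1ℚ) (2ℚ * (I + T) - 1ℚ)
          (reciprocal-difference A eA V eV hA hV (d₁ I R T B)) (reciprocal-difference B eB W eW hB hW (d₂ R B)) (reciprocal-difference B eB A eA hB hA (d₃ R T B))
          (reciprocal-difference W eW A eA hW hA (d₄ R T B)) (reciprocal-difference B eB V eV hB hV (d₅ I R T B)) (reciprocal-difference W eW V eV hW hV (d₆ I R T B))))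
          (regroup (2ℚ * (T + R) - 1ℚ) (2ℚ * I) (2ℚ * R) (2ℚ * T - 1ℚ) (2ℚ * (I + R + T) - 1ℚ) (2ℚ * (I + T) - 1ℚ) ((1ℚ + eA) * (1ℚ + eB) * ((1ℚ - eV) * (1ℚ - eW))))))
    where
    d₁ : ∀ I R T B → B + (2ℚ * (T + R) - 1ℚ) + 2ℚ * I - (B + (2ℚ * (T + R) - 1ℚ)) ≡ 2ℚ * I
    d₁ = solve-∀ ring
    d₂ : ∀ R B → B + 2ℚ * R - B ≡ 2ℚ * R
    d₂ = solve-∀ ring
    d₃ : ∀ R T B → B + (2ℚ * (T + R) - 1ℚ) - B ≡ (2ℚ * (T + R) - 1ℚ)
    d₃ = solve-∀ ring
    d₄ : ∀ R T B → B + (2ℚ * (T + R) - 1ℚ) - (B + 2ℚ * R) ≡ (2ℚ * T - 1ℚ)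
    d₄ = solve-∀ ring
    d₅ : ∀ I R T B → B + (2ℚ * (T + R) - 1ℚ) + 2ℚ * I - B ≡ (2ℚ * (I + R + T) - 1ℚ)
    d₅ = solve-∀ ring
    d₆ : ∀ I R T B → B + (2ℚ * (T + R) - 1ℚ) + 2ℚ * I - (B + 2ℚ * R) ≡ (2ℚ * (I + T) - 1ℚ)
    d₆ = solve-∀ ring
    regroup : ∀ δ x y τ σ q P → δ * τ * σ * q * (x * y * P) ≡ δ * P * (x * y * τ * σ * q)
    regroup = solve-∀ ring

  -- The same expansion with the roles exchanged: V and W now carry the plus signs, A + 1 and B + 1
  -- the minus signs, and the gaps are 1 - 2I and 1 - 2R.
  residues₂ : ∀ A B V W {fA fB eV eW} → (A + 1ℚ) * fA ≡ 1ℚ → (B + 1ℚ) * fB ≡ 1ℚ → V * eV ≡ 1ℚ → W * eW ≡ 1ℚ →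
    A ≡ B + δ I R T → V ≡ A + 2ℚ * I → W ≡ B + 2ℚ * R →
    (1ℚ - fB) * (δ I R T - 1ℚ) * a₁ I R T + (1ℚ - fA) * (δ I R T + 1ℚ) * a₂ I R T + δ I R T * c₀ I R T
    ≡ δ I R T * (1ℚ - eW) * (q I R T + 1ℚ) * b₄ I R T + δ I R T * (1ℚ - eV) * (q I R T - 1ℚ) * b₅ I R T
      + δ I R T * ((1ℚ + eV) * (1ℚ + eW) * ((1ℚ - fA) * (1ℚ - fB))) * c₀ I R T
  residues₂ A B V W {fA} {fB} {eV} {eW} hA hB hV hW refl refl refl =
    trans (linear₂ fA fB eV eW)
      (cong (λ x → δ I R T * (1ℚ - eW) * (q I R T + 1ℚ) * b₄ I R T + δ I R T * (1ℚ - eV) * (q I R T - 1ℚ) * b₅ I R T + x)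
        (trans (sym (partial-fractions eV eW fA fB (1ℚ - 2ℚ * I) (1ℚ - 2ℚ * R) (2ℚ * (I + T) - 1ℚ) (2ℚ * (I + R + T) - 2ℚ) (2ℚ * T) (2ℚ * (T + R) - 1ℚ)
          (reciprocal-difference V eV (A + 1ℚ) fA hV hA (d₁ I R T B)) (reciprocal-difference W eW (B + 1ℚ) fB hW hB (d₂ R B)) (reciprocal-difference W eW V eV hW hV (d₃ I R T B))
          (reciprocal-difference (B + 1ℚ) fB V eV hB hV (d₄ I R T B)) (reciprocal-difference W eW (A + 1ℚ) fA hW hA (d₅ R T B)) (reciprocal-difference (B + 1ℚ) fB (A + 1ℚ) fA hB hA (d₆ R T B))))
          (regroup (2ℚ * (T + R) - 1ℚ) I R (2ℚ * T) (2ℚ * (I + R + T) - 2ℚ) (2ℚ * (I + T) - 1ℚ) ((1ℚ + eV) * (1ℚ + eW) * ((1ℚ - fA) * (1ℚ - fB))))))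
    where
    d₁ : ∀ I R T B → B + (2ℚ * (T + R) - 1ℚ) + 1ℚ - (B + (2ℚ * (T + R) - 1ℚ) + 2ℚ * I) ≡ 1ℚ - 2ℚ * I
    d₁ = solve-∀ ring
    d₂ : ∀ R B → B + 1ℚ - (B + 2ℚ * R) ≡ 1ℚ - 2ℚ * R
    d₂ = solve-∀ ring
    d₃ : ∀ I R T B → B + (2ℚ * (T + R) - 1ℚ) + 2ℚ * I - (B + 2ℚ * R) ≡ (2ℚ * (I + T) - 1ℚ)
    d₃ = solve-∀ ring
    d₄ : ∀ I R T B → B + (2ℚ * (T + R) - 1ℚ) + 2ℚ * I - (B + 1ℚ) ≡ (2ℚ * (I + R + T) - 2ℚ)
    d₄ = solve-∀ ring
    d₅ : ∀ R T B → B + (2ℚ * (T + R) - 1ℚ) + 1ℚ - (B + 2ℚ * R) ≡ (2ℚ * T)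
    d₅ = solve-∀ ring
    d₆ : ∀ R T B → B + (2ℚ * (T + R) - 1ℚ) + 1ℚ - (B + 1ℚ) ≡ (2ℚ * (T + R) - 1ℚ)
    d₆ = solve-∀ ring
    regroup : ∀ δ I R t s q P → q * s * t * δ * ((1ℚ - 2ℚ * I) * (1ℚ - 2ℚ * R) * P) ≡ δ * P * ((2ℚ * I - 1ℚ) * (2ℚ * R - 1ℚ) * t * s * q)
    regroup = solve-∀ ring

-- The coefficient identities behind the Pieri rule

*-factor₅ : ∀ u v w z pi pr pt pk {gi gr gt k f pf} → gi ≡ pi * u → gr ≡ pr * v → gt ≡ pt * w → k ≡ pk * z → f ≡ pf →
  gi * gr * gt * k * f ≡ pi * pr * pt * pk * pf * (u * v * w * z)
*-factor₅ u v w z pi pr pt pk {pf = pf} refl refl refl refl refl = lem pi pr pt pk pf u v w z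
  where
  lem : ∀ a b c d e u v w z → a * u * (b * v) * (c * w) * (d * z) * e ≡ a * b * c * d * e * (u * v * w * z)
  lem = solve-∀ ring

*-factor₄ : ∀ u v w z pi pr pt pk {gi gr gt k } → gi ≡ pi * u → gr ≡ pr * v → gt ≡ pt * w → k ≡ pk * z →
  gi * gr * gt * k ≡ pi * pr * pt * pk * (u * v * w * z)
*-factor₄ u v w z pi pr pt pk refl refl refl refl = lem pi pr pt pk u v w z
  where
  lem : ∀ a b c d u v w z → a * u * (b * v) * (c * w) * (d * z) ≡ a * b * c * d * (u * v * w * z)
  lem = solve-∀ ring

ι-down : ∀ x → ι (x I.- + 1) ≡ ι x - 1ℚ
ι-down x = trans (ι-sub x (+ 1)) (cong (λ y → ι x - y) ι-1)

-- The six values have arguments differing by at most one from (I, R, T), so a single product of ξ's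
-- and a ζ divides them all. κ is evaluated at I + R + T - 1 and I + R + T - 2; the hypothesis puts
-- these at k + 1 and k, where `ζ` applies.
module Values (I R T : ℤ) (k : ℕ) (sum : I I.+ R I.+ T ≡ + suc (suc k)) where
  i r t Ω : ℚ
  i = ι I
  r = ι R
  t = ι T
  Ω = ξ I * ξ R * ξ T * ζ k

  private
    ι-k : ι (+ suc k) ≡ i + r + t - 1ℚ
    ι-k = trans (lem (ι (+ suc k))) (cong (_- 1ℚ) (trans (sym (ι-suc (suc k))) (trans (cong ι (sym sum)) (trans (ι-+ (I I.+ R) T) (cong (_+ t) (ι-+ I R))))))
      where
      lem : ∀ x → x ≡ x + 1ℚ - 1ℚ
      lem = solve-∀ ring
    κ-hi : ∀ {s} → s ≡ I I.+ R I.+ T I.- + 1 → κ s ≡ (2ℚ * (i + r + t) - 2ℚ) * ζ k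
    κ-hi e = trans (cong κ (trans e (cong (I._- + 1) sum))) (trans (κ-ζ k) (cong (_* ζ k) (trans (cong (2ℚ *_) ι-k) (lem (i + r + t)))))
      where
      lem : ∀ x → 2ℚ * (x - 1ℚ) ≡ 2ℚ * x - 2ℚ
      lem = solve-∀ ring
    κ-lo : ∀ {s} → s ≡ I I.+ R I.+ T I.- + 1 I.- + 1 → κ s ≡ (2ℚ * (i + r + t) - 1ℚ) * ζ k
    κ-lo e = trans (cong κ (trans e (cong (λ x → x I.- + 1 I.- + 1) sum))) (trans (κ-ζ⁻ k) (cong (_* ζ k) (trans (cong (λ x → 2ℚ * x + 1ℚ) ι-k) (lem (i + r + t)))))
      where
      lem : ∀ x → 2ℚ * (x - 1ℚ) + 1ℚ ≡ 2ℚ * x - 1ℚ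
      lem = solve-∀ ring
    q-i : 2ℚ * (ι (I I.- + 1) + t) + 1ℚ ≡ q i r t
    q-i = trans (cong (λ x → 2ℚ * (x + t) + 1ℚ) (ι-down I)) (lem i t)
      where
      lem : ∀ i t → 2ℚ * (i - 1ℚ + t) + 1ℚ ≡ 2ℚ * (i + t) - 1ℚ
      lem = solve-∀ ring
    q-t : 2ℚ * (i + ι (T I.- + 1)) + 1ℚ ≡ q i r t
    q-t = trans (cong (λ x → 2ℚ * (i + x) + 1ℚ) (ι-down T)) (lem i t)
      where
      lem : ∀ i t → 2ℚ * (i + (t - 1ℚ)) + 1ℚ ≡ 2ℚ * (i + t) - 1ℚ
      lem = solve-∀ ring
    x₁ : ∀ I R T → I I.+ (R I.- + 1) I.+ (T I.- + 1) ≡ I I.+ R I.+ T I.- + 1 I.- + 1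
    x₁ = IR.solve-∀
    x₂ : ∀ I R T → I I.- + 1 I.+ R I.+ T ≡ I I.+ R I.+ T I.- + 1
    x₂ = IR.solve-∀
    x₃ : ∀ I R T → I I.- + 1 I.+ (R I.- + 1) I.+ T ≡ I I.+ R I.+ T I.- + 1 I.- + 1
    x₃ = IR.solve-∀
    x₄ : ∀ I R T → I I.+ (R I.- + 1) I.+ T ≡ I I.+ R I.+ T I.- + 1
    x₄ = IR.solve-∀
    x₅ : ∀ I R T → I I.- + 1 I.+ R I.+ (T I.- + 1) ≡ I I.+ R I.+ T I.- + 1 I.- + 1
    x₅ = IR.solve-∀
    x₀ : ∀ I R T → I I.+ R I.+ (T I.- + 1) ≡ I I.+ R I.+ T I.- + 1
    x₀ = IR.solve-∀

  value₁ : α I (R I.- + 1) (T I.- + 1) ≡ a₁ i r t * Ω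
  value₁ = *-factor₅ (ξ I) (ξ R) (ξ T) (ζ k) (2ℚ * i - 1ℚ) (2ℚ * r) (2ℚ * t) (2ℚ * (i + r + t) - 1ℚ) (γ-ξ I) (γ-ξ⁻ R) (γ-ξ⁻ T) (κ-lo (x₁ I R T)) q-t
  value₂ : α (I I.- + 1) R T ≡ a₂ i r t * Ω
  value₂ = *-factor₅ (ξ I) (ξ R) (ξ T) (ζ k) (2ℚ * i) (2ℚ * r - 1ℚ) (2ℚ * t - 1ℚ) (2ℚ * (i + r + t) - 2ℚ) (γ-ξ⁻ I) (γ-ξ R) (γ-ξ T) (κ-hi (x₂ I R T)) q-i
  value₃ : α (I I.- + 1) (R I.- + 1) T ≡ a₃ i r t * Ω
  value₃ = *-factor₅ (ξ I) (ξ R) (ξ T) (ζ k) (2ℚ * i) (2ℚ * r) (2ℚ * t - 1ℚ) (2ℚ * (i + r + t) - 1ℚ) (γ-ξ⁻ I) (γ-ξ⁻ R) (γ-ξ T) (κ-lo (x₃ I R T)) q-i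
  value₄ : β I (R I.- + 1) T ≡ b₄ i r t * Ω
  value₄ = *-factor₄ (ξ I) (ξ R) (ξ T) (ζ k) (2ℚ * i - 1ℚ) (2ℚ * r) (2ℚ * t - 1ℚ) (2ℚ * (i + r + t) - 2ℚ) (γ-ξ I) (γ-ξ⁻ R) (γ-ξ T) (κ-hi (x₄ I R T))
  value₅ : β (I I.- + 1) R (T I.- + 1) ≡ b₅ i r t * Ω
  value₅ = *-factor₄ (ξ I) (ξ R) (ξ T) (ζ k) (2ℚ * i) (2ℚ * r - 1ℚ) (2ℚ * t) (2ℚ * (i + r + t) - 1ℚ) (γ-ξ⁻ I) (γ-ξ R) (γ-ξ⁻ T) (κ-lo (x₅ I R T))
  value₀ : α I R (T I.- + 1) ≡ c₀ i r t * Ω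
  value₀ = *-factor₅ (ξ I) (ξ R) (ξ T) (ζ k) (2ℚ * i - 1ℚ) (2ℚ * r - 1ℚ) (2ℚ * t) (2ℚ * (i + r + t) - 2ℚ) (γ-ξ I) (γ-ξ R) (γ-ξ⁻ T) (κ-hi (x₀ I R T)) q-t

-- These are (v + 1)/v and (v - 1)/v. The factor R is a product of two of each kind, see `RR-h`.
h hᵒ : ℤ → ℚ
h v  = 1ℚ + ρ v
hᵒ v = 1ℚ - ρ v

odd : ℤ → ℤ
odd n = + 2 I.* (n I.+ + 1) I.- + 1

odd-inv : ∀ n → (2ℚ * ι n + 1ℚ) * ρ (odd n) ≡ 1ℚ
odd-inv n = trans (cong (_* ρ (odd n)) (sym (κ-odd n))) (ρ-inv (odd n) (odd≢0 (n I.+ + 1)))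

-- Weights in the part of S linear in w: one box of the first row, respectively of the second row,
-- is traded for w.
σ₁ σ₂ : ℤ → ℤ → ℚ
σ₁ v n = h v * (2ℚ * ι n * ρ (odd n))
σ₂ v n = h v * ((2ℚ * ι n + 2ℚ) * ρ (odd n))

hhᵒ-inv : ∀ v {e f} → v * e ≡ 1ℚ → (v + 1ℚ) * f ≡ 1ℚ → (1ℚ + e) * (1ℚ - f) ≡ 1ℚ
hhᵒ-inv v {e} {f} ve vf = by-lc (lem v e f) (lc+ {c = f} (diff0 ve) (lc1 {c = - e} (diff0 vf)))
  where
  lem : ∀ v e f → (1ℚ + e) * (1ℚ - f) ≡ 1ℚ + (f * (v * e - 1ℚ) + (- e) * ((v + 1ℚ) * f - 1ℚ))
  lem = solve-∀ ring

assemble₁ : ∀ hA hB hV hW P n₁ n₂ m₄ m₅ a₁ a₂ a₃ b₄ b₅ δ d Ω →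
  hA * n₁ * a₁ + hB * n₂ * a₂ + δ * a₃ ≡ δ * hV * m₄ * b₄ + δ * hW * m₅ * b₅ + δ * P * a₃ → δ * d ≡ 1ℚ →
  hA * (n₁ * d) * (a₁ * Ω) + hB * (n₂ * d) * (a₂ * Ω) + a₃ * Ω ≡ hV * m₄ * (b₄ * Ω) + hW * m₅ * (b₅ * Ω) + P * (a₃ * Ω)
assemble₁ hA hB hV hW P n₁ n₂ m₄ m₅ a₁ a₂ a₃ b₄ b₅ δ d Ω D e =
  by-lc (lem hA hB hV hW P n₁ n₂ m₄ m₅ a₁ a₂ a₃ b₄ b₅ δ d Ω)
    (lc+ {c = d * Ω} (diff0 D) (lc1 {c = hV * m₄ * (b₄ * Ω) + hW * m₅ * (b₅ * Ω) + P * (a₃ * Ω) - a₃ * Ω} (diff0 e)))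
  where
  lem : ∀ hA hB hV hW P n₁ n₂ m₄ m₅ a₁ a₂ a₃ b₄ b₅ δ d Ω →
    hA * (n₁ * d) * (a₁ * Ω) + hB * (n₂ * d) * (a₂ * Ω) + a₃ * Ω ≡ hV * m₄ * (b₄ * Ω) + hW * m₅ * (b₅ * Ω) + P * (a₃ * Ω)
      + (d * Ω * (hA * n₁ * a₁ + hB * n₂ * a₂ + δ * a₃ - (δ * hV * m₄ * b₄ + δ * hW * m₅ * b₅ + δ * P * a₃))
        + (hV * m₄ * (b₄ * Ω) + hW * m₅ * (b₅ * Ω) + P * (a₃ * Ω) - a₃ * Ω) * (δ * d - 1ℚ))
  lem = solve-∀ ring

-- Dividing through by hA hB, whose inverse is kA kB.
assemble₂ : ∀ hA hB hV hW kA kB kV kW n₁ n₂ m₄ m₅ a₁ a₂ c₀ b₄ b₅ δ d Ω →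
  kB * n₁ * a₁ + kA * n₂ * a₂ + δ * c₀ ≡ δ * kW * m₄ * b₄ + δ * kV * m₅ * b₅ + δ * (hV * hW * (kA * kB)) * c₀ →
  δ * d ≡ 1ℚ → hA * kA ≡ 1ℚ → hB * kB ≡ 1ℚ →
  hA * hB * (c₀ * Ω) + hA * (n₁ * d) * (a₁ * Ω) + hB * (n₂ * d) * (a₂ * Ω)
    ≡ hV * hW * (c₀ * Ω) + hA * hB * kW * m₄ * (b₄ * Ω) + hA * hB * kV * m₅ * (b₅ * Ω)
assemble₂ hA hB hV hW kA kB kV kW n₁ n₂ m₄ m₅ a₁ a₂ c₀ b₄ b₅ δ d Ω D e eA eB = begin
  hA * hB * (c₀ * Ω) + hA * (n₁ * d) * (a₁ * Ω) + hB * (n₂ * d) * (a₂ * Ω)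
    ≡⟨ l₁ hA hB n₁ n₂ a₁ a₂ c₀ d Ω ⟩
  hA * hB * 1ℚ * (c₀ * Ω) + hA * 1ℚ * (n₁ * d) * (a₁ * Ω) + hB * 1ℚ * (n₂ * d) * (a₂ * Ω)
    ≡⟨ cong₂ _+_ (cong₂ (λ x y → hA * hB * x * (c₀ * Ω) + hA * y * (n₁ * d) * (a₁ * Ω)) (sym e) (sym eB)) (cong (λ x → hB * x * (n₂ * d) * (a₂ * Ω)) (sym eA)) ⟩
  hA * hB * (δ * d) * (c₀ * Ω) + hA * (hB * kB) * (n₁ * d) * (a₁ * Ω) + hB * (hA * kA) * (n₂ * d) * (a₂ * Ω)
    ≡⟨ l₂ hA hB kA kB n₁ n₂ a₁ a₂ c₀ δ d Ω ⟩
  hA * hB * d * Ω * (kB * n₁ * a₁ + kA * n₂ * a₂ + δ * c₀)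
    ≡⟨ cong (hA * hB * d * Ω *_) D ⟩
  hA * hB * d * Ω * (δ * kW * m₄ * b₄ + δ * kV * m₅ * b₅ + δ * (hV * hW * (kA * kB)) * c₀)
    ≡⟨ l₃ hA hB hV hW kA kB kV kW m₄ m₅ c₀ b₄ b₅ δ d Ω ⟩
  (δ * d) * (hV * hW * ((hA * kA) * (hB * kB)) * (c₀ * Ω) + hA * hB * kW * m₄ * (b₄ * Ω) + hA * hB * kV * m₅ * (b₅ * Ω))
    ≡⟨ cong₂ (λ x y → x * (hV * hW * y * (c₀ * Ω) + hA * hB * kW * m₄ * (b₄ * Ω) + hA * hB * kV * m₅ * (b₅ * Ω))) e (cong₂ _*_ eA eB) ⟩
  1ℚ * (hV * hW * 1ℚ * (c₀ * Ω) + hA * hB * kW * m₄ * (b₄ * Ω) + hA * hB * kV * m₅ * (b₅ * Ω))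
    ≡⟨ trans (QP.*-identityˡ _) (cong (λ x → x * (c₀ * Ω) + hA * hB * kW * m₄ * (b₄ * Ω) + hA * hB * kV * m₅ * (b₅ * Ω)) (QP.*-identityʳ (hV * hW))) ⟩
  hV * hW * (c₀ * Ω) + hA * hB * kW * m₄ * (b₄ * Ω) + hA * hB * kV * m₅ * (b₅ * Ω) ∎
  where
  l₁ : ∀ hA hB n₁ n₂ a₁ a₂ c₀ d Ω → hA * hB * (c₀ * Ω) + hA * (n₁ * d) * (a₁ * Ω) + hB * (n₂ * d) * (a₂ * Ω)
    ≡ hA * hB * 1ℚ * (c₀ * Ω) + hA * 1ℚ * (n₁ * d) * (a₁ * Ω) + hB * 1ℚ * (n₂ * d) * (a₂ * Ω)
  l₁ = solve-∀ ring
  l₂ : ∀ hA hB kA kB n₁ n₂ a₁ a₂ c₀ δ d Ω → hA * hB * (δ * d) * (c₀ * Ω) + hA * (hB * kB) * (n₁ * d) * (a₁ * Ω) + hB * (hA * kA) * (n₂ * d) * (a₂ * Ω)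
    ≡ hA * hB * d * Ω * (kB * n₁ * a₁ + kA * n₂ * a₂ + δ * c₀)
  l₂ = solve-∀ ring
  l₃ : ∀ hA hB hV hW kA kB kV kW m₄ m₅ c₀ b₄ b₅ δ d Ω → hA * hB * d * Ω * (δ * kW * m₄ * b₄ + δ * kV * m₅ * b₅ + δ * (hV * hW * (kA * kB)) * c₀)
    ≡ (δ * d) * (hV * hW * ((hA * kA) * (hB * kB)) * (c₀ * Ω) + hA * hB * kW * m₄ * (b₄ * Ω) + hA * hB * kV * m₅ * (b₅ * Ω))
  l₃ = solve-∀ ring

zero-sum : ∀ {x y} → x ≡ 0ℚ → y ≡ 0ℚ → x + y ≡ 0ℚ
zero-sum refl refl = refl

α-0ⁱ : ∀ {i} r t → γ i ≡ 0ℚ → α i r t ≡ 0ℚ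
α-0ⁱ r t e = zero-*ˡ (β-0ⁱ r t e)

α-0ʳ : ∀ i {r} t → γ r ≡ 0ℚ → α i r t ≡ 0ℚ
α-0ʳ i t e = zero-*ˡ (β-0ʳ i t e)

α-0ᵗ : ∀ i r {t} → γ t ≡ 0ℚ → α i r t ≡ 0ℚ
α-0ᵗ i r e = zero-*ˡ (β-0ᵗ i r e)

ρ-minus-one : ρ -[1+ 0 ] ≡ - 1ℚ
ρ-minus-one = begin
  ρ -[1+ 0 ]                     ≡⟨ lem (ρ -[1+ 0 ]) ⟩
  - ((- 1ℚ) * ρ -[1+ 0 ])        ≡⟨ cong -_ (trans (cong (_* ρ -[1+ 0 ]) (sym (trans (ι-neg (+ 1)) (cong -_ ι-1)))) (ρ-inv -[1+ 0 ] λ ())) ⟩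
  - 1ℚ ∎
  where
  lem : ∀ x → x ≡ - ((- 1ℚ) * x)
  lem = solve-∀ ring

h-minus-one : h -[1+ 0 ] ≡ 0ℚ
h-minus-one = trans (cong (λ x → 1ℚ + x) ρ-minus-one) refl

σ₁-0 : ∀ v {n} → n ≡ + 0 → σ₁ v n ≡ 0ℚ
σ₁-0 v refl = zero-*ʳ {x = h v} (zero-*ˡ (zero-*ʳ {x = 2ℚ} ι-0))

cancel-mid : ∀ X m d b f → f * d ≡ 1ℚ → X * (m * d) * (b * f) ≡ X * m * b
cancel-mid X m d b f e = trans (lem X m d b f) (trans (cong (X * m * b *_) e) (QP.*-identityʳ _))
  where
  lem : ∀ X m d b f → X * (m * d) * (b * f) ≡ X * m * b * (f * d)
  lem = solve-∀ ring

zero-combination : ∀ x y z {a b c c'} → a ≡ 0ℚ → b ≡ 0ℚ → c ≡ 0ℚ → c' ≡ z * c → x * a + y * b + c' ≡ 0ℚ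
zero-combination x y z refl refl refl refl = lem x y z
  where
  lem : ∀ x y z → x * 0ℚ + y * 0ℚ + z * 0ℚ ≡ 0ℚ
  lem = solve-∀ ring

-- The values that 2b + c - 1 takes on shapes: positive ones, and -1 for a single row.
Base : ℤ → Set
Base B = (Σ ℕ λ y → B ≡ + suc y) ⊎ B ≡ -[1+ 0 ]

-- `Identity₁` and `Identity₂` express the Pieri rule at w^(c+1) and w^(c+2) for a fixed power of
-- uv. Strips with R and with R - 1 boxes in the second row meet at the same power, and T counts
-- from the latter, whence T + R = n + 1.
module Identities (B : ℤ) (n : ℕ) (I : ℤ) (R : ℕ) (T : ℤ) (TR : T I.+ + R ≡ + n I.+ + 1) where

  A V W n₄ n₅ : ℤ
  A = B I.+ odd (+ n)
  V = A I.+ + 2 I.* I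
  W = B I.+ + 2 I.* + R
  n₄ = I I.+ T
  n₅ = (I I.- + 1) I.+ (T I.- + 1)

  A₀ A₁ A₂ A₃ A₄ A₅ : ℚ
  A₀ = α I (+ R) (T I.- + 1)
  A₁ = α I (+ R I.- + 1) (T I.- + 1)
  A₂ = α (I I.- + 1) (+ R) T
  A₃ = α (I I.- + 1) (+ R I.- + 1) T
  A₄ = α I (+ R I.- + 1) T
  A₅ = α (I I.- + 1) (+ R) (T I.- + 1)

  Identity₁ Identity₂ : Set
  Identity₁ = σ₁ A (+ n) * A₁ + σ₂ B (+ n) * A₂ + A₃ ≡ σ₁ V n₄ * A₄ + σ₂ W n₅ * A₅ + h A * h B * (hᵒ V * hᵒ W) * A₃
  Identity₂ = h A * h B * A₀ + σ₁ A (+ n) * A₁ + σ₂ B (+ n) * A₂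
    ≡ h V * h W * A₀ + h A * h B * hᵒ W * (2ℚ * ι n₄ * ρ (odd n₄)) * A₄ + h A * h B * hᵒ V * ((2ℚ * ι n₅ + 2ℚ) * ρ (odd n₅)) * A₅

  all-zero : A₀ ≡ 0ℚ → A₁ ≡ 0ℚ → A₂ ≡ 0ℚ → A₃ ≡ 0ℚ → A₄ ≡ 0ℚ → A₅ ≡ 0ℚ → Identity₁ × Identity₂
  all-zero z₀ z₁ z₂ z₃ z₄ z₅ =
    trans (zero-combination (σ₁ A (+ n)) (σ₂ B (+ n)) 1ℚ z₁ z₂ z₃ (sym (QP.*-identityˡ A₃)))
      (sym (zero-combination (σ₁ V n₄) (σ₂ W n₅) (h A * h B * (hᵒ V * hᵒ W)) z₄ z₅ z₃ refl)) ,
    trans (zero-combination (h A * h B) (σ₁ A (+ n)) (σ₂ B (+ n)) z₀ z₁ z₂ refl)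
      (sym (zero-combination (h V * h W) (h A * h B * hᵒ W * (2ℚ * ι n₄ * ρ (odd n₄))) (h A * h B * hᵒ V * ((2ℚ * ι n₅ + 2ℚ) * ρ (odd n₅))) z₀ z₄ z₅ refl))

  ι-A : ι A ≡ ι B + (2ℚ * (ι T + ι (+ R)) - 1ℚ)
  ι-A = trans (ι-+ B (odd (+ n))) (cong (λ x → ι B + x) (trans (ι-odd (+ n I.+ + 1)) (cong (λ x → 2ℚ * x - 1ℚ) (trans (cong ι (sym TR)) (ι-+ T (+ R))))))

  ι-V : ι V ≡ ι A + 2ℚ * ι I
  ι-V = trans (ι-+ A (+ 2 I.* I)) (cong (λ x → ι A + x) (ι-2* I))

  ι-W : ι W ≡ ι B + 2ℚ * ι (+ R)
  ι-W = trans (ι-+ B (+ 2 I.* + R)) (cong (λ x → ι B + x) (ι-2* (+ R)))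

  ι-δ : 2ℚ * ι (+ n) + 1ℚ ≡ 2ℚ * (ι T + ι (+ R)) - 1ℚ
  ι-δ = trans (sym (κ-odd (+ n))) (trans (ι-odd (+ n I.+ + 1)) (cong (λ x → 2ℚ * x - 1ℚ) (trans (cong ι (sym TR)) (ι-+ T (+ R)))))

  ι-n₄ : ι n₄ ≡ ι I + ι T
  ι-n₄ = ι-+ I T

  ι-n₅ : ι n₅ ≡ ι (I I.- + 1) + ι (T I.- + 1)
  ι-n₅ = ι-+ (I I.- + 1) (T I.- + 1)

  module Generic (k : ℕ) (sum : I I.+ + R I.+ T ≡ + suc (suc k)) where
    open Values I (+ R) T k sum

    private
      δ' q' d : ℚ
      δ' = δ i r t
      q' = q i r t
      d = ρ (odd (+ n))

      δd : δ' * d ≡ 1ℚ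
      δd = trans (cong (_* d) (sym ι-δ)) (odd-inv (+ n))

      n₁≡ : 2ℚ * ι (+ n) ≡ δ' - 1ℚ
      n₁≡ = trans (lem (ι (+ n))) (cong (_- 1ℚ) ι-δ)
        where
        lem : ∀ x → 2ℚ * x ≡ 2ℚ * x + 1ℚ - 1ℚ
        lem = solve-∀ ring

      n₂≡ : 2ℚ * ι (+ n) + 2ℚ ≡ δ' + 1ℚ
      n₂≡ = trans (lem (ι (+ n))) (cong (_+ 1ℚ) ι-δ)
        where
        lem : ∀ x → 2ℚ * x + 2ℚ ≡ 2ℚ * x + 1ℚ + 1ℚ
        lem = solve-∀ ring

      m₄≡ : 2ℚ * ι n₄ ≡ q' + 1ℚ
      m₄≡ = trans (cong (2ℚ *_) ι-n₄) (lem i t)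
        where
        lem : ∀ i t → 2ℚ * (i + t) ≡ 2ℚ * (i + t) - 1ℚ + 1ℚ
        lem = solve-∀ ring

      m₅≡ : 2ℚ * ι n₅ + 2ℚ ≡ q' - 1ℚ
      m₅≡ = trans (cong (λ x → 2ℚ * x + 2ℚ) (trans ι-n₅ (cong₂ _+_ (ι-down I) (ι-down T)))) (lem i t)
        where
        lem : ∀ i t → 2ℚ * (i - 1ℚ + (t - 1ℚ)) + 2ℚ ≡ 2ℚ * (i + t) - 1ℚ - 1ℚ
        lem = solve-∀ ring

      term₁ : ∀ X → X * (2ℚ * ι (+ n) * d) * A₁ ≡ X * ((δ' - 1ℚ) * d) * (a₁ i r t * Ω)
      term₁ X = cong₂ (λ x y → X * (x * d) * y) n₁≡ value₁

      term₂ : ∀ X → X * ((2ℚ * ι (+ n) + 2ℚ) * d) * A₂ ≡ X * ((δ' + 1ℚ) * d) * (a₂ i r t * Ω)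
      term₂ X = cong₂ (λ x y → X * (x * d) * y) n₂≡ value₂

      term₄ : ∀ X → X * (2ℚ * ι n₄ * ρ (odd n₄)) * A₄ ≡ X * (q' + 1ℚ) * (b₄ i r t * Ω)
      term₄ X = trans (cancel-mid X (2ℚ * ι n₄) (ρ (odd n₄)) (β I (+ R I.- + 1) T) (2ℚ * (ι I + ι T) + 1ℚ) (trans (cong (λ x → (2ℚ * x + 1ℚ) * ρ (odd n₄)) (sym ι-n₄)) (odd-inv n₄)))
        (cong₂ (λ x y → X * x * y) m₄≡ value₄)

      term₅ : ∀ X → X * ((2ℚ * ι n₅ + 2ℚ) * ρ (odd n₅)) * A₅ ≡ X * (q' - 1ℚ) * (b₅ i r t * Ω)
      term₅ X = trans (cancel-mid X (2ℚ * ι n₅ + 2ℚ) (ρ (odd n₅)) (β (I I.- + 1) (+ R) (T I.- + 1)) (2ℚ * (ι (I I.- + 1) + ι (T I.- + 1)) + 1ℚ) (trans (cong (λ x → (2ℚ * x + 1ℚ) * ρ (odd n₅)) (sym ι-n₅)) (odd-inv n₅)))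
        (cong₂ (λ x y → X * x * y) m₅≡ value₅)

      ι-succ : ∀ x → ι (x I.+ + 1) ≡ ι x + 1ℚ
      ι-succ x = trans (ι-+ x (+ 1)) (cong (λ y → ι x + y) ι-1)

    regular : A ≢ + 0 → B ≢ + 0 → V ≢ + 0 → W ≢ + 0 → A I.+ + 1 ≢ + 0 → B I.+ + 1 ≢ + 0 → Identity₁ × Identity₂
    regular A≢0 B≢0 V≢0 W≢0 A1≢0 B1≢0 = first , second
      where
      first : Identity₁
      first = trans (cong₂ _+_ (cong₂ _+_ (term₁ (h A)) (term₂ (h B))) value₃)
        (trans (assemble₁ (h A) (h B) (h V) (h W) (h A * h B * (hᵒ V * hᵒ W)) (δ' - 1ℚ) (δ' + 1ℚ) (q' + 1ℚ) (q' - 1ℚ) (a₁ i r t) (a₂ i r t) (a₃ i r t) (b₄ i r t) (b₅ i r t) δ' d Ω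
          (residues₁ i r t (ι A) (ι B) (ι V) (ι W) (ρ-inv A A≢0) (ρ-inv B B≢0) (ρ-inv V V≢0) (ρ-inv W W≢0) ι-A ι-V ι-W) δd)
        (sym (cong₂ _+_ (cong₂ _+_ (term₄ (h V)) (term₅ (h W))) (cong (h A * h B * (hᵒ V * hᵒ W) *_) value₃))))
      kA kB : ℚ
      kA = 1ℚ - ρ (A I.+ + 1)
      kB = 1ℚ - ρ (B I.+ + 1)
      eA : (ι A + 1ℚ) * ρ (A I.+ + 1) ≡ 1ℚ
      eA = trans (cong (_* ρ (A I.+ + 1)) (sym (ι-succ A))) (ρ-inv (A I.+ + 1) A1≢0)
      eB : (ι B + 1ℚ) * ρ (B I.+ + 1) ≡ 1ℚ
      eB = trans (cong (_* ρ (B I.+ + 1)) (sym (ι-succ B))) (ρ-inv (B I.+ + 1) B1≢0)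
      second : Identity₂
      second = trans (cong₂ _+_ (cong₂ _+_ (cong (h A * h B *_) value₀) (term₁ (h A))) (term₂ (h B)))
        (trans (assemble₂ (h A) (h B) (h V) (h W) kA kB (hᵒ V) (hᵒ W) (δ' - 1ℚ) (δ' + 1ℚ) (q' + 1ℚ) (q' - 1ℚ) (a₁ i r t) (a₂ i r t) (c₀ i r t) (b₄ i r t) (b₅ i r t) δ' d Ω
          (residues₂ i r t (ι A) (ι B) (ι V) (ι W) eA eB (ρ-inv V V≢0) (ρ-inv W W≢0) ι-A ι-V ι-W) δd (hhᵒ-inv (ι A) (ρ-inv A A≢0) eA) (hhᵒ-inv (ι B) (ρ-inv B B≢0) eB))
        (sym (cong₂ _+_ (cong₂ _+_ (cong (h V * h W *_) value₀) (term₄ (h A * h B * hᵒ W))) (term₅ (h A * h B * hᵒ V)))))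

    -- For one-row shapes h(B) = 0 removes every term in which it is a factor, and the division
    -- behind `assemble₂` is impossible. In exchange V = 2(I + R + T) - 2 and W = 2R - 1 are
    -- explicit, and what remains is checked directly from the values of h at these two.
    degenerate : B ≡ -[1+ 0 ] → V ≢ + 0 → σ₁ A (+ n) * A₁ ≡ A₁ → Identity₁ × Identity₂
    degenerate B≡ V≢0 e₁ = first , second
      where
      hB : h B ≡ 0ℚ
      hB = trans (cong h B≡) h-minus-one
      ι-B : ι B ≡ - 1ℚ
      ι-B = trans (cong ι B≡) (trans (ι-neg (+ 1)) (cong -_ ι-1))
      W≢0 : W ≢ + 0
      W≢0 e = odd≢0 (+ R) (trans (IP.+-comm (+ 2 I.* + R) -[1+ 0 ]) (trans (cong (I._+ + 2 I.* + R) (sym B≡)) e))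
      h-eq : ∀ {v x} → v ≢ + 0 → ι v ≡ x → h v * x ≡ x + 1ℚ
      h-eq {v} v≢0 refl = by-lc (lem (ι v) (ρ v)) (lc1 {c = 1ℚ} (diff0 (ρ-inv v v≢0)))
        where
        lem : ∀ x e → (1ℚ + e) * x ≡ x + 1ℚ + 1ℚ * (x * e - 1ℚ)
        lem = solve-∀ ring
      hV : h V * (2ℚ * (i + r + t) - 2ℚ) ≡ 2ℚ * (i + r + t) - 1ℚ
      hV = trans (h-eq V≢0 (trans ι-V (trans (cong (λ x → x + 2ℚ * i) (trans ι-A (cong (_+ (2ℚ * (t + r) - 1ℚ)) ι-B))) (lem i r t)))) (lem′ i r t)
        where
        lem : ∀ i r t → - 1ℚ + (2ℚ * (t + r) - 1ℚ) + 2ℚ * i ≡ 2ℚ * (i + r + t) - 2ℚ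
        lem = solve-∀ ring
        lem′ : ∀ i r t → 2ℚ * (i + r + t) - 2ℚ + 1ℚ ≡ 2ℚ * (i + r + t) - 1ℚ
        lem′ = solve-∀ ring
      hW : h W * (2ℚ * r - 1ℚ) ≡ 2ℚ * r
      hW = trans (h-eq W≢0 (trans ι-W (trans (cong (_+ 2ℚ * r) ι-B) (lem r)))) (lem′ r)
        where
        lem : ∀ r → - 1ℚ + 2ℚ * r ≡ 2ℚ * r - 1ℚ
        lem = solve-∀ ring
        lem′ : ∀ r → 2ℚ * r - 1ℚ + 1ℚ ≡ 2ℚ * r
        lem′ = solve-∀ ring
      σ₂B : σ₂ B (+ n) * A₂ ≡ 0ℚ
      σ₂B = zero-*ˡ (zero-*ˡ hB)
      hAB : h A * h B ≡ 0ℚ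
      hAB = zero-*ʳ {x = h A} hB
      poly₁ : ∀ i r t x y Ω → x * (2ℚ * (i + r + t) - 2ℚ) ≡ 2ℚ * (i + r + t) - 1ℚ → y * (2ℚ * r - 1ℚ) ≡ 2ℚ * r →
        a₁ i r t * Ω + 0ℚ + a₃ i r t * Ω ≡ x * (q i r t + 1ℚ) * (b₄ i r t * Ω) + y * (q i r t - 1ℚ) * (b₅ i r t * Ω) + 0ℚ
      poly₁ i r t x y Ω ex ey = by-lc (lem i r t x y Ω)
        (lc+ {c = - ((2ℚ * i - 1ℚ) * (2ℚ * r) * (2ℚ * t - 1ℚ) * (2ℚ * (i + t)) * Ω)} (diff0 ex) (lc1 {c = - (2ℚ * i * (2ℚ * t) * (2ℚ * (i + r + t) - 1ℚ) * (2ℚ * (i + t) - 2ℚ) * Ω)} (diff0 ey)))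
        where
        lem : ∀ i r t x y Ω → (2ℚ * i - 1ℚ) * (2ℚ * r) * (2ℚ * t) * (2ℚ * (i + r + t) - 1ℚ) * (2ℚ * (i + t) - 1ℚ) * Ω + 0ℚ + 2ℚ * i * (2ℚ * r) * (2ℚ * t - 1ℚ) * (2ℚ * (i + r + t) - 1ℚ) * (2ℚ * (i + t) - 1ℚ) * Ω
          ≡ x * (2ℚ * (i + t) - 1ℚ + 1ℚ) * ((2ℚ * i - 1ℚ) * (2ℚ * r) * (2ℚ * t - 1ℚ) * (2ℚ * (i + r + t) - 2ℚ) * Ω)
            + y * (2ℚ * (i + t) - 1ℚ - 1ℚ) * (2ℚ * i * (2ℚ * r - 1ℚ) * (2ℚ * t) * (2ℚ * (i + r + t) - 1ℚ) * Ω) + 0ℚ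
            + (- ((2ℚ * i - 1ℚ) * (2ℚ * r) * (2ℚ * t - 1ℚ) * (2ℚ * (i + t)) * Ω) * (x * (2ℚ * (i + r + t) - 2ℚ) - (2ℚ * (i + r + t) - 1ℚ))
              + (- (2ℚ * i * (2ℚ * t) * (2ℚ * (i + r + t) - 1ℚ) * (2ℚ * (i + t) - 2ℚ) * Ω)) * (y * (2ℚ * r - 1ℚ) - 2ℚ * r))
        lem = solve-∀ ring
      first : Identity₁
      first = trans (cong₂ _+_ (cong₂ _+_ (trans e₁ value₁) σ₂B) value₃)
        (trans (poly₁ i r t (h V) (h W) Ω hV hW)
        (sym (cong₂ _+_ (cong₂ _+_ (term₄ (h V)) (term₅ (h W))) (zero-*ˡ (zero-*ˡ hAB)))))
      poly₂ : ∀ i r t x y Ω → x * (2ℚ * (i + r + t) - 2ℚ) ≡ 2ℚ * (i + r + t) - 1ℚ → y * (2ℚ * r - 1ℚ) ≡ 2ℚ * r →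
        0ℚ + a₁ i r t * Ω + 0ℚ ≡ x * y * (c₀ i r t * Ω) + 0ℚ + 0ℚ
      poly₂ i r t x y Ω ex ey = begin
        0ℚ + a₁ i r t * Ω + 0ℚ
          ≡⟨ l₁ (2ℚ * i - 1ℚ) (2ℚ * r) (2ℚ * t) (2ℚ * (i + r + t) - 1ℚ) (q i r t) Ω ⟩
        (2ℚ * (i + r + t) - 1ℚ) * (2ℚ * r) * ((2ℚ * i - 1ℚ) * (2ℚ * t) * q i r t * Ω)
          ≡⟨ cong₂ (λ u v → u * v * ((2ℚ * i - 1ℚ) * (2ℚ * t) * q i r t * Ω)) (sym ex) (sym ey) ⟩
        x * (2ℚ * (i + r + t) - 2ℚ) * (y * (2ℚ * r - 1ℚ)) * ((2ℚ * i - 1ℚ) * (2ℚ * t) * q i r t * Ω)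
          ≡⟨ l₂ x y (2ℚ * i - 1ℚ) (2ℚ * r - 1ℚ) (2ℚ * t) (2ℚ * (i + r + t) - 2ℚ) (q i r t) Ω ⟩
        x * y * (c₀ i r t * Ω) + 0ℚ + 0ℚ ∎
        where
        l₁ : ∀ a b c d e f → 0ℚ + a * b * c * d * e * f + 0ℚ ≡ d * b * (a * c * e * f)
        l₁ = solve-∀ ring
        l₂ : ∀ x y a b c d e f → x * d * (y * b) * (a * c * e * f) ≡ x * y * (a * b * c * d * e * f) + 0ℚ + 0ℚ
        l₂ = solve-∀ ring
      second : Identity₂
      second = trans (cong₂ _+_ (cong₂ _+_ (zero-*ˡ hAB) (trans e₁ value₁)) σ₂B)
        (trans (poly₂ i r t (h V) (h W) Ω hV hW)
        (sym (cong₂ _+_ (cong₂ _+_ (cong (h V * h W *_) value₀) (zero-*ˡ (zero-*ˡ (zero-*ˡ hAB)))) (zero-*ˡ (zero-*ˡ (zero-*ˡ hAB))))))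

open Identities using (Identity₁; Identity₂)

suc≢0 : ∀ {z m} → z ≡ + suc m → z ≢ + 0
suc≢0 refl ()

odd-+ : ∀ n → odd (+ n) ≡ + suc (2 N.* n)
odd-+ n = trans (lem (+ n)) (cong (λ x → + 1 I.+ x) (sym (IP.pos-* 2 n)))
  where
  lem : ∀ x → + 2 I.* (x I.+ + 1) I.- + 1 ≡ + 1 I.+ + 2 I.* x
  lem = IR.solve-∀

-- With B = -1 one has A = 2(n + 1) at arm n + 1, and the quotient in h(A) is inverse to the other
-- factor of `σ₁`.
σ₁-2n : ∀ {A} n → A ≡ -[1+ 0 ] I.+ odd (+ suc n) → σ₁ A (+ suc n) ≡ 1ℚ
σ₁-2n {A} n refl = trans (sym (QP.*-assoc (h A) (2ℚ * ι (+ suc n)) (ρ (odd (+ suc n)))))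
  (trans (cong (_* ρ (odd (+ suc n))) (trans (cong (h A *_) (sym ι-A)) (by-lc {Y = ι A + 1ℚ} (lem (ι A) (ρ A)) (lc1 {c = 1ℚ} (diff0 (ρ-inv A A≢0))))))
  (trans (cong (λ x → (x + 1ℚ) * ρ (odd (+ suc n))) ι-A) (odd-inv (+ suc n))))
  where
  A≡ : ∀ x → -[1+ 0 ] I.+ (+ 2 I.* (x I.+ + 1) I.- + 1) ≡ + 2 I.* x
  A≡ = IR.solve-∀
  A≢0 : A ≢ + 0
  A≢0 e = 2+≢0 n (trans (sym (A≡ (+ suc n))) e)
  ι-A : ι A ≡ 2ℚ * ι (+ suc n)
  ι-A = trans (cong ι (A≡ (+ suc n))) (ι-2* (+ suc n))
  lem : ∀ x e → (1ℚ + e) * x ≡ x + 1ℚ + 1ℚ * (x * e - 1ℚ)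
  lem = solve-∀ ring

-- n + I ≥ 1 gives I + R + T ≥ 2, the range covered by `Values`. Apart from negative indices only n
-- = I = 0 is left over.
identities-large : ∀ B → Base B → ∀ n i R t TR k → + n I.+ + i ≡ + suc k → Identity₁ B n (+ i) R (+ t) TR × Identity₂ B n (+ i) R (+ t) TR
identities-large B (inj₁ (y , refl)) n i R t TR k ni = Identities.Generic.regular B n (+ i) R (+ t) TR k sum
  (suc≢0 A≡) (λ ()) (suc≢0 (cong₂ I._+_ A≡ (sym (IP.pos-* 2 i)))) (suc≢0 (cong (λ x → + suc y I.+ x) (sym (IP.pos-* 2 R)))) (suc≢0 (cong (I._+ + 1) A≡)) (λ ())
  where
  A≡ : + suc y I.+ odd (+ n) ≡ + suc (y N.+ suc (2 N.* n))
  A≡ = cong (λ x → + suc y I.+ x) (odd-+ n)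
  lem : ∀ i R t → i I.+ R I.+ t ≡ t I.+ R I.+ i
  lem = IR.solve-∀
  lem′ : ∀ n i → n I.+ + 1 I.+ i ≡ + 1 I.+ (n I.+ i)
  lem′ = IR.solve-∀
  sum : + i I.+ + R I.+ + t ≡ + suc (suc k)
  sum = trans (lem (+ i) (+ R) (+ t)) (trans (cong (I._+ + i) TR) (trans (lem′ (+ n) (+ i)) (cong (λ x → + 1 I.+ x) ni)))
identities-large B (inj₂ refl) n i R t TR k ni = Identities.Generic.degenerate B n (+ i) R (+ t) TR k sum refl
  (λ e → 2+≢0 k (trans (cong (+ 2 I.*_) (sym ni)) (trans (sym (V≡ (+ n) (+ i))) e))) (e₁ n R t TR)
  where
  V≡ : ∀ n i → -[1+ 0 ] I.+ (+ 2 I.* (n I.+ + 1) I.- + 1) I.+ + 2 I.* i ≡ + 2 I.* (n I.+ i)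
  V≡ = IR.solve-∀
  lem : ∀ i R t → i I.+ R I.+ t ≡ t I.+ R I.+ i
  lem = IR.solve-∀
  lem′ : ∀ n i → n I.+ + 1 I.+ i ≡ + 1 I.+ (n I.+ i)
  lem′ = IR.solve-∀
  sum : + i I.+ + R I.+ + t ≡ + suc (suc k)
  sum = trans (lem (+ i) (+ R) (+ t)) (trans (cong (I._+ + i) TR) (trans (lem′ (+ n) (+ i)) (cong (λ x → + 1 I.+ x) ni)))
  -- For n ≥ 1 the weight σ₁ is 1. For n = 0 either R = 0 or T = 0, and then the coefficient itself
  -- vanishes.
  e₁ : ∀ n R t → + t I.+ + R ≡ + n I.+ + 1 → σ₁ (-[1+ 0 ] I.+ odd (+ n)) (+ n) * α (+ i) (+ R I.- + 1) (+ t I.- + 1) ≡ α (+ i) (+ R I.- + 1) (+ t I.- + 1)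
  e₁ (suc n) R t _ = trans (cong (_* α (+ i) (+ R I.- + 1) (+ t I.- + 1)) (σ₁-2n n refl)) (QP.*-identityˡ (α (+ i) (+ R I.- + 1) (+ t I.- + 1)))
  e₁ zero zero t _ = trans (zero-*ʳ {x = σ₁ (-[1+ 0 ] I.+ odd (+ 0)) (+ 0)} z) (sym z)
    where
    z : α (+ i) -[1+ 0 ] (+ t I.- + 1) ≡ 0ℚ
    z = α-0ʳ (+ i) (+ t I.- + 1) (γ-neg 0)
  e₁ zero (suc R) zero _ = trans (zero-*ʳ {x = σ₁ (-[1+ 0 ] I.+ odd (+ 0)) (+ 0)} z) (sym z)
    where
    z : α (+ i) (+ R) -[1+ 0 ] ≡ 0ℚ
    z = α-0ᵗ (+ i) (+ R) (γ-neg 0)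
  e₁ zero (suc R) (suc t) e with trans (sym (NP.+-suc t R)) (NP.suc-injective (IP.+-injective e))
  ... | ()

identities : ∀ B → Base B → ∀ n I R T TR → Identity₁ B n I R T TR × Identity₂ B n I R T TR
identities B b n -[1+ i ] R T TR = Identities.all-zero B n -[1+ i ] R T TR
  (α-0ⁱ (+ R) (T I.- + 1) (γ-neg i)) (α-0ⁱ (+ R I.- + 1) (T I.- + 1) (γ-neg i)) (α-0ⁱ (+ R) T (γ-neg (suc (i N.+ 0))))
  (α-0ⁱ (+ R I.- + 1) T (γ-neg (suc (i N.+ 0)))) (α-0ⁱ (+ R I.- + 1) T (γ-neg i)) (α-0ⁱ (+ R) (T I.- + 1) (γ-neg (suc (i N.+ 0))))
identities B b n (+ i) R -[1+ t ] TR = Identities.all-zero B n (+ i) R -[1+ t ] TR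
  (α-0ᵗ (+ i) (+ R) (γ-neg (suc (t N.+ 0)))) (α-0ᵗ (+ i) (+ R I.- + 1) (γ-neg (suc (t N.+ 0)))) (α-0ᵗ (+ i I.- + 1) (+ R) (γ-neg t))
  (α-0ᵗ (+ i I.- + 1) (+ R I.- + 1) (γ-neg t)) (α-0ᵗ (+ i) (+ R I.- + 1) (γ-neg t)) (α-0ᵗ (+ i I.- + 1) (+ R) (γ-neg (suc (t N.+ 0))))
-- With I = R = 0 one has V = A and W = B, so the two terms in `A₀` agree while every other
-- coefficient vanishes.
identities B b zero (+ zero) zero (+ t) TR =
  trans (cong₂ _+_ (cong₂ _+_ (zero-*ʳ {x = σ₁ A (+ 0)} z₁) (zero-*ʳ {x = σ₂ B (+ 0)} z₂)) z₃) (sym (zero-combination (σ₁ V n₄) (σ₂ W n₅) (h A * h B * (hᵒ V * hᵒ W)) z₄ z₅ z₃ refl)) ,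
  trans (trans (cong₂ _+_ (cong (λ x → h A * h B * A₀ + x) (zero-*ʳ {x = σ₁ A (+ 0)} z₁)) (zero-*ʳ {x = σ₂ B (+ 0)} z₂)) (cong (λ x → x + 0ℚ + 0ℚ) (cong₂ (λ x y → h x * h y * A₀) (sym (IP.+-identityʳ A)) (sym (IP.+-identityʳ B)))))
    (sym (cong₂ _+_ (cong (λ x → h V * h W * A₀ + x) (zero-*ʳ {x = h A * h B * hᵒ W * (2ℚ * ι n₄ * ρ (odd n₄))} z₄)) (zero-*ʳ {x = h A * h B * hᵒ V * ((2ℚ * ι n₅ + 2ℚ) * ρ (odd n₅))} z₅)))
  where
  open Identities B zero (+ 0) 0 (+ t) TR using (A; V; W; n₄; n₅; A₀; A₁; A₂; A₃; A₄; A₅)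
  z₁ : A₁ ≡ 0ℚ
  z₁ = α-0ʳ (+ 0) (+ t I.- + 1) (γ-neg 0)
  z₂ : A₂ ≡ 0ℚ
  z₂ = α-0ⁱ (+ 0) (+ t) (γ-neg 0)
  z₃ : A₃ ≡ 0ℚ
  z₃ = α-0ⁱ -[1+ 0 ] (+ t) (γ-neg 0)
  z₄ : A₄ ≡ 0ℚ
  z₄ = α-0ʳ (+ 0) (+ t) (γ-neg 0)
  z₅ : A₅ ≡ 0ℚ
  z₅ = α-0ⁱ (+ 0) (+ t I.- + 1) (γ-neg 0)
identities B b zero (+ zero) (suc R) (+ suc t) TR with trans (sym (NP.+-suc t R)) (NP.suc-injective (IP.+-injective TR))
... | ()
-- Here T = 0 and R is forced to be 1. `A₄` does not vanish, but it is multiplied by 2 n₄ = 0.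
identities B b zero (+ zero) (suc R) (+ zero) TR =
  trans (cong₂ _+_ (cong₂ _+_ (zero-*ʳ {x = σ₁ A (+ 0)} z₁) (zero-*ʳ {x = σ₂ B (+ 0)} z₂)) z₃)
    (sym (cong₂ _+_ (cong₂ _+_ (zero-*ˡ (σ₁-0 V refl)) (zero-*ʳ {x = σ₂ W n₅} z₅)) (zero-*ʳ {x = h A * h B * (hᵒ V * hᵒ W)} z₃))) ,
  trans (zero-combination (h A * h B) (σ₁ A (+ 0)) (σ₂ B (+ 0)) z₀ z₁ z₂ refl)
    (sym (cong₂ _+_ (cong₂ _+_ (zero-*ʳ {x = h V * h W} z₀) (zero-*ˡ (zero-*ʳ {x = h A * h B * hᵒ W} (zero-*ˡ (zero-*ʳ {x = 2ℚ} ι-0))))) (zero-*ʳ {x = h A * h B * hᵒ V * ((2ℚ * ι n₅ + 2ℚ) * ρ (odd n₅))} z₅)))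
  where
  open Identities B zero (+ 0) (suc R) (+ 0) TR using (A; V; W; n₄; n₅; A₀; A₁; A₂; A₃; A₄; A₅)
  z₀ : A₀ ≡ 0ℚ
  z₀ = α-0ᵗ (+ 0) (+ suc R) (γ-neg 0)
  z₁ : A₁ ≡ 0ℚ
  z₁ = α-0ᵗ (+ 0) (+ R) (γ-neg 0)
  z₂ : A₂ ≡ 0ℚ
  z₂ = α-0ⁱ (+ suc R) (+ 0) (γ-neg 0)
  z₃ : A₃ ≡ 0ℚ
  z₃ = α-0ⁱ (+ R) (+ 0) (γ-neg 0)
  z₅ : A₅ ≡ 0ℚ
  z₅ = α-0ⁱ (+ suc R) -[1+ 0 ] (γ-neg 0)
identities B b zero (+ suc i) R (+ t) TR = identities-large B b 0 (suc i) R t TR i refl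
identities B b (suc n) (+ i) R (+ t) TR = identities-large B b (suc n) i R t TR (n N.+ i) refl

-- The Pieri rule

arm : ℕ → ℕ → ℕ → ℤ
arm N b c = + N I.- + c I.- + 2 I.* + b

-- This and `𝐀`, which equals 2a + c by `𝐀-shape`, are two of the denominators of R, expressed by
-- the size and (b , c).
𝐁 : ℕ → ℕ → ℤ
𝐁 b c = + 2 I.* + b I.+ + c I.- + 1

𝐀 : ℕ → ℕ → ℕ → ℤ
𝐀 N b c = 𝐁 b c I.+ odd (arm N b c)

hh : ℕ → ℕ → ℕ → ℚ
hh N b c = h (𝐀 N b c) * h (𝐁 b c)

-- The paper's R for adding i boxes to the first row, r to the second and one to the first column
-- of the shape of size N with parameters (b , c); I stands for i + 1.
Rfac : ℕ → ℕ → ℕ → ℤ → ℕ → ℚ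
Rfac N b c I r = hh N b c * (hᵒ (𝐀 N b c I.+ + 2 I.* I) * hᵒ (𝐁 b c I.+ + 2 I.* + suc r))

abstract
  -- A cut-off beyond every possible strip, abstract so that sums of this length do not unfold.
  bound : ℕ → ℕ → ℕ
  bound N m = suc (suc (N N.+ m))

  bound-spec : ∀ N m → suc (N N.+ m) N.< bound N m
  bound-spec N m = NP.≤-refl

-- Branching coefficients for strips without and with a box in the column. The horizontal-strip
-- condition is built in: α vanishes as soon as the first row would receive a negative number of
-- boxes or the second row would outgrow the old first row.
ψ₀ ψ₁ : ℕ → ℕ → ℕ → ℕ → ℕ → ℚ
ψ₀ m N b c r = α (+ m I.- + r) (+ r) (arm N b c I.- + r)
ψ₁ m N b c r = α (+ m I.- + 1 I.- + r) (+ r) (arm N b c I.- + r) * Rfac N b c (+ m I.- + r) r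

step : ℕ → ℕ → (ℕ → ℕ → ℚ) → ℕ → ℕ → ℚ
step m N φ b c = ∑ (suc (bound N m)) (λ r → ψ₀ m N b c r * φ (b N.+ r) c) + ∑ (suc (bound N m)) (λ r → ψ₁ m N b c r * φ (b N.+ r) (suc c))

shift : ℕ → (ℕ → ℚ) → ℕ → ℚ
shift zero    g C       = g C
shift (suc c) g zero    = 0ℚ
shift (suc c) g (suc C) = shift c g C

mono : ℤ → ℤ → ℤ → ℚ
mono A B b = γ (A I.- b) * γ (B I.- b)

-- The coefficients of w^0, w^1, w^2 in S / w^c. `mono A B b` is the coefficient of u^A v^B in
-- (uv)^b times a Legendre polynomial whose degree is fixed by homogeneity. With n = a - b the
-- powers w^0 and w^2 carry P_n, while w^1 carries P_(n-1) and P_(n+1).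
local : ℕ → ℤ → ℤ → ℕ → ℕ → ℕ → ℚ
local N A B b c 0 = mono A B (+ b)
local N A B b c 1 = σ₁ (𝐀 N b c) (arm N b c) * mono A B (+ b) + σ₂ (𝐁 b c) (arm N b c) * mono A B (+ b I.- + 1)
local N A B b c 2 = hh N b c * mono A B (+ b I.- + 1)
local N A B b c (suc (suc (suc _))) = 0ℚ

-- The coefficient of u^A v^B w^C in the super-symmetric polynomial S attached to (b , c).
kernel : ℕ → ℕ → ℤ → ℤ → ℕ → ℕ → ℚ
kernel N C A B b c = shift c (local N A B b c) C

shift-at : ∀ c g k → shift c g (c N.+ k) ≡ g k
shift-at zero    g k = refl
shift-at (suc c) g k = shift-at c g k

shift-suc-at : ∀ c g k → shift (suc c) g (c N.+ suc k) ≡ g k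
shift-suc-at zero    g k = refl
shift-suc-at (suc c) g k = shift-suc-at c g k

shift-suc-0 : ∀ c g → shift (suc c) g (c N.+ 0) ≡ 0ℚ
shift-suc-0 zero    g = refl
shift-suc-0 (suc c) g = shift-suc-0 c g

shift-below : ∀ {c C} g → C N.< c → shift c g C ≡ 0ℚ
shift-below {suc c} {zero}  g _ = refl
shift-below {suc c} {suc C} g (s≤s C<c) = shift-below g C<c

pred-shift : (ℕ → ℚ) → ℕ → ℚ
pred-shift g zero    = 0ℚ
pred-shift g (suc C) = g C

Valid : ℕ → ℕ → Set
Valid b c = (Σ ℕ λ b' → b ≡ suc b') ⊎ c ≡ 0

h-hᵒ : ∀ v → v ≢ + 0 → v ≢ + 1 → hᵒ v * h (v I.- + 1) ≡ 1ℚ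
h-hᵒ v v≢0 v≢1 = trans (QP.*-comm (hᵒ v) (h (v I.- + 1))) (hhᵒ-inv (ι (v I.- + 1)) (ρ-inv (v I.- + 1) (λ e → v≢1 (trans (lem v) (cong (I._+ + 1) e))))
    (trans (cong (_* ρ v) (trans (cong (_+ 1ℚ) (ι-down v)) (lem′ (ι v)))) (ρ-inv v v≢0)))
  where
  lem : ∀ v → v ≡ v I.- + 1 I.+ + 1
  lem = IR.solve-∀
  lem′ : ∀ x → x - 1ℚ + 1ℚ ≡ x
  lem′ = solve-∀ ring

base-nonneg : ∀ B → Base B → ∀ n → Σ ℕ λ a → B I.+ odd (+ n) ≡ + a
base-nonneg B (inj₁ (y , refl)) n = suc y N.+ suc (2 N.* n) , cong (λ x → + suc y I.+ x) (odd-+ n)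
base-nonneg B (inj₂ refl)       n = 2 N.* n , cong (λ x → -[1+ 0 ] I.+ x) (odd-+ n)

base-cancel : ∀ B → Base B → ∀ r → h B * (hᵒ (B I.+ + 2 I.* (+ r I.+ + 1)) * h (B I.+ + 2 I.* (+ r I.+ + 1) I.- + 1)) ≡ h B
base-cancel B (inj₂ refl) r = trans (zero-*ˡ h-minus-one) (sym h-minus-one)
base-cancel B (inj₁ (y , refl)) r = trans (cong (h (+ suc y) *_) (h-hᵒ (B I.+ + 2 I.* (+ r I.+ + 1)) (λ q → big (trans (sym W≡) q)) (λ q → big₁ (trans (sym W≡) q)))) (QP.*-identityʳ (h (+ suc y)))
  where
  W≡ : B I.+ + 2 I.* (+ r I.+ + 1) ≡ + (suc y N.+ 2 N.* (r N.+ 1))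
  W≡ = cong (λ x → + suc y I.+ x) (sym (IP.pos-* 2 (r N.+ 1)))
  big : + (suc y N.+ 2 N.* (r N.+ 1)) ≢ + 0
  big ()
  big₁ : + (suc y N.+ 2 N.* (r N.+ 1)) ≢ + 1
  big₁ q with trans (sym (cong (λ x → x N.+ (r N.+ 1 N.+ 0)) (NP.+-comm r 1))) (NP.m+n≡0⇒n≡0 y (NP.suc-injective (IP.+-injective q)))
  ... | ()

-- The Pieri rule at one power of w, with the terms of the left (L) and right (R) side as functions
-- of r. In the application `G` is `mono` at b - 1 + x, so the `f` terms stand at (uv)^(b+r) and the
-- `g` terms at (uv)^(b+r-1).
module Core (B : ℤ) (base : Base B) (n m k : ℕ) (n<k : suc n N.< k) (G : ℤ → ℚ) where

  A : ℤ
  A = B I.+ odd (+ n)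

  H : ℚ
  H = h A * h B

  V⟨_⟩ W⟨_⟩ : ℤ → ℤ
  V⟨ x ⟩ = A I.+ + 2 I.* (+ m I.- x)
  W⟨ x ⟩ = B I.+ + 2 I.* (x I.+ + 1)

  a⟨_⟩ a⁻⟨_⟩ : ℤ → ℚ
  a⟨ x ⟩ = α (+ m I.- x) x (+ n I.- x)
  a⁻⟨ x ⟩ = α (+ m I.- + 1 I.- x) x (+ n I.- x)

  Rf⟨_⟩ : ℤ → ℚ
  Rf⟨ x ⟩ = H * (hᵒ V⟨ x ⟩ * hᵒ W⟨ x ⟩)

  private
    cong₃ : ∀ {i i' r t t'} → i ≡ i' → t ≡ t' → α i r t ≡ α i' r t'
    cong₃ refl refl = refl

    γ-n : γ (+ n I.- + k) ≡ 0ℚ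
    γ-n = γ-minus (NP.<-trans (NP.n<1+n n) n<k)

    γ-n⁻ : γ (+ n I.- + 1 I.- + k) ≡ 0ℚ
    γ-n⁻ = trans (cong γ (trans (sub-sub (+ n) (+ k)) (sym (sub-suc (+ n) (+ k))))) (γ-minus (NP.<-trans (NP.<-trans (NP.n<1+n n) n<k) (NP.n<1+n k)))

    e-TR : ∀ n R → n I.- (R I.- + 1) I.+ R ≡ n I.+ + 1
    e-TR = IR.solve-∀
    e₁ : ∀ n R → n I.- + 1 I.- (R I.- + 1) ≡ n I.- (R I.- + 1) I.- + 1
    e₁ = IR.solve-∀
    e₂ : ∀ m R → m I.- R ≡ m I.- (R I.- + 1) I.- + 1
    e₂ = IR.solve-∀
    e₃ : ∀ n R → n I.+ + 1 I.- R ≡ n I.- (R I.- + 1)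
    e₃ = IR.solve-∀
    e₄ : ∀ B R → B I.+ + 2 I.* (R I.- + 1 I.+ + 1) ≡ B I.+ + 2 I.* R
    e₄ = IR.solve-∀

  fL₁ fR₁ : ℤ → ℚ
  fL₁ x = σ₁ A (+ n) * α (+ m I.- x) x (+ n I.- + 1 I.- x) + a⁻⟨ x ⟩
  fR₁ x = a⟨ x ⟩ * σ₁ V⟨ x ⟩ ((+ m I.- x) I.+ (+ n I.- x)) + a⁻⟨ x ⟩ * Rf⟨ x ⟩

  gL₁ gR₁ : ℕ → ℚ
  gL₁ r = σ₂ B (+ n) * α (+ m I.- + r) (+ r) (+ n I.+ + 1 I.- + r)
  gR₁ r = a⟨ + r ⟩ * σ₂ (B I.+ + 2 I.* + r) ((+ m I.- + r) I.+ (+ n I.- + r))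

  -- Aligns both families at the same power of uv, after which the two sides can be compared
  -- coefficient by coefficient.
  shift-pair : ∀ (f : ℤ → ℚ) (g : ℕ → ℚ) → f -[1+ 0 ] ≡ 0ℚ → f (+ k) ≡ 0ℚ →
    ∑ (suc k) (λ r → f (+ r) * G (+ suc r)) + ∑ (suc k) (λ r → g r * G (+ r)) ≡ ∑ (suc k) (λ r → (f (+ r I.- + 1) + g r) * G (+ r))
  shift-pair f g z₁ z₂ = trans (cong (_+ ∑ (suc k) (λ r → g r * G (+ r))) (sym (∑-shift k f G z₁ z₂)))
    (trans (sym (∑-+ (suc k) {λ r → f (+ r I.- + 1) * G (+ r)} {λ r → g r * G (+ r)})) (∑-cong (suc k) (λ r → sym (QP.*-distribʳ-+ (G (+ r)) (f (+ r I.- + 1)) (g r)))))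

  core₁ : ∑ (suc k) (λ r → fL₁ (+ r) * G (+ suc r)) + ∑ (suc k) (λ r → gL₁ r * G (+ r))
        ≡ ∑ (suc k) (λ r → fR₁ (+ r) * G (+ suc r)) + ∑ (suc k) (λ r → gR₁ r * G (+ r))
  core₁ = trans (shift-pair fL₁ gL₁ (zero-sum (zero-*ʳ {x = σ₁ A (+ n)} (α-0ʳ (+ m I.- -[1+ 0 ]) (+ n I.- + 1 I.- -[1+ 0 ]) (γ-neg 0))) (α-0ʳ (+ m I.- + 1 I.- -[1+ 0 ]) (+ n I.- -[1+ 0 ]) (γ-neg 0)))
                              (zero-sum (zero-*ʳ {x = σ₁ A (+ n)} (α-0ᵗ (+ m I.- + k) (+ k) γ-n⁻)) (α-0ᵗ (+ m I.- + 1 I.- + k) (+ k) γ-n)))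
    (trans (∑-cong (suc k) (λ r → cong (_* G (+ r)) (pointwise r)))
    (sym (shift-pair fR₁ gR₁ (zero-sum (zero-*ˡ (α-0ʳ (+ m I.- -[1+ 0 ]) (+ n I.- -[1+ 0 ]) (γ-neg 0))) (zero-*ˡ (α-0ʳ (+ m I.- + 1 I.- -[1+ 0 ]) (+ n I.- -[1+ 0 ]) (γ-neg 0))))
                             (zero-sum (zero-*ˡ (α-0ᵗ (+ m I.- + k) (+ k) γ-n)) (zero-*ˡ (α-0ᵗ (+ m I.- + 1 I.- + k) (+ k) γ-n))))))
    where
    pointwise : ∀ R → fL₁ (+ R I.- + 1) + gL₁ R ≡ fR₁ (+ R I.- + 1) + gR₁ R
    pointwise R = begin
      σ₁ A (+ n) * α I x (+ n I.- + 1 I.- x) + a⁻⟨ x ⟩ + gL₁ R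
        ≡⟨ cong₂ _+_ (cong₂ (λ u v → σ₁ A (+ n) * u + v) (cong₃ refl (e₁ (+ n) (+ R))) (cong₃ (sub-sub (+ m) x) refl))
             (cong (σ₂ B (+ n) *_) (cong₃ (e₂ (+ m) (+ R)) (e₃ (+ n) (+ R)))) ⟩
      σ₁ A (+ n) * A₁ + A₃ + σ₂ B (+ n) * A₂
        ≡⟨ l₁ (σ₁ A (+ n) * A₁) A₃ (σ₂ B (+ n) * A₂) ⟩
      σ₁ A (+ n) * A₁ + σ₂ B (+ n) * A₂ + A₃
        ≡⟨ proj₁ (identities B base n I R T (e-TR (+ n) (+ R))) ⟩
      σ₁ V n₄ * A₄ + σ₂ W n₅ * A₅ + H * (hᵒ V * hᵒ W) * A₃
        ≡⟨ l₂ (σ₁ V n₄) A₄ (σ₂ W n₅) A₅ (H * (hᵒ V * hᵒ W)) A₃ ⟩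
      A₄ * σ₁ V n₄ + A₃ * (H * (hᵒ V * hᵒ W)) + A₅ * σ₂ W n₅
        ≡⟨ cong₂ _+_ (cong₂ (λ u v → A₄ * σ₁ V n₄ + u * (H * (hᵒ V * hᵒ v))) (cong₃ (sym (sub-sub (+ m) x)) refl) (sym (e₄ B (+ R))))
             (cong₂ (λ u v → u * σ₂ W v) (cong₃ (sym (e₂ (+ m) (+ R))) (sym (e₂ (+ n) (+ R)))) (cong₂ I._+_ (sym (e₂ (+ m) (+ R))) (sym (e₂ (+ n) (+ R))))) ⟩
      fR₁ x + gR₁ R ∎
      where
      x I T : ℤ
      x = + R I.- + 1
      I = + m I.- x
      T = + n I.- x
      open Identities B n I R T (e-TR (+ n) (+ R)) using (V; W; n₄; n₅; A₁; A₂; A₃; A₄; A₅)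
      l₁ : ∀ a b c → a + b + c ≡ a + c + b
      l₁ = solve-∀ ring
      l₂ : ∀ s a t b u c → s * a + t * b + u * c ≡ a * s + c * u + b * t
      l₂ = solve-∀ ring

  fL₂ fR₂ : ℤ → ℚ
  fL₂ x = σ₁ A (+ n) * α (+ m I.- + 1 I.- x) x (+ n I.- + 1 I.- x)
  fR₂ x = a⁻⟨ x ⟩ * Rf⟨ x ⟩ * σ₁ (V⟨ x ⟩ I.- + 1) ((+ m I.- + 1 I.- x) I.+ (+ n I.- x))

  gL₂ gR₂ : ℕ → ℚ
  gL₂ r = H * a⟨ + r ⟩ + σ₂ B (+ n) * α (+ m I.- + 1 I.- + r) (+ r) (+ n I.+ + 1 I.- + r)
  gR₂ r = a⟨ + r ⟩ * (h V⟨ + r ⟩ * h (B I.+ + 2 I.* + r)) + a⁻⟨ + r ⟩ * Rf⟨ + r ⟩ * σ₂ (W⟨ + r ⟩ I.- + 1) ((+ m I.- + 1 I.- + r) I.+ (+ n I.- + r))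

  A≥0 : Σ ℕ λ a → A ≡ + a
  A≥0 = base-nonneg B base n

  -- Where α is nonzero, m - 1 - x ≥ 0 and hence V ≥ 2, so neither V nor V - 1 is a vanishing
  -- denominator.
  cancel-V : ∀ x → a⁻⟨ x ⟩ * (hᵒ V⟨ x ⟩ * h (V⟨ x ⟩ I.- + 1)) ≡ a⁻⟨ x ⟩
  cancel-V x = go (+ m I.- + 1 I.- x) refl
    where
    e : ∀ A m x → A I.+ + 2 I.* (m I.- x) ≡ A I.+ + 2 I.* (m I.- + 1 I.- x) I.+ + 2
    e = IR.solve-∀
    go : ∀ j → + m I.- + 1 I.- x ≡ j → α j x (+ n I.- x) * (hᵒ V⟨ x ⟩ * h (V⟨ x ⟩ I.- + 1)) ≡ α j x (+ n I.- x)
    go -[1+ j ] _ = trans (zero-*ˡ (α-0ⁱ x (+ n I.- x) (γ-neg j))) (sym (α-0ⁱ x (+ n I.- x) (γ-neg j)))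
    go (+ j) p = trans (cong (α (+ j) x (+ n I.- x) *_) (h-hᵒ V⟨ x ⟩ (λ q → big (trans (sym V≡) q)) (λ q → big₁ (trans (sym V≡) q)))) (QP.*-identityʳ (α (+ j) x (+ n I.- x)))
      where
      V≡ : V⟨ x ⟩ ≡ + (proj₁ A≥0 N.+ 2 N.* j N.+ 2)
      V≡ = trans (e A (+ m) x) (cong (I._+ + 2) (cong₂ I._+_ (proj₂ A≥0) (trans (cong (+ 2 I.*_) p) (sym (IP.pos-* 2 j)))))
      big : + (proj₁ A≥0 N.+ 2 N.* j N.+ 2) ≢ + 0
      big q with trans (NP.+-comm 2 (proj₁ A≥0 N.+ 2 N.* j)) (IP.+-injective q)
      ... | ()
      big₁ : + (proj₁ A≥0 N.+ 2 N.* j N.+ 2) ≢ + 1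
      big₁ q with trans (NP.+-comm 2 (proj₁ A≥0 N.+ 2 N.* j)) (IP.+-injective q)
      ... | ()

  cancel-W : ∀ r → h B * (hᵒ W⟨ + r ⟩ * h (W⟨ + r ⟩ I.- + 1)) ≡ h B
  cancel-W = base-cancel B base

  -- R is the quotient of the `hh` of the smaller shape by that of the larger one, in the sense that
  -- this product returns `H`. With Adams' formula it settles the coefficient of w^(c+3).
  cancel-both : ∀ r → a⁻⟨ + r ⟩ * Rf⟨ + r ⟩ * (h (V⟨ + r ⟩ I.- + 1) * h (W⟨ + r ⟩ I.- + 1)) ≡ H * a⁻⟨ + r ⟩
  cancel-both r = trans (l₁ a⁻⟨ + r ⟩ (h A) (h B) (hᵒ V⟨ + r ⟩) (hᵒ W⟨ + r ⟩) (h (V⟨ + r ⟩ I.- + 1)) (h (W⟨ + r ⟩ I.- + 1)))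
    (trans (cong₂ (λ u v → u * (h A * v)) (cancel-V (+ r)) (cancel-W r)) (QP.*-comm a⁻⟨ + r ⟩ H))
    where
    l₁ : ∀ a p q v w v' w' → a * (p * q * (v * w)) * (v' * w') ≡ a * (v * v') * (p * (q * (w * w')))
    l₁ = solve-∀ ring

  core₂ : ∑ (suc k) (λ r → fL₂ (+ r) * G (+ suc r)) + ∑ (suc k) (λ r → gL₂ r * G (+ r))
        ≡ ∑ (suc k) (λ r → fR₂ (+ r) * G (+ suc r)) + ∑ (suc k) (λ r → gR₂ r * G (+ r))
  core₂ = trans (shift-pair fL₂ gL₂ (zero-*ʳ {x = σ₁ A (+ n)} (α-0ʳ (+ m I.- + 1 I.- -[1+ 0 ]) (+ n I.- + 1 I.- -[1+ 0 ]) (γ-neg 0)))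
                              (zero-*ʳ {x = σ₁ A (+ n)} (α-0ᵗ (+ m I.- + 1 I.- + k) (+ k) γ-n⁻)))
    (trans (∑-cong (suc k) (λ r → cong (_* G (+ r)) (pointwise r)))
    (sym (shift-pair fR₂ gR₂ (zero-*ˡ (zero-*ˡ (α-0ʳ (+ m I.- + 1 I.- -[1+ 0 ]) (+ n I.- -[1+ 0 ]) (γ-neg 0))))
                             (zero-*ˡ (zero-*ˡ (α-0ᵗ (+ m I.- + 1 I.- + k) (+ k) γ-n))))))
    where
    f₁ : ∀ n R → n I.- + 1 I.- (R I.- + 1) ≡ n I.- R
    f₁ = IR.solve-∀
    f₂ : ∀ n R → n I.- R ≡ n I.- (R I.- + 1) I.- + 1
    f₂ = IR.solve-∀
    -- The next two steps cancel the factors of R against those of σ₁ and σ₂.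
    simp₄ : ∀ x → fR₂ x ≡ H * hᵒ W⟨ x ⟩ * (2ℚ * ι ((+ m I.- + 1 I.- x) I.+ (+ n I.- x)) * ρ (odd ((+ m I.- + 1 I.- x) I.+ (+ n I.- x)))) * a⁻⟨ x ⟩
    simp₄ x = trans (l a⁻⟨ x ⟩ H (hᵒ V⟨ x ⟩) (hᵒ W⟨ x ⟩) (h (V⟨ x ⟩ I.- + 1)) y) (trans (cong (λ u → H * hᵒ W⟨ x ⟩ * y * u) (cancel-V x)) refl)
      where
      y : ℚ
      y = 2ℚ * ι ((+ m I.- + 1 I.- x) I.+ (+ n I.- x)) * ρ (odd ((+ m I.- + 1 I.- x) I.+ (+ n I.- x)))
      l : ∀ a H v w v' y → a * (H * (v * w)) * (v' * y) ≡ H * w * y * (a * (v * v'))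
      l = solve-∀ ring
    simp₅ : ∀ r → a⁻⟨ + r ⟩ * Rf⟨ + r ⟩ * σ₂ (W⟨ + r ⟩ I.- + 1) ((+ m I.- + 1 I.- + r) I.+ (+ n I.- + r))
      ≡ H * hᵒ V⟨ + r ⟩ * ((2ℚ * ι ((+ m I.- + 1 I.- + r) I.+ (+ n I.- + r)) + 2ℚ) * ρ (odd ((+ m I.- + 1 I.- + r) I.+ (+ n I.- + r)))) * a⁻⟨ + r ⟩
    simp₅ r = trans (l a⁻⟨ + r ⟩ (h A) (h B) (hᵒ V⟨ + r ⟩) (hᵒ W⟨ + r ⟩) (h (W⟨ + r ⟩ I.- + 1)) y) (cong (λ u → h A * u * hᵒ V⟨ + r ⟩ * y * a⁻⟨ + r ⟩) (cancel-W r))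
      where
      y : ℚ
      y = (2ℚ * ι ((+ m I.- + 1 I.- + r) I.+ (+ n I.- + r)) + 2ℚ) * ρ (odd ((+ m I.- + 1 I.- + r) I.+ (+ n I.- + r)))
      l : ∀ a p q v w w' y → a * (p * q * (v * w)) * (w' * y) ≡ p * (q * (w * w')) * v * y * a
      l = solve-∀ ring
    pointwise : ∀ R → fL₂ (+ R I.- + 1) + gL₂ R ≡ fR₂ (+ R I.- + 1) + gR₂ R
    pointwise R = begin
      σ₁ A (+ n) * α (+ m I.- + 1 I.- x) x (+ n I.- + 1 I.- x) + (H * a⟨ + R ⟩ + σ₂ B (+ n) * α (+ m I.- + 1 I.- + R) (+ R) (+ n I.+ + 1 I.- + R))
        ≡⟨ cong₂ _+_ (cong (σ₁ A (+ n) *_) (cong₃ (f₁ (+ m) (+ R)) (e₁ (+ n) (+ R))))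
             (cong₂ (λ u v → H * u + σ₂ B (+ n) * v) (cong₃ refl (f₂ (+ n) (+ R))) (cong₃ (sub-sub (+ m) (+ R)) (e₃ (+ n) (+ R)))) ⟩
      σ₁ A (+ n) * A₁ + (H * A₀ + σ₂ B (+ n) * A₂)
        ≡⟨ l₁ (σ₁ A (+ n) * A₁) (H * A₀) (σ₂ B (+ n) * A₂) ⟩
      H * A₀ + σ₁ A (+ n) * A₁ + σ₂ B (+ n) * A₂
        ≡⟨ proj₂ (identities B base n I R T (e-TR (+ n) (+ R))) ⟩
      h V * h W * A₀ + H * hᵒ W * (2ℚ * ι n₄ * ρ (odd n₄)) * A₄ + H * hᵒ V * ((2ℚ * ι n₅ + 2ℚ) * ρ (odd n₅)) * A₅
        ≡⟨ l₂ (h V * h W) A₀ (H * hᵒ W * (2ℚ * ι n₄ * ρ (odd n₄)) * A₄) (H * hᵒ V * ((2ℚ * ι n₅ + 2ℚ) * ρ (odd n₅)) * A₅) ⟩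
      H * hᵒ W * (2ℚ * ι n₄ * ρ (odd n₄)) * A₄ + (A₀ * (h V * h W) + H * hᵒ V * ((2ℚ * ι n₅ + 2ℚ) * ρ (odd n₅)) * A₅)
        ≡⟨ cong₂ _+_ (cong₃′ (sym (e₄ B (+ R))) (cong (I._+ T) (sym (f₁ (+ m) (+ R)))) (cong₃ (sym (f₁ (+ m) (+ R))) refl))
             (cong₂ (λ u v → u * (h V * h W) + v) (cong₃ refl (sym (f₂ (+ n) (+ R)))) (cong₃″ (cong₂ I._+_ (sym (sub-sub (+ m) (+ R))) (sym (f₂ (+ n) (+ R)))) (cong₃ (sym (sub-sub (+ m) (+ R))) (sym (f₂ (+ n) (+ R)))))) ⟩
      H * hᵒ W⟨ x ⟩ * (2ℚ * ι ((+ m I.- + 1 I.- x) I.+ T) * ρ (odd ((+ m I.- + 1 I.- x) I.+ T))) * a⁻⟨ x ⟩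
        + (a⟨ + R ⟩ * (h V * h W) + H * hᵒ V * ((2ℚ * ι ((+ m I.- + 1 I.- + R) I.+ (+ n I.- + R)) + 2ℚ) * ρ (odd ((+ m I.- + 1 I.- + R) I.+ (+ n I.- + R)))) * a⁻⟨ + R ⟩)
        ≡⟨ cong₂ (λ u v → u + (a⟨ + R ⟩ * (h V * h W) + v)) (sym (simp₄ x)) (sym (simp₅ R)) ⟩
      fR₂ x + gR₂ R ∎
      where
      x I T : ℤ
      x = + R I.- + 1
      I = + m I.- + R
      T = + n I.- x
      open Identities B n I R T (e-TR (+ n) (+ R)) using (V; W; n₄; n₅; A₀; A₁; A₂; A₄; A₅)
      cong₃′ : ∀ {w w' ν ν' a a'} → w ≡ w' → ν ≡ ν' → a ≡ a' → H * hᵒ w * (2ℚ * ι ν * ρ (odd ν)) * a ≡ H * hᵒ w' * (2ℚ * ι ν' * ρ (odd ν')) * a'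
      cong₃′ refl refl refl = refl
      cong₃″ : ∀ {ν ν' a a'} → ν ≡ ν' → a ≡ a' → H * hᵒ V * ((2ℚ * ι ν + 2ℚ) * ρ (odd ν)) * a ≡ H * hᵒ V * ((2ℚ * ι ν' + 2ℚ) * ρ (odd ν')) * a'
      cong₃″ refl refl = refl
      l₁ : ∀ a b c → a + (b + c) ≡ b + a + c
      l₁ = solve-∀ ring
      l₂ : ∀ s a t u → s * a + t + u ≡ t + (a * s + u)
      l₂ = solve-∀ ring

base-𝐁 : ∀ b c → Valid b c → Base (𝐁 b c)
base-𝐁 (suc b) c _ = inj₁ (2 N.* b N.+ c , trans (lem (+ b) (+ c)) (cong (λ x → + 1 I.+ (x I.+ + c)) (sym (IP.pos-* 2 b))))
  where
  lem : ∀ b c → + 2 I.* (+ 1 I.+ b) I.+ c I.- + 1 ≡ + 1 I.+ (+ 2 I.* b I.+ c)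
  lem = IR.solve-∀
base-𝐁 zero c (inj₁ (_ , ()))
base-𝐁 zero c (inj₂ refl) = inj₂ refl

∑-linear : ∀ K (g u v : ℕ → ℚ) s t → ∑ K (λ i → g i * (s * u i + t * v i)) ≡ s * ∑ K (λ i → g i * u i) + t * ∑ K (λ i → g i * v i)
∑-linear K g u v s t = trans (∑-cong K (λ i → lem (g i) s t (u i) (v i))) (trans (∑-+ K {λ i → s * (g i * u i)} {λ i → t * (g i * v i)}) (cong₂ _+_ (∑-*ˡ K s) (∑-*ˡ K t)))
  where
  lem : ∀ g s t u v → g * (s * u + t * v) ≡ s * (g * u) + t * (g * v)
  lem = solve-∀ ring

∑-scale : ∀ K (g u : ℕ → ℚ) s → ∑ K (λ i → g i * (s * u i)) ≡ s * ∑ K (λ i → g i * u i)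
∑-scale K g u s = trans (∑-cong K (λ i → *-left-comm (g i) s (u i))) (∑-*ˡ K s)

-- S is multiplied by P_m + w P_(m-1), the coefficient of x^m in (1 + x w)((1 - x u)(1 - x
-- v))^(-1/2). `left` is the contribution of one Legendre factor to one power of w; `right₀` and
-- `right₁` sum over strips without and with a box in the column.
module Pieri (n b c m : ℕ) (valid : Valid b c) (A₀ B₀ : ℤ) where

  N k : ℕ
  N = n N.+ (2 N.* b N.+ c)
  k = bound N m

  n≡ : arm N b c ≡ + n
  n≡ = trans (cong (λ x → x I.- + c I.- + 2 I.* + b) (cong (λ x → + n I.+ (x I.+ + c)) (IP.pos-* 2 b))) (lem (+ n) (+ b) (+ c))
    where
    lem : ∀ n b c → n I.+ (+ 2 I.* b I.+ c) I.- c I.- + 2 I.* b ≡ n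
    lem = IR.solve-∀

  n<k : suc n N.< k
  n<k = NP.≤-<-trans (s≤s (NP.≤-trans (NP.m≤m+n n (2 N.* b N.+ c)) (NP.m≤m+n N m))) (bound-spec N m)

  m≤k : m N.≤ k
  m≤k = NP.<⇒≤ (NP.≤-<-trans (NP.m≤n⇒m≤1+n (NP.m≤n+m m N)) (bound-spec N m))

  G : ℤ → ℚ
  G x = mono A₀ B₀ (+ b I.- + 1 I.+ x)

  open Core (𝐁 b c) (base-𝐁 b c valid) n m k n<k G public

  conv : ℤ → ℤ → ℚ
  conv M x = ∑ (suc k) (λ i → γ (+ i) * γ (M I.- + i) * mono (A₀ I.- + i) (B₀ I.- M I.+ + i) x)

  strips : ℤ → ℤ → ℤ → ℚ
  strips M ν x = ∑ (suc k) (λ r → α (M I.- + r) (+ r) (ν I.- + r) * mono A₀ B₀ (x I.+ + r))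

  adams-mono : ∀ m n x → m N.≤ k → n N.< k → A₀ I.+ B₀ ≡ + 2 I.* x I.+ (+ m I.+ + n) → conv (+ m) x ≡ strips (+ m) (+ n) x
  adams-mono m n x m≤k n<k e = trans (∑-cong (suc k) (λ i → cong₂ (λ u v → γ (+ i) * γ (+ m I.- + i) * (γ u * γ v)) (i₁ A₀ (+ i) x) (i₂ B₀ (+ m) (+ i) x)))
    (trans (adams k m n (A₀ I.- x) (B₀ I.- x) m≤k n<k (trans (i₃ A₀ B₀ x) (trans (cong (I._- + 2 I.* x) e) (i₄ x (+ m I.+ + n)))))
    (∑-cong (suc k) (λ r → cong₂ (λ u v → α (+ m I.- + r) (+ r) (+ n I.- + r) * (γ u * γ v)) (i₅ A₀ x (+ r)) (i₅ B₀ x (+ r)))))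
    where
    i₁ : ∀ A i x → A I.- i I.- x ≡ A I.- x I.- i
    i₁ = IR.solve-∀
    i₂ : ∀ B m i x → B I.- m I.+ i I.- x ≡ B I.- x I.- m I.+ i
    i₂ = IR.solve-∀
    i₃ : ∀ A B x → (A I.- x) I.+ (B I.- x) ≡ A I.+ B I.- + 2 I.* x
    i₃ = IR.solve-∀
    i₄ : ∀ x y → + 2 I.* x I.+ y I.- + 2 I.* x ≡ y
    i₄ = IR.solve-∀
    i₅ : ∀ A x r → A I.- x I.- r ≡ A I.- (x I.+ r)
    i₅ = IR.solve-∀

  -- For m = 0 the factor is P_(-1) = 0 and both sums vanish termwise; otherwise this is Adams'
  -- formula with m - 1.
  adams-mono⁻ : ∀ m n x → m N.≤ k → n N.< k → A₀ I.+ B₀ ≡ + 2 I.* x I.+ (+ m I.- + 1 I.+ + n) → conv (+ m I.- + 1) x ≡ strips (+ m I.- + 1) (+ n) x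
  adams-mono⁻ zero n x _ _ _ = trans (∑-0 (suc k) (λ i _ → zero-*ˡ {y = mono (A₀ I.- + i) (B₀ I.- -[1+ 0 ] I.+ + i) x} (zero-*ʳ {x = γ (+ i)} (γ-neg′ i)))) (sym (∑-0 (suc k) (λ r _ → zero-*ˡ {y = mono A₀ B₀ (x I.+ + r)} (α-0ⁱ (+ r) (+ n I.- + r) (γ-neg′ r)))))
    where
    γ-neg′ : ∀ i → γ (-[1+ 0 ] I.- + i) ≡ 0ℚ
    γ-neg′ zero    = γ-neg 0
    γ-neg′ (suc i) = γ-neg (suc i)
  adams-mono⁻ (suc m) n x m≤k n<k e = adams-mono m n x (NP.<⇒≤ m≤k) n<k e

  -- When n = 0 the formula would involve a negative arm, but then σ₁ vanishes.
  σ₁-adams : ∀ v m n x → n N.< k → (∀ n' → n' N.< k → A₀ I.+ B₀ ≡ + 2 I.* x I.+ (m I.+ + n') → conv m x ≡ strips m (+ n') x) →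
    A₀ I.+ B₀ ≡ + 2 I.* x I.+ (m I.+ (+ n I.- + 1)) → σ₁ v (+ n) * conv m x ≡ σ₁ v (+ n) * strips m (+ n I.- + 1) x
  σ₁-adams v m zero    x _ _ _ = trans (zero-*ˡ (σ₁-0 v refl)) (sym (zero-*ˡ (σ₁-0 v refl)))
  σ₁-adams v m (suc n) x n<k f e = cong (σ₁ v (+ suc n) *_) (f n (NP.<⇒≤ n<k) e)

  ψ₀≡ : ∀ r → ψ₀ m N b c r ≡ a⟨ + r ⟩
  ψ₀≡ r = cong (λ ν → α (+ m I.- + r) (+ r) (ν I.- + r)) n≡

  ψ₁≡ : ∀ r → ψ₁ m N b c r ≡ a⁻⟨ + r ⟩ * Rf⟨ + r ⟩
  ψ₁≡ r = cong₂ (λ ν s → α (+ m I.- + 1 I.- + r) (+ r) (ν I.- + r) * (h (𝐁 b c I.+ odd ν) * h (𝐁 b c) * (hᵒ (𝐁 b c I.+ odd ν I.+ + 2 I.* (+ m I.- + r)) * hᵒ (𝐁 b c I.+ + 2 I.* s))))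
    n≡ (cong +_ (NP.+-comm 1 r))

  arm-r : ∀ r → arm (N N.+ m) (b N.+ r) c ≡ (+ m I.- + r) I.+ (+ n I.- + r)
  arm-r r = trans (lem (+ N) (+ m) (+ b) (+ c) (+ r)) (cong (λ ν → (+ m I.- + r) I.+ (ν I.- + r)) n≡)
    where
    lem : ∀ N m b c r → N I.+ m I.- c I.- + 2 I.* (b I.+ r) ≡ (m I.- r) I.+ (N I.- c I.- + 2 I.* b I.- r)
    lem = IR.solve-∀

  arm-r⁺ : ∀ r → arm (N N.+ m) (b N.+ r) (suc c) ≡ (+ m I.- + 1 I.- + r) I.+ (+ n I.- + r)
  arm-r⁺ r = trans (lem (+ N) (+ m) (+ b) (+ c) (+ r)) (cong (λ ν → (+ m I.- + 1 I.- + r) I.+ (ν I.- + r)) n≡)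
    where
    lem : ∀ N m b c r → N I.+ m I.- (+ 1 I.+ c) I.- + 2 I.* (b I.+ r) ≡ (m I.- + 1 I.- r) I.+ (N I.- c I.- + 2 I.* b I.- r)
    lem = IR.solve-∀

  𝐁-r : ∀ r → 𝐁 (b N.+ r) c ≡ 𝐁 b c I.+ + 2 I.* + r
  𝐁-r r = lem (+ b) (+ c) (+ r)
    where
    lem : ∀ b c r → + 2 I.* (b I.+ r) I.+ c I.- + 1 ≡ + 2 I.* b I.+ c I.- + 1 I.+ + 2 I.* r
    lem = IR.solve-∀

  𝐁-r⁺ : ∀ r → 𝐁 (b N.+ r) (suc c) ≡ W⟨ + r ⟩ I.- + 1
  𝐁-r⁺ r = lem (+ b) (+ c) (+ r)
    where
    lem : ∀ b c r → + 2 I.* (b I.+ r) I.+ (+ 1 I.+ c) I.- + 1 ≡ + 2 I.* b I.+ c I.- + 1 I.+ + 2 I.* (r I.+ + 1) I.- + 1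
    lem = IR.solve-∀

  𝐀-r : ∀ r → 𝐀 (N N.+ m) (b N.+ r) c ≡ V⟨ + r ⟩
  𝐀-r r = trans (cong₂ (λ B ν → B I.+ odd ν) (𝐁-r r) (arm-r r)) (lem (𝐁 b c) (+ n) (+ m) (+ r))
    where
    lem : ∀ B n m r → B I.+ + 2 I.* r I.+ (+ 2 I.* ((m I.- r) I.+ (n I.- r) I.+ + 1) I.- + 1) ≡ B I.+ (+ 2 I.* (n I.+ + 1) I.- + 1) I.+ + 2 I.* (m I.- r)
    lem = IR.solve-∀

  𝐀-r⁺ : ∀ r → 𝐀 (N N.+ m) (b N.+ r) (suc c) ≡ V⟨ + r ⟩ I.- + 1
  𝐀-r⁺ r = trans (cong₂ (λ B ν → B I.+ odd ν) (𝐁-r⁺ r) (arm-r⁺ r)) (lem (𝐁 b c) (+ n) (+ m) (+ r))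
    where
    lem : ∀ B n m r → B I.+ + 2 I.* (r I.+ + 1) I.- + 1 I.+ (+ 2 I.* ((m I.- + 1 I.- r) I.+ (n I.- r) I.+ + 1) I.- + 1) ≡ B I.+ (+ 2 I.* (n I.+ + 1) I.- + 1) I.+ + 2 I.* (m I.- r) I.- + 1
    lem = IR.solve-∀

  mono-hi : ∀ r → mono A₀ B₀ (+ b I.+ + r) ≡ G (+ suc r)
  mono-hi r = cong (mono A₀ B₀) (lem (+ b) (+ r))
    where
    lem : ∀ b r → b I.+ r ≡ b I.- + 1 I.+ (+ 1 I.+ r)
    lem = IR.solve-∀

  mono-lo : ∀ r → mono A₀ B₀ (+ (b N.+ r) I.- + 1) ≡ G (+ r)
  mono-lo r = cong (mono A₀ B₀) (lem (+ b) (+ r))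
    where
    lem : ∀ b r → b I.+ r I.- + 1 ≡ b I.- + 1 I.+ r
    lem = IR.solve-∀

  left : ℤ → ℕ → ℚ
  left M j = ∑ (suc k) (λ i → γ (+ i) * γ (M I.- + i) * local N (A₀ I.- + i) (B₀ I.- M I.+ + i) b c j)

  right₀ right₁ : ℕ → ℚ
  right₀ j = ∑ (suc k) (λ r → ψ₀ m N b c r * local (N N.+ m) A₀ B₀ (b N.+ r) c j)
  right₁ j = ∑ (suc k) (λ r → ψ₁ m N b c r * local (N N.+ m) A₀ B₀ (b N.+ r) (suc c) j)

  left₁ : ∀ M → left M 1 ≡ σ₁ A (+ n) * conv M (+ b) + σ₂ (𝐁 b c) (+ n) * conv M (+ b I.- + 1)
  left₁ M = trans (∑-cong (suc k) (λ i → cong (λ ν → γ (+ i) * γ (M I.- + i) * (σ₁ (𝐁 b c I.+ odd ν) ν * mono (A₀ I.- + i) (B₀ I.- M I.+ + i) (+ b) + σ₂ (𝐁 b c) ν * mono (A₀ I.- + i) (B₀ I.- M I.+ + i) (+ b I.- + 1))) n≡))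
    (∑-linear (suc k) (λ i → γ (+ i) * γ (M I.- + i)) (λ i → mono (A₀ I.- + i) (B₀ I.- M I.+ + i) (+ b)) (λ i → mono (A₀ I.- + i) (B₀ I.- M I.+ + i) (+ b I.- + 1)) (σ₁ A (+ n)) (σ₂ (𝐁 b c) (+ n)))

  left₂ : ∀ M → left M 2 ≡ H * conv M (+ b I.- + 1)
  left₂ M = trans (∑-cong (suc k) (λ i → cong (λ ν → γ (+ i) * γ (M I.- + i) * (h (𝐁 b c I.+ odd ν) * h (𝐁 b c) * mono (A₀ I.- + i) (B₀ I.- M I.+ + i) (+ b I.- + 1))) n≡))
    (∑-scale (suc k) (λ i → γ (+ i) * γ (M I.- + i)) (λ i → mono (A₀ I.- + i) (B₀ I.- M I.+ + i) (+ b I.- + 1)) H)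

  Size : ℕ → Set
  Size j = A₀ I.+ B₀ ≡ + n I.+ + 2 I.* + b I.+ + m I.- + j

  level₀ : Size 0 → left (+ m) 0 ≡ right₀ 0
  level₀ sz = trans (adams-mono m n (+ b) m≤k (NP.<⇒≤ n<k) (trans sz (lem (+ n) (+ b) (+ m)))) (∑-cong (suc k) (λ r → cong (_* mono A₀ B₀ (+ b I.+ + r)) (sym (ψ₀≡ r))))
    where
    lem : ∀ n b m → n I.+ + 2 I.* b I.+ m I.- + 0 ≡ + 2 I.* b I.+ (m I.+ n)
    lem = IR.solve-∀

  ∑²-eq : ∀ (f₁ f₂ g₁ g₂ : ℕ → ℚ) → (∀ r → f₁ r + f₂ r ≡ g₁ r + g₂ r) → ∑ (suc k) f₁ + ∑ (suc k) f₂ ≡ ∑ (suc k) g₁ + ∑ (suc k) g₂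
  ∑²-eq f₁ f₂ g₁ g₂ e = trans (sym (∑-+ (suc k) {f₁} {f₂})) (trans (∑-cong (suc k) e) (∑-+ (suc k) {g₁} {g₂}))

  -- The coefficient of w^(c+1): Adams' formula expands P_m P_(n-1), P_m P_(n+1) and P_(m-1) P_n,
  -- and `core₁` then matches the powers of uv.
  level₁ : Size 1 → left (+ m) 1 + left (+ m I.- + 1) 0 ≡ right₀ 1 + right₁ 0
  level₁ sz = begin
    left (+ m) 1 + conv (+ m I.- + 1) (+ b)
      ≡⟨ cong₂ _+_ (trans (left₁ (+ m)) (cong₂ _+_
           (σ₁-adams A (+ m) n (+ b) (NP.<⇒≤ n<k) (λ n' → adams-mono m n' (+ b) m≤k) (trans sz (l₁ (+ n) (+ b) (+ m))))
           (cong (σ₂ (𝐁 b c) (+ n) *_) (trans (adams-mono m (suc n) (+ b I.- + 1) m≤k n<k (trans sz (l₂ (+ n) (+ b) (+ m)))) (cong (λ ν → strips (+ m) (+ ν) (+ b I.- + 1)) (NP.+-comm 1 n))))))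
           (adams-mono⁻ m n (+ b) m≤k (NP.<⇒≤ n<k) (trans sz (l₃ (+ n) (+ b) (+ m)))) ⟩
    σ₁ A (+ n) * strips (+ m) (+ n I.- + 1) (+ b) + σ₂ (𝐁 b c) (+ n) * strips (+ m) (+ n I.+ + 1) (+ b I.- + 1) + strips (+ m I.- + 1) (+ n) (+ b)
      ≡⟨ gather ⟩
    ∑ (suc k) (λ r → fL₁ (+ r) * G (+ suc r)) + ∑ (suc k) (λ r → gL₁ r * G (+ r))
      ≡⟨ core₁ ⟩
    ∑ (suc k) (λ r → fR₁ (+ r) * G (+ suc r)) + ∑ (suc k) (λ r → gR₁ r * G (+ r))
      ≡⟨ ∑²-eq (λ r → fR₁ (+ r) * G (+ suc r)) (λ r → gR₁ r * G (+ r)) (λ r → ψ₀ m N b c r * local (N N.+ m) A₀ B₀ (b N.+ r) c 1) (λ r → ψ₁ m N b c r * local (N N.+ m) A₀ B₀ (b N.+ r) (suc c) 0) finish ⟩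
    right₀ 1 + right₁ 0 ∎
    where
    l₁ : ∀ n b m → n I.+ + 2 I.* b I.+ m I.- + 1 ≡ + 2 I.* b I.+ (m I.+ (n I.- + 1))
    l₁ = IR.solve-∀
    l₂ : ∀ n b m → n I.+ + 2 I.* b I.+ m I.- + 1 ≡ + 2 I.* (b I.- + 1) I.+ (m I.+ (+ 1 I.+ n))
    l₂ = IR.solve-∀
    l₃ : ∀ n b m → n I.+ + 2 I.* b I.+ m I.- + 1 ≡ + 2 I.* b I.+ (m I.- + 1 I.+ n)
    l₃ = IR.solve-∀
    s₁ s₂ : ℚ
    s₁ = σ₁ A (+ n)
    s₂ = σ₂ (𝐁 b c) (+ n)
    u v w : ℕ → ℚ
    u r = α (+ m I.- + r) (+ r) (+ n I.- + 1 I.- + r)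
    v r = α (+ m I.- + r) (+ r) (+ n I.+ + 1 I.- + r)
    w r = a⁻⟨ + r ⟩
    gather : s₁ * strips (+ m) (+ n I.- + 1) (+ b) + s₂ * strips (+ m) (+ n I.+ + 1) (+ b I.- + 1) + strips (+ m I.- + 1) (+ n) (+ b)
      ≡ ∑ (suc k) (λ r → fL₁ (+ r) * G (+ suc r)) + ∑ (suc k) (λ r → gL₁ r * G (+ r))
    gather = begin
      s₁ * ∑ (suc k) (λ r → u r * mono A₀ B₀ (+ b I.+ + r)) + s₂ * ∑ (suc k) (λ r → v r * G (+ r)) + ∑ (suc k) (λ r → w r * mono A₀ B₀ (+ b I.+ + r))
        ≡⟨ cong₂ _+_ (cong₂ _+_ (trans (sym (∑-*ˡ (suc k) s₁ {λ r → u r * mono A₀ B₀ (+ b I.+ + r)})) (∑-cong (suc k) (λ r → cong (λ x → s₁ * (u r * x)) (mono-hi r)))) (trans (sym (∑-*ˡ (suc k) s₂ {λ r → v r * G (+ r)})) (∑-cong (suc k) (λ r → sym (QP.*-assoc s₂ (v r) (G (+ r))))))) (∑-cong (suc k) (λ r → cong (w r *_) (mono-hi r))) ⟩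
      ∑ (suc k) (λ r → s₁ * (u r * G (+ suc r))) + ∑ (suc k) (λ r → gL₁ r * G (+ r)) + ∑ (suc k) (λ r → w r * G (+ suc r))
        ≡⟨ swap (∑ (suc k) (λ r → s₁ * (u r * G (+ suc r)))) (∑ (suc k) (λ r → gL₁ r * G (+ r))) (∑ (suc k) (λ r → w r * G (+ suc r))) ⟩
      ∑ (suc k) (λ r → s₁ * (u r * G (+ suc r))) + ∑ (suc k) (λ r → w r * G (+ suc r)) + ∑ (suc k) (λ r → gL₁ r * G (+ r))
        ≡⟨ cong (_+ ∑ (suc k) (λ r → gL₁ r * G (+ r))) (trans (sym (∑-+ (suc k) {λ r → s₁ * (u r * G (+ suc r))} {λ r → w r * G (+ suc r)})) (∑-cong (suc k) (λ r → dist s₁ (u r) (w r) (G (+ suc r))))) ⟩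
      ∑ (suc k) (λ r → fL₁ (+ r) * G (+ suc r)) + ∑ (suc k) (λ r → gL₁ r * G (+ r)) ∎
      where
      swap : ∀ a b c → a + b + c ≡ a + c + b
      swap = solve-∀ ring
      dist : ∀ s u w g → s * (u * g) + w * g ≡ (s * u + w) * g
      dist = solve-∀ ring
    finish : ∀ r → fR₁ (+ r) * G (+ suc r) + gR₁ r * G (+ r) ≡ ψ₀ m N b c r * local (N N.+ m) A₀ B₀ (b N.+ r) c 1 + ψ₁ m N b c r * local (N N.+ m) A₀ B₀ (b N.+ r) (suc c) 0
    finish r = sym (trans (cong₂ _+_ (cong₂ _*_ (ψ₀≡ r) (subst₄ (𝐀-r r) (𝐁-r r) (arm-r r) (mono-hi r) (mono-lo r))) (cong₂ _*_ (ψ₁≡ r) (mono-hi r)))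
      (dist a⟨ + r ⟩ (σ₁ V⟨ + r ⟩ ν) (σ₂ (𝐁 b c I.+ + 2 I.* + r) ν) (a⁻⟨ + r ⟩ * Rf⟨ + r ⟩) (G (+ suc r)) (G (+ r))))
      where
      ν : ℤ
      ν = (+ m I.- + r) I.+ (+ n I.- + r)
      subst₄ : ∀ {x x' y y' z z' p p' q q'} → x ≡ x' → y ≡ y' → z ≡ z' → p ≡ p' → q ≡ q' → σ₁ x z * p + σ₂ y z * q ≡ σ₁ x' z' * p' + σ₂ y' z' * q'
      subst₄ refl refl refl refl refl = refl
      dist : ∀ a s t b g g' → a * (s * g + t * g') + b * g ≡ (a * s + b) * g + a * t * g'
      dist = solve-∀ ring

  -- The coefficient of w^(c+2), coming from P_m P_n, P_(m-1) P_(n-1) and P_(m-1) P_(n+1), matched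
  -- by `core₂`.
  level₂ : Size 2 → left (+ m) 2 + left (+ m I.- + 1) 1 ≡ right₀ 2 + right₁ 1
  level₂ sz = begin
    left (+ m) 2 + left (+ m I.- + 1) 1
      ≡⟨ cong₂ _+_ (trans (left₂ (+ m)) (cong (H *_) (adams-mono m n (+ b I.- + 1) m≤k (NP.<⇒≤ n<k) (trans sz (l₁ (+ n) (+ b) (+ m))))))
           (trans (left₁ (+ m I.- + 1)) (cong₂ _+_
             (σ₁-adams A (+ m I.- + 1) n (+ b) (NP.<⇒≤ n<k) (λ n' → adams-mono⁻ m n' (+ b) m≤k) (trans sz (l₂ (+ n) (+ b) (+ m))))
             (cong (s₂ *_) (trans (adams-mono⁻ m (suc n) (+ b I.- + 1) m≤k n<k (trans sz (l₃ (+ n) (+ b) (+ m)))) (cong (λ ν → strips (+ m I.- + 1) (+ ν) (+ b I.- + 1)) (NP.+-comm 1 n)))))) ⟩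
    H * strips (+ m) (+ n) (+ b I.- + 1) + (s₁ * strips (+ m I.- + 1) (+ n I.- + 1) (+ b) + s₂ * strips (+ m I.- + 1) (+ n I.+ + 1) (+ b I.- + 1))
      ≡⟨ gather ⟩
    ∑ (suc k) (λ r → fL₂ (+ r) * G (+ suc r)) + ∑ (suc k) (λ r → gL₂ r * G (+ r))
      ≡⟨ core₂ ⟩
    ∑ (suc k) (λ r → fR₂ (+ r) * G (+ suc r)) + ∑ (suc k) (λ r → gR₂ r * G (+ r))
      ≡⟨ ∑²-eq (λ r → fR₂ (+ r) * G (+ suc r)) (λ r → gR₂ r * G (+ r)) (λ r → ψ₀ m N b c r * local (N N.+ m) A₀ B₀ (b N.+ r) c 2) (λ r → ψ₁ m N b c r * local (N N.+ m) A₀ B₀ (b N.+ r) (suc c) 1) finish ⟩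
    right₀ 2 + right₁ 1 ∎
    where
    l₁ : ∀ n b m → n I.+ + 2 I.* b I.+ m I.- + 2 ≡ + 2 I.* (b I.- + 1) I.+ (m I.+ n)
    l₁ = IR.solve-∀
    l₂ : ∀ n b m → n I.+ + 2 I.* b I.+ m I.- + 2 ≡ + 2 I.* b I.+ (m I.- + 1 I.+ (n I.- + 1))
    l₂ = IR.solve-∀
    l₃ : ∀ n b m → n I.+ + 2 I.* b I.+ m I.- + 2 ≡ + 2 I.* (b I.- + 1) I.+ (m I.- + 1 I.+ (+ 1 I.+ n))
    l₃ = IR.solve-∀
    s₁ s₂ : ℚ
    s₁ = σ₁ A (+ n)
    s₂ = σ₂ (𝐁 b c) (+ n)
    u v : ℕ → ℚ
    u r = α (+ m I.- + 1 I.- + r) (+ r) (+ n I.- + 1 I.- + r)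
    v r = α (+ m I.- + 1 I.- + r) (+ r) (+ n I.+ + 1 I.- + r)
    gather : H * ∑ (suc k) (λ r → a⟨ + r ⟩ * G (+ r)) + (s₁ * ∑ (suc k) (λ r → u r * mono A₀ B₀ (+ b I.+ + r)) + s₂ * ∑ (suc k) (λ r → v r * G (+ r)))
      ≡ ∑ (suc k) (λ r → fL₂ (+ r) * G (+ suc r)) + ∑ (suc k) (λ r → gL₂ r * G (+ r))
    gather = begin
      H * ∑ (suc k) (λ r → a⟨ + r ⟩ * G (+ r)) + (s₁ * ∑ (suc k) (λ r → u r * mono A₀ B₀ (+ b I.+ + r)) + s₂ * ∑ (suc k) (λ r → v r * G (+ r)))
        ≡⟨ cong₂ _+_ (sym (∑-*ˡ (suc k) H {λ r → a⟨ + r ⟩ * G (+ r)})) (cong₂ _+_ (trans (sym (∑-*ˡ (suc k) s₁ {λ r → u r * mono A₀ B₀ (+ b I.+ + r)})) (∑-cong (suc k) (λ r → trans (cong (λ x → s₁ * (u r * x)) (mono-hi r)) (sym (QP.*-assoc s₁ (u r) (G (+ suc r))))))) (sym (∑-*ˡ (suc k) s₂ {λ r → v r * G (+ r)}))) ⟩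
      X + (∑ (suc k) (λ r → fL₂ (+ r) * G (+ suc r)) + Y)
        ≡⟨ swap X (∑ (suc k) (λ r → fL₂ (+ r) * G (+ suc r))) Y ⟩
      ∑ (suc k) (λ r → fL₂ (+ r) * G (+ suc r)) + (X + Y)
        ≡⟨ cong (λ x → ∑ (suc k) (λ r → fL₂ (+ r) * G (+ suc r)) + x) (trans (sym (∑-+ (suc k) {λ r → H * (a⟨ + r ⟩ * G (+ r))} {λ r → s₂ * (v r * G (+ r))})) (∑-cong (suc k) (λ r → dist H a⟨ + r ⟩ s₂ (v r) (G (+ r))))) ⟩
      ∑ (suc k) (λ r → fL₂ (+ r) * G (+ suc r)) + ∑ (suc k) (λ r → gL₂ r * G (+ r)) ∎
      where
      X Y : ℚ
      X = ∑ (suc k) (λ r → H * (a⟨ + r ⟩ * G (+ r)))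
      Y = ∑ (suc k) (λ r → s₂ * (v r * G (+ r)))
      swap : ∀ a b c → a + (b + c) ≡ b + (a + c)
      swap = solve-∀ ring
      dist : ∀ H a s v g → H * (a * g) + s * (v * g) ≡ (H * a + s * v) * g
      dist = solve-∀ ring
    finish : ∀ r → fR₂ (+ r) * G (+ suc r) + gR₂ r * G (+ r) ≡ ψ₀ m N b c r * local (N N.+ m) A₀ B₀ (b N.+ r) c 2 + ψ₁ m N b c r * local (N N.+ m) A₀ B₀ (b N.+ r) (suc c) 1
    finish r = sym (trans (cong₂ _+_ (cong₂ _*_ (ψ₀≡ r) (cong₂ _*_ (cong₂ (λ x y → h x * h y) (𝐀-r r) (𝐁-r r)) (mono-lo r))) (cong₂ _*_ (ψ₁≡ r) (subst₄ (𝐀-r⁺ r) (𝐁-r⁺ r) (arm-r⁺ r) (mono-hi r) (mono-lo r))))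
      (dist a⟨ + r ⟩ (h V⟨ + r ⟩ * h (𝐁 b c I.+ + 2 I.* + r)) (a⁻⟨ + r ⟩ * Rf⟨ + r ⟩) (σ₁ (V⟨ + r ⟩ I.- + 1) ν) (σ₂ (W⟨ + r ⟩ I.- + 1) ν) (G (+ suc r)) (G (+ r))))
      where
      ν : ℤ
      ν = (+ m I.- + 1 I.- + r) I.+ (+ n I.- + r)
      subst₄ : ∀ {x x' y y' z z' p p' q q'} → x ≡ x' → y ≡ y' → z ≡ z' → p ≡ p' → q ≡ q' → σ₁ x z * p + σ₂ y z * q ≡ σ₁ x' z' * p' + σ₂ y' z' * q'
      subst₄ refl refl refl refl refl = refl
      dist : ∀ a x b s t g g' → a * (x * g') + b * (s * g + t * g') ≡ b * s * g + (a * x + b * t) * g'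
      dist = solve-∀ ring

  -- At the top only P_(m-1) P_n is left, and after Adams' formula `cancel-both` matches the strips
  -- one by one.
  level₃ : Size 3 → left (+ m I.- + 1) 2 ≡ right₁ 2
  level₃ sz = trans (left₂ (+ m I.- + 1)) (trans (cong (H *_) (adams-mono⁻ m n (+ b I.- + 1) m≤k (NP.<⇒≤ n<k) (trans sz (l₁ (+ n) (+ b) (+ m)))))
    (trans (sym (∑-*ˡ (suc k) H {λ r → a⁻⟨ + r ⟩ * G (+ r)})) (∑-cong (suc k) finish)))
    where
    l₁ : ∀ n b m → n I.+ + 2 I.* b I.+ m I.- + 3 ≡ + 2 I.* (b I.- + 1) I.+ (m I.- + 1 I.+ n)
    l₁ = IR.solve-∀
    finish : ∀ r → H * (a⁻⟨ + r ⟩ * G (+ r)) ≡ ψ₁ m N b c r * local (N N.+ m) A₀ B₀ (b N.+ r) (suc c) 2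
    finish r = sym (trans (cong₂ _*_ (ψ₁≡ r) (cong₂ _*_ (cong₂ (λ x y → h x * h y) (𝐀-r⁺ r) (𝐁-r⁺ r)) (mono-lo r)))
      (trans (sym (QP.*-assoc (a⁻⟨ + r ⟩ * Rf⟨ + r ⟩) (h (V⟨ + r ⟩ I.- + 1) * h (W⟨ + r ⟩ I.- + 1)) (G (+ r)))) (trans (cong (_* G (+ r)) (cancel-both r)) (QP.*-assoc H a⁻⟨ + r ⟩ (G (+ r))))))

  K₀ K₁ : ℕ → ℚ
  K₀ C = ∑ (suc k) (λ i → γ (+ i) * γ (+ m I.- + i) * kernel N C (A₀ I.- + i) (B₀ I.- + m I.+ + i) b c)
  K₁ C = ∑ (suc k) (λ i → γ (+ i) * γ (+ m I.- + 1 I.- + i) * kernel N C (A₀ I.- + i) (B₀ I.- (+ m I.- + 1) I.+ + i) b c)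

  K₀-at : ∀ j → K₀ (c N.+ j) ≡ left (+ m) j
  K₀-at j = ∑-cong (suc k) (λ i → cong (γ (+ i) * γ (+ m I.- + i) *_) (shift-at c (local N (A₀ I.- + i) (B₀ I.- + m I.+ + i) b c) j))

  K₁-at : ∀ j → K₁ (c N.+ j) ≡ left (+ m I.- + 1) j
  K₁-at j = ∑-cong (suc k) (λ i → cong (γ (+ i) * γ (+ m I.- + 1 I.- + i) *_) (shift-at c (local N (A₀ I.- + i) (B₀ I.- (+ m I.- + 1) I.+ + i) b c) j))

  K₀-below : ∀ {C} → C N.< c → K₀ C ≡ 0ℚ
  K₀-below C<c = ∑-0 (suc k) (λ i _ → zero-*ʳ {x = γ (+ i) * γ (+ m I.- + i)} (shift-below (local N (A₀ I.- + i) (B₀ I.- + m I.+ + i) b c) C<c))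

  K₁-below : ∀ {C} → C N.< c → K₁ C ≡ 0ℚ
  K₁-below C<c = ∑-0 (suc k) (λ i _ → zero-*ʳ {x = γ (+ i) * γ (+ m I.- + 1 I.- + i)} (shift-below (local N (A₀ I.- + i) (B₀ I.- (+ m I.- + 1) I.+ + i) b c) C<c))

  K₁-pred-0 : ∀ C → C N.≤ c → pred-shift K₁ C ≡ 0ℚ
  K₁-pred-0 zero    _   = refl
  K₁-pred-0 (suc C) C<c = K₁-below C<c

  K₁-pred-suc : ∀ j → pred-shift K₁ (c N.+ suc j) ≡ left (+ m I.- + 1) j
  K₁-pred-suc j = trans (cong (pred-shift K₁) (NP.+-suc c j)) (K₁-at j)

  stepK : ℕ → ℚ
  stepK C = step m N (kernel (N N.+ m) C A₀ B₀) b c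

  stepK-0 : stepK (c N.+ 0) ≡ right₀ 0 + 0ℚ
  stepK-0 = cong₂ _+_ (∑-cong (suc k) (λ r → cong (ψ₀ m N b c r *_) (shift-at c (local (N N.+ m) A₀ B₀ (b N.+ r) c) 0)))
    (∑-0 (suc k) (λ r _ → zero-*ʳ {x = ψ₁ m N b c r} (shift-suc-0 c (local (N N.+ m) A₀ B₀ (b N.+ r) (suc c)))))

  stepK-suc : ∀ j → stepK (c N.+ suc j) ≡ right₀ (suc j) + right₁ j
  stepK-suc j = cong₂ _+_ (∑-cong (suc k) (λ r → cong (ψ₀ m N b c r *_) (shift-at c (local (N N.+ m) A₀ B₀ (b N.+ r) c) (suc j))))
    (∑-cong (suc k) (λ r → cong (ψ₁ m N b c r *_) (shift-suc-at c (local (N N.+ m) A₀ B₀ (b N.+ r) (suc c)) j)))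

  left-zero : ∀ M j → left M (3 N.+ j) ≡ 0ℚ
  left-zero M j = ∑-0 (suc k) (λ i _ → QP.*-zeroʳ (γ (+ i) * γ (M I.- + i)))

  right₀-zero : ∀ j → right₀ (3 N.+ j) ≡ 0ℚ
  right₀-zero j = ∑-0 (suc k) (λ r _ → QP.*-zeroʳ (ψ₀ m N b c r))

  right₁-zero : ∀ j → right₁ (3 N.+ j) ≡ 0ℚ
  right₁-zero j = ∑-0 (suc k) (λ r _ → QP.*-zeroʳ (ψ₁ m N b c r))

  at-level : ∀ j → A₀ I.+ B₀ I.+ + (c N.+ j) ≡ + N I.+ + m → Size j
  at-level j e = trans (lem A₀ B₀ (+ c) (+ j)) (trans (cong (λ x → x I.- (+ c I.+ + j)) (trans e (cong (λ x → + n I.+ (x I.+ + c) I.+ + m) (IP.pos-* 2 b)))) (lem′ (+ n) (+ b) (+ c) (+ m) (+ j)))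
    where
    lem : ∀ A B c j → A I.+ B ≡ A I.+ B I.+ (c I.+ j) I.- (c I.+ j)
    lem = IR.solve-∀
    lem′ : ∀ n b c m j → n I.+ (+ 2 I.* b I.+ c) I.+ m I.- (c I.+ j) ≡ n I.+ + 2 I.* b I.+ m I.- j
    lem′ = IR.solve-∀

  pieri-at : ∀ j → Size j → K₀ (c N.+ j) + pred-shift K₁ (c N.+ j) ≡ stepK (c N.+ j)
  pieri-at 0 sz = trans (cong₂ _+_ (trans (K₀-at 0) (level₀ sz)) (K₁-pred-0 (c N.+ 0) (NP.≤-reflexive (NP.+-identityʳ c)))) (sym stepK-0)
  pieri-at 1 sz = trans (cong₂ _+_ (K₀-at 1) (K₁-pred-suc 0)) (trans (level₁ sz) (sym (stepK-suc 0)))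
  pieri-at 2 sz = trans (cong₂ _+_ (K₀-at 2) (K₁-pred-suc 1)) (trans (level₂ sz) (sym (stepK-suc 1)))
  pieri-at 3 sz = trans (cong₂ _+_ (trans (K₀-at 3) (left-zero (+ m) 0)) (trans (K₁-pred-suc 2) (level₃ sz))) (sym (trans (stepK-suc 2) (cong (_+ right₁ 2) (right₀-zero 0))))
  pieri-at (suc (suc (suc (suc j)))) sz = trans (cong₂ _+_ (trans (K₀-at (4 N.+ j)) (left-zero (+ m) (suc j))) (trans (K₁-pred-suc (3 N.+ j)) (left-zero (+ m I.- + 1) j)))
    (sym (trans (stepK-suc (3 N.+ j)) (cong₂ _+_ (right₀-zero (suc j)) (right₁-zero j))))

  pieri-below : ∀ {C} → C N.< c → K₀ C + pred-shift K₁ C ≡ stepK C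
  pieri-below {C} C<c = trans (cong₂ _+_ (K₀-below C<c) (K₁-pred-0 C (NP.<⇒≤ C<c)))
    (sym (cong₂ _+_ (∑-0 (suc k) (λ r _ → zero-*ʳ {x = ψ₀ m N b c r} (shift-below (local (N N.+ m) A₀ B₀ (b N.+ r) c) C<c)))
                    (∑-0 (suc k) (λ r _ → zero-*ʳ {x = ψ₁ m N b c r} (shift-below (local (N N.+ m) A₀ B₀ (b N.+ r) (suc c)) (NP.m<n⇒m<1+n C<c))))))

  pieri : ∀ C → A₀ I.+ B₀ I.+ + C ≡ + N I.+ + m → K₀ C + pred-shift K₁ C ≡ stepK C
  pieri C e with C N.<? c
  ... | yes C<c = pieri-below C<c
  ... | no C≮c = subst (λ C → K₀ C + pred-shift K₁ C ≡ stepK C) C≡ (pieri-at (C ∸ c) (at-level (C ∸ c) (trans (cong (λ C → A₀ I.+ B₀ I.+ + C) C≡) e)))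
    where
    C≡ : c N.+ (C ∸ c) ≡ C
    C≡ = NP.m+[n∸m]≡n (NP.≮⇒≥ C≮c)

step-cong : ∀ m N b c {φ χ : ℕ → ℕ → ℚ} → (∀ r → ψ₀ m N b c r * φ (b N.+ r) c ≡ ψ₀ m N b c r * χ (b N.+ r) c) →
  (∀ r → ψ₁ m N b c r * φ (b N.+ r) (suc c) ≡ ψ₁ m N b c r * χ (b N.+ r) (suc c)) → step m N φ b c ≡ step m N χ b c
step-cong m N b c e₀ e₁ = cong₂ _+_ (∑-cong (suc (bound N m)) e₀) (∑-cong (suc (bound N m)) e₁)

step-+ : ∀ m N b c (φ χ : ℕ → ℕ → ℚ) → step m N (λ b c → φ b c + χ b c) b c ≡ step m N φ b c + step m N χ b c
step-+ m N b c φ χ = trans (cong₂ _+_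
    (trans (∑-cong K (λ r → QP.*-distribˡ-+ (ψ₀ m N b c r) (φ (b N.+ r) c) (χ (b N.+ r) c))) (∑-+ K {λ r → ψ₀ m N b c r * φ (b N.+ r) c} {λ r → ψ₀ m N b c r * χ (b N.+ r) c}))
    (trans (∑-cong K (λ r → QP.*-distribˡ-+ (ψ₁ m N b c r) (φ (b N.+ r) (suc c)) (χ (b N.+ r) (suc c)))) (∑-+ K {λ r → ψ₁ m N b c r * φ (b N.+ r) (suc c)} {λ r → ψ₁ m N b c r * χ (b N.+ r) (suc c)})))
  (interchange (∑ K (λ r → ψ₀ m N b c r * φ (b N.+ r) c)) (∑ K (λ r → ψ₀ m N b c r * χ (b N.+ r) c)) (∑ K (λ r → ψ₁ m N b c r * φ (b N.+ r) (suc c))) (∑ K (λ r → ψ₁ m N b c r * χ (b N.+ r) (suc c))))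
  where
  K : ℕ
  K = suc (bound N m)

step-* : ∀ m N b c s (φ : ℕ → ℕ → ℚ) → step m N (λ b c → s * φ b c) b c ≡ s * step m N φ b c
step-* m N b c s φ = trans (cong₂ _+_ (∑-scale K (ψ₀ m N b c) (λ r → φ (b N.+ r) c) s) (∑-scale K (ψ₁ m N b c) (λ r → φ (b N.+ r) (suc c)) s))
  (sym (QP.*-distribˡ-+ s (∑ K (λ r → ψ₀ m N b c r * φ (b N.+ r) c)) (∑ K (λ r → ψ₁ m N b c r * φ (b N.+ r) (suc c)))))
  where
  K : ℕ
  K = suc (bound N m)

-- Z μ φ is the sum of φ over the shapes of size |μ|, weighted by chains of horizontal strips of sizes μ.
Z : List ℕ → (ℕ → ℕ → ℚ) → ℚ
Z []      φ = φ 0 0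
Z (m ∷ μ) φ = Z μ (step m (NL.sum μ) φ)

IsShape : ℕ → ℕ → ℕ → Set
IsShape N b c = Valid b c × Σ ℕ λ n → N ≡ n N.+ (2 N.* b N.+ c)

α-support : ∀ i r t → α i r t ≡ 0ℚ ⊎ Σ ℕ λ i' → Σ ℕ λ t' → i ≡ + i' × t ≡ + t'
α-support -[1+ i ] r t = inj₁ (α-0ⁱ r t (γ-neg i))
α-support (+ i) r -[1+ t ] = inj₁ (α-0ᵗ (+ i) r (γ-neg t))
α-support (+ i) r (+ t) = inj₂ (i , t , refl , refl)

-- `step` leads from shapes to shapes only: γ kills every strip that is too long, and opening a
-- column under an empty second row carries the factor h(-1) = 0.
step-shape : ∀ m N b c {φ χ} → IsShape N b c → (∀ b c → IsShape (m N.+ N) b c → φ b c ≡ χ b c) → step m N φ b c ≡ step m N χ b c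
step-shape m N b c {φ} {χ} (v , n , refl) e = step-cong m N b c {φ} {χ} e₀ e₁
  where
  size : ∀ r {i t} δ → + m I.- δ I.- + r ≡ + i → arm N b c I.- + r ≡ + t → ∀ d → δ ≡ + d → m N.+ N ≡ (i N.+ t) N.+ (2 N.* (b N.+ r) N.+ (d N.+ c))
  size r {i} {t} δ p q d refl = IP.+-injective (trans (lem (+ m) (+ N) (+ b) (+ c) (+ r) (+ d)) (trans (cong₂ (λ x y → x I.+ y I.+ (+ 2 I.* (+ b I.+ + r) I.+ (+ d I.+ + c))) p q)
    (cong (λ x → + i I.+ + t I.+ (x I.+ (+ d I.+ + c))) (sym (IP.pos-* 2 (b N.+ r))))))
    where
    lem : ∀ m N b c r d → m I.+ N ≡ (m I.- d I.- r) I.+ (N I.- c I.- + 2 I.* b I.- r) I.+ (+ 2 I.* (b I.+ r) I.+ (d I.+ c))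
    lem = IR.solve-∀
  grow : ∀ r → Valid b c → Valid (b N.+ r) c
  grow r (inj₁ (b' , refl)) = inj₁ (b' N.+ r , refl)
  grow r (inj₂ refl) = inj₂ refl
  e₀ : ∀ r → ψ₀ m N b c r * φ (b N.+ r) c ≡ ψ₀ m N b c r * χ (b N.+ r) c
  e₀ r with α-support (+ m I.- + r) (+ r) (arm N b c I.- + r)
  ... | inj₁ z = trans (zero-*ˡ z) (sym (zero-*ˡ z))
  ... | inj₂ (i , t , p , q) = cong (ψ₀ m N b c r *_) (e (b N.+ r) c (grow r v , i N.+ t , size r (+ 0) (trans (cong (I._- + r) (m-0 (+ m))) p) q 0 refl))
  e₁ : ∀ r → ψ₁ m N b c r * φ (b N.+ r) (suc c) ≡ ψ₁ m N b c r * χ (b N.+ r) (suc c)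
  e₁ r with α-support (+ m I.- + 1 I.- + r) (+ r) (arm N b c I.- + r)
  ... | inj₁ z = trans (zero-*ˡ (zero-*ˡ z)) (sym (zero-*ˡ (zero-*ˡ z)))
  ... | inj₂ (i , t , p , q) = go v
    where
    go : Valid b c → ψ₁ m N b c r * φ (b N.+ r) (suc c) ≡ ψ₁ m N b c r * χ (b N.+ r) (suc c)
    go′ : ∀ b' → b ≡ b' → c ≡ 0 → ψ₁ m N b c r * φ (b N.+ r) (suc c) ≡ ψ₁ m N b c r * χ (b N.+ r) (suc c)
    go (inj₁ (b' , refl)) = cong (ψ₁ m N b c r *_) (e (b N.+ r) (suc c) (inj₁ (b' N.+ r , refl) , i N.+ t , size r (+ 1) p q 1 refl))
    go (inj₂ c≡0) = go′ b refl c≡0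
    go′ (suc b') refl _ = go (inj₁ (b' , refl))
    go′ zero b≡0 c≡0 = trans (zero-*ˡ z) (sym (zero-*ˡ z))
      where
      z : ψ₁ m N b c r ≡ 0ℚ
      z = zero-*ʳ {x = α (+ m I.- + 1 I.- + r) (+ r) (arm N b c I.- + r)} (zero-*ˡ (zero-*ʳ {x = h (𝐀 N b c)} (trans (cong₂ (λ b c → h (𝐁 b c)) b≡0 c≡0) h-minus-one)))

IsShape-0 : IsShape 0 0 0
IsShape-0 = inj₂ refl , 0 , refl

Z-cong : ∀ μ {φ χ} → (∀ b c → IsShape (NL.sum μ) b c → φ b c ≡ χ b c) → Z μ φ ≡ Z μ χ
Z-cong []      e = e 0 0 IsShape-0
Z-cong (m ∷ μ) e = Z-cong μ (λ b c s → step-shape m (NL.sum μ) b c s e)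

Z-+ : ∀ μ φ χ → Z μ (λ b c → φ b c + χ b c) ≡ Z μ φ + Z μ χ
Z-+ []      φ χ = refl
Z-+ (m ∷ μ) φ χ = trans (Z-cong μ (λ b c _ → step-+ m (NL.sum μ) b c φ χ)) (Z-+ μ (step m (NL.sum μ) φ) (step m (NL.sum μ) χ))

Z-* : ∀ μ s φ → Z μ (λ b c → s * φ b c) ≡ s * Z μ φ
Z-* []      s φ = refl
Z-* (m ∷ μ) s φ = trans (Z-cong μ (λ b c _ → step-* m (NL.sum μ) b c s φ)) (Z-* μ s (step m (NL.sum μ) φ))

Z-0 : ∀ μ {φ} → (∀ b c → IsShape (NL.sum μ) b c → φ b c ≡ 0ℚ) → Z μ φ ≡ 0ℚ
Z-0 μ {φ} e = trans (Z-cong μ (λ b c s → trans (e b c s) (sym (QP.*-zeroˡ 0ℚ)))) (trans (Z-* μ 0ℚ (λ _ _ → 0ℚ)) (QP.*-zeroˡ (Z μ (λ _ _ → 0ℚ))))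

Z-∑ : ∀ μ K (φ : ℕ → ℕ → ℕ → ℚ) → Z μ (λ b c → ∑ K (λ i → φ i b c)) ≡ ∑ K (λ i → Z μ (φ i))
Z-∑ μ zero    φ = Z-0 μ (λ _ _ _ → refl)
Z-∑ μ (suc K) φ = trans (Z-+ μ (φ 0) (λ b c → ∑ K (λ i → φ (suc i) b c))) (cong (λ x → Z μ (φ 0) + x) (Z-∑ μ K (φ ∘ suc)))

-- Adjoining one variable x at a time, and the kernel theorem

atZero : ℕ → ℚ → ℚ
atZero zero    q = q
atZero (suc m) q = 0ℚ

-- If f ν is the coefficient of y^ν in F(y) then T m f ν is that of x^m y^ν in F(y) ∏_j (1 - x y_j)^(-1/2).
T : ℕ → (List ℕ → ℚ) → List ℕ → ℚ
T m f []      = atZero m (f [])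
T m f (x ∷ ν) = ∑ (suc m) (λ i → γ (+ i) * shift i (λ y → T (m ∸ i) (λ κ → f (y ∷ κ)) ν) x)

-- As `T`, with the additional factor 1 + x w, where C is the exponent of w.
T′ : ℕ → (ℕ → List ℕ → ℚ) → ℕ → List ℕ → ℚ
T′ zero    F C ν = T 0 (F C) ν
T′ (suc m) F C ν = T (suc m) (F C) ν + pred-shift (λ C → T m (F C) ν) C

isZero : List ℕ → ℚ
isZero []          = 1ℚ
isZero (zero ∷ ν)  = isZero ν
isZero (suc _ ∷ ν) = 0ℚ

-- GE μ C ν is the coefficient of x^μ in e_C ∏_j g_(ν_j).
GE : List ℕ → ℕ → List ℕ → ℚ
GE []      zero    ν = isZero ν
GE []      (suc C) ν = 0ℚ
GE (m ∷ μ) C       ν = T′ m (GE μ) C ν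

shift-cong : ∀ i x {f g : ℕ → ℚ} → (∀ y → f y ≡ g y) → shift i f x ≡ shift i g x
shift-cong zero    x       e = e x
shift-cong (suc i) zero    e = refl
shift-cong (suc i) (suc x) e = shift-cong i x e

shift-* : ∀ i x s (f : ℕ → ℚ) → shift i (λ y → s * f y) x ≡ s * shift i f x
shift-* zero    x       s f = refl
shift-* (suc i) zero    s f = sym (QP.*-zeroʳ s)
shift-* (suc i) (suc x) s f = shift-* i x s f

shift-+ : ∀ i x (f g : ℕ → ℚ) → shift i (λ y → f y + g y) x ≡ shift i f x + shift i g x
shift-+ zero    x       f g = refl
shift-+ (suc i) zero    f g = refl
shift-+ (suc i) (suc x) f g = shift-+ i x f g

shift-0 : ∀ i x {f : ℕ → ℚ} → (∀ y → f y ≡ 0ℚ) → shift i f x ≡ 0ℚ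
shift-0 zero    x       e = e x
shift-0 (suc i) zero    e = refl
shift-0 (suc i) (suc x) e = shift-0 i x e

T-pair : ∀ m f A B → T m f (A ∷ B ∷ []) ≡ ∑ (suc m) (λ i → γ (+ i) * γ (+ (m ∸ i)) * shift i (λ y → shift (m ∸ i) (λ z → f (y ∷ z ∷ [])) B) A)
T-pair m f A B = ∑-cong (suc m) (λ i → trans (cong (γ (+ i) *_) (trans (shift-cong i A (λ y → inner (m ∸ i) y)) (shift-* i A (γ (+ (m ∸ i))) (λ y → shift (m ∸ i) (λ z → f (y ∷ z ∷ [])) B)))) (sym (QP.*-assoc (γ (+ i)) (γ (+ (m ∸ i))) (shift i (λ y → shift (m ∸ i) (λ z → f (y ∷ z ∷ [])) B) A))))
  where
  atZero-∸ : ∀ {i k} q → i N.< k → atZero (k ∸ i) q ≡ 0ℚ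
  atZero-∸ {zero}  {suc k} q _ = refl
  atZero-∸ {suc i} {suc k} q (s≤s p) = atZero-∸ q p
  inner : ∀ k y → T k (λ κ → f (y ∷ κ)) (B ∷ []) ≡ γ (+ k) * shift k (λ z → f (y ∷ z ∷ [])) B
  inner k y = trans (∑-single (suc k) k {λ i → γ (+ i) * shift i (λ z → atZero (k ∸ i) (f (y ∷ z ∷ []))) B} NP.≤-refl zeros) (cong (λ j → γ (+ k) * shift k (λ z → atZero j (f (y ∷ z ∷ []))) B) (NP.n∸n≡0 k))
    where
    zeros : ∀ i → i N.< suc k → i ≢ k → γ (+ i) * shift i (λ z → atZero (k ∸ i) (f (y ∷ z ∷ []))) B ≡ 0ℚ
    zeros i i<sk i≢k = zero-*ʳ {x = γ (+ i)} (shift-0 i B (λ z → atZero-∸ (f (y ∷ z ∷ [])) (NP.≤∧≢⇒< (NP.≤-pred i<sk) i≢k)))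

-- The hypothesis speaks of natural b only, while `local` also reads `mono` at b - 1. For b = 0 that
-- index is -1, but the coefficient in front then contains h(-1) = 0.
kernel-neg : ∀ N C A B b c → Valid b c → (∀ b → γ (A I.- + b) * γ (B I.- + b) ≡ 0ℚ) → kernel N C A B b c ≡ 0ℚ
kernel-neg N C A B b c v z = shift-0 c C (go b c v)
  where
  lo : ∀ b → mono A B (+ suc b I.- + 1) ≡ 0ℚ
  lo b = z b
  go : ∀ b c → Valid b c → ∀ j → local N A B b c j ≡ 0ℚ
  go b c _ 0 = z b
  go (suc b) c _ 1 = trans (cong₂ (λ x y → σ₁ (𝐀 N (suc b) c) (arm N (suc b) c) * x + σ₂ (𝐁 (suc b) c) (arm N (suc b) c) * y) (z (suc b)) (lo b)) (zero-sum (QP.*-zeroʳ (σ₁ (𝐀 N (suc b) c) (arm N (suc b) c))) (QP.*-zeroʳ (σ₂ (𝐁 (suc b) c) (arm N (suc b) c))))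
  go zero c (inj₂ refl) 1 = zero-sum (zero-*ʳ {x = σ₁ (𝐀 N 0 0) (arm N 0 0)} (z 0)) (zero-*ˡ (zero-*ˡ h-minus-one))
  go zero c (inj₁ (_ , ())) 1
  go (suc b) c _ 2 = zero-*ʳ {x = hh N (suc b) c} (lo b)
  go zero c (inj₂ refl) 2 = zero-*ˡ (zero-*ʳ {x = h (𝐀 N 0 0)} h-minus-one)
  go zero c (inj₁ (_ , ())) 2
  go b c _ (suc (suc (suc _))) = refl

γ-below-0 : ∀ {A i} → A N.< i → ∀ b → γ (+ A I.- + i I.- + b) ≡ 0ℚ
γ-below-0 {A} {i} A<i b = trans (cong γ (lem (+ A) (+ i) (+ b))) (γ-minus {A} {i N.+ b} (NP.≤-trans A<i (NP.m≤m+n i b)))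
  where
  lem : ∀ A i b → A I.- i I.- b ≡ A I.- (i I.+ b)
  lem = IR.solve-∀

convolve : ℕ → ℤ → ℤ → ℤ → ℕ → ℕ → ℕ → ℕ → ℚ
convolve K M A B N C b c = ∑ (suc K) (λ i → γ (+ i) * γ (M I.- + i) * kernel N C (A I.- + i) (B I.- M I.+ + i) b c)

pieri-shape : ∀ m N b c → IsShape N b c → ∀ A B C → A I.+ B I.+ + C ≡ + N I.+ + m →
  convolve (bound N m) (+ m) A B N C b c + pred-shift (λ C → convolve (bound N m) (+ m I.- + 1) A B N C b c) C ≡ step m N (kernel (N N.+ m) C A B) b c
pieri-shape m N b c (v , n , refl) A B C e = Pieri.pieri n b c m v A B C e

shift-split : ∀ i x (f : ℕ → ℚ) → (Σ ℕ λ y → x ≡ i N.+ y × shift i f x ≡ f y) ⊎ (x N.< i × shift i f x ≡ 0ℚ)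
shift-split i x f with x N.<? i
... | yes x<i = inj₂ (x<i , shift-below f x<i)
... | no x≮i = inj₁ (x ∸ i , sym x≡ , trans (cong (shift i f) (sym x≡)) (shift-at i f (x ∸ i)))
  where
  x≡ : i N.+ (x ∸ i) ≡ x
  x≡ = NP.m+[n∸m]≡n (NP.≮⇒≥ x≮i)

-- The identity e_C g_A g_B = Σ S · F read at x^μ, with the sum over shapes kept as the chain sum
-- `Z`.
KernelTheorem : List ℕ → Set
KernelTheorem μ = ∀ A B C → A N.+ B N.+ C ≡ NL.sum μ → GE μ C (A ∷ B ∷ []) ≡ Z μ (kernel (NL.sum μ) C (+ A) (+ B))

module _ (μ : List ℕ) (ih : KernelTheorem μ) (A B C k : ℕ) (size : A N.+ B N.+ C ≡ k N.+ NL.sum μ) where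
  private
    N : ℕ
    N = NL.sum μ

    cancel₂ : ∀ i j → + (i N.+ j) I.- + i ≡ + j
    cancel₂ i j = lem (+ i) (+ j)
      where
      lem : ∀ i j → i I.+ j I.- i ≡ j
      lem = IR.solve-∀

    +∸ : ∀ {i} → i N.≤ k → + k ≡ + i I.+ + (k ∸ i)
    +∸ i≤k = cong +_ (sym (NP.m+[n∸m]≡n i≤k))

    term : ∀ i → i N.≤ k → shift i (λ y → shift (k ∸ i) (λ z → GE μ C (y ∷ z ∷ [])) B) A ≡ Z μ (kernel N C (+ A I.- + i) (+ B I.- + k I.+ + i))
    -- Exponents smaller than the shift give zero on the left through `shift` and on the right
    -- through γ at negative arguments.
    term i i≤k with shift-split i A (λ y → shift (k ∸ i) (λ z → GE μ C (y ∷ z ∷ [])) B)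
    ... | inj₂ (A<i , e) = trans e (sym (Z-0 μ (λ b c s → kernel-neg N C (+ A I.- + i) (+ B I.- + k I.+ + i) b c (proj₁ s) (λ b → zero-*ˡ (γ-below-0 A<i b)))))
    ... | inj₁ (y , refl , e) with shift-split (k ∸ i) B (λ z → GE μ C (y ∷ z ∷ []))
    ...   | inj₂ (B<j , e′) = trans e (trans e′ (sym (Z-0 μ (λ b c s → kernel-neg N C (+ (i N.+ y) I.- + i) (+ B I.- + k I.+ + i) b c (proj₁ s)
              (λ b → zero-*ʳ {x = γ (+ (i N.+ y) I.- + i I.- + b)} (trans (cong (λ x → γ (x I.- + b)) (trans (cong (λ x → + B I.- x I.+ + i) (+∸ i≤k)) (lem (+ B) (+ i) (+ (k ∸ i))))) (γ-below-0 B<j b)))))))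
      where
      lem : ∀ B i j → B I.- (i I.+ j) I.+ i ≡ B I.- j
      lem = IR.solve-∀
    ...   | inj₁ (z , refl , e′) = trans e (trans e′ (trans (ih y z C size′) (cong₂ (λ u v → Z μ (kernel N C u v)) (sym (cancel₂ i y)) (sym (trans (cong (λ x → + (k ∸ i N.+ z) I.- x I.+ + i) (+∸ i≤k)) (lem (+ i) (+ (k ∸ i)) (+ z)))))))
      where
      lem : ∀ i j z → j I.+ z I.- (i I.+ j) I.+ i ≡ z
      lem = IR.solve-∀
      lem′ : ∀ i y j z C → i I.+ y I.+ (j I.+ z) I.+ C ≡ i I.+ j I.+ (y I.+ z I.+ C)
      lem′ = IR.solve-∀
      size′ : y N.+ z N.+ C ≡ N
      size′ = NP.+-cancelˡ-≡ k _ _ (trans (trans (cong (N._+ (y N.+ z N.+ C)) (sym (NP.m+[n∸m]≡n i≤k))) (IP.+-injective (sym (lem′ (+ i) (+ y) (+ (k ∸ i)) (+ z) (+ C))))) size)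

  T-kernel : ∀ K → k N.≤ K → T k (GE μ C) (A ∷ B ∷ []) ≡ Z μ (convolve K (+ k) (+ A) (+ B) N C)
  T-kernel K k≤K = begin
    T k (GE μ C) (A ∷ B ∷ [])
      ≡⟨ T-pair k (GE μ C) A B ⟩
    ∑ (suc k) (λ i → γ (+ i) * γ (+ (k ∸ i)) * shift i (λ y → shift (k ∸ i) (λ z → GE μ C (y ∷ z ∷ [])) B) A)
      ≡⟨ ∑-cong< (suc k) (λ i i<k → cong₂ (λ x y → γ (+ i) * γ x * y) (sym (trans (cong (I._- + i) (+∸ (NP.≤-pred i<k))) (lem (+ i) (+ (k ∸ i))))) (term i (NP.≤-pred i<k))) ⟩
    ∑ (suc k) (λ i → γ (+ i) * γ (+ k I.- + i) * Z μ (κer i))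
      ≡⟨ sym (∑-mono (s≤s k≤K) (λ i k<i → zero-*ˡ {y = Z μ (κer i)} (zero-*ʳ {x = γ (+ i)} (γ-minus k<i)))) ⟩
    ∑ (suc K) (λ i → γ (+ i) * γ (+ k I.- + i) * Z μ (κer i))
      ≡⟨ ∑-cong (suc K) (λ i → sym (Z-* μ (γ (+ i) * γ (+ k I.- + i)) (κer i))) ⟩
    ∑ (suc K) (λ i → Z μ (λ b c → γ (+ i) * γ (+ k I.- + i) * κer i b c))
      ≡⟨ sym (Z-∑ μ (suc K) (λ i b c → γ (+ i) * γ (+ k I.- + i) * κer i b c)) ⟩
    Z μ (convolve K (+ k) (+ A) (+ B) N C) ∎
    where
    κer : ℕ → ℕ → ℕ → ℚ
    κer i = kernel N C (+ A I.- + i) (+ B I.- + k I.+ + i)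
    lem : ∀ i j → i I.+ j I.- i ≡ j
    lem = IR.solve-∀

convolve-neg : ∀ K A B N C b c → convolve K -[1+ 0 ] A B N C b c ≡ 0ℚ
convolve-neg K A B N C b c = ∑-0 (suc K) (λ i _ → zero-*ˡ {y = kernel N C (A I.- + i) (B I.- -[1+ 0 ] I.+ + i) b c} (zero-*ʳ {x = γ (+ i)} (γ-neg′ i)))
  where
  γ-neg′ : ∀ i → γ (-[1+ 0 ] I.- + i) ≡ 0ℚ
  γ-neg′ zero    = γ-neg 0
  γ-neg′ (suc i) = γ-neg (suc i)

T′-kernel : ∀ μ → KernelTheorem μ → ∀ m A B C → A N.+ B N.+ C ≡ m N.+ NL.sum μ → let N = NL.sum μ in
  T′ m (GE μ) C (A ∷ B ∷ []) ≡ Z μ (λ b c → convolve (bound N m) (+ m) (+ A) (+ B) N C b c + pred-shift (λ C → convolve (bound N m) (+ m I.- + 1) (+ A) (+ B) N C b c) C)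
T′-kernel μ ih m A B C size = go m C size
  where
  N : ℕ
  N = NL.sum μ
  m≤ : ∀ m → m N.≤ bound N m
  m≤ m = NP.<⇒≤ (NP.≤-<-trans (NP.m≤n⇒m≤1+n (NP.m≤n+m m N)) (bound-spec N m))
  pred-0 : ∀ C b c → pred-shift (λ C → convolve (bound N 0) -[1+ 0 ] (+ A) (+ B) N C b c) C ≡ 0ℚ
  pred-0 zero    b c = refl
  pred-0 (suc C) b c = convolve-neg (bound N 0) (+ A) (+ B) N C b c
  go : ∀ m C → A N.+ B N.+ C ≡ m N.+ N → T′ m (GE μ) C (A ∷ B ∷ []) ≡
    Z μ (λ b c → convolve (bound N m) (+ m) (+ A) (+ B) N C b c + pred-shift (λ C → convolve (bound N m) (+ m I.- + 1) (+ A) (+ B) N C b c) C)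
  go zero C size = trans (T-kernel μ ih A B C 0 size (bound N 0) z≤n)
    (Z-cong μ (λ b c _ → sym (trans (cong (λ x → convolve (bound N 0) (+ 0) (+ A) (+ B) N C b c + x) (pred-0 C b c)) (QP.+-identityʳ _))))
  go (suc m) zero size = trans (cong (_+ 0ℚ) (T-kernel μ ih A B 0 (suc m) size (bound N (suc m)) (m≤ (suc m))))
    (trans (QP.+-identityʳ _) (Z-cong μ (λ b c _ → sym (QP.+-identityʳ _))))
  go (suc m) (suc C) size = trans (cong₂ _+_ (T-kernel μ ih A B (suc C) (suc m) size (bound N (suc m)) (m≤ (suc m)))
      (T-kernel μ ih A B C m (NP.suc-injective (trans (sym (NP.+-suc (A N.+ B) C)) size)) (bound N (suc m)) (NP.<⇒≤ (m≤ (suc m)))))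
    (sym (Z-+ μ (convolve (bound N (suc m)) (+ suc m) (+ A) (+ B) N (suc C)) (convolve (bound N (suc m)) (+ m) (+ A) (+ B) N C)))

-- Adjoining a variable x multiplies the generating function in u, v, w by P_m + w P_(m-1) at x^m;
-- the Pieri rule inside `Z` turns this into one more strip.
kernel-step : ∀ m μ → KernelTheorem μ → KernelTheorem (m ∷ μ)
kernel-step m μ ih A B C size = trans (T′-kernel μ ih m A B C size)
  (trans (Z-cong μ (λ b c s → pieri-shape m N b c s (+ A) (+ B) C (cong +_ (trans size (NP.+-comm m N)))))
  (cong (λ M → Z μ (step m N (kernel M C (+ A) (+ B)))) (NP.+-comm N m)))
  where
  N : ℕ
  N = NL.sum μ

kernel-theorem : ∀ μ → KernelTheorem μ
kernel-theorem []      zero zero zero refl = sym (cong₂ _*_ γ-0 γ-0)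
kernel-theorem (m ∷ μ) = kernel-step m μ (kernel-theorem μ)

-- Power sums and the Cauchy identity

-- Multiplication by the power sum p_r on coefficients.
D : ℕ → (List ℕ → ℚ) → List ℕ → ℚ
D r f []      = 0ℚ
D r f (x ∷ ν) = shift r (λ y → f (y ∷ ν)) x + D r (λ κ → f (x ∷ κ)) ν

D-cong : ∀ r ν {f g} → (∀ κ → length κ ≡ length ν → f κ ≡ g κ) → D r f ν ≡ D r g ν
D-cong r []      e = refl
D-cong r (x ∷ ν) e = cong₂ _+_ (shift-cong r x (λ y → e (y ∷ ν) refl)) (D-cong r ν (λ κ l → e (x ∷ κ) (cong suc l)))

D-+ : ∀ r ν f g → D r (λ κ → f κ + g κ) ν ≡ D r f ν + D r g ν
D-+ r []      f g = refl
D-+ r (x ∷ ν) f g = trans (cong₂ _+_ (shift-+ r x (λ y → f (y ∷ ν)) (λ y → g (y ∷ ν))) (D-+ r ν (λ κ → f (x ∷ κ)) (λ κ → g (x ∷ κ))))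
  (interchange (shift r (λ y → f (y ∷ ν)) x) (shift r (λ y → g (y ∷ ν)) x) (D r (λ κ → f (x ∷ κ)) ν) (D r (λ κ → g (x ∷ κ)) ν))

D-* : ∀ r ν s f → D r (λ κ → s * f κ) ν ≡ s * D r f ν
D-* r []      s f = sym (QP.*-zeroʳ s)
D-* r (x ∷ ν) s f = trans (cong₂ _+_ (shift-* r x s (λ y → f (y ∷ ν))) (D-* r ν s (λ κ → f (x ∷ κ))))
  (sym (QP.*-distribˡ-+ s (shift r (λ y → f (y ∷ ν)) x) (D r (λ κ → f (x ∷ κ)) ν)))

D-0 : ∀ r ν {f} → (∀ κ → f κ ≡ 0ℚ) → D r f ν ≡ 0ℚ
D-0 r []      e = refl
D-0 r (x ∷ ν) e = zero-sum (shift-0 r x (λ y → e (y ∷ ν))) (D-0 r ν (λ κ → e (x ∷ κ)))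

D-∑ : ∀ r ν K (f : ℕ → List ℕ → ℚ) → D r (λ κ → ∑ K (λ i → f i κ)) ν ≡ ∑ K (λ i → D r (f i) ν)
D-∑ r ν zero    f = D-0 r ν (λ _ → refl)
D-∑ r ν (suc K) f = trans (D-+ r ν (f 0) (λ κ → ∑ K (λ i → f (suc i) κ))) (cong (λ x → D r (f 0) ν + x) (D-∑ r ν K (f ∘ suc)))

D-∑L : ∀ {X : Set} r ν (xs : List X) (f : X → List ℕ → ℚ) → D r (λ κ → ∑L xs (λ x → f x κ)) ν ≡ ∑L xs (λ x → D r (f x) ν)
D-∑L r ν []       f = D-0 r ν (λ _ → refl)
D-∑L r ν (x ∷ xs) f = trans (D-+ r ν (f x) (λ κ → ∑L xs (λ x → f x κ))) (cong (λ y → D r (f x) ν + y) (D-∑L r ν xs f))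

shift-shift : ∀ i j x (f : ℕ → ℚ) → shift i (shift j f) x ≡ shift (i N.+ j) f x
shift-shift zero    j x       f = refl
shift-shift (suc i) j zero    f = refl
shift-shift (suc i) j (suc x) f = shift-shift i j x f

shift-comm : ∀ i j x (f : ℕ → ℚ) → shift i (shift j f) x ≡ shift j (shift i f) x
shift-comm i j x f = trans (shift-shift i j x f) (trans (cong (λ k → shift k f x) (NP.+-comm i j)) (sym (shift-shift j i x f)))

shift-D : ∀ i r x ν (f : ℕ → List ℕ → ℚ) → shift i (λ y → D r (f y) ν) x ≡ D r (λ κ → shift i (λ y → f y κ) x) ν
shift-D zero    r x       ν f = refl
shift-D (suc i) r zero    ν f = sym (D-0 r ν (λ _ → refl))
shift-D (suc i) r (suc x) ν f = shift-D i r x ν f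

D-comm : ∀ r s ν f → D r (D s f) ν ≡ D s (D r f) ν
D-comm r s []      f = refl
D-comm r s (x ∷ ν) f = begin
  shift r (λ y → shift s (λ z → f (z ∷ ν)) y + D s (λ κ → f (y ∷ κ)) ν) x + D r (λ κ → shift s (λ y → f (y ∷ κ)) x + D s (λ κ' → f (x ∷ κ')) κ) ν
    ≡⟨ cong₂ _+_ (shift-+ r x (shift s (λ z → f (z ∷ ν))) (λ y → D s (λ κ → f (y ∷ κ)) ν)) (D-+ r ν (λ κ → shift s (λ y → f (y ∷ κ)) x) (D s (λ κ' → f (x ∷ κ')))) ⟩
  (shift r (shift s (λ z → f (z ∷ ν))) x + shift r (λ y → D s (λ κ → f (y ∷ κ)) ν) x) + (D r (λ κ → shift s (λ y → f (y ∷ κ)) x) ν + D r (D s (λ κ' → f (x ∷ κ'))) ν)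
    ≡⟨ cong₂ _+_ (cong₂ _+_ (shift-comm r s x (λ z → f (z ∷ ν))) (shift-D r s x ν (λ y κ → f (y ∷ κ)))) (cong₂ _+_ (sym (shift-D s r x ν (λ y κ → f (y ∷ κ)))) (D-comm r s ν (λ κ' → f (x ∷ κ')))) ⟩
  (shift s (shift r (λ z → f (z ∷ ν))) x + D s (λ κ → shift r (λ y → f (y ∷ κ)) x) ν) + (shift s (λ y → D r (λ κ → f (y ∷ κ)) ν) x + D s (D r (λ κ' → f (x ∷ κ'))) ν)
    ≡⟨ interchange (shift s (shift r (λ z → f (z ∷ ν))) x) (D s (λ κ → shift r (λ y → f (y ∷ κ)) x) ν) (shift s (λ y → D r (λ κ → f (y ∷ κ)) ν) x) (D s (D r (λ κ' → f (x ∷ κ'))) ν) ⟩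
  (shift s (shift r (λ z → f (z ∷ ν))) x + shift s (λ y → D r (λ κ → f (y ∷ κ)) ν) x) + (D s (λ κ → shift r (λ y → f (y ∷ κ)) x) ν + D s (D r (λ κ' → f (x ∷ κ'))) ν)
    ≡⟨ sym (cong₂ _+_ (shift-+ s x (shift r (λ z → f (z ∷ ν))) (λ y → D r (λ κ → f (y ∷ κ)) ν)) (D-+ s ν (λ κ → shift r (λ y → f (y ∷ κ)) x) (D r (λ κ' → f (x ∷ κ'))))) ⟩
  shift s (λ y → shift r (λ z → f (z ∷ ν)) y + D r (λ κ → f (y ∷ κ)) ν) x + D s (λ κ → shift r (λ y → f (y ∷ κ)) x + D r (λ κ' → f (x ∷ κ')) κ) ν ∎

-- Coefficient of y^ν in p_ρ, built by successive multiplication. `pmCoeff-PM` identifies it with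
-- the count of maps from parts to variables.
PM : List ℕ → List ℕ → ℚ
PM []      ν = isZero ν
PM (r ∷ ρ) ν = D r (PM ρ) ν

length-filter : ∀ {X : Set} (p : X → Bool) (xs : List X) → ι (+ length (filterᵇ p xs)) ≡ ∑L xs (λ x → [ p x ]ᵇ)
length-filter p []       = ι-0
length-filter p (x ∷ xs) with p x
... | true  = trans (ι-+ (+ 1) (+ length (filterᵇ p xs))) (cong₂ _+_ ι-1 (length-filter p xs))
... | false = trans (length-filter p xs) (sym (QP.+-identityˡ _))

matches : (ℕ → ℕ) → List ℕ → Bool
matches F []      = true
matches F (y ∷ μ) = (F 0 N.≡ᵇ y) ∧ matches (F ∘ suc) μ

allB-matches : ∀ (F : ℕ → ℕ) (H : ℕ → ℕ) μ (ν : List ℕ) k → (∀ i → at ν (k N.+ i) ≡ at μ i) → (∀ i → H i ≡ suc (k N.+ i)) →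
  allB (λ i → F i N.≡ᵇ at ν (i ∸ 1)) (map suc (applyUpTo (λ i → k N.+ i) (length μ))) ≡ matches (λ i → F (suc (k N.+ i))) μ
allB-matches F H []      ν k e e′ = refl
allB-matches F H (y ∷ μ) ν k e e′ = cong₂ _∧_ (cong (F (suc (k N.+ 0)) N.≡ᵇ_) (e 0))
  (trans (cong (λ l → allB (λ i → F i N.≡ᵇ at ν (i ∸ 1)) (map suc l)) (applyUpTo-cong (length μ) (λ i → NP.+-suc k i)))
  (trans (allB-matches F (λ i → suc (suc k N.+ i)) μ ν (suc k) (λ i → trans (cong (at ν) (sym (NP.+-suc k i))) (e (suc i))) (λ i → refl))
         (matches-cong μ (λ i → cong (F ∘ suc) (sym (NP.+-suc k i))))))
  where
  applyUpTo-cong : ∀ n {f g : ℕ → ℕ} → (∀ i → f i ≡ g i) → applyUpTo f n ≡ applyUpTo g n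
  applyUpTo-cong zero    e = refl
  applyUpTo-cong (suc n) e = cong₂ _∷_ (e 0) (applyUpTo-cong n (λ i → e (suc i)))
  matches-cong : ∀ μ {f g : ℕ → ℕ} → (∀ i → f i ≡ g i) → matches f μ ≡ matches g μ
  matches-cong []      e = refl
  matches-cong (y ∷ μ) e = cong₂ _∧_ (cong (N._≡ᵇ y) (e 0)) (matches-cong μ (λ i → e (suc i)))

[∧] : ∀ a b → [ a ∧ b ]ᵇ ≡ [ a ]ᵇ * [ b ]ᵇ
[∧] true  b = sym (QP.*-identityˡ [ b ]ᵇ)
[∧] false b = sym (QP.*-zeroˡ [ b ]ᵇ)

shift-≡ᵇ : ∀ r F y (q : ℚ) → [ r N.+ F N.≡ᵇ y ]ᵇ * q ≡ shift r (λ y' → [ F N.≡ᵇ y' ]ᵇ * q) y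
shift-≡ᵇ zero    F y       q = refl
shift-≡ᵇ (suc r) F zero    q = QP.*-zeroˡ q
shift-≡ᵇ (suc r) F (suc y) q = shift-≡ᵇ r F y q

-- Multiplication by p_r adds r to the exponent of one variable, which is the choice of an image for
-- one further part.
D-matches : ∀ r F μ → ∑ (length μ) (λ j → [ matches (λ i → (if j N.≡ᵇ i then r else 0) N.+ F i) μ ]ᵇ) ≡ D r (λ ν → [ matches F ν ]ᵇ) μ
D-matches r F []      = refl
D-matches r F (y ∷ μ) = cong₂ _+_ head tail
  where
  head : [ (r N.+ F 0 N.≡ᵇ y) ∧ matches (F ∘ suc) μ ]ᵇ ≡ shift r (λ y → [ (F 0 N.≡ᵇ y) ∧ matches (F ∘ suc) μ ]ᵇ) y
  head = trans ([∧] (r N.+ F 0 N.≡ᵇ y) (matches (F ∘ suc) μ)) (trans (shift-≡ᵇ r (F 0) y [ matches (F ∘ suc) μ ]ᵇ) (shift-cong r y (λ y' → sym ([∧] (F 0 N.≡ᵇ y') (matches (F ∘ suc) μ)))))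
  tail : ∑ (length μ) (λ j → [ (F 0 N.≡ᵇ y) ∧ matches (λ i → (if j N.≡ᵇ i then r else 0) N.+ F (suc i)) μ ]ᵇ) ≡ D r (λ κ → [ (F 0 N.≡ᵇ y) ∧ matches (F ∘ suc) κ ]ᵇ) μ
  tail = trans (∑-cong (length μ) (λ j → [∧] (F 0 N.≡ᵇ y) (matches (λ i → (if j N.≡ᵇ i then r else 0) N.+ F (suc i)) μ)))
    (trans (∑-*ˡ (length μ) [ F 0 N.≡ᵇ y ]ᵇ) (trans (cong ([ F 0 N.≡ᵇ y ]ᵇ *_) (D-matches r (F ∘ suc) μ))
    (trans (sym (D-* r μ [ F 0 N.≡ᵇ y ]ᵇ (λ κ → [ matches (F ∘ suc) κ ]ᵇ))) (D-cong r μ (λ κ _ → sym ([∧] (F 0 N.≡ᵇ y) (matches (F ∘ suc) κ)))))))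

pm : ℕ → List ℕ → List ℕ → ℚ
pm ℓ ρ ν = ∑L (lists (length ρ) (range1 ℓ)) (λ f → [ matches (λ i → fiberSum ρ f (suc i)) ν ]ᵇ)

pmCoeff-pm : ∀ ρ μ → ι (+ pmCoeff ρ μ) ≡ pm (length μ) ρ μ
pmCoeff-pm ρ μ = trans (length-filter (λ f → allB (λ i → fiberSum ρ f i N.≡ᵇ at μ (i ∸ 1)) (range1 (length μ))) (lists (length ρ) (range1 (length μ))))
  (∑L-cong (lists (length ρ) (range1 (length μ))) (λ f → cong [_]ᵇ (allB-matches (fiberSum ρ f) suc μ μ 0 (λ _ → refl) (λ _ → refl))))

pm-PM : ∀ ρ ν → pm (length ν) ρ ν ≡ PM ρ ν
pm-PM [] ν = trans (QP.+-identityʳ [ matches (λ _ → 0) ν ]ᵇ) (go ν)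
  where
  go : ∀ ν → [ matches (λ _ → 0) ν ]ᵇ ≡ isZero ν
  go []          = refl
  go (zero ∷ ν)  = go ν
  go (suc _ ∷ ν) = refl
pm-PM (r ∷ ρ) ν = begin
  ∑L (concatMap (λ x → map (x ∷_) L) (range1 ℓ)) F
    ≡⟨ ∑L-concatMap (λ x → map (x ∷_) L) (range1 ℓ) ⟩
  ∑L (range1 ℓ) (λ x → ∑L (map (x ∷_) L) F)
    ≡⟨ ∑L-map suc (upTo ℓ) ⟩
  ∑L (upTo ℓ) (λ j → ∑L (map (suc j ∷_) L) F)
    ≡⟨ ∑L-applyUpTo ℓ id ⟩
  ∑ ℓ (λ j → ∑L (map (suc j ∷_) L) F)
    ≡⟨ ∑-cong ℓ (λ j → ∑L-map (suc j ∷_) L) ⟩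
  ∑ ℓ (λ j → ∑L L (λ f → F (suc j ∷ f)))
    ≡⟨ swap ℓ L (λ j f → F (suc j ∷ f)) ⟩
  ∑L L (λ f → ∑ ℓ (λ j → F (suc j ∷ f)))
    ≡⟨ ∑L-cong L (λ f → D-matches r (λ i → fiberSum ρ f (suc i)) ν) ⟩
  ∑L L (λ f → D r (λ κ → [ matches (λ i → fiberSum ρ f (suc i)) κ ]ᵇ) ν)
    ≡⟨ sym (D-∑L r ν L (λ f κ → [ matches (λ i → fiberSum ρ f (suc i)) κ ]ᵇ)) ⟩
  D r (pm ℓ ρ) ν
    ≡⟨ D-cong r ν (λ κ l → trans (cong (λ ℓ → pm ℓ ρ κ) (sym l)) (pm-PM ρ κ)) ⟩
  D r (PM ρ) ν ∎
  where
  ℓ : ℕ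
  ℓ = length ν
  L : List (List ℕ)
  L = lists (length ρ) (range1 ℓ)
  F : List ℕ → ℚ
  F f = [ matches (λ i → fiberSum (r ∷ ρ) f (suc i)) ν ]ᵇ
  swap : ∀ n {X : Set} (xs : List X) (g : ℕ → X → ℚ) → ∑ n (λ j → ∑L xs (g j)) ≡ ∑L xs (λ x → ∑ n (λ j → g j x))
  swap zero    xs g = sym (∑L-0 xs (λ _ → refl))
  swap (suc n) xs g = trans (cong (λ y → ∑L xs (g 0) + y) (swap n xs (g ∘ suc))) (sym (∑L-+ xs))

pmCoeff-PM : ∀ ρ μ → ℕtoℚ (pmCoeff ρ μ) ≡ PM ρ μ
pmCoeff-PM ρ μ = trans (ι-ℕtoℚ (pmCoeff ρ μ)) (trans (pmCoeff-pm ρ μ) (pm-PM ρ μ))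

γ-step : ∀ i → 2ℚ * ι (+ suc i) * γ (+ suc i) ≡ 2ℚ * ι (+ i) * γ (+ i) + γ (+ i)
γ-step i = trans (cong (2ℚ * ι (+ suc i) *_) (γ-ξ (+ suc i))) (trans (l₁ (ι (+ suc i)) (ξ (+ suc i))) (trans (cong₂ (λ x y → (2ℚ * x - 1ℚ) * y) (ι-suc i) (γ-suc i)) (l₂ (ι (+ i)) (γ (+ i)))))
  where
  l₁ : ∀ z x → 2ℚ * z * ((2ℚ * z - 1ℚ) * x) ≡ (2ℚ * z - 1ℚ) * (2ℚ * z * x)
  l₁ = solve-∀ ring
  l₂ : ∀ i g → (2ℚ * (i + 1ℚ) - 1ℚ) * g ≡ 2ℚ * i * g + g
  l₂ = solve-∀ ring

-- The differential equation 2x f' = (x / (1 - x)) f of f = (1 - x)^(-1/2), in coefficients.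
γ-partial-sums : ∀ i → 2ℚ * ι (+ i) * γ (+ i) ≡ ∑ i (λ j → γ (+ j))
γ-partial-sums zero    = zero-*ˡ (zero-*ʳ {x = 2ℚ} ι-0)
γ-partial-sums (suc i) = trans (γ-step i) (trans (cong (_+ γ (+ i)) (γ-partial-sums i)) (sym (∑-last i {λ j → γ (+ j)})))

∑-triangle-swap : ∀ m (F : ℕ → ℕ → ℚ) → ∑ m (λ i → ∑ (m ∸ i) (F i)) ≡ ∑ m (λ j → ∑ (m ∸ j) (λ i → F i j))
∑-triangle-swap zero    F = refl
∑-triangle-swap (suc m) F = begin
  ∑ (suc m) (F 0) + ∑ m (λ i → ∑ (m ∸ i) (F (suc i)))
    ≡⟨ cong (λ x → ∑ (suc m) (F 0) + x) (∑-triangle-swap m (F ∘ suc)) ⟩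
  ∑ (suc m) (F 0) + ∑ m G
    ≡⟨ cong (λ x → ∑ (suc m) (F 0) + x) (sym (trans (∑-last m {G}) (trans (cong (λ k → ∑ m G + ∑ k (λ i → F (suc i) m)) (NP.n∸n≡0 m)) (QP.+-identityʳ (∑ m G))))) ⟩
  ∑ (suc m) (F 0) + ∑ (suc m) G
    ≡⟨ sym (∑-+ (suc m) {F 0} {G}) ⟩
  ∑ (suc m) (λ j → F 0 j + G j)
    ≡⟨ ∑-cong< (suc m) (λ j j<m → cong (λ k → ∑ k (λ i → F i j)) (sym (NP.+-∸-assoc 1 (NP.≤-pred j<m)))) ⟩
  ∑ (suc m) (λ j → ∑ (suc m ∸ j) (λ i → F i j)) ∎
  where
  G : ℕ → ℚ
  G j = ∑ (m ∸ j) (λ i → F (suc i) j)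

∑-triangle-reindex : ∀ m (Y : ℕ → ℕ → ℚ) → ∑ (suc m) (λ i → ∑ i (λ l → Y l i)) ≡ ∑ m (λ l → ∑ (m ∸ l) (λ j → Y l (suc (l N.+ j))))
∑-triangle-reindex zero    Y = refl
∑-triangle-reindex (suc m) Y = begin
  ∑ (suc (suc m)) (λ i → ∑ i (λ l → Y l i))
    ≡⟨ ∑-last (suc m) {λ i → ∑ i (λ l → Y l i)} ⟩
  ∑ (suc m) (λ i → ∑ i (λ l → Y l i)) + ∑ (suc m) (λ l → Y l (suc m))
    ≡⟨ cong (_+ ∑ (suc m) (λ l → Y l (suc m))) (trans (∑-triangle-reindex m Y) (sym (trans (∑-last m {G}) (trans (cong (λ k → ∑ m G + ∑ k (λ j → Y m (suc (m N.+ j)))) (NP.n∸n≡0 m)) (QP.+-identityʳ (∑ m G)))))) ⟩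
  ∑ (suc m) G + ∑ (suc m) (λ l → Y l (suc m))
    ≡⟨ sym (∑-+ (suc m) {G} {λ l → Y l (suc m)}) ⟩
  ∑ (suc m) (λ l → G l + Y l (suc m))
    ≡⟨ ∑-cong< (suc m) (λ l l<m → trans (cong (λ k → G l + Y l (suc k)) (sym (NP.m+[n∸m]≡n (NP.≤-pred l<m)))) (trans (sym (∑-last (m ∸ l) {λ j → Y l (suc (l N.+ j))})) (cong (λ k → ∑ k (λ j → Y l (suc (l N.+ j)))) (sym (NP.+-∸-assoc 1 (NP.≤-pred l<m)))))) ⟩
  ∑ (suc m) (λ l → ∑ (suc m ∸ l) (λ j → Y l (suc (l N.+ j)))) ∎
  where
  G : ℕ → ℚ
  G l = ∑ (m ∸ l) (λ j → Y l (suc (l N.+ j)))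

shift-∑ : ∀ i x K (f : ℕ → ℕ → ℚ) → shift i (λ y → ∑ K (λ j → f j y)) x ≡ ∑ K (λ j → shift i (f j) x)
shift-∑ zero    x       K f = refl
shift-∑ (suc i) zero    K f = sym (∑-0 K (λ _ _ → refl))
shift-∑ (suc i) (suc x) K f = shift-∑ i x K f

T-cong : ∀ m ν {f g} → (∀ κ → f κ ≡ g κ) → T m f ν ≡ T m g ν
T-cong m []      e = cong (atZero m) (e [])
T-cong m (x ∷ ν) e = ∑-cong (suc m) (λ i → cong (γ (+ i) *_) (shift-cong i x (λ y → T-cong (m ∸ i) ν (λ κ → e (y ∷ κ)))))

T-0 : ∀ f ν → T 0 f ν ≡ f ν
T-0 f []      = refl
T-0 f (x ∷ ν) = trans (QP.+-identityʳ _) (trans (cong₂ _*_ γ-0 (T-0 (λ κ → f (x ∷ κ)) ν)) (QP.*-identityˡ (f (x ∷ ν))))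

-- The logarithmic derivative 2x d/dx log ∏_j (1 - x y_j)^(-1/2) = Σ_(r ≥ 1) p_r(y) x^r, compared at
-- x^m. It determines `T m f` from smaller m.
EulerT : List ℕ → Set
EulerT ν = ∀ m f → 2ℚ * ι (+ m) * T m f ν ≡ ∑ m (λ j → D (suc j) (T (m ∸ suc j) f) ν)

module _ (x : ℕ) (ν : List ℕ) (ih : EulerT ν) (m : ℕ) (f : List ℕ → ℚ) where
  private
    S : ℕ → ℚ
    S i = shift i (λ y → T (m ∸ i) (λ κ → f (y ∷ κ)) ν) x

    U : ℕ → List ℕ → ℕ → ℚ
    U k κ i = shift i (λ y → T k (λ κ' → f (y ∷ κ')) κ) x

    split : ∀ i → i N.≤ m → 2ℚ * ι (+ m) * (γ (+ i) * S i) ≡ 2ℚ * ι (+ i) * γ (+ i) * S i + γ (+ i) * shift i (λ y → 2ℚ * ι (+ (m ∸ i)) * T (m ∸ i) (λ κ → f (y ∷ κ)) ν) x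
    split i i≤m = trans (cong (λ k → 2ℚ * k * (γ (+ i) * S i)) (trans (cong (λ k → ι (+ k)) (sym (NP.m+[n∸m]≡n i≤m))) (ι-+ (+ i) (+ (m ∸ i)))))
      (trans (lem (ι (+ i)) (ι (+ (m ∸ i))) (γ (+ i)) (S i)) (cong (λ y → 2ℚ * ι (+ i) * γ (+ i) * S i + γ (+ i) * y) (sym (shift-* i x (2ℚ * ι (+ (m ∸ i))) (λ y → T (m ∸ i) (λ κ → f (y ∷ κ)) ν)))))
      where
      lem : ∀ a b g s → 2ℚ * (a + b) * (g * s) ≡ 2ℚ * a * g * s + g * (2ℚ * b * s)
      lem = solve-∀ ring

    m∸-swap : ∀ i j → m ∸ i ∸ suc j ≡ m ∸ suc j ∸ i
    m∸-swap i j = trans (NP.∸-+-assoc m i (suc j)) (trans (cong (m ∸_) (NP.+-comm i (suc j))) (sym (NP.∸-+-assoc m (suc j) i)))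

    bnd : ∀ {j} → j N.< m → m ∸ j ≡ suc (m ∸ suc j)
    bnd {j} j<m = NP.+-∸-assoc 1 j<m

    part₁ : ∑ (suc m) (λ i → 2ℚ * ι (+ i) * γ (+ i) * S i) ≡ ∑ m (λ j → shift (suc j) (λ y → T (m ∸ suc j) f (y ∷ ν)) x)
    part₁ = begin
      ∑ (suc m) (λ i → 2ℚ * ι (+ i) * γ (+ i) * S i)
        ≡⟨ ∑-cong (suc m) (λ i → trans (cong (_* S i) (γ-partial-sums i)) (sym (∑-*ʳ i (S i)))) ⟩
      ∑ (suc m) (λ i → ∑ i (λ l → γ (+ l) * S i))
        ≡⟨ ∑-triangle-reindex m (λ l i → γ (+ l) * S i) ⟩
      ∑ m (λ l → ∑ (m ∸ l) (λ j → γ (+ l) * S (suc (l N.+ j))))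
        ≡⟨ ∑-triangle-swap m (λ l j → γ (+ l) * S (suc (l N.+ j))) ⟩
      ∑ m (λ j → ∑ (m ∸ j) (λ l → γ (+ l) * S (suc (l N.+ j))))
        ≡⟨ ∑-cong< m (λ j j<m → trans (cong (λ k → ∑ k (λ l → γ (+ l) * S (suc (l N.+ j)))) (bnd j<m)) (∑-cong (suc (m ∸ suc j)) (λ l → cong (γ (+ l) *_) (S≡ l j)))) ⟩
      ∑ m (λ j → ∑ (suc (m ∸ suc j)) (λ l → γ (+ l) * shift (suc j) (λ y → shift l (λ y' → T (m ∸ suc j ∸ l) (λ κ → f (y' ∷ κ)) ν) y) x))
        ≡⟨ ∑-cong m (λ j → trans (∑-cong (suc (m ∸ suc j)) (λ l → sym (shift-* (suc j) x (γ (+ l)) (λ y → shift l (λ y' → T (m ∸ suc j ∸ l) (λ κ → f (y' ∷ κ)) ν) y)))) (sym (shift-∑ (suc j) x (suc (m ∸ suc j)) (λ l y → γ (+ l) * shift l (λ y' → T (m ∸ suc j ∸ l) (λ κ → f (y' ∷ κ)) ν) y)))) ⟩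
      ∑ m (λ j → shift (suc j) (λ y → T (m ∸ suc j) f (y ∷ ν)) x) ∎
      where
      S≡ : ∀ l j → S (suc (l N.+ j)) ≡ shift (suc j) (shift l (λ y' → T (m ∸ suc j ∸ l) (λ κ → f (y' ∷ κ)) ν)) x
      S≡ l j = sym (trans (shift-shift (suc j) l x (λ y' → T (m ∸ suc j ∸ l) (λ κ → f (y' ∷ κ)) ν))
        (cong₂ (λ a b → shift a (λ y' → T b (λ κ → f (y' ∷ κ)) ν) x) (cong suc (NP.+-comm j l)) (trans (NP.∸-+-assoc m (suc j) l) (cong (λ k → m ∸ suc k) (NP.+-comm j l)))))

    part₂ : ∑ (suc m) (λ i → γ (+ i) * shift i (λ y → 2ℚ * ι (+ (m ∸ i)) * T (m ∸ i) (λ κ → f (y ∷ κ)) ν) x) ≡ ∑ m (λ j → D (suc j) (λ κ → T (m ∸ suc j) f (x ∷ κ)) ν)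
    part₂ = begin
      ∑ (suc m) (λ i → γ (+ i) * shift i (λ y → 2ℚ * ι (+ (m ∸ i)) * T (m ∸ i) (λ κ → f (y ∷ κ)) ν) x)
        ≡⟨ ∑-cong (suc m) (λ i → cong (γ (+ i) *_) (trans (shift-cong i x (λ y → ih (m ∸ i) (λ κ → f (y ∷ κ)))) (trans (shift-∑ i x (m ∸ i) (λ j y → D (suc j) (T (m ∸ i ∸ suc j) (λ κ → f (y ∷ κ))) ν)) (∑-cong (m ∸ i) (λ j → shift-D i (suc j) x ν (λ y → T (m ∸ i ∸ suc j) (λ κ → f (y ∷ κ)))))))) ⟩
      ∑ (suc m) (λ i → γ (+ i) * ∑ (m ∸ i) (λ j → D (suc j) (λ κ → U (m ∸ i ∸ suc j) κ i) ν))
        ≡⟨ ∑-cong (suc m) (λ i → sym (∑-*ˡ (m ∸ i) (γ (+ i)) {λ j → D (suc j) (λ κ → U (m ∸ i ∸ suc j) κ i) ν})) ⟩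
      ∑ (suc m) W
        ≡⟨ trans (∑-last m {W}) (trans (cong (λ k → ∑ m W + ∑ k (λ j → γ (+ m) * D (suc j) (λ κ → U (m ∸ m ∸ suc j) κ m) ν)) (NP.n∸n≡0 m)) (QP.+-identityʳ (∑ m W))) ⟩
      ∑ m W
        ≡⟨ ∑-triangle-swap m (λ i j → γ (+ i) * D (suc j) (λ κ → U (m ∸ i ∸ suc j) κ i) ν) ⟩
      ∑ m (λ j → ∑ (m ∸ j) (λ i → γ (+ i) * D (suc j) (λ κ → U (m ∸ i ∸ suc j) κ i) ν))
        ≡⟨ ∑-cong< m (λ j j<m → trans (cong (λ k → ∑ k (λ i → γ (+ i) * D (suc j) (λ κ → U (m ∸ i ∸ suc j) κ i) ν)) (bnd j<m))
             (trans (∑-cong (suc (m ∸ suc j)) (λ i → trans (cong (λ k → γ (+ i) * D (suc j) (λ κ → U k κ i) ν) (m∸-swap i j)) (sym (D-* (suc j) ν (γ (+ i)) (λ κ → U (m ∸ suc j ∸ i) κ i)))))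
                    (sym (D-∑ (suc j) ν (suc (m ∸ suc j)) (λ i κ → γ (+ i) * U (m ∸ suc j ∸ i) κ i))))) ⟩
      ∑ m (λ j → D (suc j) (λ κ → T (m ∸ suc j) f (x ∷ κ)) ν) ∎
      where
      W : ℕ → ℚ
      W i = ∑ (m ∸ i) (λ j → γ (+ i) * D (suc j) (λ κ → U (m ∸ i ∸ suc j) κ i) ν)

  euler-T-∷ : 2ℚ * ι (+ m) * T m f (x ∷ ν) ≡ ∑ m (λ j → D (suc j) (T (m ∸ suc j) f) (x ∷ ν))
  euler-T-∷ = begin
    2ℚ * ι (+ m) * ∑ (suc m) (λ i → γ (+ i) * S i)
      ≡⟨ sym (∑-*ˡ (suc m) (2ℚ * ι (+ m)) {λ i → γ (+ i) * S i}) ⟩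
    ∑ (suc m) (λ i → 2ℚ * ι (+ m) * (γ (+ i) * S i))
      ≡⟨ ∑-cong< (suc m) (λ i i<m → split i (NP.≤-pred i<m)) ⟩
    ∑ (suc m) (λ i → P i + Q i)
      ≡⟨ ∑-+ (suc m) {P} {Q} ⟩
    ∑ (suc m) P + ∑ (suc m) Q
      ≡⟨ cong₂ _+_ part₁ part₂ ⟩
    ∑ m (λ j → shift (suc j) (λ y → T (m ∸ suc j) f (y ∷ ν)) x) + ∑ m (λ j → D (suc j) (λ κ → T (m ∸ suc j) f (x ∷ κ)) ν)
      ≡⟨ sym (∑-+ m {λ j → shift (suc j) (λ y → T (m ∸ suc j) f (y ∷ ν)) x} {λ j → D (suc j) (λ κ → T (m ∸ suc j) f (x ∷ κ)) ν}) ⟩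
    ∑ m (λ j → D (suc j) (T (m ∸ suc j) f) (x ∷ ν)) ∎
    where
    P Q : ℕ → ℚ
    P i = 2ℚ * ι (+ i) * γ (+ i) * S i
    Q i = γ (+ i) * shift i (λ y → 2ℚ * ι (+ (m ∸ i)) * T (m ∸ i) (λ κ → f (y ∷ κ)) ν) x

euler-T : ∀ ν → EulerT ν
euler-T []      zero    f = zero-*ˡ (zero-*ʳ {x = 2ℚ} ι-0)
euler-T []      (suc m) f = trans (QP.*-zeroʳ (2ℚ * ι (+ suc m))) (sym (∑-0 (suc m) (λ _ _ → refl)))
euler-T (x ∷ ν) m       f = euler-T-∷ x ν (euler-T ν) m f

-- Differentiating products of power sums

rem : ℕ → List ℕ → List ℕ
rem s []      = []
rem s (r ∷ ρ) = if r N.≡ᵇ s then ρ else r ∷ rem s ρ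

≡ᵇ-true : ∀ {m n} → (m N.≡ᵇ n) ≡ true → m ≡ n
≡ᵇ-true {m} {n} e = NP.≡ᵇ⇒≡ m n (subst Data.Bool.T (sym e) tt)

≡ᵇ-refl : ∀ n → (n N.≡ᵇ n) ≡ true
≡ᵇ-refl zero    = refl
≡ᵇ-refl (suc n) = ≡ᵇ-refl n

≡ᵇ-false : ∀ {m n} → m ≢ n → (m N.≡ᵇ n) ≡ false
≡ᵇ-false {m} {n} m≢n with m N.≡ᵇ n in e
... | true  = ⊥-elim (m≢n (≡ᵇ-true e))
... | false = refl

PM-rem : ∀ s ρ ν → cnt s ρ ≢ 0 → PM ρ ν ≡ D s (PM (rem s ρ)) ν
PM-rem s []      ν c≢0 = ⊥-elim (c≢0 refl)
PM-rem s (r ∷ ρ) ν c≢0 with r N.≡ᵇ s in e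
... | true  = cong (λ r → D r (PM ρ) ν) (≡ᵇ-true e)
... | false = trans (D-cong r ν (λ κ _ → PM-rem s ρ κ c≢0)) (D-comm r s ν (PM (rem s ρ)))

shift-weight : ∀ r x (g : ℕ → ℚ) → ι (+ x) * shift r g x ≡ ι (+ r) * shift r g x + shift r (λ y → ι (+ y) * g y) x
shift-weight r x g with shift-split r x g
... | inj₂ (x<r , e) = trans (zero-*ʳ {x = ι (+ x)} e) (sym (zero-sum (zero-*ʳ {x = ι (+ r)} e) (shift-below (λ y → ι (+ y) * g y) x<r)))
... | inj₁ (y , refl , e) = trans (cong₂ _*_ (ι-+ (+ r) (+ y)) e) (trans (QP.*-distribʳ-+ (g y) (ι (+ r)) (ι (+ y))) (cong₂ _+_ (cong (ι (+ r) *_) (sym e)) (sym (shift-at r (λ y → ι (+ y) * g y) y))))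

∑-δ : ∀ n r (q : ℕ → ℚ) → r N.< n → ∑ n (λ s → [ r N.≡ᵇ s ]ᵇ * q s) ≡ q r
∑-δ n r q r<n = trans (∑-single n r {λ s → [ r N.≡ᵇ s ]ᵇ * q s} r<n (λ s _ s≢r → zero-*ˡ {y = q s} (cong [_]ᵇ (≡ᵇ-false (λ e → s≢r (sym e))))))
  (trans (cong (λ b → [ b ]ᵇ * q r) (≡ᵇ-refl r)) (QP.*-identityˡ (q r)))

-- The operator x d/dx in the first variable applied to p_ρ: a part s contributes s x^s times p of
-- the remaining parts, and equal parts are grouped by multiplicity.
EulerPM : List ℕ → ℕ → Set
EulerPM ρ n = ∀ m μ → ι (+ m) * PM ρ (m ∷ μ) ≡ ∑ n (λ s → ι (+ s) * ι (+ cnt s ρ) * shift s (λ y → PM (rem s ρ) (y ∷ μ)) m)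

euler-PM-∷ : ∀ r ρ n → r N.< n → EulerPM ρ n → EulerPM (r ∷ ρ) n
euler-PM-∷ r ρ n r<n ih m μ = begin
  ι (+ m) * (shift r (λ y → PM ρ (y ∷ μ)) m + D r (λ κ → PM ρ (m ∷ κ)) μ)
    ≡⟨ QP.*-distribˡ-+ (ι (+ m)) (shift r (λ y → PM ρ (y ∷ μ)) m) (D r (λ κ → PM ρ (m ∷ κ)) μ) ⟩
  ι (+ m) * shift r (λ y → PM ρ (y ∷ μ)) m + ι (+ m) * D r (λ κ → PM ρ (m ∷ κ)) μ
    ≡⟨ cong₂ _+_ (shift-weight r m (λ y → PM ρ (y ∷ μ))) (sym (D-* r μ (ι (+ m)) (λ κ → PM ρ (m ∷ κ)))) ⟩
  X + shift r (λ y → ι (+ y) * PM ρ (y ∷ μ)) m + D r (λ κ → ι (+ m) * PM ρ (m ∷ κ)) μ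
    ≡⟨ cong₂ (λ u v → X + u + v) (shift-cong r m (λ y → ih y μ)) (D-cong r μ (λ κ _ → ih m κ)) ⟩
  X + shift r (λ y → ∑ n (λ s → c s * shift s (λ z → PM (rem s ρ) (z ∷ μ)) y)) m + D r (λ κ → ∑ n (λ s → c s * shift s (λ y → PM (rem s ρ) (y ∷ κ)) m)) μ
    ≡⟨ cong₂ (λ u v → X + u + v)
         (trans (shift-∑ r m n (λ s y → c s * shift s (λ z → PM (rem s ρ) (z ∷ μ)) y)) (∑-cong n (λ s → trans (shift-* r m (c s) (shift s (λ z → PM (rem s ρ) (z ∷ μ)))) (cong (c s *_) (shift-comm r s m (λ z → PM (rem s ρ) (z ∷ μ)))))))
         (trans (D-∑ r μ n (λ s κ → c s * shift s (λ y → PM (rem s ρ) (y ∷ κ)) m)) (∑-cong n (λ s → trans (D-* r μ (c s) (λ κ → shift s (λ y → PM (rem s ρ) (y ∷ κ)) m)) (cong (c s *_) (sym (shift-D s r m μ (λ y κ → PM (rem s ρ) (y ∷ κ)))))))) ⟩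
  X + ∑ n (λ s → c s * U s) + ∑ n (λ s → c s * V s)
    ≡⟨ trans (QP.+-assoc X (∑ n (λ s → c s * U s)) (∑ n (λ s → c s * V s))) (cong (λ u → X + u) (sym (∑-+ n {λ s → c s * U s} {λ s → c s * V s}))) ⟩
  X + ∑ n (λ s → c s * U s + c s * V s)
    ≡⟨ cong₂ _+_ (sym (∑-δ n r (λ s → ι (+ s) * shift s (λ y → PM ρ (y ∷ μ)) m) r<n))
         (∑-cong n (λ s → trans (sym (QP.*-distribˡ-+ (c s) (U s) (V s))) (cong (c s *_) (sym (shift-+ s m (shift r (λ z → PM (rem s ρ) (z ∷ μ))) (λ y → D r (λ κ → PM (rem s ρ) (y ∷ κ)) μ)))))) ⟩
  ∑ n (λ s → [ r N.≡ᵇ s ]ᵇ * (ι (+ s) * shift s (λ y → PM ρ (y ∷ μ)) m)) + ∑ n (λ s → c s * shift s (λ y → PM (r ∷ rem s ρ) (y ∷ μ)) m)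
    ≡⟨ sym (∑-+ n {λ s → [ r N.≡ᵇ s ]ᵇ * (ι (+ s) * shift s (λ y → PM ρ (y ∷ μ)) m)} {λ s → c s * shift s (λ y → PM (r ∷ rem s ρ) (y ∷ μ)) m}) ⟩
  ∑ n (λ s → [ r N.≡ᵇ s ]ᵇ * (ι (+ s) * shift s (λ y → PM ρ (y ∷ μ)) m) + c s * shift s (λ y → PM (r ∷ rem s ρ) (y ∷ μ)) m)
    ≡⟨ ∑-cong n pointwise ⟩
  ∑ n (λ s → ι (+ s) * ι (+ cnt s (r ∷ ρ)) * shift s (λ y → PM (rem s (r ∷ ρ)) (y ∷ μ)) m) ∎
  where
  c U V : ℕ → ℚ
  c s = ι (+ s) * ι (+ cnt s ρ)
  U s = shift s (shift r (λ z → PM (rem s ρ) (z ∷ μ))) m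
  V s = shift s (λ y → D r (λ κ → PM (rem s ρ) (y ∷ κ)) μ) m
  X : ℚ
  X = ι (+ r) * shift r (λ y → PM ρ (y ∷ μ)) m
  zero-case : ∀ {k a b x} → k ≡ 0 → x * ι (+ k) * a ≡ x * ι (+ k) * b
  zero-case {x = x} refl = trans (zero-*ˡ (zero-*ʳ {x = x} ι-0)) (sym (zero-*ˡ (zero-*ʳ {x = x} ι-0)))
  -- If r does not occur in ρ, then putting r back after `rem` does not restore ρ, but the
  -- multiplicity in `c` is then zero.
  collapse : ∀ s → r ≡ s → c s * shift s (λ y → PM (r ∷ rem s ρ) (y ∷ μ)) m ≡ c s * shift s (λ y → PM ρ (y ∷ μ)) m
  collapse s refl with cnt r ρ N.≟ 0
  ... | yes z = zero-case {x = ι (+ s)} z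
  ... | no nz = cong (c s *_) (shift-cong s m (λ y → sym (PM-rem s ρ (y ∷ μ) nz)))
  pointwise : ∀ s → [ r N.≡ᵇ s ]ᵇ * (ι (+ s) * shift s (λ y → PM ρ (y ∷ μ)) m) + c s * shift s (λ y → PM (r ∷ rem s ρ) (y ∷ μ)) m
    ≡ ι (+ s) * ι (+ cnt s (r ∷ ρ)) * shift s (λ y → PM (rem s (r ∷ ρ)) (y ∷ μ)) m
  pointwise s with r N.≡ᵇ s in e
  ... | false = trans (cong (_+ c s * shift s (λ y → PM (r ∷ rem s ρ) (y ∷ μ)) m) (QP.*-zeroˡ (ι (+ s) * shift s (λ y → PM ρ (y ∷ μ)) m))) (QP.+-identityˡ _)
  ... | true  = trans (cong (λ u → 1ℚ * (ι (+ s) * G) + u) (collapse s (≡ᵇ-true e))) (trans (lem (ι (+ s)) G (ι (+ cnt s ρ))) (cong (λ k → ι (+ s) * k * G) (sym (ι-suc (cnt s ρ)))))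
    where
    G : ℚ
    G = shift s (λ y → PM ρ (y ∷ μ)) m
    lem : ∀ s g k → 1ℚ * (s * g) + s * k * g ≡ s * (k + 1ℚ) * g
    lem = solve-∀ ring

euler-PM : ∀ ρ n → All (N._< n) ρ → EulerPM ρ n
euler-PM []      n _ m μ = trans (empty m) (sym (∑-0 n (λ s _ → zero-*ˡ (zero-*ʳ {x = ι (+ s)} ι-0))))
  where
  empty : ∀ m → ι (+ m) * isZero (m ∷ μ) ≡ 0ℚ
  empty zero    = zero-*ˡ ι-0
  empty (suc m) = QP.*-zeroʳ (ι (+ suc m))
euler-PM (r ∷ ρ) n (r<n ∷ ps) = euler-PM-∷ r ρ n r<n (euler-PM ρ n ps)

-- Partitions as filtered lists

∧-true : ∀ {a b} → a ∧ b ≡ true → a ≡ true × b ≡ true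
∧-true {true} {true} _ = refl , refl

∧-intro : ∀ {a b} → a ≡ true → b ≡ true → a ∧ b ≡ true
∧-intro refl refl = refl

≤ᵇ-true : ∀ {m n} → (m N.≤ᵇ n) ≡ true → m N.≤ n
≤ᵇ-true {m} {n} e = NP.≤ᵇ⇒≤ m n (subst Data.Bool.T (sym e) tt)

≤ᵇ-intro : ∀ {m n} → m N.≤ n → (m N.≤ᵇ n) ≡ true
≤ᵇ-intro {m} {n} m≤n with m N.≤ᵇ n in e
... | true  = refl
... | false = ⊥-elim (subst Data.Bool.T e (NP.≤⇒≤ᵇ m≤n))

-- The head is compared with all later entries rather than with its neighbour, a form that survives
-- deletion and insertion of parts.
Decreasing : List ℕ → Set
Decreasing []      = ⊤
Decreasing (x ∷ ρ) = All (N._≤ x) ρ × Decreasing ρ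

Par : ℕ → List ℕ → Set
Par N ρ = Decreasing ρ × All (1 N.≤_) ρ × NL.sum ρ ≡ N

All-map : ∀ {P Q : ℕ → Set} {ρ} → (∀ {x} → P x → Q x) → All P ρ → All Q ρ
All-map f []       = []
All-map f (p ∷ ps) = f p ∷ All-map f ps

weaklyDec⇒ : ∀ ρ → weaklyDec ρ ≡ true → Decreasing ρ
weaklyDec⇒ []          _ = tt
weaklyDec⇒ (x ∷ [])    _ = [] , tt
weaklyDec⇒ (x ∷ y ∷ ρ) e = extend (≤ᵇ-true (proj₁ p)) (weaklyDec⇒ (y ∷ ρ) (proj₂ p))
  where
  p : (y N.≤ᵇ x) ≡ true × weaklyDec (y ∷ ρ) ≡ true
  p = ∧-true {y N.≤ᵇ x} e
  extend : y N.≤ x → Decreasing (y ∷ ρ) → Decreasing (x ∷ y ∷ ρ)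
  extend y≤x (ps , d) = (y≤x ∷ All-map (λ q → NP.≤-trans q y≤x) ps) , ps , d

⇒weaklyDec : ∀ ρ → Decreasing ρ → weaklyDec ρ ≡ true
⇒weaklyDec []          _ = refl
⇒weaklyDec (x ∷ [])    _ = refl
⇒weaklyDec (x ∷ y ∷ ρ) ((y≤x ∷ _) , d) = ∧-intro (≤ᵇ-intro y≤x) (⇒weaklyDec (y ∷ ρ) d)

isPar⇒ : ∀ {N} ρ → isPar N ρ ≡ true → Par N ρ
isPar⇒ {N} ρ e with ∧-true {weaklyDec ρ} e
... | d , e' with ∧-true {allB (λ x → 1 N.≤ᵇ x) ρ} e'
...   | p , s = weaklyDec⇒ ρ d , go ρ p , ≡ᵇ-true s
  where
  go : ∀ ρ → allB (λ x → 1 N.≤ᵇ x) ρ ≡ true → All (1 N.≤_) ρ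
  go []      _ = []
  go (x ∷ ρ) e with ∧-true {1 N.≤ᵇ x} e
  ... | a , b = ≤ᵇ-true a ∷ go ρ b

⇒isPar : ∀ {N} ρ → Par N ρ → isPar N ρ ≡ true
⇒isPar {N} ρ (d , p , s) = ∧-intro (⇒weaklyDec ρ d) (∧-intro (go p) (trans (cong (N._≡ᵇ N) s) (≡ᵇ-refl N)))
  where
  go : ∀ {ρ} → All (1 N.≤_) ρ → allB (λ x → 1 N.≤ᵇ x) ρ ≡ true
  go []       = refl
  go (p ∷ ps) = ∧-intro (≤ᵇ-intro p) (go ps)

listEq-true : ∀ {ρ τ} → listEq ρ τ ≡ true → ρ ≡ τ
listEq-true {[]}    {[]}    _ = refl
listEq-true {x ∷ ρ} {y ∷ τ} e with ∧-true {x N.≡ᵇ y} e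
... | a , b = cong₂ _∷_ (≡ᵇ-true a) (listEq-true b)

listEq-refl : ∀ ρ → listEq ρ ρ ≡ true
listEq-refl []      = refl
listEq-refl (x ∷ ρ) = ∧-intro (≡ᵇ-refl x) (listEq-refl ρ)

[]ᵇ-false : ∀ b → b ≢ true → [ b ]ᵇ ≡ 0ℚ
[]ᵇ-false true  n = ⊥-elim (n refl)
[]ᵇ-false false n = refl

guarded : ∀ b {x y} → (b ≡ true → x ≡ y) → [ b ]ᵇ * x ≡ [ b ]ᵇ * y
guarded true          e = cong (1ℚ *_) (e refl)
guarded false {x} {y} e = trans (QP.*-zeroˡ x) (sym (QP.*-zeroˡ y))

≡ᵇ-sym : ∀ x t → (x N.≡ᵇ t) ≡ (t N.≡ᵇ x)
≡ᵇ-sym zero    zero    = refl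
≡ᵇ-sym zero    (suc t) = refl
≡ᵇ-sym (suc x) zero    = refl
≡ᵇ-sym (suc x) (suc t) = ≡ᵇ-sym x t

count-lists : ∀ k n τ → All (N._< n) τ → ∑L (lists k (upTo n)) (λ ρ → [ listEq ρ τ ]ᵇ) ≡ [ k N.≡ᵇ length τ ]ᵇ
count-lists zero    n []      _ = refl
count-lists zero    n (t ∷ τ) _ = refl
count-lists (suc k) n τ ps = trans (∑L-concatMap (λ x → map (x ∷_) (lists k (upTo n))) (upTo n)) (trans (∑L-applyUpTo n id) (go τ ps))
  where
  inner : ∀ x τ → ∑L (map (x ∷_) (lists k (upTo n))) (λ ρ → [ listEq ρ τ ]ᵇ) ≡ ∑L (lists k (upTo n)) (λ ρ → [ listEq (x ∷ ρ) τ ]ᵇ)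
  inner x τ = ∑L-map (x ∷_) (lists k (upTo n))
  go : ∀ τ → All (N._< n) τ → ∑ n (λ x → ∑L (map (x ∷_) (lists k (upTo n))) (λ ρ → [ listEq ρ τ ]ᵇ)) ≡ [ suc k N.≡ᵇ length τ ]ᵇ
  go []      _ = ∑-0 n (λ x _ → trans (inner x []) (∑L-0 (lists k (upTo n)) (λ _ → refl)))
  go (t ∷ τ) (t<n ∷ ps) = trans (∑-cong n (λ x → trans (inner x (t ∷ τ)) (trans (∑L-cong (lists k (upTo n)) (λ ρ → [∧] (x N.≡ᵇ t) (listEq ρ τ)))
      (trans (∑L-*ˡ (lists k (upTo n)) [ x N.≡ᵇ t ]ᵇ) (cong₂ _*_ (cong [_]ᵇ (≡ᵇ-sym x t)) (count-lists k n τ ps))))))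
    (∑-δ n t (λ _ → [ k N.≡ᵇ length τ ]ᵇ) t<n)

parts≤sum : ∀ ρ → All (N._≤ NL.sum ρ) ρ
parts≤sum []      = []
parts≤sum (x ∷ ρ) = NP.m≤m+n x (NL.sum ρ) ∷ All-map (λ q → NP.≤-trans q (NP.m≤n+m (NL.sum ρ) x)) (parts≤sum ρ)

length≤sum : ∀ {ρ} → All (1 N.≤_) ρ → length ρ N.≤ NL.sum ρ
length≤sum []       = z≤n
length≤sum (p ∷ ps) = NP.+-mono-≤ p (length≤sum ps)

allLists : ℕ → List (List ℕ)
allLists N = concatMap (λ k → lists k (upTo (suc N))) (upTo (suc N))

∑par : ∀ N f → ∑L (partitions N) f ≡ ∑L (allLists N) (λ ρ → [ isPar N ρ ]ᵇ * f ρ)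
∑par N f = ∑L-filter (isPar N) (allLists N)

∑par-cong : ∀ N {f g} → (∀ ρ → Par N ρ → f ρ ≡ g ρ) → ∑L (partitions N) f ≡ ∑L (partitions N) g
∑par-cong N {f} {g} e = trans (∑par N f) (trans (∑L-cong (allLists N) (λ ρ → guarded (isPar N ρ) (λ p → e ρ (isPar⇒ ρ p)))) (sym (∑par N g)))

count-all : ∀ N τ → All (N._< suc N) τ → length τ N.≤ N → ∑L (allLists N) (λ ρ → [ listEq ρ τ ]ᵇ) ≡ 1ℚ
count-all N τ ps l = begin
  ∑L (allLists N) (λ ρ → [ listEq ρ τ ]ᵇ)
    ≡⟨ ∑L-concatMap (λ k → lists k (upTo (suc N))) (upTo (suc N)) {λ ρ → [ listEq ρ τ ]ᵇ} ⟩
  ∑L (upTo (suc N)) (λ k → ∑L (lists k (upTo (suc N))) (λ ρ → [ listEq ρ τ ]ᵇ))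
    ≡⟨ ∑L-applyUpTo (suc N) id {λ k → ∑L (lists k (upTo (suc N))) (λ ρ → [ listEq ρ τ ]ᵇ)} ⟩
  ∑ (suc N) (λ k → ∑L (lists k (upTo (suc N))) (λ ρ → [ listEq ρ τ ]ᵇ))
    ≡⟨ ∑-cong (suc N) (λ k → trans (count-lists k (suc N) τ ps) (trans (cong [_]ᵇ (≡ᵇ-sym k (length τ))) (sym (QP.*-identityʳ [ length τ N.≡ᵇ k ]ᵇ)))) ⟩
  ∑ (suc N) (λ k → [ length τ N.≡ᵇ k ]ᵇ * 1ℚ)
    ≡⟨ ∑-δ (suc N) (length τ) (λ _ → 1ℚ) (s≤s l) ⟩
  1ℚ ∎

-- Every partition of N occurs exactly once in `partitions N`: it is among the lists of length at
-- most N with entries at most N, and these are enumerated without repetition.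
∑par-δ : ∀ N τ (f : List ℕ → ℚ) → Par N τ → ∑L (partitions N) (λ ρ → [ listEq ρ τ ]ᵇ * f ρ) ≡ f τ
∑par-δ N τ f pτ@(_ , pos , s≡) = begin
  ∑L (partitions N) (λ ρ → [ listEq ρ τ ]ᵇ * f ρ)
    ≡⟨ ∑par N (λ ρ → [ listEq ρ τ ]ᵇ * f ρ) ⟩
  ∑L (allLists N) (λ ρ → [ isPar N ρ ]ᵇ * ([ listEq ρ τ ]ᵇ * f ρ))
    ≡⟨ ∑L-cong (allLists N) (λ ρ → trans (*-left-comm [ isPar N ρ ]ᵇ [ listEq ρ τ ]ᵇ (f ρ)) (trans (guarded (listEq ρ τ) (λ e → sub ρ (listEq-true e))) (QP.*-comm [ listEq ρ τ ]ᵇ (f τ)))) ⟩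
  ∑L (allLists N) (λ ρ → f τ * [ listEq ρ τ ]ᵇ)
    ≡⟨ ∑L-*ˡ (allLists N) (f τ) {λ ρ → [ listEq ρ τ ]ᵇ} ⟩
  f τ * ∑L (allLists N) (λ ρ → [ listEq ρ τ ]ᵇ)
    ≡⟨ cong (f τ *_) (count-all N τ (subst (λ n → All (N._< suc n) τ) s≡ (All-map s≤s (parts≤sum τ))) (subst (length τ N.≤_) s≡ (length≤sum pos))) ⟩
  f τ * 1ℚ
    ≡⟨ QP.*-identityʳ (f τ) ⟩
  f τ ∎
  where
  sub : ∀ ρ → ρ ≡ τ → [ isPar N ρ ]ᵇ * f ρ ≡ f τ
  sub ρ refl = trans (cong (λ b → [ b ]ᵇ * f τ) (⇒isPar τ pτ)) (QP.*-identityˡ (f τ))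

-- Removing and inserting a part

ins : ℕ → List ℕ → List ℕ
ins s []      = s ∷ []
ins s (r ∷ σ) = if r N.≤ᵇ s then s ∷ r ∷ σ else r ∷ ins s σ

cnt-∷-≡ : ∀ s ρ → cnt s (s ∷ ρ) ≡ suc (cnt s ρ)
cnt-∷-≡ s ρ rewrite ≡ᵇ-refl s = refl

cnt-∷-≢ : ∀ {r s} ρ → r ≢ s → cnt s (r ∷ ρ) ≡ cnt s ρ
cnt-∷-≢ ρ r≢s rewrite ≡ᵇ-false r≢s = refl

rem-∷-≡ : ∀ s ρ → rem s (s ∷ ρ) ≡ ρ
rem-∷-≡ s ρ rewrite ≡ᵇ-refl s = refl

rem-∷-≢ : ∀ {r s} ρ → r ≢ s → rem s (r ∷ ρ) ≡ r ∷ rem s ρ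
rem-∷-≢ ρ r≢s rewrite ≡ᵇ-false r≢s = refl

ins-≤ : ∀ {r s} σ → r N.≤ s → ins s (r ∷ σ) ≡ s ∷ r ∷ σ
ins-≤ σ r≤s rewrite ≤ᵇ-intro r≤s = refl

ins-> : ∀ {r s} σ → s N.< r → ins s (r ∷ σ) ≡ r ∷ ins s σ
ins-> {r} {s} σ s<r with r N.≤ᵇ s in e
... | true  = ⊥-elim (NP.<⇒≱ s<r (≤ᵇ-true e))
... | false = refl

rem-ins : ∀ s σ → rem s (ins s σ) ≡ σ
rem-ins s []      = rem-∷-≡ s []
rem-ins s (r ∷ σ) with NP.≤-<-connex r s
... | inj₁ r≤s = trans (cong (rem s) (ins-≤ σ r≤s)) (rem-∷-≡ s (r ∷ σ))
... | inj₂ s<r = trans (cong (rem s) (ins-> σ s<r)) (trans (rem-∷-≢ (ins s σ) (λ e → NP.<⇒≢ s<r (sym e))) (cong (r ∷_) (rem-ins s σ)))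

cnt-ins : ∀ s σ → cnt s (ins s σ) ≡ suc (cnt s σ)
cnt-ins s []      = cnt-∷-≡ s []
cnt-ins s (r ∷ σ) with NP.≤-<-connex r s
... | inj₁ r≤s = trans (cong (cnt s) (ins-≤ σ r≤s)) (cnt-∷-≡ s (r ∷ σ))
... | inj₂ s<r = trans (cong (cnt s) (ins-> σ s<r)) (trans (cnt-∷-≢ (ins s σ) r≢s) (trans (cnt-ins s σ) (cong suc (sym (cnt-∷-≢ σ r≢s)))))
  where
  r≢s : r ≢ s
  r≢s e = NP.<⇒≢ s<r (sym e)

cnt-≤ : ∀ {s x} ρ → All (N._≤ x) ρ → cnt s ρ ≢ 0 → s N.≤ x
cnt-≤ []      []       c = ⊥-elim (c refl)
cnt-≤ {s} (r ∷ ρ) (p ∷ ps) c with r N.≟ s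
... | yes refl = p
... | no r≢s = cnt-≤ ρ ps (λ e → c (trans (cnt-∷-≢ ρ r≢s) e))

ins-rem : ∀ s ρ → Decreasing ρ → cnt s ρ ≢ 0 → ins s (rem s ρ) ≡ ρ
ins-rem s []      _ c = ⊥-elim (c refl)
ins-rem s (r ∷ ρ) (ps , d) c with r N.≟ s
... | yes refl = trans (cong (ins s) (rem-∷-≡ s ρ)) (go ρ ps)
  where
  go : ∀ ρ → All (N._≤ s) ρ → ins s ρ ≡ s ∷ ρ
  go []      _ = refl
  go (x ∷ ρ) (p ∷ _) = ins-≤ ρ p
... | no r≢s = trans (cong (ins s) (rem-∷-≢ ρ r≢s)) (trans (ins-> (rem s ρ) (NP.≤∧≢⇒< (cnt-≤ ρ ps c') (λ e → r≢s (sym e)))) (cong (r ∷_) (ins-rem s ρ d c')))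
  where
  c' : cnt s ρ ≢ 0
  c' e = c (trans (cnt-∷-≢ ρ r≢s) e)

All-rem : ∀ {P : ℕ → Set} s ρ → All P ρ → All P (rem s ρ)
All-rem s []      []       = []
All-rem s (r ∷ ρ) (p ∷ ps) with r N.≡ᵇ s
... | true  = ps
... | false = p ∷ All-rem s ρ ps

Decreasing-rem : ∀ s ρ → Decreasing ρ → Decreasing (rem s ρ)
Decreasing-rem s []      _ = tt
Decreasing-rem s (r ∷ ρ) (ps , d) with r N.≡ᵇ s
... | true  = d
... | false = All-rem s ρ ps , Decreasing-rem s ρ d

All-ins : ∀ {P : ℕ → Set} s σ → P s → All P σ → All P (ins s σ)
All-ins s []      p []       = p ∷ []
All-ins s (r ∷ σ) p (q ∷ qs) with r N.≤ᵇ s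
... | true  = p ∷ q ∷ qs
... | false = q ∷ All-ins s σ p qs

Decreasing-ins : ∀ s σ → Decreasing σ → Decreasing (ins s σ)
Decreasing-ins s []      _ = [] , tt
Decreasing-ins s (r ∷ σ) (ps , d) with NP.≤-<-connex r s
... | inj₁ r≤s = subst Decreasing (sym (ins-≤ σ r≤s)) ((r≤s ∷ All-map (λ q → NP.≤-trans q r≤s) ps) , ps , d)
... | inj₂ s<r = subst Decreasing (sym (ins-> σ s<r)) (All-ins s σ (NP.<⇒≤ s<r) ps , Decreasing-ins s σ d)

sum-ins : ∀ s σ → NL.sum (ins s σ) ≡ s N.+ NL.sum σ
sum-ins s []      = refl
sum-ins s (r ∷ σ) with r N.≤ᵇ s
... | true  = refl
... | false = trans (cong (r N.+_) (sum-ins s σ)) (trans (sym (NP.+-assoc r s (NL.sum σ))) (trans (cong (N._+ NL.sum σ) (NP.+-comm r s)) (NP.+-assoc s r (NL.sum σ))))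

length-ins : ∀ s σ → length (ins s σ) ≡ suc (length σ)
length-ins s []      = refl
length-ins s (r ∷ σ) with r N.≤ᵇ s
... | true  = refl
... | false = cong suc (length-ins s σ)

cnt-ins-≢ : ∀ {i s} σ → i ≢ s → cnt i (ins s σ) ≡ cnt i σ
cnt-ins-≢ {i} {s} []      i≢s = cnt-∷-≢ [] (λ e → i≢s (sym e))
cnt-ins-≢ {i} {s} (r ∷ σ) i≢s with r N.≤ᵇ s
... | true  = cnt-∷-≢ (r ∷ σ) (λ e → i≢s (sym e))
... | false with r N.≡ᵇ i
...   | true  = cong suc (cnt-ins-≢ σ i≢s)
...   | false = cnt-ins-≢ σ i≢s

Par-ins : ∀ {M} s σ → 1 N.≤ s → Par M σ → Par (s N.+ M) (ins s σ)
Par-ins s σ 1≤s (d , p , refl) = Decreasing-ins s σ d , All-ins s σ 1≤s p , sum-ins s σ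

Par-rem : ∀ {M} s ρ → Par (s N.+ M) ρ → cnt s ρ ≢ 0 → Par M (rem s ρ)
Par-rem {M} s ρ (d , p , e) c = Decreasing-rem s ρ d , All-rem s ρ p , NP.+-cancelˡ-≡ s _ _ (trans (sym (sum-ins s (rem s ρ))) (trans (cong NL.sum (ins-rem s ρ d c)) e))

∑L-swap : ∀ {X Y : Set} (xs : List X) (ys : List Y) (g : X → Y → ℚ) → ∑L xs (λ x → ∑L ys (g x)) ≡ ∑L ys (λ y → ∑L xs (λ x → g x y))
∑L-swap []       ys g = sym (∑L-0 ys (λ _ → refl))
∑L-swap (x ∷ xs) ys g = trans (cong (λ u → ∑L ys (g x) + u) (∑L-swap xs ys g)) (sym (∑L-+ ys {g x} {λ y → ∑L xs (λ x → g x y)}))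

[]ᵇ-iff : ∀ a b → (a ≡ true → b ≡ true) → (b ≡ true → a ≡ true) → [ a ]ᵇ ≡ [ b ]ᵇ
[]ᵇ-iff true  true  f g = refl
[]ᵇ-iff false false f g = refl
[]ᵇ-iff true  false f g with f refl
... | ()
[]ᵇ-iff false true  f g with g refl
... | ()

1≤⇒≢0 : ∀ {n} → 1 N.≤ n → n ≢ 0
1≤⇒≢0 (s≤s _) ()

-- `rem s` and `ins s` are inverse bijections between the partitions containing s and the partitions
-- of the smaller size. The change of summation index is carried out by a double sum over the graph
-- of this bijection.
∑par-rem : ∀ s M (X : List ℕ → ℚ) → 1 N.≤ s → ∑L (partitions (s N.+ M)) (λ ρ → [ 1 N.≤ᵇ cnt s ρ ]ᵇ * X (rem s ρ)) ≡ ∑L (partitions M) X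
∑par-rem s M X 1≤s = begin
  ∑L PN (λ ρ → [ 1 N.≤ᵇ cnt s ρ ]ᵇ * X (rem s ρ))
    ≡⟨ ∑par-cong (s N.+ M) (λ ρ p → trans (guarded (1 N.≤ᵇ cnt s ρ) (λ e → sym (∑par-δ M (rem s ρ) X (Par-rem s ρ p (1≤⇒≢0 (≤ᵇ-true e)))))) (sym (∑L-*ˡ PM' [ 1 N.≤ᵇ cnt s ρ ]ᵇ {λ σ → [ listEq σ (rem s ρ) ]ᵇ * X σ}))) ⟩
  ∑L PN (λ ρ → ∑L PM' (λ σ → [ 1 N.≤ᵇ cnt s ρ ]ᵇ * ([ listEq σ (rem s ρ) ]ᵇ * X σ)))
    ≡⟨ ∑par-cong (s N.+ M) (λ ρ p → ∑L-cong PM' (λ σ → trans (sym (QP.*-assoc [ 1 N.≤ᵇ cnt s ρ ]ᵇ [ listEq σ (rem s ρ) ]ᵇ (X σ))) (trans (cong (_* X σ) (trans (sym ([∧] (1 N.≤ᵇ cnt s ρ) (listEq σ (rem s ρ)))) (iff ρ σ p))) (QP.*-comm [ listEq ρ (ins s σ) ]ᵇ (X σ))))) ⟩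
  ∑L PN (λ ρ → ∑L PM' (λ σ → X σ * [ listEq ρ (ins s σ) ]ᵇ))
    ≡⟨ ∑L-swap PN PM' (λ ρ σ → X σ * [ listEq ρ (ins s σ) ]ᵇ) ⟩
  ∑L PM' (λ σ → ∑L PN (λ ρ → X σ * [ listEq ρ (ins s σ) ]ᵇ))
    ≡⟨ ∑par-cong M (λ σ p → trans (∑L-*ˡ PN (X σ) {λ ρ → [ listEq ρ (ins s σ) ]ᵇ}) (trans (cong (X σ *_) (trans (∑L-cong PN (λ ρ → sym (QP.*-identityʳ [ listEq ρ (ins s σ) ]ᵇ))) (∑par-δ (s N.+ M) (ins s σ) (λ _ → 1ℚ) (Par-ins s σ 1≤s p)))) (QP.*-identityʳ (X σ)))) ⟩
  ∑L PM' X ∎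
  where
  PN PM' : List (List ℕ)
  PN = partitions (s N.+ M)
  PM' = partitions M
  iff : ∀ ρ σ → Par (s N.+ M) ρ → [ (1 N.≤ᵇ cnt s ρ) ∧ listEq σ (rem s ρ) ]ᵇ ≡ [ listEq ρ (ins s σ) ]ᵇ
  iff ρ σ (d , _) = []ᵇ-iff ((1 N.≤ᵇ cnt s ρ) ∧ listEq σ (rem s ρ)) (listEq ρ (ins s σ)) to from
    where
    to : (1 N.≤ᵇ cnt s ρ) ∧ listEq σ (rem s ρ) ≡ true → listEq ρ (ins s σ) ≡ true
    to e with ∧-true {1 N.≤ᵇ cnt s ρ} e
    ... | c , l = subst (λ τ → listEq ρ τ ≡ true) (sym (trans (cong (ins s) (listEq-true {σ} {rem s ρ} l)) (ins-rem s ρ d (1≤⇒≢0 (≤ᵇ-true c))))) (listEq-refl ρ)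
    from : listEq ρ (ins s σ) ≡ true → (1 N.≤ᵇ cnt s ρ) ∧ listEq σ (rem s ρ) ≡ true
    from e = subst (λ τ → (1 N.≤ᵇ cnt s τ) ∧ listEq σ (rem s τ) ≡ true) (sym (listEq-true {ρ} e))
      (∧-intro (≤ᵇ-intro (subst (1 N.≤_) (sym (cnt-ins s σ)) (s≤s z≤n))) (subst (λ τ → listEq σ τ ≡ true) (sym (rem-ins s σ)) (listEq-refl σ)))

-- Norms of the power sums

∏ : ℕ → (ℕ → ℕ) → ℕ
∏ zero    F = 1
∏ (suc n) F = F 0 N.* ∏ n (F ∘ suc)

∏-cong< : ∀ n {F G} → (∀ i → i N.< n → F i ≡ G i) → ∏ n F ≡ ∏ n G
∏-cong< zero    e = refl
∏-cong< (suc n) e = cong₂ N._*_ (e 0 (s≤s z≤n)) (∏-cong< n (λ i i<n → e (suc i) (s≤s i<n)))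

∏-extend : ∀ m k {F} → (∀ i → m N.≤ i → F i ≡ 1) → ∏ (m N.+ k) F ≡ ∏ m F
∏-extend zero    zero    e = refl
∏-extend zero    (suc k) e = trans (cong₂ N._*_ (e 0 z≤n) (∏-extend zero k (λ i _ → e (suc i) z≤n))) refl
∏-extend (suc m) k {F} e = cong (F 0 N.*_) (∏-extend m k (λ i m≤i → e (suc i) (s≤s m≤i)))

∏-update : ∀ n k c {F G} → k N.< n → (∀ i → i ≢ k → F i ≡ G i) → F k ≡ c N.* G k → ∏ n F ≡ c N.* ∏ n G
∏-update (suc n) zero    c {F} {G} _ e u = trans (cong₂ N._*_ u (∏-cong< n (λ i _ → e (suc i) (λ ())))) (NP.*-assoc c (G 0) (∏ n (G ∘ suc)))
∏-update (suc n) (suc k) c {F} {G} (s≤s k<n) e u = trans (cong₂ N._*_ (e 0 (λ ())) (∏-update n k c k<n (λ i i≢k → e (suc i) (λ p → i≢k (NP.suc-injective p))) u))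
  (trans (sym (NP.*-assoc (G 0) c (∏ n (G ∘ suc)))) (trans (cong (N._* ∏ n (G ∘ suc)) (NP.*-comm (G 0) c)) (NP.*-assoc c (G 0) (∏ n (G ∘ suc)))))

∏-nonzero : ∀ n {F} → (∀ i → F i ≢ 0) → ∏ n F ≢ 0
∏-nonzero zero    e ()
∏-nonzero (suc n) {F} e z with NP.m*n≡0⇒m≡0∨n≡0 (F 0) z
... | inj₁ p = e 0 p
... | inj₂ p = ∏-nonzero n (λ i → e (suc i)) p

product-∏ : ∀ {X : Set} (g : X → ℕ) (f : ℕ → X) n → NL.product (map g (applyUpTo f n)) ≡ ∏ n (g ∘ f)
product-∏ g f zero    = refl
product-∏ g f (suc n) = cong (g (f 0) N.*_) (product-∏ g (f ∘ suc) n)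

zfac : List ℕ → ℕ → ℕ
zfac ρ i = (suc i N.^ cnt (suc i) ρ) N.* (cnt (suc i) ρ) N.!

zee-∏ : ∀ ρ → zee ρ ≡ ∏ (NL.sum ρ) (zfac ρ)
zee-∏ ρ = trans (cong (λ l → NL.product (map g l)) (LP.map-applyUpTo id suc (NL.sum ρ))) (product-∏ g suc (NL.sum ρ))
  where
  g : ℕ → ℕ
  g i = (i N.^ cnt i ρ) N.* (cnt i ρ) N.!

cnt-0 : ∀ {s x} ρ → All (N._≤ x) ρ → x N.< s → cnt s ρ ≡ 0
cnt-0 {s} ρ ps x<s with cnt s ρ N.≟ 0
... | yes z = z
... | no nz = ⊥-elim (NP.<⇒≱ x<s (cnt-≤ ρ ps nz))

-- Only the factor for parts of size k + 1 changes, from c copies to c + 1. The product runs over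
-- more sizes for the longer list, but sizes beyond the sum of σ contribute 1.
zee-ins : ∀ k σ → zee (ins (suc k) σ) ≡ suc k N.* suc (cnt (suc k) σ) N.* zee σ
zee-ins k σ = begin
  zee (ins (suc k) σ)
    ≡⟨ zee-∏ (ins (suc k) σ) ⟩
  ∏ (NL.sum (ins (suc k) σ)) (zfac (ins (suc k) σ))
    ≡⟨ cong (λ n → ∏ n (zfac (ins (suc k) σ))) (sum-ins (suc k) σ) ⟩
  ∏ (suc k N.+ NL.sum σ) (zfac (ins (suc k) σ))
    ≡⟨ ∏-update (suc k N.+ NL.sum σ) k (suc k N.* suc c) {zfac (ins (suc k) σ)} {zfac σ} (s≤s (NP.m≤m+n k (NL.sum σ))) (λ i i≢k → cong (λ c → (suc i N.^ c) N.* c N.!) (cnt-ins-≢ σ (λ p → i≢k (NP.suc-injective p)))) changed ⟩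
  suc k N.* suc c N.* ∏ (suc k N.+ NL.sum σ) (zfac σ)
    ≡⟨ cong (suc k N.* suc c N.*_) (trans (cong (λ n → ∏ n (zfac σ)) (NP.+-comm (suc k) (NL.sum σ))) (trans (∏-extend (NL.sum σ) (suc k) (λ i i≥ → cong (λ c → (suc i N.^ c) N.* c N.!) (cnt-0 σ (parts≤sum σ) (s≤s i≥)))) (sym (zee-∏ σ)))) ⟩
  suc k N.* suc c N.* zee σ ∎
  where
  c : ℕ
  c = cnt (suc k) σ
  lem : ∀ a b p f → a N.* p N.* (b N.* f) ≡ a N.* b N.* (p N.* f)
  lem = NR.solve-∀
  changed : zfac (ins (suc k) σ) k ≡ suc k N.* suc c N.* zfac σ k
  changed = trans (cong (λ c → (suc k N.^ c) N.* c N.!) (cnt-ins (suc k) σ)) (lem (suc k) (suc c) (suc k N.^ c) (c N.!))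

zee≢0 : ∀ ρ → zee ρ ≢ 0
zee≢0 ρ e = ∏-nonzero (NL.sum ρ) (λ i z → bad i (NP.m*n≡0⇒m≡0∨n≡0 (suc i N.^ cnt (suc i) ρ) z)) (trans (sym (zee-∏ ρ)) e)
  where
  ^≢0 : ∀ i c → suc i N.^ c ≢ 0
  ^≢0 i c e = N.≢-nonZero⁻¹ (suc i N.^ c) {{NP.m^n≢0 (suc i) c}} e
  bad : ∀ i → suc i N.^ cnt (suc i) ρ ≡ 0 ⊎ (cnt (suc i) ρ) N.! ≡ 0 → ⊥
  bad i (inj₁ p) = ^≢0 i (cnt (suc i) ρ) p
  bad i (inj₂ p) = N.≢-nonZero⁻¹ ((cnt (suc i) ρ) N.!) {{NP._!≢0 (cnt (suc i) ρ)}} p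

norm : List ℕ → ℕ
norm ρ = zee ρ N.* 2 N.^ length ρ

norm≢0 : ∀ ρ → + norm ρ ≢ + 0
norm≢0 ρ e with NP.m*n≡0⇒m≡0∨n≡0 (zee ρ) (IP.+-injective e)
... | inj₁ p = zee≢0 ρ p
... | inj₂ p = N.≢-nonZero⁻¹ (2 N.^ length ρ) {{NP.m^n≢0 2 (length ρ)}} p

-- The reciprocal of the norm of a power sum, i.e. the coefficient of p_τ(x) p_τ(y) in the Cauchy
-- kernel.
wt : List ℕ → ℚ
wt τ = ρ (+ norm τ)

wt-inv : ∀ ρ → ι (+ norm ρ) * wt ρ ≡ 1ℚ
wt-inv τ = ρ-inv (+ norm τ) (norm≢0 τ)

norm-ins : ∀ k σ → norm (ins (suc k) σ) ≡ norm σ N.* (2 N.* (suc k N.* cnt (suc k) (ins (suc k) σ)))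
norm-ins k σ = trans (cong₂ (λ x y → x N.* 2 N.^ y) (zee-ins k σ) (length-ins (suc k) σ)) (trans (lem (suc k) (suc (cnt (suc k) σ)) (zee σ) (2 N.^ length σ)) (cong (λ c → norm σ N.* (2 N.* (suc k N.* c))) (sym (cnt-ins (suc k) σ))))
  where
  lem : ∀ s c z p → s N.* c N.* z N.* (2 N.* p) ≡ z N.* p N.* (2 N.* (s N.* c))
  lem = NR.solve-∀

wt-ins : ∀ k σ → 2ℚ * (ι (+ suc k) * ι (+ cnt (suc k) (ins (suc k) σ))) * wt (ins (suc k) σ) ≡ wt σ
wt-ins k σ = ι-cancel (+ norm σ) (norm≢0 σ) (trans (sym (QP.*-assoc (ι (+ norm σ)) (2ℚ * (ι (+ suc k) * ι (+ c))) (wt τ))) (trans (cong (_* wt τ) (sym ι-norm)) (trans (wt-inv τ) (sym (wt-inv σ)))))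
  where
  τ : List ℕ
  τ = ins (suc k) σ
  c : ℕ
  c = cnt (suc k) τ
  ι-norm : ι (+ norm τ) ≡ ι (+ norm σ) * (2ℚ * (ι (+ suc k) * ι (+ c)))
  ι-norm = trans (cong (λ n → ι (+ n)) (norm-ins k σ)) (trans (cong ι (IP.pos-* (norm σ) (2 N.* (suc k N.* c)))) (trans (ι-* (+ norm σ) (+ (2 N.* (suc k N.* c))))
    (cong (ι (+ norm σ) *_) (trans (cong ι (IP.pos-* 2 (suc k N.* c))) (trans (ι-2* (+ (suc k N.* c))) (cong (2ℚ *_) (trans (cong ι (IP.pos-* (suc k) c)) (ι-* (+ suc k) (+ c)))))))))

-- Coefficient of x^μ y^ν in the power-sum form of the Cauchy kernel.
pairing : ℕ → List ℕ → List ℕ → ℚ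
pairing N ν μ = ∑L (partitions N) (λ ρ → wt ρ * PM ρ ν * PM ρ μ)

module _ (m M : ℕ) (ν μ : List ℕ) where
  private
    N : ℕ
    N = m N.+ M

    X : ℕ → List ℕ → ℚ
    X s σ = wt σ * D s (PM σ) ν * shift s (λ y → PM σ (y ∷ μ)) m

    summand : List ℕ → ℕ → ℚ
    summand ρ s = 2ℚ * (wt ρ * PM ρ ν) * (ι (+ s) * ι (+ cnt s ρ) * shift s (λ y → PM (rem s ρ) (y ∷ μ)) m)

    summand-rem : ∀ k ρ → Par N ρ → summand ρ (suc k) ≡ [ 1 N.≤ᵇ cnt (suc k) ρ ]ᵇ * X (suc k) (rem (suc k) ρ)
    summand-rem k ρ (d , _) with cnt (suc k) ρ N.≟ 0
    ... | yes z = trans (zero-*ʳ {x = 2ℚ * (wt ρ * PM ρ ν)} (zero-*ˡ (zero-*ʳ {x = ι (+ suc k)} (trans (cong (λ c → ι (+ c)) z) ι-0)))) (sym (zero-*ˡ (cong (λ c → [ 1 N.≤ᵇ c ]ᵇ) z)))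
    ... | no nz = trans (trans (lem (wt ρ) (PM ρ ν) (ι (+ suc k)) (ι (+ cnt (suc k) ρ)) S) (cong₂ (λ x y → x * y * S) weight≡ (PM-rem (suc k) ρ ν nz)))
        (trans (sym (QP.*-identityˡ _)) (cong (λ b → [ b ]ᵇ * X (suc k) (rem (suc k) ρ)) (sym (≤ᵇ-intro (NP.n≢0⇒n>0 nz)))))
      where
      S : ℚ
      S = shift (suc k) (λ y → PM (rem (suc k) ρ) (y ∷ μ)) m
      lem : ∀ w p s c q → 2ℚ * (w * p) * (s * c * q) ≡ 2ℚ * (s * c) * w * p * q
      lem = solve-∀ ring
      weight≡ : 2ℚ * (ι (+ suc k) * ι (+ cnt (suc k) ρ)) * wt ρ ≡ wt (rem (suc k) ρ)
      weight≡ = subst (λ τ → 2ℚ * (ι (+ suc k) * ι (+ cnt (suc k) τ)) * wt τ ≡ wt (rem (suc k) ρ)) (ins-rem (suc k) ρ d nz) (wt-ins k (rem (suc k) ρ))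

    per-part : ∀ j → j N.< N → ∑L (partitions N) (λ ρ → summand ρ (suc j)) ≡ ∑L (partitions (N ∸ suc j)) (X (suc j))
    per-part j j<N = trans (∑par-cong N (summand-rem j)) (trans (cong (λ n → ∑L (partitions n) (λ ρ → [ 1 N.≤ᵇ cnt (suc j) ρ ]ᵇ * X (suc j) (rem (suc j) ρ))) (sym (NP.m+[n∸m]≡n j<N))) (∑par-rem (suc j) (N ∸ suc j) (X (suc j)) (s≤s z≤n)))

    beyond : ∀ j → m N.≤ j → ∑L (partitions (N ∸ suc j)) (X (suc j)) ≡ 0ℚ
    beyond j m≤j = ∑L-0 (partitions (N ∸ suc j)) (λ σ → zero-*ʳ {x = wt σ * D (suc j) (PM σ) ν} (shift-below (λ y → PM σ (y ∷ μ)) (s≤s m≤j)))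

    within : ∀ j → j N.< m → ∑L (partitions (N ∸ suc j)) (X (suc j)) ≡ D (suc j) (λ κ → pairing (m ∸ suc j N.+ M) κ (m ∸ suc j ∷ μ)) ν
    within j j<m = trans (cong (λ n → ∑L (partitions n) (X (suc j))) (NP.+-∸-comm M j<m)) (trans (∑L-cong (partitions (m ∸ suc j N.+ M)) pointwise) (sym (D-∑L (suc j) ν (partitions (m ∸ suc j N.+ M)) (λ σ κ → wt σ * PM σ κ * PM σ (m ∸ suc j ∷ μ)))))
      where
      lem : ∀ w d q → w * d * q ≡ w * q * d
      lem = solve-∀ ring
      pointwise : ∀ σ → X (suc j) σ ≡ D (suc j) (λ κ → wt σ * PM σ κ * PM σ (m ∸ suc j ∷ μ)) ν
      pointwise σ = trans (cong (wt σ * D (suc j) (PM σ) ν *_) (trans (cong (shift (suc j) (λ y → PM σ (y ∷ μ))) (sym (NP.m+[n∸m]≡n j<m))) (shift-at (suc j) (λ y → PM σ (y ∷ μ)) (m ∸ suc j))))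
        (trans (lem (wt σ) (D (suc j) (PM σ) ν) (PM σ (m ∸ suc j ∷ μ))) (trans (sym (D-* (suc j) ν (wt σ * PM σ (m ∸ suc j ∷ μ)) (PM σ))) (D-cong (suc j) ν (λ κ _ → lem (wt σ) (PM σ (m ∸ suc j ∷ μ)) (PM σ κ)))))

  -- Differentiating p_ρ(x) in its first variable removes a part s with the factor s times its
  -- multiplicity. By `wt-ins` twice that factor converts the weight of ρ into the weight of the
  -- remaining parts, and `∑par-rem` sums over those. The outcome is the recursion of `euler-T`.
  pairing-euler : 2ℚ * ι (+ m) * pairing N ν (m ∷ μ) ≡ ∑ m (λ j → D (suc j) (λ κ → pairing (m ∸ suc j N.+ M) κ (m ∸ suc j ∷ μ)) ν)
  pairing-euler = begin
    2ℚ * ι (+ m) * pairing N ν (m ∷ μ)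
      ≡⟨ sym (∑L-*ˡ (partitions N) (2ℚ * ι (+ m)) {λ ρ → wt ρ * PM ρ ν * PM ρ (m ∷ μ)}) ⟩
    ∑L (partitions N) (λ ρ → 2ℚ * ι (+ m) * (wt ρ * PM ρ ν * PM ρ (m ∷ μ)))
      ≡⟨ ∑par-cong N (λ ρ p → trans (lem (ι (+ m)) (wt ρ) (PM ρ ν) (PM ρ (m ∷ μ))) (trans (cong (2ℚ * (wt ρ * PM ρ ν) *_) (euler-PM ρ (suc N) (subst (λ n → All (N._< suc n) ρ) (proj₂ (proj₂ p)) (All-map s≤s (parts≤sum ρ))) m μ)) (sym (∑-*ˡ (suc N) (2ℚ * (wt ρ * PM ρ ν)) {λ s → ι (+ s) * ι (+ cnt s ρ) * shift s (λ y → PM (rem s ρ) (y ∷ μ)) m})))) ⟩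
    ∑L (partitions N) (λ ρ → ∑ (suc N) (summand ρ))
      ≡⟨ swap (suc N) (partitions N) summand ⟩
    ∑L (partitions N) (λ ρ → summand ρ 0) + ∑ N (λ j → ∑L (partitions N) (λ ρ → summand ρ (suc j)))
      ≡⟨ cong₂ _+_ (∑L-0 (partitions N) (λ ρ → zero-*ʳ {x = 2ℚ * (wt ρ * PM ρ ν)} (zero-*ˡ (zero-*ˡ ι-0)))) (∑-cong< N per-part) ⟩
    0ℚ + ∑ N (λ j → ∑L (partitions (N ∸ suc j)) (X (suc j)))
      ≡⟨ QP.+-identityˡ _ ⟩
    ∑ N (λ j → ∑L (partitions (N ∸ suc j)) (X (suc j)))
      ≡⟨ ∑-mono (NP.m≤m+n m M) beyond ⟩
    ∑ m (λ j → ∑L (partitions (N ∸ suc j)) (X (suc j)))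
      ≡⟨ ∑-cong< m within ⟩
    ∑ m (λ j → D (suc j) (λ κ → pairing (m ∸ suc j N.+ M) κ (m ∸ suc j ∷ μ)) ν) ∎
    where
    lem : ∀ m w p q → 2ℚ * m * (w * p * q) ≡ 2ℚ * (w * p) * (m * q)
    lem = solve-∀ ring
    swap : ∀ n {Y : Set} (ys : List Y) (g : Y → ℕ → ℚ) → ∑L ys (λ y → ∑ n (g y)) ≡ ∑ n (λ i → ∑L ys (λ y → g y i))
    swap zero    ys g = ∑L-0 ys (λ _ → refl)
    swap (suc n) ys g = trans (∑L-+ ys {λ y → g y 0} {λ y → ∑ n (λ i → g y (suc i))}) (cong (λ u → ∑L ys (λ y → g y 0) + u) (swap n ys (λ y i → g y (suc i))))

-- Exponent zero amounts to setting that variable to zero. Parts must be positive, since `D 0` would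
-- count the variables.
PM-0∷ : ∀ ρ μ → All (1 N.≤_) ρ → PM ρ (0 ∷ μ) ≡ PM ρ μ
PM-0∷ []          μ _ = refl
PM-0∷ (suc r ∷ ρ) μ (_ ∷ ps) = trans (QP.+-identityˡ _) (D-cong (suc r) μ (λ κ _ → PM-0∷ ρ κ ps))

-- Both sides satisfy the same Euler relation, which determines them after division by 2m; b bounds
-- m for the induction.
pairing-T : ∀ b m M ν μ → m N.≤ b → pairing (m N.+ M) ν (m ∷ μ) ≡ T m (λ κ → pairing M κ μ) ν
pairing-T b zero M ν μ _ = trans (∑par-cong M (λ ρ p → cong (wt ρ * PM ρ ν *_) (PM-0∷ ρ μ (proj₁ (proj₂ p))))) (sym (T-0 (λ κ → pairing M κ μ) ν))
pairing-T (suc b) (suc m) M ν μ (s≤s m≤b) = ι-cancel (+ 2 I.* + suc m) (2+≢0 m)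
  (trans (cong (_* pairing (suc m N.+ M) ν (suc m ∷ μ)) (ι-2* (+ suc m)))
  (trans (pairing-euler (suc m) M ν μ)
  (trans (∑-cong (suc m) (λ j → D-cong (suc j) ν (λ κ _ → pairing-T b (m ∸ j) M κ μ (NP.≤-trans (NP.m∸n≤m m j) m≤b))))
  (sym (trans (cong (_* T (suc m) (λ κ → pairing M κ μ) ν) (ι-2* (+ suc m))) (euler-T ν (suc m) (λ κ → pairing M κ μ)))))))

-- The Cauchy identity for ∏ (1 - x_i y_j)^(-1/2).
cauchy : ∀ μ ν → pairing (NL.sum μ) ν μ ≡ GE μ 0 ν
cauchy []      ν = trans (QP.+-identityʳ _) (trans (QP.*-identityʳ _) (trans (cong (_* isZero ν) wt-[]) (QP.*-identityˡ (isZero ν))))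
  where
  wt-[] : wt [] ≡ 1ℚ
  wt-[] = trans (sym (QP.*-identityˡ (wt []))) (trans (cong (_* wt []) (sym ι-1)) (wt-inv []))
cauchy (m ∷ μ) ν = trans (pairing-T m m (NL.sum μ) ν μ NP.≤-refl) (trans (T-cong m ν (cauchy μ)) (T′-0 m))
  where
  T′-0 : ∀ m → T m (GE μ 0) ν ≡ T′ m (GE μ) 0 ν
  T′-0 zero    = refl
  T′-0 (suc m) = sym (QP.+-identityʳ _)

-- Elementary symmetric functions

T-+ : ∀ m ν f g → T m (λ κ → f κ + g κ) ν ≡ T m f ν + T m g ν
T-+ zero    []      f g = refl
T-+ (suc m) []      f g = refl
T-+ m       (x ∷ ν) f g = trans (∑-cong (suc m) (λ i → trans (cong (γ (+ i) *_) (trans (shift-cong i x (λ y → T-+ (m ∸ i) ν (λ κ → f (y ∷ κ)) (λ κ → g (y ∷ κ)))) (shift-+ i x (λ y → T (m ∸ i) (λ κ → f (y ∷ κ)) ν) (λ y → T (m ∸ i) (λ κ → g (y ∷ κ)) ν))))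
    (QP.*-distribˡ-+ (γ (+ i)) (shift i (λ y → T (m ∸ i) (λ κ → f (y ∷ κ)) ν) x) (shift i (λ y → T (m ∸ i) (λ κ → g (y ∷ κ)) ν) x))))
  (∑-+ (suc m) {λ i → γ (+ i) * shift i (λ y → T (m ∸ i) (λ κ → f (y ∷ κ)) ν) x} {λ i → γ (+ i) * shift i (λ y → T (m ∸ i) (λ κ → g (y ∷ κ)) ν) x})

T-* : ∀ m ν s f → T m (λ κ → s * f κ) ν ≡ s * T m f ν
T-* zero    []      s f = refl
T-* (suc m) []      s f = sym (QP.*-zeroʳ s)
T-* m       (x ∷ ν) s f = trans (∑-cong (suc m) (λ i → trans (cong (γ (+ i) *_) (trans (shift-cong i x (λ y → T-* (m ∸ i) ν s (λ κ → f (y ∷ κ)))) (shift-* i x s (λ y → T (m ∸ i) (λ κ → f (y ∷ κ)) ν))))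
    (*-left-comm (γ (+ i)) s (shift i (λ y → T (m ∸ i) (λ κ → f (y ∷ κ)) ν) x))))
  (∑-*ˡ (suc m) s {λ i → γ (+ i) * shift i (λ y → T (m ∸ i) (λ κ → f (y ∷ κ)) ν) x})

T-0′ : ∀ m ν {f} → (∀ κ → f κ ≡ 0ℚ) → T m f ν ≡ 0ℚ
T-0′ m ν {f} e = trans (T-cong m ν (λ κ → trans (e κ) (sym (QP.*-zeroˡ 0ℚ)))) (trans (T-* m ν 0ℚ (λ _ → 0ℚ)) (QP.*-zeroˡ (T m (λ _ → 0ℚ) ν)))

T-∑ : ∀ m ν K (f : ℕ → List ℕ → ℚ) → T m (λ κ → ∑ K (λ i → f i κ)) ν ≡ ∑ K (λ i → T m (f i) ν)
T-∑ m ν zero    f = T-0′ m ν (λ _ → refl)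
T-∑ m ν (suc K) f = trans (T-+ m ν (f 0) (λ κ → ∑ K (λ i → f (suc i) κ))) (cong (λ x → T m (f 0) ν + x) (T-∑ m ν K (f ∘ suc)))

antidiagonal : ℕ → (ℕ → ℕ → ℚ) → ℚ
antidiagonal s g = ∑ (suc s) (λ i → g i (s ∸ i))

antidiagonal-shiftˡ : ∀ x s (g : ℕ → ℕ → ℚ) → antidiagonal s (λ i j → shift x (λ y → g y j) i) ≡ shift x (λ s → antidiagonal s g) s
antidiagonal-shiftˡ zero    s       g = refl
antidiagonal-shiftˡ (suc x) zero    g = QP.+-identityʳ 0ℚ
antidiagonal-shiftˡ (suc x) (suc s) g = trans (QP.+-identityˡ _) (antidiagonal-shiftˡ x s g)

antidiagonal-shiftʳ : ∀ z s (g : ℕ → ℕ → ℚ) → antidiagonal s (λ i j → shift z (g i) j) ≡ shift z (λ s → antidiagonal s g) s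
antidiagonal-shiftʳ zero    s       g = refl
antidiagonal-shiftʳ (suc z) zero    g = QP.+-identityʳ 0ℚ
antidiagonal-shiftʳ (suc z) (suc s) g = begin
  ∑ (suc (suc s)) (λ i → shift (suc z) (g i) (suc s ∸ i))
    ≡⟨ ∑-last (suc s) {λ i → shift (suc z) (g i) (suc s ∸ i)} ⟩
  ∑ (suc s) (λ i → shift (suc z) (g i) (suc s ∸ i)) + shift (suc z) (g (suc s)) (suc s ∸ suc s)
    ≡⟨ cong₂ _+_ (∑-cong< (suc s) (λ i i<s → cong (shift (suc z) (g i)) (NP.+-∸-assoc 1 (NP.≤-pred i<s)))) (cong (shift (suc z) (g (suc s))) (NP.n∸n≡0 (suc s))) ⟩
  antidiagonal s (λ i j → shift z (g i) j) + 0ℚ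
    ≡⟨ trans (QP.+-identityʳ _) (antidiagonal-shiftʳ z s g) ⟩
  shift z (λ s → antidiagonal s g) s ∎

γγ-sum-step : ∀ s → 2ℚ * ι (+ suc s) * antidiagonal (suc s) (λ i j → γ (+ i) * γ (+ j)) ≡ 2ℚ * ι (+ suc s) * antidiagonal s (λ i j → γ (+ i) * γ (+ j))
γγ-sum-step s = begin
  2ℚ * ι (+ suc s) * antidiagonal (suc s) (λ i j → γ (+ i) * γ (+ j))
    ≡⟨ sym (∑-*ˡ (suc (suc s)) (2ℚ * ι (+ suc s)) {λ i → γ (+ i) * γ (+ (suc s ∸ i))}) ⟩
  ∑ (suc (suc s)) (λ i → 2ℚ * ι (+ suc s) * (γ (+ i) * γ (+ (suc s ∸ i))))
    ≡⟨ ∑-cong< (suc (suc s)) (λ i i<s → trans (cong (λ k → 2ℚ * k * (γ (+ i) * γ (+ (suc s ∸ i)))) (trans (cong (λ k → ι (+ k)) (sym (NP.m+[n∸m]≡n (NP.≤-pred i<s)))) (ι-+ (+ i) (+ (suc s ∸ i))))) (l₁ (ι (+ i)) (ι (+ (suc s ∸ i))) (γ (+ i)) (γ (+ (suc s ∸ i))))) ⟩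
  ∑ (suc (suc s)) (λ i → u i * γ (+ (suc s ∸ i)) + γ (+ i) * u (suc s ∸ i))
    ≡⟨ ∑-+ (suc (suc s)) {λ i → u i * γ (+ (suc s ∸ i))} {λ i → γ (+ i) * u (suc s ∸ i)} ⟩
  ∑ (suc (suc s)) (λ i → u i * γ (+ (suc s ∸ i))) + ∑ (suc (suc s)) (λ i → γ (+ i) * u (suc s ∸ i))
    ≡⟨ cong₂ _+_ first second ⟩
  ∑ (suc s) (λ i → (u i + γ (+ i)) * γ (+ (s ∸ i))) + ∑ (suc s) (λ i → γ (+ i) * (u (s ∸ i) + γ (+ (s ∸ i))))
    ≡⟨ sym (∑-+ (suc s) {λ i → (u i + γ (+ i)) * γ (+ (s ∸ i))} {λ i → γ (+ i) * (u (s ∸ i) + γ (+ (s ∸ i)))}) ⟩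
  ∑ (suc s) (λ i → (u i + γ (+ i)) * γ (+ (s ∸ i)) + γ (+ i) * (u (s ∸ i) + γ (+ (s ∸ i))))
    ≡⟨ ∑-cong< (suc s) (λ i i<s → trans (l₂ (ι (+ i)) (ι (+ (s ∸ i))) (γ (+ i)) (γ (+ (s ∸ i)))) (cong (λ k → 2ℚ * k * (γ (+ i) * γ (+ (s ∸ i)))) (trans (cong (_+ 1ℚ) (trans (sym (ι-+ (+ i) (+ (s ∸ i)))) (cong (λ k → ι (+ k)) (NP.m+[n∸m]≡n (NP.≤-pred i<s))))) (sym (ι-suc s))))) ⟩
  ∑ (suc s) (λ i → 2ℚ * ι (+ suc s) * (γ (+ i) * γ (+ (s ∸ i))))
    ≡⟨ ∑-*ˡ (suc s) (2ℚ * ι (+ suc s)) {λ i → γ (+ i) * γ (+ (s ∸ i))} ⟩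
  2ℚ * ι (+ suc s) * antidiagonal s (λ i j → γ (+ i) * γ (+ j)) ∎
  where
  u : ℕ → ℚ
  u i = 2ℚ * ι (+ i) * γ (+ i)
  u-0 : u 0 ≡ 0ℚ
  u-0 = zero-*ˡ (zero-*ʳ {x = 2ℚ} ι-0)
  l₁ : ∀ a b g k → 2ℚ * (a + b) * (g * k) ≡ 2ℚ * a * g * k + g * (2ℚ * b * k)
  l₁ = solve-∀ ring
  l₂ : ∀ a b g k → (2ℚ * a * g + g) * k + g * (2ℚ * b * k + k) ≡ 2ℚ * (a + b + 1ℚ) * (g * k)
  l₂ = solve-∀ ring
  first : ∑ (suc (suc s)) (λ i → u i * γ (+ (suc s ∸ i))) ≡ ∑ (suc s) (λ i → (u i + γ (+ i)) * γ (+ (s ∸ i)))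
  first = trans (cong (_+ ∑ (suc s) (λ i → u (suc i) * γ (+ (s ∸ i)))) (zero-*ˡ {y = γ (+ suc s)} u-0)) (trans (QP.+-identityˡ _) (∑-cong (suc s) (λ i → cong (_* γ (+ (s ∸ i))) (γ-step i))))
  second : ∑ (suc (suc s)) (λ i → γ (+ i) * u (suc s ∸ i)) ≡ ∑ (suc s) (λ i → γ (+ i) * (u (s ∸ i) + γ (+ (s ∸ i))))
  second = trans (∑-last (suc s) {λ i → γ (+ i) * u (suc s ∸ i)}) (trans (cong₂ _+_ (∑-cong< (suc s) (λ i i<s → cong (γ (+ i) *_) (trans (cong u (NP.+-∸-assoc 1 (NP.≤-pred i<s))) (γ-step (s ∸ i))))) (zero-*ʳ {x = γ (+ suc s)} (trans (cong u (NP.n∸n≡0 (suc s))) u-0))) (QP.+-identityʳ _))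

-- The square of (1 - x)^(-1/2) is the geometric series; the Euler operator shows that successive
-- coefficients agree.
γγ-sum : ∀ s → antidiagonal s (λ i j → γ (+ i) * γ (+ j)) ≡ 1ℚ
γγ-sum zero    = trans (QP.+-identityʳ _) (cong₂ _*_ γ-0 γ-0)
γγ-sum (suc s) = trans (ι-cancel (+ 2 I.* + suc s) (2+≢0 s) (trans (cong (_* antidiagonal (suc s) (λ i j → γ (+ i) * γ (+ j))) (ι-2* (+ suc s))) (trans (γγ-sum-step s) (sym (cong (_* antidiagonal s (λ i j → γ (+ i) * γ (+ j))) (ι-2* (+ suc s))))))) (γγ-sum s)

∑-antidiagonals : ∀ m (Y : ℕ → ℕ → ℚ) → ∑ m (λ l → ∑ (m ∸ l) (Y l)) ≡ ∑ m (λ r → antidiagonal r Y)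
∑-antidiagonals m Y = trans (∑-cong m (λ l → ∑-cong (m ∸ l) (λ j → cong (Y l) (sym (NP.m+n∸m≡n l j))))) (trans (sym (∑-triangle-reindex m (λ l i → Y l (i ∸ suc l)))) (QP.+-identityˡ _))

-- Gives two extra variables y a common value t and extracts t^s. On `GE` this is multiplication by
-- the complete symmetric function h_s = Σ_(i+j=s) g_i g_j.
pairSum : ℕ → (List ℕ → ℚ) → List ℕ → ℚ
pairSum s f ν = antidiagonal s (λ i j → f (i ∷ j ∷ ν))

antidiagonal-∑ : ∀ s K (g : ℕ → ℕ → ℕ → ℚ) → antidiagonal s (λ i j → ∑ K (λ x → g x i j)) ≡ ∑ K (λ x → antidiagonal s (g x))
antidiagonal-∑ s K g = ∑-swap (suc s) K {λ i x → g x i (s ∸ i)}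

antidiagonal-* : ∀ s c (g : ℕ → ℕ → ℚ) → antidiagonal s (λ i j → c * g i j) ≡ c * antidiagonal s g
antidiagonal-* s c g = ∑-*ˡ (suc s) c {λ i → g i (s ∸ i)}

-- Multiplying two factors (1 - x y)^(-1/2) with the same y gives the geometric series.
pairSum-T : ∀ s m f ν → pairSum s (T m f) ν ≡ ∑ (suc m) (λ r → shift r (λ s' → T (m ∸ r) (pairSum s' f) ν) s)
pairSum-T s m f ν = begin
  antidiagonal s (λ i j → ∑ (suc m) (λ x → γ (+ x) * shift x (λ y → A x y j) i))
    ≡⟨ antidiagonal-∑ s (suc m) (λ x i j → γ (+ x) * shift x (λ y → A x y j) i) ⟩
  ∑ (suc m) (λ x → antidiagonal s (λ i j → γ (+ x) * shift x (λ y → A x y j) i))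
    ≡⟨ ∑-cong (suc m) (λ x → trans (antidiagonal-* s (γ (+ x)) (λ i j → shift x (λ y → A x y j) i)) (cong (γ (+ x) *_) (trans (antidiagonal-shiftˡ x s (A x)) (shift-cong x s (inner x))))) ⟩
  ∑ (suc m) (λ x → γ (+ x) * shift x (λ s' → ∑ (suc (m ∸ x)) (λ z → γ (+ z) * shift z (λ s″ → T (m ∸ x ∸ z) (pairSum s″ f) ν) s')) s)
    ≡⟨ ∑-cong< (suc m) (λ x x<m → trans (cong (γ (+ x) *_) (trans (shift-∑ x s (suc (m ∸ x)) (λ z s' → γ (+ z) * shift z (λ s″ → T (m ∸ x ∸ z) (pairSum s″ f) ν) s')) (∑-cong (suc (m ∸ x)) (λ z → trans (shift-* x s (γ (+ z)) (shift z (λ s″ → T (m ∸ x ∸ z) (pairSum s″ f) ν))) (cong (γ (+ z) *_) (H≡ x z))))))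
         (trans (sym (∑-*ˡ (suc (m ∸ x)) (γ (+ x)) {λ z → γ (+ z) * H (x N.+ z)})) (cong (λ k → ∑ k (λ z → γ (+ x) * (γ (+ z) * H (x N.+ z)))) (sym (NP.+-∸-assoc 1 (NP.≤-pred x<m)))))) ⟩
  ∑ (suc m) (λ x → ∑ (suc m ∸ x) (λ z → γ (+ x) * (γ (+ z) * H (x N.+ z))))
    ≡⟨ ∑-antidiagonals (suc m) (λ x z → γ (+ x) * (γ (+ z) * H (x N.+ z))) ⟩
  ∑ (suc m) (λ r → antidiagonal r (λ x z → γ (+ x) * (γ (+ z) * H (x N.+ z))))
    ≡⟨ ∑-cong (suc m) collapse ⟩
  ∑ (suc m) H ∎
  where
  A : ℕ → ℕ → ℕ → ℚ
  A x y j = ∑ (suc (m ∸ x)) (λ z → γ (+ z) * shift z (λ w → T (m ∸ x ∸ z) (λ κ → f (y ∷ w ∷ κ)) ν) j)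
  H : ℕ → ℚ
  H r = shift r (λ s' → T (m ∸ r) (pairSum s' f) ν) s
  H≡ : ∀ x z → shift x (shift z (λ s″ → T (m ∸ x ∸ z) (pairSum s″ f) ν)) s ≡ H (x N.+ z)
  H≡ x z = trans (shift-shift x z s (λ s″ → T (m ∸ x ∸ z) (pairSum s″ f) ν)) (cong (λ k → shift (x N.+ z) (λ s″ → T k (pairSum s″ f) ν) s) (NP.∸-+-assoc m x z))
  inner : ∀ x s' → antidiagonal s' (A x) ≡ ∑ (suc (m ∸ x)) (λ z → γ (+ z) * shift z (λ s″ → T (m ∸ x ∸ z) (pairSum s″ f) ν) s')
  inner x s' = trans (antidiagonal-∑ s' (suc (m ∸ x)) (λ z y j → γ (+ z) * shift z (λ w → T (m ∸ x ∸ z) (λ κ → f (y ∷ w ∷ κ)) ν) j))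
    (∑-cong (suc (m ∸ x)) (λ z → trans (antidiagonal-* s' (γ (+ z)) (λ y j → shift z (λ w → T (m ∸ x ∸ z) (λ κ → f (y ∷ w ∷ κ)) ν) j)) (cong (γ (+ z) *_) (trans (antidiagonal-shiftʳ z s' (λ y w → T (m ∸ x ∸ z) (λ κ → f (y ∷ w ∷ κ)) ν)) (shift-cong z s' (λ s″ → sym (T-∑ (m ∸ x ∸ z) ν (suc s″) (λ i κ → f (i ∷ s″ ∸ i ∷ κ)))))))))
  collapse : ∀ r → antidiagonal r (λ x z → γ (+ x) * (γ (+ z) * H (x N.+ z))) ≡ H r
  collapse r = trans (∑-cong< (suc r) (λ x x<r → trans (cong (λ k → γ (+ x) * (γ (+ (r ∸ x)) * H k)) (NP.m+[n∸m]≡n (NP.≤-pred x<r))) (sym (QP.*-assoc (γ (+ x)) (γ (+ (r ∸ x))) (H r))))) (trans (∑-*ʳ (suc r) (H r) {λ x → γ (+ x) * γ (+ (r ∸ x))}) (trans (cong (_* H r) (γγ-sum r)) (QP.*-identityˡ (H r))))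

sgn : ℕ → ℚ
sgn zero    = 1ℚ
sgn (suc s) = - sgn s

-- Two extra variables y are set to t = -w and w^C is collected; on `GE` this forms Σ_s (-1)^s h_s
-- e_(C-s).
Θ : (ℕ → List ℕ → ℚ) → ℕ → List ℕ → ℚ
Θ F C ν = ∑ (suc C) (λ s → sgn s * pairSum s (F (C ∸ s)) ν)

-- At t = -w the two square roots give 1/(1 + x w), which cancels the factor 1 + x w of `T′`. In
-- coefficients this is the telescoping of `X` against `Y`.
Θ-T′ : ∀ m F C ν → Θ (T′ m F) C ν ≡ T m (Θ F C) ν
Θ-T′ m F C ν = trans (go m) (sym (trans (T-∑ m ν (suc C) (λ s κ → sgn s * pairSum s (F (C ∸ s)) κ)) (∑-cong (suc C) (λ s → T-* m ν (sgn s) (pairSum s (F (C ∸ s)))))))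
  where
  Q : ℕ → ℕ → ℕ → ℚ
  Q k r s = T r (pairSum s (F k)) ν
  go : ∀ m → Θ (T′ m F) C ν ≡ ∑ (suc C) (λ s → sgn s * T m (pairSum s (F (C ∸ s))) ν)
  go zero = ∑-cong (suc C) (λ s → cong (sgn s *_) (trans (pairSum-T s 0 (F (C ∸ s)) ν) (QP.+-identityʳ (T 0 (pairSum s (F (C ∸ s))) ν))))
  go (suc m) = begin
    ∑ (suc C) (λ s → sgn s * pairSum s (λ κ → T (suc m) (F (C ∸ s)) κ + pred-shift (λ k → T m (F k) κ) (C ∸ s)) ν)
      ≡⟨ ∑-cong (suc C) (λ s → trans (cong (sgn s *_) (trans (∑-+ (suc s) {λ i → T (suc m) (F (C ∸ s)) (i ∷ s ∸ i ∷ ν)} {λ i → pred-shift (λ k → T m (F k) (i ∷ s ∸ i ∷ ν)) (C ∸ s)}) (cong₂ _+_ (pairSum-T s (suc m) (F (C ∸ s)) ν) (lower s (C ∸ s)))))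
           (l (sgn s) (Q (C ∸ s) (suc m) s) (∑ (suc m) (λ r → shift (suc r) (Q (C ∸ s) (m ∸ r)) s)) (pred-shift (λ k → ∑ (suc m) (λ r → shift r (Q k (m ∸ r)) s)) (C ∸ s)))) ⟩
    ∑ (suc C) (λ s → sgn s * Q (C ∸ s) (suc m) s + (X s + Y s))
      ≡⟨ trans (∑-+ (suc C) {λ s → sgn s * Q (C ∸ s) (suc m) s} {λ s → X s + Y s}) (cong (λ u → ∑ (suc C) (λ s → sgn s * Q (C ∸ s) (suc m) s) + u) (trans (∑-+ (suc C) {X} {Y}) cancel)) ⟩
    ∑ (suc C) (λ s → sgn s * Q (C ∸ s) (suc m) s) + 0ℚ
      ≡⟨ QP.+-identityʳ _ ⟩
    ∑ (suc C) (λ s → sgn s * Q (C ∸ s) (suc m) s) ∎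
    where
    X Y : ℕ → ℚ
    X s = sgn s * ∑ (suc m) (λ r → shift (suc r) (Q (C ∸ s) (m ∸ r)) s)
    Y s = sgn s * pred-shift (λ k → ∑ (suc m) (λ r → shift r (Q k (m ∸ r)) s)) (C ∸ s)
    l : ∀ s a b c → s * (a + b + c) ≡ s * a + (s * b + s * c)
    l = solve-∀ ring
    lower : ∀ s k → ∑ (suc s) (λ i → pred-shift (λ k → T m (F k) (i ∷ s ∸ i ∷ ν)) k) ≡ pred-shift (λ k → ∑ (suc m) (λ r → shift r (Q k (m ∸ r)) s)) k
    lower s zero    = ∑-0 (suc s) (λ _ _ → refl)
    lower s (suc k) = pairSum-T s m (F k) ν
    X-0 : X 0 ≡ 0ℚ
    X-0 = zero-*ʳ {x = 1ℚ} (∑-0 (suc m) (λ r _ → refl))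
    Y-C : Y C ≡ 0ℚ
    Y-C = zero-*ʳ {x = sgn C} (cong (pred-shift (λ k → ∑ (suc m) (λ r → shift r (Q k (m ∸ r)) C))) (NP.n∸n≡0 C))
    XY : ∀ s → s N.< C → X (suc s) + Y s ≡ 0ℚ
    XY s s<C = trans (cong (λ k → X (suc s) + sgn s * pred-shift (λ k → ∑ (suc m) (λ r → shift r (Q k (m ∸ r)) s)) k) (NP.+-∸-assoc 1 s<C)) (neg (sgn s) (∑ (suc m) (λ r → shift r (Q (C ∸ suc s) (m ∸ r)) s)))
      where
      neg : ∀ a b → (- a) * b + a * b ≡ 0ℚ
      neg = solve-∀ ring
    cancel : ∑ (suc C) X + ∑ (suc C) Y ≡ 0ℚ
    cancel = trans (cong₂ _+_ (trans (cong (_+ ∑ C (X ∘ suc)) X-0) (QP.+-identityˡ (∑ C (X ∘ suc)))) (trans (∑-last C {Y}) (trans (cong (λ y → ∑ C Y + y) Y-C) (QP.+-identityʳ (∑ C Y)))))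
      (trans (sym (∑-+ C {X ∘ suc} {Y})) (∑-0 C XY))

-- The classical relation between complete and elementary functions. Without any x all terms vanish
-- for degree reasons, and `Θ-T′` adjoins the variables one by one.
Θ-GE : ∀ μ C ν → Θ (GE μ) (suc C) ν ≡ 0ℚ
Θ-GE []      C ν = ∑-0 (suc (suc C)) (λ s s<C → zero-*ʳ {x = sgn s} (∑-0 (suc s) (λ i i<s → empty s i (suc C ∸ s) refl (NP.≤-pred i<s) (NP.≤-pred s<C))))
  where
  positive : ∀ i j → i N.+ j ≢ 0 → isZero (i ∷ j ∷ ν) ≡ 0ℚ
  positive zero    zero    n = ⊥-elim (n refl)
  positive zero    (suc j) n = refl
  positive (suc i) j       n = refl
  empty : ∀ s i k → suc C ∸ s ≡ k → i N.≤ s → s N.≤ suc C → GE [] k (i ∷ s ∸ i ∷ ν) ≡ 0ℚ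
  empty s i (suc k) _ _ _ = refl
  empty s i zero e i≤s s≤C = positive i (s ∸ i) (λ z → nonzero s e (trans (sym (NP.m+[n∸m]≡n i≤s)) z))
    where
    nonzero : ∀ s → suc C ∸ s ≡ 0 → s ≢ 0
    nonzero zero    ()
    nonzero (suc s) _ ()
Θ-GE (m ∷ μ) C ν = trans (Θ-T′ m (GE μ) (suc C) ν) (T-0′ m ν (λ κ → Θ-GE μ C κ))

T-0∷ : ∀ m f ν → T m f (0 ∷ ν) ≡ T m (λ κ → f (0 ∷ κ)) ν
T-0∷ m f ν = trans (cong₂ _+_ (trans (cong (_* T m (λ κ → f (0 ∷ κ)) ν) γ-0) (QP.*-identityˡ (T m (λ κ → f (0 ∷ κ)) ν))) (∑-0 m (λ i _ → QP.*-zeroʳ (γ (+ suc i))))) (QP.+-identityʳ _)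

GE-0∷ : ∀ μ C ν → GE μ C (0 ∷ ν) ≡ GE μ C ν
GE-0∷ []      zero    ν = refl
GE-0∷ []      (suc C) ν = refl
GE-0∷ (m ∷ μ) C       ν = go m C
  where
  Tm : ∀ m C → T m (GE μ C) (0 ∷ ν) ≡ T m (GE μ C) ν
  Tm m C = trans (T-0∷ m (GE μ C) ν) (T-cong m ν (λ κ → GE-0∷ μ C κ))
  go : ∀ m C → T′ m (GE μ) C (0 ∷ ν) ≡ T′ m (GE μ) C ν
  go zero    C       = Tm 0 C
  go (suc m) zero    = cong (_+ 0ℚ) (Tm (suc m) 0)
  go (suc m) (suc C) = cong₂ _+_ (Tm (suc m) (suc C)) (Tm m C)

GE-recursion : ∀ μ C ν → GE μ (suc C) ν ≡ ∑ (suc C) (λ s → sgn s * pairSum (suc s) (GE μ (C ∸ s)) ν)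
GE-recursion μ C ν = begin
  GE μ (suc C) ν
    ≡⟨ sym (trans (GE-0∷ μ (suc C) (0 ∷ ν)) (GE-0∷ μ (suc C) ν)) ⟩
  GE μ (suc C) (0 ∷ 0 ∷ ν)
    ≡⟨ l (GE μ (suc C) (0 ∷ 0 ∷ ν)) S ⟩
  Θ (GE μ) (suc C) ν + (- 1ℚ) * S
    ≡⟨ cong (_+ (- 1ℚ) * S) (Θ-GE μ C ν) ⟩
  0ℚ + (- 1ℚ) * S
    ≡⟨ trans (QP.+-identityˡ _) (sym (∑-*ˡ (suc C) (- 1ℚ) {λ s → - sgn s * pairSum (suc s) (GE μ (C ∸ s)) ν})) ⟩
  ∑ (suc C) (λ s → (- 1ℚ) * (- sgn s * pairSum (suc s) (GE μ (C ∸ s)) ν))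
    ≡⟨ ∑-cong (suc C) (λ s → l′ (sgn s) (pairSum (suc s) (GE μ (C ∸ s)) ν)) ⟩
  ∑ (suc C) (λ s → sgn s * pairSum (suc s) (GE μ (C ∸ s)) ν) ∎
  where
  S : ℚ
  S = ∑ (suc C) (λ s → - sgn s * pairSum (suc s) (GE μ (C ∸ s)) ν)
  l : ∀ x s → x ≡ 1ℚ * (x + 0ℚ) + s + (- 1ℚ) * s
  l = solve-∀ ring
  l′ : ∀ a b → (- 1ℚ) * (- a * b) ≡ a * b
  l′ = solve-∀ ring

-- Orthogonality

Symmetric : (List ℕ → ℚ) → Set
Symmetric f = ∀ {ν ν'} → ν ↭ ν' → f ν ≡ f ν'

D-symmetric : ∀ r f → Symmetric f → Symmetric (D r f)
D-symmetric r f sym-f Perm.refl = refl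
D-symmetric r f sym-f (Perm.prep {xs = xs} {ys} x p) = cong₂ _+_ (shift-cong r x (λ y → sym-f (Perm.prep y p))) (D-symmetric r (λ κ → f (x ∷ κ)) (λ q → sym-f (Perm.prep x q)) p)
D-symmetric r f sym-f (Perm.swap {xs = xs} {ys} x y p) = begin
  shift r (λ z → f (z ∷ y ∷ xs)) x + (shift r (λ z → f (x ∷ z ∷ xs)) y + D r (λ κ → f (x ∷ y ∷ κ)) xs)
    ≡⟨ cong₂ _+_ (shift-cong r x (λ z → sym-f (Perm.swap z y p))) (cong₂ _+_ (shift-cong r y (λ z → sym-f (Perm.swap x z p)))
         (trans (D-symmetric r (λ κ → f (x ∷ y ∷ κ)) (λ q → sym-f (Perm.prep x (Perm.prep y q))) p) (D-cong r ys (λ κ _ → sym-f (Perm.swap x y Perm.refl))))) ⟩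
  shift r (λ z → f (y ∷ z ∷ ys)) x + (shift r (λ z → f (z ∷ x ∷ ys)) y + D r (λ κ → f (y ∷ x ∷ κ)) ys)
    ≡⟨ l (shift r (λ z → f (y ∷ z ∷ ys)) x) (shift r (λ z → f (z ∷ x ∷ ys)) y) (D r (λ κ → f (y ∷ x ∷ κ)) ys) ⟩
  shift r (λ z → f (z ∷ x ∷ ys)) y + (shift r (λ z → f (y ∷ z ∷ ys)) x + D r (λ κ → f (y ∷ x ∷ κ)) ys) ∎
  where
  l : ∀ a b c → a + (b + c) ≡ b + (a + c)
  l = solve-∀ ring
D-symmetric r f sym-f (Perm.trans p q) = trans (D-symmetric r f sym-f p) (D-symmetric r f sym-f q)

isZero-symmetric : Symmetric isZero
isZero-symmetric Perm.refl = refl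
isZero-symmetric (Perm.prep zero p) = isZero-symmetric p
isZero-symmetric (Perm.prep (suc x) p) = refl
isZero-symmetric (Perm.swap zero zero p) = isZero-symmetric p
isZero-symmetric (Perm.swap zero (suc y) p) = refl
isZero-symmetric (Perm.swap (suc x) zero p) = refl
isZero-symmetric (Perm.swap (suc x) (suc y) p) = refl
isZero-symmetric (Perm.trans p q) = trans (isZero-symmetric p) (isZero-symmetric q)

PM-symmetric : ∀ ρ → Symmetric (PM ρ)
PM-symmetric []      = isZero-symmetric
PM-symmetric (r ∷ ρ) = D-symmetric r (PM ρ) (PM-symmetric ρ)

-- Sorting exponent vectors into partitions

sort⁺ : List ℕ → List ℕ
sort⁺ []          = []
sort⁺ (zero ∷ ν)  = sort⁺ ν
sort⁺ (suc x ∷ ν) = ins (suc x) (sort⁺ ν)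

ins-↭ : ∀ s σ → ins s σ ↭ s ∷ σ
ins-↭ s []      = Perm.refl
ins-↭ s (r ∷ σ) with r N.≤ᵇ s
... | true  = Perm.refl
... | false = Perm.trans (Perm.prep r (ins-↭ s σ)) (Perm.swap r s Perm.refl)

zeros : List ℕ → ℕ
zeros []          = 0
zeros (zero ∷ ν)  = suc (zeros ν)
zeros (suc _ ∷ ν) = zeros ν

sort⁺-↭ : ∀ ν → ν ↭ replicate (zeros ν) 0 ++ sort⁺ ν
sort⁺-↭ []          = Perm.refl
sort⁺-↭ (zero ∷ ν)  = Perm.prep 0 (sort⁺-↭ ν)
sort⁺-↭ (suc x ∷ ν) = Perm.trans (Perm.prep (suc x) (sort⁺-↭ ν)) (Perm.trans (Perm.↭-sym (PermP.shift (suc x) (replicate (zeros ν) 0) (sort⁺ ν))) (PermP.++⁺ˡ (replicate (zeros ν) 0) (Perm.↭-sym (ins-↭ (suc x) (sort⁺ ν)))))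

PM-zeros : ∀ k ρ ν → All (1 N.≤_) ρ → PM ρ (replicate k 0 ++ ν) ≡ PM ρ ν
PM-zeros zero    ρ ν p = refl
PM-zeros (suc k) ρ ν p = trans (PM-0∷ ρ (replicate k 0 ++ ν) p) (PM-zeros k ρ ν p)

PM-sort : ∀ ρ ν → All (1 N.≤_) ρ → PM ρ ν ≡ PM ρ (sort⁺ ν)
PM-sort ρ ν p = trans (PM-symmetric ρ (sort⁺-↭ ν)) (PM-zeros (zeros ν) ρ (sort⁺ ν) p)

sum-sort : ∀ ν → NL.sum (sort⁺ ν) ≡ NL.sum ν
sum-sort []          = refl
sum-sort (zero ∷ ν)  = sum-sort ν
sum-sort (suc x ∷ ν) = trans (sum-ins (suc x) (sort⁺ ν)) (cong (suc x N.+_) (sum-sort ν))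

Par-sort : ∀ ν → Par (NL.sum ν) (sort⁺ ν)
Par-sort ν = dec ν , pos ν , sum-sort ν
  where
  dec : ∀ ν → Decreasing (sort⁺ ν)
  dec []          = tt
  dec (zero ∷ ν)  = dec ν
  dec (suc x ∷ ν) = Decreasing-ins (suc x) (sort⁺ ν) (dec ν)
  pos : ∀ ν → All (1 N.≤_) (sort⁺ ν)
  pos []          = []
  pos (zero ∷ ν)  = pos ν
  pos (suc x ∷ ν) = All-ins (suc x) (sort⁺ ν) (s≤s z≤n) (pos ν)

mCoeff-PM : ∀ N q μ → mCoeff N q μ ≡ ∑L (partitions N) (λ ρ → q ρ * PM ρ μ)
mCoeff-PM N q μ = trans (sumQ-∑L (partitions N) (λ ρ → q ρ * ℕtoℚ (pmCoeff ρ μ))) (∑L-cong (partitions N) (λ ρ → cong (q ρ *_) (pmCoeff-PM ρ μ)))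

inner2-∑L : ∀ N q d → inner2 N q d ≡ ∑L (partitions N) (λ ρ → q ρ * d ρ * ι (+ norm ρ))
inner2-∑L N q d = trans (sumQ-∑L (partitions N) (λ ρ → q ρ * d ρ * ℕtoℚ (norm ρ))) (∑L-cong (partitions N) (λ ρ → cong (q ρ * d ρ *_) (ι-ℕtoℚ (norm ρ))))

-- `Below` gives information about partitions only, whereas expanding e_C produces unsorted exponent
-- vectors with zeros.
mCoeff-sort : ∀ N d ν → mCoeff N d ν ≡ mCoeff N d (sort⁺ ν)
mCoeff-sort N d ν = trans (mCoeff-PM N d ν) (trans (∑par-cong N (λ ρ p → cong (d ρ *_) (PM-sort ρ ν (proj₁ (proj₂ p))))) (sym (mCoeff-PM N d (sort⁺ ν))))

-- Membership in the span of the m_ν with ν strictly below lam.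
Below : ℕ → List ℕ → (List ℕ → ℚ) → Set
Below N lam d = ∀ ν → isPar N ν ≡ true → sdom ν lam ≡ false → mCoeff N d ν ≡ 0ℚ

-- f is the monomial expansion of a symmetric function of degree N orthogonal to the m_ν with ν ◁ lam.
Rep : ℕ → List ℕ → (List ℕ → ℚ) → Set
Rep N lam f = Σ (List ℕ → ℚ) λ q → (∀ μ → NL.sum μ ≡ N → mCoeff N q μ ≡ f μ) × (∀ d → Below N lam d → inner2 N q d ≡ 0ℚ)

module _ {N : ℕ} {lam : List ℕ} where

  Rep-cong : ∀ {f g} → (∀ μ → NL.sum μ ≡ N → f μ ≡ g μ) → Rep N lam f → Rep N lam g
  Rep-cong e (q , c , o) = q , (λ μ s → trans (c μ s) (e μ s)) , o

  Rep-0 : Rep N lam (λ _ → 0ℚ)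
  Rep-0 = (λ _ → 0ℚ) , (λ μ _ → trans (mCoeff-PM N (λ _ → 0ℚ) μ) (∑L-0 (partitions N) (λ ρ → QP.*-zeroˡ (PM ρ μ)))) ,
    (λ d _ → trans (inner2-∑L N (λ _ → 0ℚ) d) (∑L-0 (partitions N) (λ ρ → zero-*ˡ (QP.*-zeroˡ (d ρ)))))

  Rep-+ : ∀ {f g} → Rep N lam f → Rep N lam g → Rep N lam (λ μ → f μ + g μ)
  Rep-+ (q , c , o) (q' , c' , o') = (λ ρ → q ρ + q' ρ) ,
    (λ μ s → trans (mCoeff-PM N (λ ρ → q ρ + q' ρ) μ) (trans (∑L-cong (partitions N) (λ ρ → QP.*-distribʳ-+ (PM ρ μ) (q ρ) (q' ρ))) (trans (∑L-+ (partitions N) {λ ρ → q ρ * PM ρ μ} {λ ρ → q' ρ * PM ρ μ}) (cong₂ _+_ (trans (sym (mCoeff-PM N q μ)) (c μ s)) (trans (sym (mCoeff-PM N q' μ)) (c' μ s)))))) ,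
    (λ d b → trans (inner2-∑L N (λ ρ → q ρ + q' ρ) d) (trans (∑L-cong (partitions N) (λ ρ → l (q ρ) (q' ρ) (d ρ) (ι (+ norm ρ)))) (trans (∑L-+ (partitions N) {λ ρ → q ρ * d ρ * ι (+ norm ρ)} {λ ρ → q' ρ * d ρ * ι (+ norm ρ)}) (zero-sum (trans (sym (inner2-∑L N q d)) (o d b)) (trans (sym (inner2-∑L N q' d)) (o' d b))))))
    where
    l : ∀ a b d n → (a + b) * d * n ≡ a * d * n + b * d * n
    l = solve-∀ ring

  Rep-* : ∀ {f} s → Rep N lam f → Rep N lam (λ μ → s * f μ)
  Rep-* s (q , c , o) = (λ ρ → s * q ρ) ,
    (λ μ e → trans (mCoeff-PM N (λ ρ → s * q ρ) μ) (trans (∑L-cong (partitions N) (λ ρ → QP.*-assoc s (q ρ) (PM ρ μ))) (trans (∑L-*ˡ (partitions N) s {λ ρ → q ρ * PM ρ μ}) (cong (s *_) (trans (sym (mCoeff-PM N q μ)) (c μ e)))))) ,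
    (λ d b → trans (inner2-∑L N (λ ρ → s * q ρ) d) (trans (∑L-cong (partitions N) (λ ρ → l s (q ρ) (d ρ) (ι (+ norm ρ)))) (trans (∑L-*ˡ (partitions N) s {λ ρ → q ρ * d ρ * ι (+ norm ρ)}) (zero-*ʳ {x = s} (trans (sym (inner2-∑L N q d)) (o d b))))))
    where
    l : ∀ s a d n → s * a * d * n ≡ s * (a * d * n)
    l = solve-∀ ring

  Rep-∑ : ∀ K {f : ℕ → List ℕ → ℚ} → (∀ i → i N.< K → Rep N lam (f i)) → Rep N lam (λ μ → ∑ K (λ i → f i μ))
  Rep-∑ zero    r = Rep-0
  Rep-∑ (suc K) r = Rep-+ (r 0 (s≤s z≤n)) (Rep-∑ K (λ i i<K → r (suc i) (s≤s i<K)))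

  -- Duality of the g_ν and the m_ν: by the Cauchy identity g_ν has power-sum coordinates
  -- `wt ρ * PM ρ ν`, and the inner product with d cancels the weights and returns the coefficient
  -- of m_ν in d.
  Rep-g : ∀ ν → (∀ d → Below N lam d → mCoeff N d ν ≡ 0ℚ) → Rep N lam (λ μ → GE μ 0 ν)
  Rep-g ν good = (λ ρ → wt ρ * PM ρ ν) ,
    (λ μ e → trans (mCoeff-PM N (λ ρ → wt ρ * PM ρ ν) μ) (trans (cong (λ n → pairing n ν μ) (sym e)) (cauchy μ ν))) ,
    (λ d b → trans (inner2-∑L N (λ ρ → wt ρ * PM ρ ν) d) (trans (∑L-cong (partitions N) (λ ρ → trans (l (wt ρ) (PM ρ ν) (d ρ) (ι (+ norm ρ))) (trans (cong (_* (d ρ * PM ρ ν)) (wt-inv ρ)) (QP.*-identityˡ (d ρ * PM ρ ν))))) (trans (sym (mCoeff-PM N d ν)) (good d b))))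
    where
    l : ∀ w p d n → w * p * d * n ≡ n * w * (d * p)
    l = solve-∀ ring

  -- `GE-recursion` replaces e_C by pairs of g's put in front, so every product of g's that arises
  -- still contains `base`, and a condition on vectors ending in `base` is enough.
  Rep-GE : ∀ (base : List ℕ) → (∀ κ → NL.sum (κ ++ base) ≡ N → ∀ d → Below N lam d → mCoeff N d (κ ++ base) ≡ 0ℚ) →
    ∀ bnd C κ → C N.≤ bnd → C N.+ NL.sum (κ ++ base) ≡ N → Rep N lam (λ μ → GE μ C (κ ++ base))
  Rep-GE base good bnd zero κ _ e = Rep-g (κ ++ base) (good κ e)
  Rep-GE base good (suc bnd) (suc C) κ (s≤s C≤b) e = Rep-cong (λ μ _ → sym (GE-recursion μ C (κ ++ base)))
    (Rep-∑ (suc C) (λ s s<C → Rep-* (sgn s) (Rep-∑ (suc (suc s)) (λ i i<s →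
      Rep-GE base good bnd (C ∸ s) (i ∷ suc s ∸ i ∷ κ) (NP.≤-trans (NP.m∸n≤m C s) C≤b) (size s i (NP.≤-pred s<C) (NP.≤-pred i<s))))))
    where
    size : ∀ s i → s N.≤ C → i N.≤ suc s → C ∸ s N.+ (i N.+ (suc s ∸ i N.+ NL.sum (κ ++ base))) ≡ N
    size s i s≤C i≤s = trans (cong (C ∸ s N.+_) (trans (sym (NP.+-assoc i (suc s ∸ i) _)) (cong (N._+ NL.sum (κ ++ base)) (NP.m+[n∸m]≡n i≤s))))
      (trans (sym (NP.+-assoc (C ∸ s) (suc s) _)) (trans (cong (N._+ NL.sum (κ ++ base)) (trans (NP.+-suc (C ∸ s) s) (cong suc (NP.m∸n+n≡m s≤C)))) e))

-- Exponents that cannot lie strictly below the shape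

All-unsort : ∀ {x} ν → All (N._≤ x) (sort⁺ ν) → All (N._≤ x) ν
All-unsort {x} ν ps = PermP.All-resp-↭ (Perm.↭-sym (sort⁺-↭ ν)) (pad (zeros ν))
  where
  pad : ∀ k → All (N._≤ x) (replicate k 0 ++ sort⁺ ν)
  pad zero    = ps
  pad (suc k) = z≤n ∷ pad k

sort⁺-pair : ∀ κ A B → sort⁺ (κ ++ suc A ∷ suc B ∷ []) ↭ suc A ∷ suc B ∷ sort⁺ κ
sort⁺-pair []          A B = ins-↭ (suc A) (suc B ∷ [])
sort⁺-pair (zero ∷ κ)  A B = sort⁺-pair κ A B
sort⁺-pair (suc x ∷ κ) A B = Perm.trans (ins-↭ (suc x) _) (Perm.trans (Perm.prep (suc x) (sort⁺-pair κ A B)) (Perm.trans (Perm.swap (suc x) (suc A) Perm.refl) (Perm.prep (suc A) (Perm.trans (Perm.swap (suc x) (suc B) Perm.refl) (Perm.prep (suc B) (Perm.↭-sym (ins-↭ (suc x) (sort⁺ κ))))))))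

sort⁺-zeros : ∀ κ ν → NL.sum κ ≡ 0 → sort⁺ (κ ++ ν) ≡ sort⁺ ν
sort⁺-zeros []         ν e = refl
sort⁺-zeros (zero ∷ κ) ν e = sort⁺-zeros κ ν e

all-ones : ∀ ρ → All (N._≤ 1) ρ → All (1 N.≤_) ρ → ρ ≡ replicate (NL.sum ρ) 1
all-ones []                 _ _ = refl
all-ones (suc zero ∷ ρ)     (_ ∷ ps) (_ ∷ qs) = cong (1 ∷_) (all-ones ρ ps qs)
all-ones (suc (suc x) ∷ ρ)  (s≤s () ∷ _) _

allB-upTo : ∀ n (f : ℕ → ℕ) (p : ℕ → Bool) → allB p (applyUpTo f n) ≡ true → ∀ k → k N.< n → p (f k) ≡ true
allB-upTo (suc n) f p e zero    _         = proj₁ (∧-true {p (f 0)} e)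
allB-upTo (suc n) f p e (suc k) (s≤s k<n) = allB-upTo n (f ∘ suc) p (proj₂ (∧-true {p (f 0)} e)) k k<n

dom-take : ∀ μ lam → dom μ lam ≡ true → ∀ k → k N.≤ NL.sum μ N.+ NL.sum lam → NL.sum (take k μ) N.≤ NL.sum (take k lam)
dom-take μ lam e k k≤ = ≤ᵇ-true (allB-upTo (suc (NL.sum μ N.+ NL.sum lam)) id (λ k → NL.sum (take k μ) N.≤ᵇ NL.sum (take k lam)) e k (s≤s k≤))

+-cancel-≤ : ∀ {a b c d} → a N.+ b N.≤ c N.+ d → c N.≤ a → b N.≤ d
+-cancel-≤ {a} {b} {c} {d} p q = NP.+-cancelˡ-≤ c b d (NP.≤-trans (NP.+-monoˡ-≤ b q) p)

-- Dominance bounds the largest part by a, so A = a. Then B is at least `suc b` while the bound on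
-- two parts makes the second part at most `suc b`. The bound on three parts finally leaves only
-- ones.
extremal : ∀ a b c A B κ → suc b N.≤ a → a N.≤ A → a N.+ suc b N.≤ A N.+ B → NL.sum (κ ++ A ∷ B ∷ []) ≡ a N.+ suc b N.+ c →
  dom (sort⁺ (κ ++ A ∷ B ∷ [])) (shape a (suc b) c) ≡ true → sort⁺ (κ ++ A ∷ B ∷ []) ≡ shape a (suc b) c
extremal a b c A B κ b<a a≤A ab≤ sumν dom-true = go (sort⁺ ν) refl
  where
  ν lam : List ℕ
  ν = κ ++ A ∷ B ∷ []
  lam = shape a (suc b) c
  parν : Par (a N.+ suc b N.+ c) (sort⁺ ν)
  parν = subst (λ N → Par N (sort⁺ ν)) sumν (Par-sort ν)
  -- `dom` compares prefixes only up to the sum of the two sizes, so the prefix of length 3 has to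
  -- be shown to lie in that range.
  big : 3 N.≤ NL.sum (sort⁺ ν) N.+ NL.sum lam
  big = NP.+-mono-≤ {2} {NL.sum (sort⁺ ν)} {1} {NL.sum lam} (subst (2 N.≤_) (sym (proj₂ (proj₂ parν))) (NP.≤-trans (NP.+-mono-≤ (NP.≤-trans (s≤s z≤n) b<a) (s≤s z≤n)) (NP.m≤m+n (a N.+ suc b) c))) (NP.≤-trans (NP.≤-trans (s≤s z≤n) b<a) (NP.m≤m+n a _))
  d : ∀ k → k N.≤ 3 → NL.sum (take k (sort⁺ ν)) N.≤ NL.sum (take k lam)
  d k k≤3 = dom-take (sort⁺ ν) lam dom-true k (NP.≤-trans k≤3 big)
  last₂ : ∀ {P : ℕ → Set} κ → All P (κ ++ A ∷ B ∷ []) → P A × P B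
  last₂ []      (p ∷ q ∷ []) = p , q
  last₂ (_ ∷ κ) (_ ∷ ps) = last₂ κ ps
  finish : ∀ rest → All (N._≤ suc b) rest → All (1 N.≤_) rest → Decreasing rest → NL.sum rest ≡ c → a N.+ (suc b N.+ NL.sum (take 1 rest)) N.≤ NL.sum (take 3 lam) → rest ≡ replicate c 1
  finish [] _ _ _ refl _ = refl
  finish (zero ∷ r) _ (() ∷ _) _ _ _
  finish (suc z ∷ r) _ pos (ps , _) refl d₃ = all-ones (suc z ∷ r) (z≤1 ∷ All-map (λ q → NP.≤-trans q z≤1) ps) pos
    where
    z≤1 : suc z N.≤ 1
    z≤1 = NP.≤-trans (NP.≤-reflexive (sym (NP.+-identityʳ (suc z)))) (NP.+-cancelˡ-≤ (suc b) _ _ (NP.+-cancelˡ-≤ a _ _ d₃))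
  step₂ : ∀ y rest B → suc b N.≤ B → y ∷ rest ↭ B ∷ sort⁺ κ → Par (a N.+ suc b N.+ c) (a ∷ y ∷ rest) → a N.+ (y N.+ 0) N.≤ a N.+ (suc b N.+ 0) → a N.+ (y N.+ NL.sum (take 1 rest)) N.≤ NL.sum (take 3 lam) → a ∷ y ∷ rest ≡ lam
  step₂ y rest B b≤B p (((_ ∷ _) , ps , dec) , (_ ∷ _ ∷ pos) , s) d₂ d₃ with NP.≤-antisym (NP.+-cancelʳ-≤ 0 y (suc b) (NP.+-cancelˡ-≤ a (y N.+ 0) (suc b N.+ 0) d₂)) (NP.≤-trans b≤B (head (PermP.All-resp-↭ p (NP.≤-refl ∷ ps))))
    where
    head : ∀ {x xs} {P : ℕ → Set} → All P (x ∷ xs) → P x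
    head (p ∷ _) = p
  ... | refl = cong (λ r → a ∷ suc b ∷ r) (finish rest ps pos dec (NP.+-cancelˡ-≡ (a N.+ suc b) _ _ (trans (NP.+-assoc a (suc b) _) s)) d₃)
  step₁ : ∀ x rest → sort⁺ ν ≡ x ∷ rest → x ∷ rest ≡ lam
  step₁ x rest e = cont (NP.≤-antisym x≤a (NP.≤-trans a≤A A≤x)) A B refl refl rest refl
    where
    x≤a : x N.≤ a
    x≤a = NP.+-cancelʳ-≤ 0 x a (subst (λ l → NL.sum (take 1 l) N.≤ a N.+ 0) e (d 1 (s≤s z≤n)))
    par′ : Par (a N.+ suc b N.+ c) (x ∷ rest)
    par′ = subst (Par (a N.+ suc b N.+ c)) e parν
    A≤x : A N.≤ x
    A≤x = proj₁ (last₂ κ (All-unsort ν (subst (All (N._≤ x)) (sym e) (NP.≤-refl ∷ proj₁ (proj₁ par′)))))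
    cont : x ≡ a → ∀ A′ B′ → A ≡ A′ → B ≡ B′ → ∀ rest′ → rest ≡ rest′ → x ∷ rest ≡ lam
    cont x≡a zero B′ A≡ _ _ _ = ⊥-elim (NP.<⇒≱ (NP.≤-trans (s≤s z≤n) b<a) (subst (a N.≤_) A≡ a≤A))
    cont x≡a (suc A′) zero A≡ B≡ _ _ = ⊥-elim (NP.<⇒≱ {0} {suc b} (s≤s z≤n) (+-cancel-≤ {a} {suc b} {A} {0} (subst (λ B → a N.+ suc b N.≤ A N.+ B) B≡ ab≤) (subst (A N.≤_) x≡a A≤x)))
    cont x≡a (suc A′) (suc B′) A≡ B≡ rest′ rest≡ = cont₂ rest′ rest≡ tail-perm
      where
      A≡a : A ≡ a
      A≡a = NP.≤-antisym (subst (A N.≤_) x≡a A≤x) a≤A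
      b≤B : suc b N.≤ suc B′
      b≤B = subst (suc b N.≤_) B≡ (+-cancel-≤ {a} {suc b} {A} {B} ab≤ (NP.≤-reflexive A≡a))
      perm : x ∷ rest ↭ suc A′ ∷ suc B′ ∷ sort⁺ κ
      perm = subst (_↭ suc A′ ∷ suc B′ ∷ sort⁺ κ) (trans (sym (cong₂ (λ A B → sort⁺ (κ ++ A ∷ B ∷ [])) A≡ B≡)) e) (sort⁺-pair κ A′ B′)
      tail-perm : rest ↭ suc B′ ∷ sort⁺ κ
      tail-perm = PermP.drop-∷ (subst (λ y → y ∷ rest ↭ suc A′ ∷ suc B′ ∷ sort⁺ κ) (trans x≡a (trans (sym A≡a) A≡)) perm)
      cont₂ : ∀ rest′ → rest ≡ rest′ → rest ↭ suc B′ ∷ sort⁺ κ → x ∷ rest ≡ lam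
      cont₂ [] rest≡ q with PermP.↭-length (subst (_↭ suc B′ ∷ sort⁺ κ) rest≡ q)
      ... | ()
      cont₂ (y ∷ r) rest≡ q = trans eq (step₂ y r (suc B′) b≤B (subst (_↭ suc B′ ∷ sort⁺ κ) rest≡ q) (subst (Par (a N.+ suc b N.+ c)) eq par′) (subst (λ l → NL.sum (take 2 l) N.≤ NL.sum (take 2 lam)) e′ (d 2 (s≤s (s≤s z≤n)))) (subst (λ l → NL.sum (take 3 l) N.≤ NL.sum (take 3 lam)) e′ (d 3 NP.≤-refl)))
        where
        eq : x ∷ rest ≡ a ∷ y ∷ r
        eq = cong₂ _∷_ x≡a rest≡
        e′ : sort⁺ ν ≡ a ∷ y ∷ r
        e′ = trans e eq
  go : ∀ l → sort⁺ ν ≡ l → sort⁺ ν ≡ lam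
  go [] e = ⊥-elim (NP.<⇒≢ {0} (NP.≤-trans (s≤s z≤n) (NP.≤-trans (NP.≤-trans (s≤s z≤n) b<a) (NP.≤-trans (NP.m≤m+n a (suc b)) (NP.m≤m+n (a N.+ suc b) c)))) (trans (cong NL.sum (sym e)) (proj₂ (proj₂ parν))))
  go (x ∷ rest) e = trans e (step₁ x rest e)

Shape : ℕ → ℕ → ℕ → Set
Shape a b c = b N.≤ a × (1 N.≤ b ⊎ c ≡ 0) × 1 N.≤ a N.+ b N.+ c

sdom-false : ∀ ν lam → (dom ν lam ≡ true → ν ≡ lam) → sdom ν lam ≡ false
sdom-false ν lam f with dom ν lam
... | false = refl
... | true with f refl
...   | refl = cong not (listEq-refl ν)

-- After sorting, such an exponent vector either equals the shape or is not dominated by it; in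
-- neither case does it occur in d.
orthogonal-pair : ∀ a b c → Shape a b c → ∀ A B κ → a N.≤ A → a N.+ b N.≤ A N.+ B → NL.sum (κ ++ A ∷ B ∷ []) ≡ a N.+ b N.+ c →
  ∀ d → Below (a N.+ b N.+ c) (shape a b c) d → mCoeff (a N.+ b N.+ c) d (κ ++ A ∷ B ∷ []) ≡ 0ℚ
orthogonal-pair a b c (b≤a , v , pos) A B κ a≤A ab≤ s d below =
  trans (mCoeff-sort N d ν) (below (sort⁺ ν) (⇒isPar (sort⁺ ν) (subst (λ N → Par N (sort⁺ ν)) s (Par-sort ν))) (sdom-false (sort⁺ ν) (shape a b c) (λ e → eq b b≤a v pos ab≤ s e)))
  where
  N : ℕ
  N = a N.+ b N.+ c
  ν : List ℕ
  ν = κ ++ A ∷ B ∷ []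
  eq : ∀ b → b N.≤ a → (1 N.≤ b ⊎ c ≡ 0) → 1 N.≤ a N.+ b N.+ c → a N.+ b N.≤ A N.+ B → NL.sum ν ≡ a N.+ b N.+ c → dom (sort⁺ ν) (shape a b c) ≡ true → sort⁺ ν ≡ shape a b c
  eq (suc b) b<a v pos ab≤ s e = extremal a b c A B κ b<a a≤A ab≤ s e
  eq zero _ (inj₁ ()) _ _ _ _
  eq zero _ (inj₂ refl) pos _ s _ = trans (sort⁺-zeros κ (A ∷ B ∷ []) κ≡0) (trans (cong₂ (λ A B → sort⁺ (A ∷ B ∷ [])) A≡a B≡0) (single a (subst (1 N.≤_) (trans (NP.+-identityʳ (a N.+ 0)) (NP.+-identityʳ a)) pos)))
    where
    single : ∀ a → 1 N.≤ a → sort⁺ (a ∷ 0 ∷ []) ≡ a ∷ []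
    single (suc a) _ = refl
    sum-++ : ∀ κ → NL.sum (κ ++ A ∷ B ∷ []) ≡ NL.sum κ N.+ (A N.+ (B N.+ 0))
    sum-++ []      = refl
    sum-++ (x ∷ κ) = trans (cong (x N.+_) (sum-++ κ)) (sym (NP.+-assoc x (NL.sum κ) _))
    total : A N.+ (NL.sum κ N.+ (B N.+ 0)) ≡ a
    total = trans (trans (sym (NP.+-assoc A (NL.sum κ) (B N.+ 0))) (trans (cong (N._+ (B N.+ 0)) (NP.+-comm A (NL.sum κ))) (NP.+-assoc (NL.sum κ) A (B N.+ 0)))) (trans (sym (sum-++ κ)) (trans s (trans (NP.+-identityʳ (a N.+ 0)) (NP.+-identityʳ a))))
    A≡a : A ≡ a
    A≡a = NP.≤-antisym (subst (A N.≤_) total (NP.m≤m+n A _)) a≤A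
    rest≡0 : NL.sum κ N.+ (B N.+ 0) ≡ 0
    rest≡0 = NP.+-cancelˡ-≡ A _ _ (trans total (trans (sym A≡a) (sym (NP.+-identityʳ A))))
    κ≡0 : NL.sum κ ≡ 0
    κ≡0 = NP.m+n≡0⇒m≡0 (NL.sum κ) rest≡0
    B≡0 : B ≡ 0
    B≡0 = trans (sym (NP.+-identityʳ B)) (NP.m+n≡0⇒n≡0 (NL.sum κ) rest≡0)

-- Inverting the triangular system

δ² : ℕ → ℕ → ℕ → ℕ → ℚ
δ² b c b' c' = [ b' N.≡ᵇ b ]ᵇ * [ c' N.≡ᵇ c ]ᵇ

δ²-≢ : ∀ {b c b' c'} → ¬ (b' ≡ b × c' ≡ c) → δ² b c b' c' ≡ 0ℚ
δ²-≢ {b} {c} {b'} {c'} n with b' N.≟ b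
... | no b≢ = zero-*ˡ (cong [_]ᵇ (≡ᵇ-false b≢))
... | yes refl with c' N.≟ c
...   | no c≢ = zero-*ʳ {x = [ b' N.≡ᵇ b ]ᵇ} (cong [_]ᵇ (≡ᵇ-false c≢))
...   | yes refl = ⊥-elim (n (refl , refl))

-- Total weight of the chains of horizontal strips of sizes μ that end in the shape (b , c).
-- `tabSum-F` identifies it with the tableau sum.
F : ℕ → ℕ → List ℕ → ℚ
F b c μ = Z μ (δ² b c)

∑-δ-zero : ∀ n r (q : ℕ → ℚ) → n N.≤ r → ∑ n (λ s → [ r N.≡ᵇ s ]ᵇ * q s) ≡ 0ℚ
∑-δ-zero n r q n≤r = ∑-0 n (λ s s<n → zero-*ˡ {y = q s} (cong [_]ᵇ (≡ᵇ-false (λ e → NP.<⇒≢ (NP.≤-trans s<n n≤r) (sym e)))))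

expand-δ : ∀ K L (φ : ℕ → ℕ → ℚ) b c → (L N.≤ c → φ b c ≡ 0ℚ) → (K N.≤ b → φ b c ≡ 0ℚ) →
  φ b c ≡ ∑ L (λ c' → ∑ K (λ b' → φ b' c' * δ² b' c' b c))
expand-δ K L φ b c zc zb = sym (trans (∑-cong L (λ c' → trans (∑-cong K (λ b' → l (φ b' c') [ b N.≡ᵇ b' ]ᵇ [ c N.≡ᵇ c' ]ᵇ)) (∑-*ˡ K [ c N.≡ᵇ c' ]ᵇ {λ b' → [ b N.≡ᵇ b' ]ᵇ * φ b' c'}))) outer)
  where
  l : ∀ f x y → f * (x * y) ≡ y * (x * f)
  l = solve-∀ ring
  inner : ∑ K (λ b' → [ b N.≡ᵇ b' ]ᵇ * φ b' c) ≡ φ b c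
  inner with b N.<? K
  ... | yes b<K = ∑-δ K b (λ b' → φ b' c) b<K
  ... | no b≮K = trans (∑-δ-zero K b (λ b' → φ b' c) (NP.≮⇒≥ b≮K)) (sym (zb (NP.≮⇒≥ b≮K)))
  outer : ∑ L (λ c' → [ c N.≡ᵇ c' ]ᵇ * ∑ K (λ b' → [ b N.≡ᵇ b' ]ᵇ * φ b' c')) ≡ φ b c
  outer with c N.<? L
  ... | yes c<L = trans (∑-δ L c (λ c' → ∑ K (λ b' → [ b N.≡ᵇ b' ]ᵇ * φ b' c')) c<L) inner
  ... | no c≮L = trans (∑-δ-zero L c (λ c' → ∑ K (λ b' → [ b N.≡ᵇ b' ]ᵇ * φ b' c')) (NP.≮⇒≥ c≮L)) (sym (zc (NP.≮⇒≥ c≮L)))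

mono-high : ∀ A b {b'} → b N.< b' → mono (+ A) (+ b) (+ b') ≡ 0ℚ
mono-high A b {b'} b<b' = zero-*ʳ {x = γ (+ A I.- + b')} (γ-minus b<b')

-- A power (uv)^(b'-1) with b' - 1 > b exceeds v^b. The value b' = b + 1 is not excluded, because
-- the terms of `local` of degree 1 and 2 contain (uv)^(b'-1).
kernel-high : ∀ N C A b b' c' → suc (suc b) N.≤ b' → kernel N C (+ A) (+ b) b' c' ≡ 0ℚ
kernel-high N C A b (suc b') c' (s≤s b<b') = shift-0 c' C go
  where
  hi : mono (+ A) (+ b) (+ suc b') ≡ 0ℚ
  hi = mono-high A b (NP.m<n⇒m<1+n b<b')
  lo : mono (+ A) (+ b) (+ suc b' I.- + 1) ≡ 0ℚ
  lo = mono-high A b b<b'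
  go : ∀ j → local N (+ A) (+ b) (suc b') c' j ≡ 0ℚ
  go 0 = hi
  go 1 = zero-sum (zero-*ʳ {x = σ₁ (𝐀 N (suc b') c') (arm N (suc b') c')} hi) (zero-*ʳ {x = σ₂ (𝐁 (suc b') c') (arm N (suc b') c')} lo)
  go 2 = zero-*ʳ {x = hh N (suc b') c'} lo
  go (suc (suc (suc j))) = refl

GE-expansion : ∀ b c A μ → A N.+ b N.+ c ≡ NL.sum μ → GE μ c (A ∷ b ∷ []) ≡
  ∑ (suc c) (λ c' → ∑ (suc (suc b)) (λ b' → kernel (NL.sum μ) c (+ A) (+ b) b' c' * F b' c' μ))
GE-expansion b c A μ s = begin
  GE μ c (A ∷ b ∷ [])
    ≡⟨ kernel-theorem μ A b c s ⟩
  Z μ φ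
    ≡⟨ Z-cong μ (λ b' c' _ → expand-δ (suc (suc b)) (suc c) φ b' c' (λ c<c' → shift-below (local (NL.sum μ) (+ A) (+ b) b' c') c<c') (kernel-high (NL.sum μ) c A b b' c')) ⟩
  Z μ (λ x y → ∑ (suc c) (λ c' → ∑ (suc (suc b)) (λ b' → φ b' c' * δ² b' c' x y)))
    ≡⟨ trans (Z-∑ μ (suc c) (λ c' x y → ∑ (suc (suc b)) (λ b' → φ b' c' * δ² b' c' x y))) (∑-cong (suc c) (λ c' → trans (Z-∑ μ (suc (suc b)) (λ b' x y → φ b' c' * δ² b' c' x y)) (∑-cong (suc (suc b)) (λ b' → Z-* μ (φ b' c') (δ² b' c'))))) ⟩
  ∑ (suc c) (λ c' → ∑ (suc (suc b)) (λ b' → φ b' c' * F b' c' μ)) ∎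
  where
  φ : ℕ → ℕ → ℚ
  φ = kernel (NL.sum μ) c (+ A) (+ b)

-- The choice A = n + b, B = b makes the system triangular. For c' = c only the term of `local` free
-- of w is met, which leaves b' ≤ b, and the diagonal entry is γ(n).
F-solve : ∀ b c n μ → n N.+ (2 N.* b N.+ c) ≡ NL.sum μ → γ (+ n) * F b c μ ≡
  GE μ c (n N.+ b ∷ b ∷ []) + (- 1ℚ) * (∑ c (λ c' → ∑ (suc (suc b)) (λ b' → kernel (NL.sum μ) c (+ (n N.+ b)) (+ b) b' c' * F b' c' μ)) + ∑ b (λ b' → kernel (NL.sum μ) c (+ (n N.+ b)) (+ b) b' c * F b' c μ))
F-solve b c n μ s = begin
  γ (+ n) * F b c μ
    ≡⟨ cong (_* F b c μ) (sym diag) ⟩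
  φ b c * F b c μ
    ≡⟨ l (φ b c * F b c μ) S R ⟩
  (S + (R + φ b c * F b c μ)) + (- 1ℚ) * (S + R)
    ≡⟨ cong (λ x → (S + x) + (- 1ℚ) * (S + R)) (sym (trans (∑-last (suc b) {λ b' → φ b' c * F b' c μ}) (trans (cong₂ _+_ (∑-last b {λ b' → φ b' c * F b' c μ}) (zero-*ˡ {y = F (suc b) c μ} top)) (QP.+-identityʳ _)))) ⟩
  (S + ∑ (suc (suc b)) (λ b' → φ b' c * F b' c μ)) + (- 1ℚ) * (S + R)
    ≡⟨ cong (_+ (- 1ℚ) * (S + R)) (sym (trans (GE-expansion b c (n N.+ b) μ size) (∑-last c {λ c' → ∑ (suc (suc b)) (λ b' → φ b' c' * F b' c' μ)}))) ⟩
  GE μ c (n N.+ b ∷ b ∷ []) + (- 1ℚ) * (S + R) ∎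
  where
  φ : ℕ → ℕ → ℚ
  φ = kernel (NL.sum μ) c (+ (n N.+ b)) (+ b)
  S R : ℚ
  S = ∑ c (λ c' → ∑ (suc (suc b)) (λ b' → φ b' c' * F b' c' μ))
  R = ∑ b (λ b' → φ b' c * F b' c μ)
  l : ∀ x s r → x ≡ (s + (r + x)) + (- 1ℚ) * (s + r)
  l = solve-∀ ring
  size : n N.+ b N.+ b N.+ c ≡ NL.sum μ
  size = trans (lem n b c) s
    where
    lem : ∀ n b c → n N.+ b N.+ b N.+ c ≡ n N.+ (2 N.* b N.+ c)
    lem = NR.solve-∀
  at-c : ∀ b' → φ b' c ≡ mono (+ (n N.+ b)) (+ b) (+ b')
  at-c b' = trans (cong (shift c (local (NL.sum μ) (+ (n N.+ b)) (+ b) b' c)) (sym (NP.+-identityʳ c))) (shift-at c (local (NL.sum μ) (+ (n N.+ b)) (+ b) b' c) 0)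
  diag : φ b c ≡ γ (+ n)
  diag = trans (at-c b) (trans (cong₂ (λ x y → γ x * γ y) (lem (+ n) (+ b)) (IP.+-inverseʳ (+ b))) (trans (cong (γ (+ n) *_) γ-0) (QP.*-identityʳ (γ (+ n)))))
    where
    lem : ∀ n b → n I.+ b I.- b ≡ n
    lem = IR.solve-∀
  top : φ (suc b) c ≡ 0ℚ
  top = trans (at-c (suc b)) (mono-high (n N.+ b) b NP.≤-refl)

F-empty : ∀ b c μ → ¬ IsShape (NL.sum μ) b c → F b c μ ≡ 0ℚ
F-empty b c μ ¬s = Z-0 μ (λ b' c' s → δ²-≢ {b} {c} {b'} {c'} (λ { (refl , refl) → ¬s s }))

module _ (a₀ b₀ c₀ : ℕ) (sh : Shape a₀ b₀ c₀) where
  private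
    N : ℕ
    N = a₀ N.+ b₀ N.+ c₀
    lam : List ℕ
    lam = shape a₀ b₀ c₀
    -- This region is closed under the recursion: b' may rise to b + 1 only when c' < c, so b + c
    -- never grows. Inside it A = N - b - c ≥ a₀ and A + B = N - c ≥ a₀ + b₀, as `orthogonal-pair`
    -- demands.
    P : ℕ → ℕ → Set
    P c b = c N.≤ c₀ → b N.+ c N.≤ b₀ N.+ c₀ → Rep N lam (F b c)

  isShape? : ∀ b c → Dec (IsShape N b c)
  isShape? b c with 2 N.* b N.+ c N.≤? N | valid? b c
    where
    valid? : ∀ b c → Dec (Valid b c)
    valid? (suc b) c       = yes (inj₁ (b , refl))
    valid? zero    zero    = yes (inj₂ refl)
    valid? zero    (suc c) = no λ { (inj₁ (_ , ())) ; (inj₂ ()) }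
  ... | yes le | yes v = yes (v , N ∸ (2 N.* b N.+ c) , sym (NP.m∸n+n≡m le))
  ... | no ¬le | _     = no λ { (_ , n , e) → ¬le (subst (2 N.* b N.+ c N.≤_) (sym e) (NP.m≤n+m (2 N.* b N.+ c) n)) }
  ... | yes _  | no ¬v = no λ { (v , _) → ¬v v }

  Rep-F-step : ∀ b c → (∀ c' → c' N.< c → ∀ b' → P c' b') → (∀ b' → b' N.< b → P c b') → P c b
  Rep-F-step b c ihc ihb c≤ bc≤ = go (isShape? b c)
   where
   go : Dec (IsShape N b c) → Rep N lam (F b c)
   go (no ¬s) = Rep-cong (λ μ s → sym (F-empty b c μ (λ sh → ¬s (subst (λ n → IsShape n b c) s sh)))) Rep-0
   -- The scalar κ(n) (2n + 1) is the reciprocal of the diagonal entry γ(n).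
   go (yes (v , n , N≡)) = Rep-cong (λ μ s → solved μ s) (Rep-* (κ (+ n) * (2ℚ * ι (+ n) + 1ℚ)) (Rep-+ repGE (Rep-* (- 1ℚ) (Rep-+ repS repR))))
    where
    φ : ℕ → ℕ → ℚ
    φ = kernel N c (+ (n N.+ b)) (+ b)
    rhs : List ℕ → ℚ
    rhs μ = GE μ c (n N.+ b ∷ b ∷ []) + (- 1ℚ) * (∑ c (λ c' → ∑ (suc (suc b)) (λ b' → φ b' c' * F b' c' μ)) + ∑ b (λ b' → φ b' c * F b' c μ))
    solved : ∀ μ → NL.sum μ ≡ N → κ (+ n) * (2ℚ * ι (+ n) + 1ℚ) * rhs μ ≡ F b c μ
    solved μ s = trans (cong (κ (+ n) * (2ℚ * ι (+ n) + 1ℚ) *_) (sym (subst (λ M → γ (+ n) * F b c μ ≡ GE μ c (n N.+ b ∷ b ∷ []) + (- 1ℚ) * (∑ c (λ c' → ∑ (suc (suc b)) (λ b' → kernel M c (+ (n N.+ b)) (+ b) b' c' * F b' c' μ)) + ∑ b (λ b' → kernel M c (+ (n N.+ b)) (+ b) b' c * F b' c μ))) s (F-solve b c n μ (trans (sym N≡) (sym s))))))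
      (trans (l (κ (+ n)) (2ℚ * ι (+ n) + 1ℚ) (γ (+ n)) (F b c μ)) (trans (cong (_* F b c μ) (γκ-inv n)) (QP.*-identityˡ (F b c μ))))
      where
      l : ∀ k o g f → k * o * (g * f) ≡ g * k * o * f
      l = solve-∀ ring
    sizeA : n N.+ b N.+ (b N.+ c) ≡ a₀ N.+ (b₀ N.+ c₀)
    sizeA = trans (lem n b c) (trans (sym N≡) (NP.+-assoc a₀ b₀ c₀))
      where
      lem : ∀ n b c → n N.+ b N.+ (b N.+ c) ≡ n N.+ (2 N.* b N.+ c)
      lem = NR.solve-∀
    a≤A : a₀ N.≤ n N.+ b
    a≤A = NP.+-cancelʳ-≤ (b N.+ c) a₀ (n N.+ b) (subst (a₀ N.+ (b N.+ c) N.≤_) (sym sizeA) (NP.+-monoʳ-≤ a₀ bc≤))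
    ab≤ : a₀ N.+ b₀ N.≤ n N.+ b N.+ b
    ab≤ = NP.+-cancelʳ-≤ c (a₀ N.+ b₀) (n N.+ b N.+ b) (subst (a₀ N.+ b₀ N.+ c N.≤_) (trans (NP.+-assoc a₀ b₀ c₀) (trans (sym sizeA) (sym (NP.+-assoc (n N.+ b) b c)))) (NP.+-monoʳ-≤ (a₀ N.+ b₀) c≤))
    repGE : Rep N lam (λ μ → GE μ c (n N.+ b ∷ b ∷ []))
    repGE = Rep-GE (n N.+ b ∷ b ∷ []) (λ κ e → orthogonal-pair a₀ b₀ c₀ sh (n N.+ b) b κ a≤A ab≤ e) c c [] NP.≤-refl (trans (lem c (n N.+ b) b) (trans sizeA (sym (NP.+-assoc a₀ b₀ c₀))))
      where
      lem : ∀ c A b → c N.+ (A N.+ (b N.+ 0)) ≡ A N.+ (b N.+ c)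
      lem = NR.solve-∀
    repS : Rep N lam (λ μ → ∑ c (λ c' → ∑ (suc (suc b)) (λ b' → φ b' c' * F b' c' μ)))
    repS = Rep-∑ c (λ c' c'<c → Rep-∑ (suc (suc b)) (λ b' b'<b → Rep-* (φ b' c') (ihc c' c'<c b' (NP.≤-trans (NP.<⇒≤ c'<c) c≤) (NP.≤-trans (NP.≤-trans (NP.+-monoˡ-≤ c' (NP.≤-pred b'<b)) (NP.≤-trans (NP.≤-reflexive (sym (NP.+-suc b c'))) (NP.+-monoʳ-≤ b c'<c))) bc≤))))
    repR : Rep N lam (λ μ → ∑ b (λ b' → φ b' c * F b' c μ))
    repR = Rep-∑ b (λ b' b'<b → Rep-* (φ b' c) (ihb b' b'<b c≤ (NP.≤-trans (NP.+-monoˡ-≤ c (NP.<⇒≤ b'<b)) bc≤)))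

  -- Lexicographic induction with c outermost, since smaller c may come with larger b.
  Rep-F : Rep N lam (F b₀ c₀)
  Rep-F = <-rec (λ c → ∀ b → P c b) (λ c ihc b → <-rec (P c) (λ b ihb → Rep-F-step b c (λ c' c'<c → ihc c'<c) (λ b' b'<b → ihb b'<b)) b) c₀ b₀ NP.≤-refl NP.≤-refl

-- Tableaux

range1-suc : ∀ p (f : ℕ → ℚ) → ∑L (range1 (suc p)) f ≡ ∑L (range1 p) f + f (suc p)
range1-suc p f = trans (toSum (suc p)) (trans (∑-last p {λ i → f (suc i)}) (cong (_+ f (suc p)) (sym (toSum p))))
  where
  toSum : ∀ p → ∑L (range1 p) f ≡ ∑ p (λ i → f (suc i))
  toSum p = trans (∑L-map suc (upTo p) {f}) (∑L-applyUpTo p id {f ∘ suc})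

Within : ℕ → ℕ → Set
Within p x = 1 N.≤ x × x N.≤ p

∑L-range1-cong : ∀ p {f g : ℕ → ℚ} → (∀ x → Within p x → f x ≡ g x) → ∑L (range1 p) f ≡ ∑L (range1 p) g
∑L-range1-cong zero    e = refl
∑L-range1-cong (suc p) {f} {g} e = trans (range1-suc p f) (trans (cong₂ _+_ (∑L-range1-cong p (λ x w → e x (proj₁ w , NP.m≤n⇒m≤1+n (proj₂ w)))) (e (suc p) (s≤s z≤n , NP.≤-refl))) (sym (range1-suc p g)))

lists-suc : ∀ n xs (f : List ℕ → ℚ) → ∑L (lists (suc n) xs) f ≡ ∑L xs (λ x → ∑L (lists n xs) (λ r → f (x ∷ r)))
lists-suc n xs f = trans (∑L-concatMap (λ x → map (x ∷_) (lists n xs)) xs {f}) (∑L-cong xs (λ x → ∑L-map (x ∷_) (lists n xs) {f}))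

∑L-lists-cong : ∀ n p {f g : List ℕ → ℚ} → (∀ r → length r ≡ n → All (Within p) r → f r ≡ g r) → ∑L (lists n (range1 p)) f ≡ ∑L (lists n (range1 p)) g
∑L-lists-cong zero    p e = cong (_+ 0ℚ) (e [] refl [])
∑L-lists-cong (suc n) p {f} {g} e = trans (lists-suc n (range1 p) f) (trans (∑L-range1-cong p (λ x w → ∑L-lists-cong n p (λ r l ws → e (x ∷ r) (cong suc l) (w ∷ ws)))) (sym (lists-suc n (range1 p) g)))

∑L-∑ : ∀ {X : Set} (xs : List X) n (g : X → ℕ → ℚ) → ∑L xs (λ x → ∑ n (g x)) ≡ ∑ n (λ i → ∑L xs (λ x → g x i))
∑L-∑ xs zero    g = ∑L-0 xs (λ _ → refl)
∑L-∑ xs (suc n) g = trans (∑L-+ xs {λ x → g x 0} {λ x → ∑ n (λ i → g x (suc i))}) (cong (λ u → ∑L xs (λ x → g x 0) + u) (∑L-∑ xs n (λ x i → g x (suc i))))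

weaklyInc-tail : ∀ x r → weaklyInc r ≡ false → weaklyInc (x ∷ r) ≡ false
weaklyInc-tail x (y ∷ r) e with x N.≤ᵇ y
... | true  = e
... | false = refl

strictlyInc-tail : ∀ x r → strictlyInc r ≡ false → strictlyInc (x ∷ r) ≡ false
strictlyInc-tail x (y ∷ r) e with x N.<ᵇ y
... | true  = e
... | false = refl

≤ᵇ-false : ∀ {m n} → n N.< m → (m N.≤ᵇ n) ≡ false
≤ᵇ-false {m} {n} n<m with m N.≤ᵇ n in e
... | true  = ⊥-elim (NP.<⇒≱ n<m (≤ᵇ-true e))
... | false = refl

-- In a weakly increasing row the copies of the largest letter p + 1 form the end, and all other
-- lists contribute nothing to the sum by hypothesis.
rows-split : ∀ p a (f : List ℕ → ℚ) → (∀ r → weaklyInc r ≡ false → f r ≡ 0ℚ) →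
  ∑L (lists a (range1 (suc p))) f ≡ ∑ (suc a) (λ i → ∑L (lists (a ∸ i) (range1 p)) (λ r → f (r ++ replicate i (suc p))))
rows-split p zero    f wi = cong (λ x → x + 0ℚ) (sym (QP.+-identityʳ (f [])))
rows-split p (suc a) f wi = begin
  ∑L (lists (suc a) R⁺) f
    ≡⟨ lists-suc a R⁺ f ⟩
  ∑L R⁺ (λ x → ∑L (lists a R⁺) (λ r → f (x ∷ r)))
    ≡⟨ range1-suc p (λ x → ∑L (lists a R⁺) (λ r → f (x ∷ r))) ⟩
  ∑L R (λ x → ∑L (lists a R⁺) (λ r → f (x ∷ r))) + ∑L (lists a R⁺) (λ r → f (v ∷ r))
    ≡⟨ cong₂ _+_ (trans (∑L-cong R (λ x → rows-split p a (λ r → f (x ∷ r)) (λ r e → wi (x ∷ r) (weaklyInc-tail x r e)))) (∑L-∑ R (suc a) (λ x i → ∑L (lists (a ∸ i) R) (λ r → f (x ∷ r ++ replicate i v)))))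
                 (trans (rows-split p a (λ r → f (v ∷ r)) (λ r e → wi (v ∷ r) (weaklyInc-tail v r e))) only-last) ⟩
  ∑ (suc a) (λ i → ∑L R (λ x → ∑L (lists (a ∸ i) R) (λ r → f (x ∷ r ++ replicate i v)))) + (f (v ∷ replicate a v) + 0ℚ)
    ≡⟨ cong₂ _+_ (∑-cong< (suc a) (λ i i<a → trans (sym (lists-suc (a ∸ i) R (λ r → f (r ++ replicate i v)))) (cong (λ k → ∑L (lists k R) (λ r → f (r ++ replicate i v))) (sym (NP.+-∸-assoc 1 (NP.≤-pred i<a))))))
                 (cong (λ k → ∑L (lists k R) (λ r → f (r ++ replicate (suc a) v))) (sym (NP.n∸n≡0 (suc a)))) ⟩
  ∑ (suc a) G + G (suc a)
    ≡⟨ sym (∑-last (suc a) {G}) ⟩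
  ∑ (suc (suc a)) G ∎
  where
  v : ℕ
  v = suc p
  R R⁺ : List ℕ
  R = range1 p
  R⁺ = range1 (suc p)
  G : ℕ → ℚ
  G i = ∑L (lists (suc a ∸ i) R) (λ r → f (r ++ replicate i v))
  vanish : ∀ n (g : List ℕ → List ℕ) → (∀ x r → weaklyInc (v ∷ g (x ∷ r)) ≡ (v N.≤ᵇ x) ∧ weaklyInc (g (x ∷ r))) → ∑L (lists (suc n) R) (λ r → f (v ∷ g r)) ≡ 0ℚ
  vanish n g e = trans (∑L-lists-cong (suc n) p zero-at) (∑L-0 (lists (suc n) R) (λ _ → refl))
    where
    zero-at : ∀ r → length r ≡ suc n → All (Within p) r → f (v ∷ g r) ≡ 0ℚ
    zero-at (x ∷ r) _ ((_ , x≤p) ∷ _) = wi (v ∷ g (x ∷ r)) (trans (e x r) (cong (_∧ weaklyInc (g (x ∷ r))) (≤ᵇ-false (s≤s x≤p))))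
  only-last : ∑ (suc a) (λ i → ∑L (lists (a ∸ i) R) (λ r → f (v ∷ r ++ replicate i v))) ≡ f (v ∷ replicate a v) + 0ℚ
  only-last = trans (∑-single (suc a) a {λ i → ∑L (lists (a ∸ i) R) (λ r → f (v ∷ r ++ replicate i v))} NP.≤-refl other) (cong (λ k → ∑L (lists k R) (λ r → f (v ∷ r ++ replicate a v))) (NP.n∸n≡0 a))
    where
    other : ∀ i → i N.< suc a → i ≢ a → ∑L (lists (a ∸ i) R) (λ r → f (v ∷ r ++ replicate i v)) ≡ 0ℚ
    other i i<a i≢a = trans (cong (λ k → ∑L (lists k R) (λ r → f (v ∷ r ++ replicate i v))) (NP.+-∸-assoc 1 {a} {suc i} (NP.≤∧≢⇒< (NP.≤-pred i<a) i≢a))) (vanish (a ∸ suc i) (λ r → r ++ replicate i v) (λ x r → refl))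

-- A strictly increasing column contains the largest letter at most once, namely at its bottom.
columns-split : ∀ p c (f : List ℕ → ℚ) → (∀ r → strictlyInc r ≡ false → f r ≡ 0ℚ) →
  ∑L (lists c (range1 (suc p))) f ≡ ∑L (lists c (range1 p)) f + pred-shift (λ c → ∑L (lists c (range1 p)) (λ r → f (r ++ suc p ∷ []))) c
columns-split p zero    f si = sym (QP.+-identityʳ _)
columns-split p (suc c) f si = begin
  ∑L (lists (suc c) R⁺) f
    ≡⟨ lists-suc c R⁺ f ⟩
  ∑L R⁺ (λ x → ∑L (lists c R⁺) (λ r → f (x ∷ r)))
    ≡⟨ range1-suc p (λ x → ∑L (lists c R⁺) (λ r → f (x ∷ r))) ⟩
  ∑L R (λ x → ∑L (lists c R⁺) (λ r → f (x ∷ r))) + ∑L (lists c R⁺) (λ r → f (v ∷ r))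
    ≡⟨ cong (_+ ∑L (lists c R⁺) (λ r → f (v ∷ r))) (trans (∑L-cong R (λ x → columns-split p c (λ r → f (x ∷ r)) (λ r e → si (x ∷ r) (strictlyInc-tail x r e)))) (∑L-+ R {λ x → ∑L (lists c R) (λ r → f (x ∷ r))} {λ x → pred-shift (λ c → ∑L (lists c R) (λ r → f (x ∷ r ++ v ∷ []))) c})) ⟩
  ∑L R (λ x → ∑L (lists c R) (λ r → f (x ∷ r))) + ∑L R (λ x → pred-shift (λ c → ∑L (lists c R) (λ r → f (x ∷ r ++ v ∷ []))) c) + ∑L (lists c R⁺) (λ r → f (v ∷ r))
    ≡⟨ trans (QP.+-assoc (∑L R (λ x → ∑L (lists c R) (λ r → f (x ∷ r)))) _ _) (cong₂ _+_ (sym (lists-suc c R f)) (tail c)) ⟩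
  ∑L (lists (suc c) R) f + ∑L (lists c R) (λ r → f (r ++ v ∷ [])) ∎
  where
  v : ℕ
  v = suc p
  R R⁺ : List ℕ
  R = range1 p
  R⁺ = range1 (suc p)
  tail : ∀ c → ∑L R (λ x → pred-shift (λ c → ∑L (lists c R) (λ r → f (x ∷ r ++ v ∷ []))) c) + ∑L (lists c R⁺) (λ r → f (v ∷ r)) ≡ ∑L (lists c R) (λ r → f (r ++ v ∷ []))
  tail zero = trans (cong (_+ (f (v ∷ []) + 0ℚ)) (∑L-0 R (λ _ → refl))) (QP.+-identityˡ _)
  tail (suc c) = trans (cong₂ _+_ (sym (lists-suc c R (λ r → f (r ++ v ∷ [])))) (trans (∑L-lists-cong (suc c) (suc p) zero-at) (∑L-0 (lists (suc c) R⁺) (λ _ → refl)))) (QP.+-identityʳ _)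
    where
    zero-at : ∀ r → length r ≡ suc c → All (Within (suc p)) r → f (v ∷ r) ≡ 0ℚ
    zero-at (x ∷ r) _ ((_ , x≤v) ∷ _) = si (v ∷ x ∷ r) (cong (_∧ strictlyInc (x ∷ r)) (≤ᵇ-false (s≤s x≤v)))

-- How the largest entries affect each tableau condition

≤ᵇ-suc : ∀ m n → (suc m N.≤ᵇ suc n) ≡ (m N.≤ᵇ n)
≤ᵇ-suc zero    n = refl
≤ᵇ-suc (suc m) n = refl

<ᵇ-intro : ∀ {m n} → m N.< n → (m N.<ᵇ n) ≡ true
<ᵇ-intro {m} {suc n} (s≤s m≤n) = trans (≤ᵇ-suc-< m n) (≤ᵇ-intro m≤n)
  where
  ≤ᵇ-suc-< : ∀ m n → (m N.<ᵇ suc n) ≡ (m N.≤ᵇ n)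
  ≤ᵇ-suc-< zero    n = refl
  ≤ᵇ-suc-< (suc m) n = refl

<ᵇ-false : ∀ {m n} → n N.≤ m → (m N.<ᵇ n) ≡ false
<ᵇ-false {m} {n} n≤m with m N.<ᵇ n in e
... | true  = ⊥-elim (NP.<⇒≱ (NP.<ᵇ⇒< m n (subst Data.Bool.T (sym e) tt)) n≤m)
... | false = refl

∧-left-comm : ∀ x y z → x ∧ (y ∧ z) ≡ y ∧ (x ∧ z)
∧-left-comm true  y     z = refl
∧-left-comm false true  z = refl
∧-left-comm false false z = refl

weaklyInc-append : ∀ {p} i r → All (Within p) r → weaklyInc (r ++ replicate i (suc p)) ≡ weaklyInc r
weaklyInc-append zero r _ = cong weaklyInc (LP.++-identityʳ r)
weaklyInc-append (suc zero) [] [] = refl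
weaklyInc-append {p} (suc (suc i)) [] [] = ∧-intro {p N.<ᵇ suc p} (<ᵇ-intro (NP.n<1+n p)) (weaklyInc-append (suc i) [] [])
weaklyInc-append (suc i) (x ∷ []) (w ∷ []) = ∧-intro (≤ᵇ-intro (NP.m≤n⇒m≤1+n (proj₂ w))) (weaklyInc-append (suc i) [] [])
weaklyInc-append (suc i) (x ∷ y ∷ r) (_ ∷ ws) = cong ((x N.≤ᵇ y) ∧_) (weaklyInc-append (suc i) (y ∷ r) ws)

strictlyInc-snoc : ∀ {p} r → All (Within p) r → strictlyInc (r ++ suc p ∷ []) ≡ strictlyInc r
strictlyInc-snoc [] [] = refl
strictlyInc-snoc (x ∷ []) (w ∷ []) = ∧-intro (<ᵇ-intro (s≤s (proj₂ w))) refl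
strictlyInc-snoc (x ∷ y ∷ r) (_ ∷ ws) = cong ((x N.<ᵇ y) ∧_) (strictlyInc-snoc (y ∷ r) ws)

allB-applyUpTo : ∀ n (q : ℕ → Bool) f → allB q (applyUpTo f n) ≡ allB (q ∘ f) (upTo n)
allB-applyUpTo zero    q f = refl
allB-applyUpTo (suc n) q f = cong (q (f 0) ∧_) (trans (allB-applyUpTo n q (f ∘ suc)) (sym (allB-applyUpTo n (q ∘ f) suc)))

columnsOK : ℕ → List ℕ → List ℕ → Bool
columnsOK b r1 r2 = allB (λ j → at r1 j N.<ᵇ at r2 j) (upTo b)

columnsOK-∷ : ∀ b x y r1 r2 → columnsOK (suc b) (x ∷ r1) (y ∷ r2) ≡ (x N.<ᵇ y) ∧ columnsOK b r1 r2
columnsOK-∷ b x y r1 r2 = cong ((x N.<ᵇ y) ∧_) (allB-applyUpTo b (λ j → at (x ∷ r1) j N.<ᵇ at (y ∷ r2) j) suc)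

-- Every box of the second row needs a smaller entry above it, so none can stand under a box with p
-- + 1. The shortened first row must therefore cover the whole second row, which is the
-- horizontal-strip condition.
columnsOK-append : ∀ {p} i r r1 r2 → All (Within p) r1 → All (Within p) r2 → length r2 N.+ r N.≤ length r1 N.+ i →
  columnsOK (length r2 N.+ r) (r1 ++ replicate i (suc p)) (r2 ++ replicate r (suc p)) ≡ (length r2 N.+ r N.≤ᵇ length r1) ∧ columnsOK (length r2) r1 r2
columnsOK-append i zero r1 [] _ _ _ = refl
columnsOK-append {p} (suc i) (suc r) [] [] _ _ _ = cong (_∧ allB (λ j → at (replicate (suc i) (suc p)) j N.<ᵇ at (replicate (suc r) (suc p)) j) (applyUpTo suc r)) (<ᵇ-false (NP.≤-refl {suc p}))
columnsOK-append {p} i (suc r) (x ∷ r1) [] (w ∷ ws) [] (s≤s le) = trans (columnsOK-∷ r x (suc p) (r1 ++ replicate i (suc p)) (replicate r (suc p))) (trans (cong₂ _∧_ (<ᵇ-intro (s≤s (proj₂ w))) (columnsOK-append i r r1 [] ws [] le)) (cong (_∧ true) (sym (≤ᵇ-suc r (length r1)))))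
columnsOK-append {p} (suc i) r [] (y ∷ r2) _ (w ∷ _) _ = cong (_∧ allB (λ j → at (replicate (suc i) (suc p)) j N.<ᵇ at (y ∷ r2 ++ replicate r (suc p)) j) (applyUpTo suc (length r2 N.+ r))) (<ᵇ-false (NP.m≤n⇒m≤1+n (proj₂ w)))
columnsOK-append {p} i r (x ∷ r1) (y ∷ r2) (_ ∷ ws) (_ ∷ ws') (s≤s le) =
  trans (columnsOK-∷ (length r2 N.+ r) x y (r1 ++ replicate i (suc p)) (r2 ++ replicate r (suc p)))
  (trans (cong ((x N.<ᵇ y) ∧_) (columnsOK-append i r r1 r2 ws ws' le))
  (trans (∧-left-comm (x N.<ᵇ y) (length r2 N.+ r N.≤ᵇ length r1) (columnsOK (length r2) r1 r2))
  (cong₂ _∧_ (sym (≤ᵇ-suc (length r2 N.+ r) (length r1))) (sym (columnsOK-∷ (length r2) x y r1 r2)))))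

-- If deleting the largest entries empties the second row, nothing may have stood below it; c is the
-- column length before deletion.
admissible : ℕ → ℕ → Bool
admissible zero (suc c) = false
admissible _    _       = true

firstColumn : List ℕ → List ℕ → List ℕ → List ℕ
firstColumn r1 r2 cl = take 1 r1 ++ take 1 r2 ++ cl

strictlyInc-take1 : ∀ r → strictlyInc (take 1 r ++ []) ≡ true
strictlyInc-take1 []      = refl
strictlyInc-take1 (x ∷ r) = refl

firstColumn-append : ∀ {p} i r c₁ r1 r2 cl → c₁ N.≤ 1 → All (Within p) r1 → All (Within p) r2 → All (Within p) cl →
  length r2 N.+ r N.≤ length r1 → 1 N.≤ length r2 N.+ r ⊎ length cl N.+ c₁ ≡ 0 →
  strictlyInc (firstColumn (r1 ++ replicate i (suc p)) (r2 ++ replicate r (suc p)) (cl ++ replicate c₁ (suc p)))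
  ≡ admissible (length r2) (length cl N.+ c₁) ∧ strictlyInc (firstColumn r1 r2 cl)
firstColumn-append i r zero (x ∷ r1) (y ∷ r2) cl _ _ _ _ _ _ = cong (λ l → strictlyInc (x ∷ y ∷ l)) (LP.++-identityʳ cl)
firstColumn-append i r (suc zero) (x ∷ r1) (y ∷ r2) cl _ (w ∷ _) (w' ∷ _) ws _ _ = strictlyInc-snoc (x ∷ y ∷ cl) (w ∷ w' ∷ ws)
firstColumn-append i r (suc (suc c₁)) r1 r2 cl (s≤s ()) _ _ _ _ _
firstColumn-append {p} i zero c₁ r1 [] [] _ _ _ _ _ (inj₂ refl) = trans (strictlyInc-take1 (r1 ++ replicate i (suc p))) (sym (strictlyInc-take1 r1))
firstColumn-append i zero c₁ r1 [] (y ∷ cl) _ _ _ _ _ (inj₂ ())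
firstColumn-append i (suc r) zero (x ∷ r1) [] [] _ (w ∷ _) _ _ _ _ = ∧-intro (<ᵇ-intro (s≤s (proj₂ w))) refl
firstColumn-append {p} i (suc r) (suc c₁) (x ∷ r1) [] [] _ _ _ _ _ _ = trans (cong (λ b → (x N.<ᵇ suc p) ∧ (b ∧ strictlyInc (suc p ∷ replicate c₁ (suc p)))) (<ᵇ-false (NP.≤-refl {suc p}))) (BP.∧-zeroʳ (x N.<ᵇ suc p))
firstColumn-append {p} i (suc r) c₁ (x ∷ r1) [] (y ∷ cl) _ _ _ (w ∷ _) _ _ = trans (cong (λ b → (x N.<ᵇ suc p) ∧ (b ∧ strictlyInc (y ∷ cl ++ replicate c₁ (suc p)))) (<ᵇ-false (NP.m≤n⇒m≤1+n (proj₂ w)))) (BP.∧-zeroʳ (x N.<ᵇ suc p))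

cnt-++ : ∀ v xs ys → cnt v (xs ++ ys) ≡ cnt v xs N.+ cnt v ys
cnt-++ v [] ys = refl
cnt-++ v (x ∷ xs) ys with x N.≡ᵇ v
... | true  = cong suc (cnt-++ v xs ys)
... | false = cnt-++ v xs ys

cnt-replicate : ∀ i v → cnt v (replicate i v) ≡ i
cnt-replicate zero    v = refl
cnt-replicate (suc i) v = trans (cnt-∷-≡ v (replicate i v)) (cong suc (cnt-replicate i v))

cnt-replicate-≢ : ∀ i {v k} → v ≢ k → cnt k (replicate i v) ≡ 0
cnt-replicate-≢ zero    ne = refl
cnt-replicate-≢ (suc i) ne = trans (cnt-∷-≢ _ ne) (cnt-replicate-≢ i ne)

cnt-append-new : ∀ {p} i r → All (Within p) r → cnt (suc p) (r ++ replicate i (suc p)) ≡ i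
cnt-append-new {p} i r ws = trans (cnt-++ (suc p) r (replicate i (suc p))) (cong₂ N._+_ (cnt-0 r (All-map proj₂ ws) NP.≤-refl) (cnt-replicate i (suc p)))

cnt-append-old : ∀ {p k} i r → k N.≤ p → cnt k (r ++ replicate i (suc p)) ≡ cnt k r
cnt-append-old {p} {k} i r k≤p = trans (cnt-++ k r (replicate i (suc p))) (trans (cong (cnt k r N.+_) (cnt-replicate-≢ i (λ e → NP.<⇒≢ (s≤s k≤p) (sym e)))) (NP.+-identityʳ (cnt k r)))

allB-range1-suc : ∀ p (q : ℕ → Bool) → allB q (range1 (suc p)) ≡ allB q (range1 p) ∧ q (suc p)
allB-range1-suc p q = trans (allB-map (suc p)) (trans (last p (q ∘ suc)) (cong (_∧ q (suc p)) (sym (allB-map p))))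
  where
  allB-map : ∀ n → allB q (range1 n) ≡ allB (q ∘ suc) (upTo n)
  allB-map n = trans (cong (allB q) (LP.map-upTo suc n)) (allB-applyUpTo n q suc)
  last : ∀ n q → allB q (upTo (suc n)) ≡ allB q (upTo n) ∧ q n
  last zero    q = BP.∧-comm (q 0) true
  last (suc n) q = trans (cong (q 0 ∧_) (trans (allB-applyUpTo (suc n) q suc) (trans (last n (q ∘ suc)) (cong (_∧ q (suc n)) (sym (allB-applyUpTo n q suc)))))) (sym (BP.∧-assoc (q 0) (allB q (applyUpTo suc n)) (q (suc n))))

allB-range1-cong : ∀ p {q q' : ℕ → Bool} → (∀ x → Within p x → q x ≡ q' x) → allB q (range1 p) ≡ allB q' (range1 p)
allB-range1-cong zero    e = refl
allB-range1-cong (suc p) {q} {q'} e = trans (allB-range1-suc p q) (trans (cong₂ _∧_ (allB-range1-cong p (λ x w → e x (proj₁ w , NP.m≤n⇒m≤1+n (proj₂ w)))) (e (suc p) (s≤s z≤n , NP.≤-refl))) (sym (allB-range1-suc p q')))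

hasType : List ℕ → List ℕ → Bool
hasType μ xs = allB (λ k → cnt k xs N.≡ᵇ at μ (length μ ∸ k)) (range1 (length μ))

hasType-append : ∀ m μ i r c₁ r1 r2 cl → All (Within (length μ)) r1 → All (Within (length μ)) r2 → All (Within (length μ)) cl →
  hasType (m ∷ μ) ((r1 ++ replicate i (suc (length μ))) ++ (r2 ++ replicate r (suc (length μ))) ++ (cl ++ replicate c₁ (suc (length μ))))
  ≡ (i N.+ (r N.+ c₁) N.≡ᵇ m) ∧ hasType μ (r1 ++ r2 ++ cl)
hasType-append m μ i r c₁ r1 r2 cl w1 w2 wc = trans (allB-range1-suc p _) (trans (cong₂ _∧_ (allB-range1-cong p old) new) (BP.∧-comm (hasType μ (r1 ++ r2 ++ cl)) (i N.+ (r N.+ c₁) N.≡ᵇ m)))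
  where
  p : ℕ
  p = length μ
  full : List ℕ
  full = (r1 ++ replicate i (suc p)) ++ (r2 ++ replicate r (suc p)) ++ (cl ++ replicate c₁ (suc p))
  cnt₃ : ∀ k xs ys zs → cnt k (xs ++ ys ++ zs) ≡ cnt k xs N.+ (cnt k ys N.+ cnt k zs)
  cnt₃ k xs ys zs = trans (cnt-++ k xs (ys ++ zs)) (cong (cnt k xs N.+_) (cnt-++ k ys zs))
  old : ∀ k → Within p k → (cnt k full N.≡ᵇ at (m ∷ μ) (suc p ∸ k)) ≡ (cnt k (r1 ++ r2 ++ cl) N.≡ᵇ at μ (p ∸ k))
  old k (_ , k≤p) = cong₂ N._≡ᵇ_
    (trans (cnt₃ k (r1 ++ replicate i (suc p)) (r2 ++ replicate r (suc p)) (cl ++ replicate c₁ (suc p))) (trans (cong₂ N._+_ (cnt-append-old i r1 k≤p) (cong₂ N._+_ (cnt-append-old r r2 k≤p) (cnt-append-old c₁ cl k≤p))) (sym (cnt₃ k r1 r2 cl))))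
    (cong (at (m ∷ μ)) (NP.+-∸-assoc 1 k≤p))
  new : (cnt (suc p) full N.≡ᵇ at (m ∷ μ) (suc p ∸ suc p)) ≡ (i N.+ (r N.+ c₁) N.≡ᵇ m)
  new = cong₂ N._≡ᵇ_
    (trans (cnt₃ (suc p) (r1 ++ replicate i (suc p)) (r2 ++ replicate r (suc p)) (cl ++ replicate c₁ (suc p))) (cong₂ N._+_ (cnt-append-new i r1 w1) (cong₂ N._+_ (cnt-append-new r r2 w2) (cnt-append-new c₁ cl wc))))
    (cong (at (m ∷ μ)) (NP.n∸n≡0 p))

-- The boxes holding the largest entry form a horizontal strip of size m. Here b and c are taken
-- before the removal, a' and b' after it.
removable : ℕ → ℕ → ℕ → ℕ → ℕ → ℕ → ℕ → ℕ → Bool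
removable b c m i r c₁ a' b' = (b N.≤ᵇ a') ∧ (admissible b' c ∧ (i N.+ (r N.+ c₁) N.≡ᵇ m))

length-append : ∀ (r : List ℕ) i {v : ℕ} → length (r ++ replicate i v) ≡ length r N.+ i
length-append r i = trans (LP.length-++ r) (cong (length r N.+_) (LP.length-replicate i))

isTab-append : ∀ m μ i r c₁ r1 r2 cl → c₁ N.≤ 1 → All (Within (length μ)) r1 → All (Within (length μ)) r2 → All (Within (length μ)) cl →
  length r2 N.+ r N.≤ length r1 N.+ i → 1 N.≤ length r2 N.+ r ⊎ length cl N.+ c₁ ≡ 0 →
  isTab (length r1 N.+ i) (length r2 N.+ r) (length cl N.+ c₁) (m ∷ μ) (r1 ++ replicate i (suc (length μ)) , r2 ++ replicate r (suc (length μ)) , cl ++ replicate c₁ (suc (length μ)))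
  ≡ removable (length r2 N.+ r) (length cl N.+ c₁) m i r c₁ (length r1) (length r2) ∧ isTab (length r1) (length r2) (length cl) μ (r1 , r2 , cl)
isTab-append m μ i r c₁ r1 r2 cl c₁≤1 w1 w2 wc b≤a v =
  combine {L = length r2 N.+ r N.≤ᵇ length r1} {s' = strictlyInc (firstColumn r1 r2 cl)} {A = admissible (length r2) (length cl N.+ c₁)} {t' = hasType μ (r1 ++ r2 ++ cl)} {e = i N.+ (r N.+ c₁) N.≡ᵇ m}
    (full-length r1 i) (full-length r2 r) (full-length cl c₁) (≡ᵇ-refl (length r1)) (≡ᵇ-refl (length r2)) (≡ᵇ-refl (length cl))
    (weaklyInc-append i r1 w1) (weaklyInc-append r r2 w2) (columnsOK-append i r r1 r2 w1 w2 b≤a)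
    (λ e → firstColumn-append i r c₁ r1 r2 cl c₁≤1 w1 w2 wc (≤ᵇ-true e) v) (hasType-append m μ i r c₁ r1 r2 cl w1 w2 wc)
  where
  full-length : ∀ r i → (length (r ++ replicate i (suc (length μ))) N.≡ᵇ length r N.+ i) ≡ true
  full-length r i = trans (cong (N._≡ᵇ (length r N.+ i)) (length-append r i)) (≡ᵇ-refl (length r N.+ i))
  combine : ∀ {l₁ l₂ l₃ k₁ k₂ k₃ u₁ u₂ u₁' u₂' o o' L s s' A t t' e} → l₁ ≡ true → l₂ ≡ true → l₃ ≡ true → k₁ ≡ true → k₂ ≡ true → k₃ ≡ true →
    u₁ ≡ u₁' → u₂ ≡ u₂' → o ≡ L ∧ o' → (L ≡ true → s ≡ A ∧ s') → t ≡ e ∧ t' →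
    l₁ ∧ l₂ ∧ l₃ ∧ u₁ ∧ u₂ ∧ o ∧ s ∧ t ≡ (L ∧ (A ∧ e)) ∧ (k₁ ∧ k₂ ∧ k₃ ∧ u₁' ∧ u₂' ∧ o' ∧ s' ∧ t')
  -- If the strip condition fails, both sides are false. Only otherwise is the first column
  -- examined, because `firstColumn-append` presupposes that condition.
  combine {u₁ = u₁} {u₂ = u₂} {L = false} refl refl refl refl refl refl refl refl refl f refl = trans (cong (u₁ ∧_) (BP.∧-zeroʳ u₂)) (BP.∧-zeroʳ u₁)
  combine {u₁ = u₁} {u₂ = u₂} {o' = o'} {L = true} {s' = s'} {A = A} {t' = t'} {e = e} refl refl refl refl refl refl refl refl refl f refl = trans (cong (λ s → u₁ ∧ u₂ ∧ o' ∧ s ∧ e ∧ t') (f refl)) (table u₁ u₂ o' A s' e t')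
    where
    table : ∀ u₁ u₂ o A s e t → u₁ ∧ u₂ ∧ o ∧ (A ∧ s) ∧ e ∧ t ≡ (A ∧ e) ∧ (u₁ ∧ u₂ ∧ o ∧ s ∧ t)
    table false u₂ o A s e t = sym (BP.∧-zeroʳ (A ∧ e))
    table true false o A s e t = sym (BP.∧-zeroʳ (A ∧ e))
    table true true false A s e t = sym (BP.∧-zeroʳ (A ∧ e))
    table true true true false s e t = refl
    table true true true true false e t = sym (BP.∧-zeroʳ e)
    table true true true true true e t = refl

-- The weight under removal of the largest entries

stripFactor : ℤ → ℤ → ℤ → ℤ → ℤ → ℕ → ℕ → ℕ → ℚ
stripFactor x₀ x₁ y₀ y₁ z₀ i r c₁ = angle (x₀ I.- y₀) (+ i) * square (x₀ I.- y₁) (+ r) * powQ (RR x₁ x₀ y₁ y₀ z₀) c₁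

stripFactor-cong : ∀ {x₀ x₀' x₁ x₁' y₀ y₀' y₁ y₁' z₀ z₀' i i' r r' c c'} → x₀ ≡ x₀' → x₁ ≡ x₁' → y₀ ≡ y₀' → y₁ ≡ y₁' → z₀ ≡ z₀' → i ≡ i' → r ≡ r' → c ≡ c' →
  stripFactor x₀ x₁ y₀ y₁ z₀ i r c ≡ stripFactor x₀' x₁' y₀' y₁' z₀' i' r' c'
stripFactor-cong refl refl refl refl refl refl refl refl = refl

partialSum : (ℕ → ℕ) → ℕ → ℕ
partialSum g i = NL.sum (map g (range1 i))

-- The i-th factor of `weight` with the three counting functions as parameters, so that passing to
-- the smaller tableau becomes a shift of these functions.
weightFactor : ℕ → ℕ → ℕ → (ℕ → ℕ) → (ℕ → ℕ) → (ℕ → ℕ) → ℕ → ℚ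
weightFactor a b c A B C i = stripFactor (a I.⊖ partialSum A (i ∸ 1)) (a I.⊖ partialSum A i) (b I.⊖ partialSum B (i ∸ 1)) (b I.⊖ partialSum B i) (c I.⊖ partialSum C (i ∸ 1)) (A i) (B i) (C i)

entries : ℕ → List ℕ → ℕ → ℕ
entries p r i = cnt (suc (p ∸ i)) r

range1-∷ : ∀ k → range1 (suc k) ≡ 1 ∷ map suc (range1 k)
range1-∷ k = cong (λ l → 1 ∷ map suc l) (sym (LP.map-upTo suc k))

partialSum-suc : ∀ g k → partialSum g (suc k) ≡ g 1 N.+ partialSum (g ∘ suc) k
partialSum-suc g k = trans (cong (NL.sum ∘ map g) (range1-∷ k)) (cong (λ l → g 1 N.+ NL.sum l) (sym (LP.map-∘ (range1 k))))

partialSum-cong : ∀ g g' → (∀ j → g (suc j) ≡ g' (suc j)) → ∀ k → partialSum g k ≡ partialSum g' k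
partialSum-cong g g' e k = cong NL.sum (trans (sym (LP.map-∘ (upTo k))) (trans (LP.map-cong e (upTo k)) (LP.map-∘ (upTo k))))

weightFactor-cong : ∀ a b c A B C A' B' C' → (∀ j → A (suc j) ≡ A' (suc j)) → (∀ j → B (suc j) ≡ B' (suc j)) → (∀ j → C (suc j) ≡ C' (suc j)) →
  ∀ k → weightFactor a b c A B C (suc k) ≡ weightFactor a b c A' B' C' (suc k)
weightFactor-cong a b c A B C A' B' C' eA eB eC k = stripFactor-cong (cong (a I.⊖_) (partialSum-cong A A' eA k)) (cong (a I.⊖_) (partialSum-cong A A' eA (suc k)))
  (cong (b I.⊖_) (partialSum-cong B B' eB k)) (cong (b I.⊖_) (partialSum-cong B B' eB (suc k))) (cong (c I.⊖_) (partialSum-cong C C' eC k)) (eA k) (eB k) (eC k)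

remaining : ∀ a g {i} → g 1 ≡ i → ∀ k → (a N.+ i) I.⊖ partialSum g (suc k) ≡ a I.⊖ partialSum (g ∘ suc) k
remaining a g refl k = trans (cong₂ I._⊖_ (NP.+-comm a (g 1)) (partialSum-suc g k)) (IP.+-cancelˡ-⊖ (g 1) a (partialSum (g ∘ suc) k))

weightFactor-suc : ∀ a b c {i r c₁} A B C → A 1 ≡ i → B 1 ≡ r → C 1 ≡ c₁ → ∀ k →
  weightFactor (a N.+ i) (b N.+ r) (c N.+ c₁) A B C (suc (suc k)) ≡ weightFactor a b c (A ∘ suc) (B ∘ suc) (C ∘ suc) (suc k)
weightFactor-suc a b c A B C eA eB eC k = stripFactor-cong (remaining a A eA k) (remaining a A eA (suc k)) (remaining b B eB k) (remaining b B eB (suc k)) (remaining c C eC k) refl refl (refl {x = C (suc (suc k))})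

weightFactor-one : ∀ a b c {i r c₁} A B C → A 1 ≡ i → B 1 ≡ r → C 1 ≡ c₁ →
  weightFactor (a N.+ i) (b N.+ r) (c N.+ c₁) A B C 1 ≡ stripFactor (+ (a N.+ i)) (+ a) (+ (b N.+ r)) (+ b) (+ (c N.+ c₁)) i r c₁
weightFactor-one a b c A B C eA eB eC = stripFactor-cong {x₀ = (a N.+ _) I.⊖ 0} {y₀ = (b N.+ _) I.⊖ 0} {z₀ = (c N.+ _) I.⊖ 0} refl (remaining a A eA 0) refl (remaining b B eB 0) refl eA eB eC

prodQ-range1-suc : ∀ p f → prodQ (range1 (suc p)) f ≡ f 1 * prodQ (range1 p) (f ∘ suc)
prodQ-range1-suc p f = trans (cong (λ l → prodQ l f) (range1-∷ p)) (cong (f 1 *_) (go (range1 p)))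
  where
  go : ∀ l → prodQ (map suc l) f ≡ prodQ l (f ∘ suc)
  go []      = refl
  go (x ∷ l) = cong (f (suc x) *_) (go l)

prodQ-range1-cong : ∀ p (f g : ℕ → ℚ) → (∀ k → f (suc k) ≡ g (suc k)) → prodQ (range1 p) f ≡ prodQ (range1 p) g
prodQ-range1-cong p f g e = go (upTo p)
  where
  go : ∀ l → prodQ (map suc l) f ≡ prodQ (map suc l) g
  go []      = refl
  go (x ∷ l) = cong₂ _*_ (e x) (go l)

entries-append : ∀ p i r j → entries (suc (suc p)) (r ++ replicate i (suc (suc p))) (suc (suc j)) ≡ entries (suc p) r (suc j)
entries-append p i r j = cnt-append-old i r (s≤s (NP.m∸n≤m p j))

-- The factor i = 1 belongs to the largest entry. For the later factors the partial sums begin with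
-- its counts, so they see the shortened rows as the full shape.
weight-append : ∀ a b c m μ i r c₁ r1 r2 cl → All (Within (length μ)) r1 → All (Within (length μ)) r2 → All (Within (length μ)) cl →
  weight (a N.+ i) (b N.+ r) (c N.+ c₁) (m ∷ μ) (r1 ++ replicate i (suc (length μ)) , r2 ++ replicate r (suc (length μ)) , cl ++ replicate c₁ (suc (length μ)))
  ≡ stripFactor (+ (a N.+ i)) (+ a) (+ (b N.+ r)) (+ b) (+ (c N.+ c₁)) i r c₁ * weight a b c μ (r1 , r2 , cl)
weight-append a b c m μ i r c₁ r1 r2 cl w1 w2 wc = trans (prodQ-range1-suc (length μ) (weightFactor (a N.+ i) (b N.+ r) (c N.+ c₁) A B C))
  (cong₂ _*_ (weightFactor-one a b c A B C eA eB eC) (tail (length μ) refl))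
  where
  A B C : ℕ → ℕ
  A = entries (suc (length μ)) (r1 ++ replicate i (suc (length μ)))
  B = entries (suc (length μ)) (r2 ++ replicate r (suc (length μ)))
  C = entries (suc (length μ)) (cl ++ replicate c₁ (suc (length μ)))
  eA : A 1 ≡ i
  eA = cnt-append-new i r1 w1
  eB : B 1 ≡ r
  eB = cnt-append-new r r2 w2
  eC : C 1 ≡ c₁
  eC = cnt-append-new c₁ cl wc
  old : ∀ p → length μ ≡ suc p → ∀ i r j → entries (suc (length μ)) (r ++ replicate i (suc (length μ))) (suc (suc j)) ≡ entries (length μ) r (suc j)
  old p e i r j = subst (λ n → entries (suc n) (r ++ replicate i (suc n)) (suc (suc j)) ≡ entries n r (suc j)) (sym e) (entries-append p i r j)
  tail : ∀ n → length μ ≡ n → prodQ (range1 n) (weightFactor (a N.+ i) (b N.+ r) (c N.+ c₁) A B C ∘ suc) ≡ prodQ (range1 n) (weightFactor a b c (entries (length μ) r1) (entries (length μ) r2) (entries (length μ) cl))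
  tail zero    _ = refl
  tail (suc p) e = prodQ-range1-cong (suc p) (weightFactor (a N.+ i) (b N.+ r) (c N.+ c₁) A B C ∘ suc) (weightFactor a b c (entries (length μ) r1) (entries (length μ) r2) (entries (length μ) cl)) (λ k → trans (weightFactor-suc a b c A B C eA eB eC k) (weightFactor-cong a b c (A ∘ suc) (B ∘ suc) (C ∘ suc) (entries (length μ) r1) (entries (length μ) r2) (entries (length μ) cl) (old p e i r1) (old p e r r2) (old p e c₁ cl) k))

tabTerm : ℕ → ℕ → ℕ → List ℕ → List ℕ → List ℕ → List ℕ → ℚ
tabTerm a b c μ r1 r2 cl = [ isTab a b c μ (r1 , r2 , cl) ]ᵇ * weight a b c μ (r1 , r2 , cl)

tabSum-∑L : ∀ a b c μ → tabSum a b c μ ≡ ∑L (lists a (range1 (length μ))) (λ r1 → ∑L (lists b (range1 (length μ))) (λ r2 → ∑L (lists c (range1 (length μ))) (tabTerm a b c μ r1 r2)))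
tabSum-∑L a b c μ = trans (sumQ-∑L (tableaux a b c μ) (weight a b c μ)) (trans (∑L-filter (isTab a b c μ) (concatMap rows₁ (L a)) {weight a b c μ})
  (trans (∑L-concatMap rows₁ (L a)) (∑L-cong (L a) (λ r1 → trans (∑L-concatMap (rows₂ r1) (L b)) (∑L-cong (L b) (λ r2 → ∑L-map (λ cl → (r1 , r2 , cl)) (L c)))))))
  where
  L : ℕ → List (List ℕ)
  L n = lists n (range1 (length μ))
  rows₂ : List ℕ → List ℕ → List Filling
  rows₂ r1 r2 = map (λ cl → (r1 , r2 , cl)) (L c)
  rows₁ : List ℕ → List Filling
  rows₁ r1 = concatMap (rows₂ r1) (L b)

isTab-support : ∀ a b c μ r1 r2 cl → isTab a b c μ (r1 , r2 , cl) ≡ true → weaklyInc r1 ≡ true × weaklyInc r2 ≡ true × strictlyInc (firstColumn r1 r2 cl) ≡ true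
isTab-support a b c μ r1 r2 cl e = proj₁ e₄ , proj₁ e₅ , proj₁ e₇
  where
  e₄ = ∧-true {weaklyInc r1} (proj₂ (∧-true {length cl N.≡ᵇ c} (proj₂ (∧-true {length r2 N.≡ᵇ b} (proj₂ (∧-true {length r1 N.≡ᵇ a} e))))))
  e₅ = ∧-true {weaklyInc r2} (proj₂ e₄)
  e₇ = ∧-true {strictlyInc (firstColumn r1 r2 cl)} (proj₂ (∧-true {columnsOK b r1 r2} (proj₂ e₅)))

tabTerm-0 : ∀ a b c μ r1 r2 cl → isTab a b c μ (r1 , r2 , cl) ≢ true → tabTerm a b c μ r1 r2 cl ≡ 0ℚ
tabTerm-0 a b c μ r1 r2 cl ne = zero-*ˡ ([]ᵇ-false (isTab a b c μ (r1 , r2 , cl)) ne)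

false≢true : ∀ {b} → b ≡ false → b ≢ true
false≢true refl ()

strictlyInc-firstColumn : ∀ r1 r2 cl → strictlyInc cl ≡ false → strictlyInc (firstColumn r1 r2 cl) ≡ false
strictlyInc-firstColumn r1 r2 cl e = go (take 1 r1) (go (take 1 r2) e)
  where
  go : ∀ l {cl} → strictlyInc cl ≡ false → strictlyInc (l ++ cl) ≡ false
  go []      e = e
  go (x ∷ l) {cl} e = strictlyInc-tail x (l ++ cl) (go l e)

removal : ℕ → ℕ → ℕ → ℕ → ℕ → ℕ → ℕ → ℚ
removal a b c m i r c₁ = [ removable b c m i r c₁ (a ∸ i) (b ∸ r) ]ᵇ * stripFactor (+ a) (+ (a ∸ i)) (+ b) (+ (b ∸ r)) (+ c) i r c₁

tabTerm-append : ∀ {a b c a' b' c'} m μ i r c₁ r1 r2 cl → c₁ N.≤ 1 → a ≡ a' N.+ i → b ≡ b' N.+ r → c ≡ c' N.+ c₁ → b N.≤ a → 1 N.≤ b ⊎ c ≡ 0 →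
  length r1 ≡ a' → length r2 ≡ b' → length cl ≡ c' → All (Within (length μ)) r1 → All (Within (length μ)) r2 → All (Within (length μ)) cl →
  tabTerm a b c (m ∷ μ) (r1 ++ replicate i (suc (length μ))) (r2 ++ replicate r (suc (length μ))) (cl ++ replicate c₁ (suc (length μ)))
  ≡ [ removable b c m i r c₁ a' b' ]ᵇ * stripFactor (+ a) (+ a') (+ b) (+ b') (+ c) i r c₁ * tabTerm a' b' c' μ r1 r2 cl
tabTerm-append m μ i r c₁ r1 r2 cl c₁≤1 refl refl refl b≤a v refl refl refl w1 w2 wc =
  trans (cong₂ _*_ (trans (cong [_]ᵇ (isTab-append m μ i r c₁ r1 r2 cl c₁≤1 w1 w2 wc b≤a v)) ([∧] (removable (length r2 N.+ r) (length cl N.+ c₁) m i r c₁ (length r1) (length r2)) (isTab (length r1) (length r2) (length cl) μ (r1 , r2 , cl))))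
                   (weight-append (length r1) (length r2) (length cl) m μ i r c₁ r1 r2 cl w1 w2 wc))
        (l [ removable (length r2 N.+ r) (length cl N.+ c₁) m i r c₁ (length r1) (length r2) ]ᵇ [ isTab (length r1) (length r2) (length cl) μ (r1 , r2 , cl) ]ᵇ (stripFactor (+ (length r1 N.+ i)) (+ length r1) (+ (length r2 N.+ r)) (+ length r2) (+ (length cl N.+ c₁)) i r c₁) (weight (length r1) (length r2) (length cl) μ (r1 , r2 , cl)))
  where
  l : ∀ x y s w → x * y * (s * w) ≡ x * s * (y * w)
  l = solve-∀ ring

module _ (a b c m : ℕ) (μ : List ℕ) (b≤a : b N.≤ a) (valid : 1 N.≤ b ⊎ c ≡ 0) where
  private
    p v : ℕ
    p = length μ
    v = suc p
    L L⁺ : ℕ → List (List ℕ)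
    L n = lists n (range1 p)
    L⁺ n = lists n (range1 (suc p))
    f : List ℕ → List ℕ → List ℕ → ℚ
    f = tabTerm a b c (m ∷ μ)
    f-row₁ : ∀ r1 r2 cl → weaklyInc r1 ≡ false → f r1 r2 cl ≡ 0ℚ
    f-row₁ r1 r2 cl e = tabTerm-0 a b c (m ∷ μ) r1 r2 cl (λ t → false≢true e (proj₁ (isTab-support a b c (m ∷ μ) r1 r2 cl t)))
    f-row₂ : ∀ r1 r2 cl → weaklyInc r2 ≡ false → f r1 r2 cl ≡ 0ℚ
    f-row₂ r1 r2 cl e = tabTerm-0 a b c (m ∷ μ) r1 r2 cl (λ t → false≢true e (proj₁ (proj₂ (isTab-support a b c (m ∷ μ) r1 r2 cl t))))
    f-column : ∀ r1 r2 cl → strictlyInc cl ≡ false → f r1 r2 cl ≡ 0ℚ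
    f-column r1 r2 cl e = tabTerm-0 a b c (m ∷ μ) r1 r2 cl (λ t → false≢true (strictlyInc-firstColumn r1 r2 cl e) (proj₂ (proj₂ (isTab-support a b c (m ∷ μ) r1 r2 cl t))))
    ext : ℕ → List ℕ → List ℕ
    ext i r = r ++ replicate i v

    columns : ∀ c₁ c' → c ≡ c' N.+ c₁ → c₁ N.≤ 1 → ∀ i r → i N.≤ a → r N.≤ b →
      ∑L (L (a ∸ i)) (λ r1 → ∑L (L (b ∸ r)) (λ r2 → ∑L (L c') (λ cl → f (ext i r1) (ext r r2) (ext c₁ cl)))) ≡ removal a b c m i r c₁ * tabSum (a ∸ i) (b ∸ r) c' μ
    columns c₁ c' ec c₁≤1 i r i≤a r≤b = begin
      ∑L (L (a ∸ i)) (λ r1 → ∑L (L (b ∸ r)) (λ r2 → ∑L (L c') (λ cl → f (ext i r1) (ext r r2) (ext c₁ cl))))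
        ≡⟨ ∑L-lists-cong (a ∸ i) p (λ r1 l₁ w₁ → trans (∑L-lists-cong (b ∸ r) p (λ r2 l₂ w₂ → trans (∑L-lists-cong c' p (λ cl l₃ w₃ →
             tabTerm-append m μ i r c₁ r1 r2 cl c₁≤1 (sym (NP.m∸n+n≡m i≤a)) (sym (NP.m∸n+n≡m r≤b)) ec b≤a valid l₁ l₂ l₃ w₁ w₂ w₃))
             (∑L-*ˡ (L c') R {g r1 r2}))) (∑L-*ˡ (L (b ∸ r)) R {λ r2 → ∑L (L c') (g r1 r2)})) ⟩
      ∑L (L (a ∸ i)) (λ r1 → R * ∑L (L (b ∸ r)) (λ r2 → ∑L (L c') (g r1 r2)))
        ≡⟨ ∑L-*ˡ (L (a ∸ i)) R {λ r1 → ∑L (L (b ∸ r)) (λ r2 → ∑L (L c') (g r1 r2))} ⟩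
      R * ∑L (L (a ∸ i)) (λ r1 → ∑L (L (b ∸ r)) (λ r2 → ∑L (L c') (g r1 r2)))
        ≡⟨ cong (R *_) (sym (tabSum-∑L (a ∸ i) (b ∸ r) c' μ)) ⟩
      R * tabSum (a ∸ i) (b ∸ r) c' μ ∎
      where
      R : ℚ
      R = removal a b c m i r c₁
      g : List ℕ → List ℕ → List ℕ → ℚ
      g = tabTerm (a ∸ i) (b ∸ r) c' μ

    unchanged : List ℕ → List ℕ → ℚ
    unchanged r1 r2 = ∑L (L c) (λ cl → f r1 r2 (ext 0 cl))
    shortened : List ℕ → List ℕ → ℕ → ℚ
    shortened r1 r2 c' = ∑L (L c') (λ cl → f r1 r2 (ext 1 cl))

    split-column : ∀ r1 r2 → ∑L (L⁺ c) (f r1 r2) ≡ unchanged r1 r2 + pred-shift (shortened r1 r2) c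
    split-column r1 r2 = trans (columns-split p c (f r1 r2) (f-column r1 r2)) (cong (_+ pred-shift (shortened r1 r2) c) (∑L-cong (L c) (λ cl → cong (f r1 r2) (sym (LP.++-identityʳ cl)))))

    pull : ∀ n i r → i N.≤ a → r N.≤ b → (∀ k → n ≡ suc k → c ≡ k N.+ 1) → ∑L (L (a ∸ i)) (λ r1 → ∑L (L (b ∸ r)) (λ r2 → pred-shift (shortened (ext i r1) (ext r r2)) n)) ≡ pred-shift (λ c' → removal a b c m i r 1 * tabSum (a ∸ i) (b ∸ r) c' μ) n
    pull zero    i r i≤a r≤b e = ∑L-0 (L (a ∸ i)) (λ r1 → ∑L-0 (L (b ∸ r)) (λ _ → refl))
    pull (suc n) i r i≤a r≤b e = columns 1 n (e n refl) NP.≤-refl i r i≤a r≤b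

    cell : ∀ i r → i N.≤ a → r N.≤ b → ∑L (L (a ∸ i)) (λ r1 → ∑L (L (b ∸ r)) (λ r2 → ∑L (L⁺ c) (f (ext i r1) (ext r r2)))) ≡
      removal a b c m i r 0 * tabSum (a ∸ i) (b ∸ r) c μ + pred-shift (λ c' → removal a b c m i r 1 * tabSum (a ∸ i) (b ∸ r) c' μ) c
    cell i r i≤a r≤b = begin
      ∑L (L (a ∸ i)) (λ r1 → ∑L (L (b ∸ r)) (λ r2 → ∑L (L⁺ c) (f (ext i r1) (ext r r2))))
        ≡⟨ ∑L-cong (L (a ∸ i)) (λ r1 → trans (∑L-cong (L (b ∸ r)) (λ r2 → split-column (ext i r1) (ext r r2))) (∑L-+ (L (b ∸ r)) {λ r2 → unchanged (ext i r1) (ext r r2)} {λ r2 → pred-shift (shortened (ext i r1) (ext r r2)) c})) ⟩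
      ∑L (L (a ∸ i)) (λ r1 → ∑L (L (b ∸ r)) (λ r2 → unchanged (ext i r1) (ext r r2)) + ∑L (L (b ∸ r)) (λ r2 → pred-shift (shortened (ext i r1) (ext r r2)) c))
        ≡⟨ ∑L-+ (L (a ∸ i)) {λ r1 → ∑L (L (b ∸ r)) (λ r2 → unchanged (ext i r1) (ext r r2))} {λ r1 → ∑L (L (b ∸ r)) (λ r2 → pred-shift (shortened (ext i r1) (ext r r2)) c)} ⟩
      ∑L (L (a ∸ i)) (λ r1 → ∑L (L (b ∸ r)) (λ r2 → unchanged (ext i r1) (ext r r2))) + ∑L (L (a ∸ i)) (λ r1 → ∑L (L (b ∸ r)) (λ r2 → pred-shift (shortened (ext i r1) (ext r r2)) c))
        ≡⟨ cong₂ _+_ (columns 0 c (sym (NP.+-identityʳ c)) z≤n i r i≤a r≤b) (pull c i r i≤a r≤b (λ k e → trans e (NP.+-comm 1 k))) ⟩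
      removal a b c m i r 0 * tabSum (a ∸ i) (b ∸ r) c μ + pred-shift (λ c' → removal a b c m i r 1 * tabSum (a ∸ i) (b ∸ r) c' μ) c ∎

  tabSum-∷ : tabSum a b c (m ∷ μ) ≡ ∑ (suc a) (λ i → ∑ (suc b) (λ r →
    removal a b c m i r 0 * tabSum (a ∸ i) (b ∸ r) c μ + pred-shift (λ c' → removal a b c m i r 1 * tabSum (a ∸ i) (b ∸ r) c' μ) c))
  tabSum-∷ = begin
    tabSum a b c (m ∷ μ)
      ≡⟨ tabSum-∑L a b c (m ∷ μ) ⟩
    ∑L (L⁺ a) (λ r1 → ∑L (L⁺ b) (λ r2 → ∑L (L⁺ c) (f r1 r2)))
      ≡⟨ rows-split p a (λ r1 → ∑L (L⁺ b) (λ r2 → ∑L (L⁺ c) (f r1 r2))) (λ r1 e → ∑L-0 (L⁺ b) (λ r2 → ∑L-0 (L⁺ c) (λ cl → f-row₁ r1 r2 cl e))) ⟩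
    ∑ (suc a) (λ i → ∑L (L (a ∸ i)) (λ r1 → ∑L (L⁺ b) (λ r2 → ∑L (L⁺ c) (f (ext i r1) r2))))
      ≡⟨ ∑-cong (suc a) (λ i → trans (∑L-cong (L (a ∸ i)) (λ r1 → rows-split p b (λ r2 → ∑L (L⁺ c) (f (ext i r1) r2)) (λ r2 e → ∑L-0 (L⁺ c) (λ cl → f-row₂ (ext i r1) r2 cl e))))
           (∑L-∑ (L (a ∸ i)) (suc b) (λ r1 r → ∑L (L (b ∸ r)) (λ r2 → ∑L (L⁺ c) (f (ext i r1) (ext r r2)))))) ⟩
    ∑ (suc a) (λ i → ∑ (suc b) (λ r → ∑L (L (a ∸ i)) (λ r1 → ∑L (L (b ∸ r)) (λ r2 → ∑L (L⁺ c) (f (ext i r1) (ext r r2))))))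
      ≡⟨ ∑-cong< (suc a) (λ i i<a → ∑-cong< (suc b) (λ r r<b → cell i r (NP.≤-pred i<a) (NP.≤-pred r<b))) ⟩
    ∑ (suc a) (λ i → ∑ (suc b) (λ r → removal a b c m i r 0 * tabSum (a ∸ i) (b ∸ r) c μ + pred-shift (λ c' → removal a b c m i r 1 * tabSum (a ∸ i) (b ∸ r) c' μ) c)) ∎

-- Binomial weights

ι-pos-* : ∀ m n → ι (+ (m N.* n)) ≡ ι (+ m) * ι (+ n)
ι-pos-* m n = trans (cong ι (IP.pos-* m n)) (ι-* (+ m) (+ n))

choose-! : ∀ k l → ((k N.+ l) NC.C k) N.* (k N.! N.* l N.!) ≡ (k N.+ l) N.!
choose-! k l = trans (cong₂ (λ x y → x N.* (k N.! N.* y N.!)) (NC.nCk≡n!/k![n-k]! k≤n) (sym (NP.m+n∸m≡n k l)))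
  (ND.m/n*n≡m {{k NP.!* (k N.+ l ∸ k) !≢0}} (NC.k![n∸k]!∣n! k≤n))
  where
  k≤n : k N.≤ k N.+ l
  k≤n = NP.m≤m+n k l

-- The double factorial (2n)!!.
even!! : ℕ → ℕ
even!! n = 2 N.^ n N.* n N.!

even!!≢0 : ∀ n → even!! n ≢ 0
even!!≢0 n e = go (NP.m*n≡0⇒m≡0∨n≡0 (2 N.^ n) e)
  where
  go : 2 N.^ n ≡ 0 ⊎ n N.! ≡ 0 → ⊥
  go (inj₁ p) = N.≢-nonZero⁻¹ (2 N.^ n) {{NP.m^n≢0 2 n}} p
  go (inj₂ p) = N.≢-nonZero⁻¹ (n N.!) {{n NP.!≢0}} p

choose-even!! : ∀ k l → ((k N.+ l) NC.C k) N.* (even!! k N.* even!! l) ≡ even!! (k N.+ l)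
choose-even!! k l = trans (lem ((k N.+ l) NC.C k) (2 N.^ k) (2 N.^ l) (k N.!) (l N.!)) (cong₂ N._*_ (sym (NP.^-distribˡ-+-* 2 k l)) (choose-! k l))
  where
  lem : ∀ c p q x y → c N.* (p N.* x N.* (q N.* y)) ≡ p N.* q N.* (c N.* (x N.* y))
  lem = NR.solve-∀

fact : ℕ → ℚ
fact n = ι (+ (n N.!))

fact-suc : ∀ n → fact (suc n) ≡ ι (+ suc n) * fact n
fact-suc n = ι-pos-* (suc n) (n N.!)

2*-suc : ∀ n → 2 N.* suc n ≡ suc (suc (2 N.* n))
2*-suc = NR.solve-∀

γ-fact : ∀ n → γ (+ n) * (ι (+ even!! n) * ι (+ even!! n)) ≡ fact (2 N.* n)
γ-fact zero    = trans (cong₂ (λ g e → g * (e * e)) γ-0 ι-1) (sym ι-1)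
γ-fact (suc n) = begin
  γ (+ suc n) * (ι (+ even!! (suc n)) * ι (+ even!! (suc n)))
    ≡⟨ cong₂ (λ g e → g * (e * e)) (trans (γ-+ (suc n)) (cong₂ (λ g o → g * (o * ρ (+ 2 I.* + suc n))) (sym (γ-+ n)) o≡)) e≡ ⟩
  γ (+ n) * (ι (+ suc (2 N.* n)) * ρ t) * (ι t * E * (ι t * E))
    ≡⟨ l (γ (+ n)) (ι (+ suc (2 N.* n))) (ι t) (ρ t) E (ρ-inv t (2+≢0 n)) ⟩
  ι t * (ι (+ suc (2 N.* n)) * (γ (+ n) * (E * E)))
    ≡⟨ cong₂ (λ x y → x * (ι (+ suc (2 N.* n)) * y)) (cong ι t≡) (γ-fact n) ⟩
  ι (+ suc (suc (2 N.* n))) * (ι (+ suc (2 N.* n)) * fact (2 N.* n))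
    ≡⟨ sym (trans (cong fact (2*-suc n)) (trans (fact-suc (suc (2 N.* n))) (cong (ι (+ suc (suc (2 N.* n))) *_) (fact-suc (2 N.* n))))) ⟩
  fact (2 N.* suc n) ∎
  where
  t : ℤ
  t = + 2 I.* + suc n
  E : ℚ
  E = ι (+ even!! n)
  t≡ : t ≡ + suc (suc (2 N.* n))
  t≡ = trans (sym (IP.pos-* 2 (suc n))) (cong +_ (2*-suc n))
  o≡ : ι (t I.- + 1) ≡ ι (+ suc (2 N.* n))
  o≡ = cong (λ z → ι (z I.- + 1)) t≡
  e≡ : ι (+ even!! (suc n)) ≡ ι t * E
  e≡ = trans (cong (ι ∘ +_) (lem (2 N.^ n) (n N.!) n)) (trans (ι-pos-* (2 N.* suc n) (even!! n)) (cong (λ z → ι z * E) (IP.pos-* 2 (suc n))))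
    where
    lem : ∀ p f n → 2 N.* p N.* (f N.+ n N.* f) ≡ 2 N.* suc n N.* (p N.* f)
    lem = NR.solve-∀
  l : ∀ g o t r e → t * r ≡ 1ℚ → g * (o * r) * (t * e * (t * e)) ≡ t * (o * (g * (e * e)))
  l g o t r e tr = by-lc (lem g o t r e) (lc1 {c = t * (o * (g * (e * e)))} (diff0 tr))
    where
    lem : ∀ g o t r e → g * (o * r) * (t * e * (t * e)) ≡ t * (o * (g * (e * e))) + t * (o * (g * (e * e))) * (t * r - 1ℚ)
    lem = solve-∀ ring

choose≢0 : ∀ {n k} l → n ≡ k N.+ l → + (n NC.C k) ≢ + 0
choose≢0 {_} {k} l refl e = N.≢-nonZero⁻¹ ((k N.+ l) N.!) {{(k N.+ l) NP.!≢0}} (trans (sym (choose-! k l)) (cong (N._* (k N.! N.* l N.!)) (IP.+-injective e)))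

choose-fact : ∀ {n k} l → n ≡ k N.+ l → ι (+ (n NC.C k)) * (fact k * fact l) ≡ fact n
choose-fact {_} {k} l refl = trans (cong (ι (+ ((k N.+ l) NC.C k)) *_) (sym (ι-pos-* (k N.!) (l N.!)))) (trans (sym (ι-pos-* ((k N.+ l) NC.C k) (k N.! N.* l N.!))) (cong (ι ∘ +_) (choose-! k l)))

module _ (y z : ℕ) where
  private
    x : ℕ
    x = y N.+ z
    C Y Z' g : ℚ
    C = ι (+ (x NC.C y))
    Y = ι (+ even!! y)
    Z' = ι (+ even!! z)
    g = γ (+ x)
    EE : ℤ
    EE = + (even!! y N.* even!! z)
    EE≢0 : EE ≢ + 0
    EE≢0 e = go (NP.m*n≡0⇒m≡0∨n≡0 (even!! y) (IP.+-injective e))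
      where
      go : even!! y ≡ 0 ⊎ even!! z ≡ 0 → ⊥
      go (inj₁ p) = even!!≢0 y p
      go (inj₂ p) = even!!≢0 z p
    CYZ : C * (Y * Z') ≡ ι (+ even!! x)
    CYZ = trans (cong (C *_) (sym (ι-pos-* (even!! y) (even!! z)))) (trans (sym (ι-pos-* (x NC.C y) (even!! y N.* even!! z))) (cong (ι ∘ +_) (choose-even!! y z)))
    cancel : ∀ u → Y * Y * (Z' * Z') * (C * C * g) ≡ Y * Y * (Z' * Z') * u → C * C * g ≡ u
    cancel u e = ι-cancel EE EE≢0 (ι-cancel EE EE≢0 (trans (sq (C * C * g)) (trans e (sym (sq u)))))
      where
      sq : ∀ w → ι EE * (ι EE * w) ≡ Y * Y * (Z' * Z') * w
      sq w = trans (cong (λ e → e * (e * w)) (ι-pos-* (even!! y) (even!! z))) (l Y Z' w)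
        where
        l : ∀ a b w → a * b * (a * b * w) ≡ a * a * (b * b) * w
        l = solve-∀ ring
    total : Y * Y * (Z' * Z') * (C * C * g) ≡ fact (2 N.* x)
    total = trans (l Y Z' C g) (trans (cong (λ e → g * (e * e)) CYZ) (γ-fact x))
      where
      l : ∀ a b c g → a * a * (b * b) * (c * c * g) ≡ g * (c * (a * b) * (c * (a * b)))
      l = solve-∀ ring

  -- Multiplied by ((2y)!! (2z)!!)^2 both sides become (2x)!. The odd version follows in the same
  -- way with (2x + 1)!.
  choose²-even : C * C * g ≡ ι (+ ((2 N.* x) NC.C (2 N.* y))) * (γ (+ y) * γ (+ z))
  choose²-even = cancel _ (trans total (trans (sym (choose-fact {2 N.* x} {2 N.* y} (2 N.* z) (NP.*-distribˡ-+ 2 y z))) (trans (cong₂ (λ p q → ι (+ ((2 N.* x) NC.C (2 N.* y))) * (p * q)) (sym (γ-fact y)) (sym (γ-fact z))) (l (ι (+ ((2 N.* x) NC.C (2 N.* y)))) (γ (+ y)) (γ (+ z)) Y Z'))))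
    where
    l : ∀ d p q a b → d * (p * (a * a) * (q * (b * b))) ≡ a * a * (b * b) * (d * (p * q))
    l = solve-∀ ring

  choose²-odd : C * C * (g * ι (+ (2 N.* x N.+ 1))) ≡ ι (+ ((2 N.* x N.+ 1) NC.C (2 N.* y))) * (γ (+ y) * γ (+ z) * ι (+ (2 N.* z N.+ 1)))
  choose²-odd = trans (sym (QP.*-assoc (C * C) g o)) (trans (cong (_* o) (cancel (ρ (+ (2 N.* x N.+ 1)) * (d * (γ (+ y) * γ (+ z) * o'))) step'))
    (trans (l₂ (ρ (+ (2 N.* x N.+ 1))) (d * (γ (+ y) * γ (+ z) * o')) o) (trans (cong (_* (d * (γ (+ y) * γ (+ z) * o'))) (ρ-inv (+ (2 N.* x N.+ 1)) o≢0)) (QP.*-identityˡ (d * (γ (+ y) * γ (+ z) * o'))))))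
    where
    o o' d : ℚ
    o = ι (+ (2 N.* x N.+ 1))
    o' = ι (+ (2 N.* z N.+ 1))
    d = ι (+ ((2 N.* x N.+ 1) NC.C (2 N.* y)))
    o≢0 : + (2 N.* x N.+ 1) ≢ + 0
    o≢0 = suc≢0 (cong +_ (NP.+-comm (2 N.* x) 1))
    l₂ : ∀ r u o → r * u * o ≡ o * r * u
    l₂ = solve-∀ ring
    fact-odd : ∀ n → fact (2 N.* n N.+ 1) ≡ ι (+ (2 N.* n N.+ 1)) * fact (2 N.* n)
    fact-odd n = subst (λ k → fact k ≡ ι (+ k) * fact (2 N.* n)) (sym (NP.+-comm (2 N.* n) 1)) (fact-suc (2 N.* n))
    splits : 2 N.* x N.+ 1 ≡ 2 N.* y N.+ (2 N.* z N.+ 1)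
    splits = trans (cong (N._+ 1) (NP.*-distribˡ-+ 2 y z)) (NP.+-assoc (2 N.* y) (2 N.* z) 1)
    l : ∀ d p q a b o' → d * (p * (a * a) * (o' * (q * (b * b)))) ≡ a * a * (b * b) * (d * (p * q * o'))
    l = solve-∀ ring
    step' : Y * Y * (Z' * Z') * (C * C * g) ≡ Y * Y * (Z' * Z') * (ρ (+ (2 N.* x N.+ 1)) * (d * (γ (+ y) * γ (+ z) * o')))
    step' = trans total (ι-cancel (+ (2 N.* x N.+ 1)) o≢0 (begin
      o * fact (2 N.* x)
        ≡⟨ sym (fact-odd x) ⟩
      fact (2 N.* x N.+ 1)
        ≡⟨ sym (choose-fact {2 N.* x N.+ 1} {2 N.* y} (2 N.* z N.+ 1) splits) ⟩
      d * (fact (2 N.* y) * fact (2 N.* z N.+ 1))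
        ≡⟨ cong₂ (λ p q → d * (p * q)) (sym (γ-fact y)) (trans (fact-odd z) (cong (o' *_) (sym (γ-fact z)))) ⟩
      d * (γ (+ y) * (Y * Y) * (o' * (γ (+ z) * (Z' * Z'))))
        ≡⟨ l d (γ (+ y)) (γ (+ z)) Y Z' o' ⟩
      Y * Y * (Z' * Z') * (d * (γ (+ y) * γ (+ z) * o'))
        ≡⟨ sym (trans (cong (_* (Y * Y * (Z' * Z') * (d * (γ (+ y) * γ (+ z) * o')))) (ρ-inv (+ (2 N.* x N.+ 1)) o≢0)) (QP.*-identityˡ _)) ⟩
      o * ρ (+ (2 N.* x N.+ 1)) * (Y * Y * (Z' * Z') * (d * (γ (+ y) * γ (+ z) * o')))
        ≡⟨ l₄ o (ρ (+ (2 N.* x N.+ 1))) (Y * Y * (Z' * Z')) (d * (γ (+ y) * γ (+ z) * o')) ⟩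
      o * (Y * Y * (Z' * Z') * (ρ (+ (2 N.* x N.+ 1)) * (d * (γ (+ y) * γ (+ z) * o')))) ∎))
      where
      l₄ : ∀ o r a u → o * r * (a * u) ≡ o * (a * (r * u))
      l₄ = solve-∀ ring

  private
    quotient : ∀ (d : ℤ) u v → d ≢ + 0 → C * C * u ≡ ι d * v → divZ (+ ((x NC.C y) N.* (x NC.C y))) d * u ≡ v
    quotient d u v d≢0 e = ι-cancel d d≢0 (trans (cong (λ q → ι d * (q * u)) (trans (divZ-ρ (+ ((x NC.C y) N.* (x NC.C y))) d) (cong (_* ρ d) (ι-pos-* (x NC.C y) (x NC.C y)))))
      (trans (l (ι d) (C * C) (ρ d) u) (trans (cong₂ _*_ (ρ-inv d d≢0) e) (QP.*-identityˡ (ι d * v)))))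
      where
      l : ∀ d c r u → d * (c * r * u) ≡ d * r * (c * u)
      l = solve-∀ ring
    in-range : ∀ u → (if y N.≤ᵇ x then u else 0ℚ) ≡ u
    in-range u = cong (λ b → if b then u else 0ℚ) (≤ᵇ-intro (NP.m≤m+n y z))

  angle-γ : angle (+ x) (+ y) * g ≡ γ (+ y) * γ (+ z)
  angle-γ = trans (cong (_* g) (in-range _)) (quotient (+ ((2 N.* x) NC.C (2 N.* y))) g (γ (+ y) * γ (+ z)) (choose≢0 {2 N.* x} {2 N.* y} (2 N.* z) (NP.*-distribˡ-+ 2 y z)) choose²-even)

  -- The odd binomial contributes (2z + 1)/(2x + 1) to the even quotient, and 1/((2x + 1) γ(x)) is
  -- κ(x).
  square-γ : square (+ x) (+ y) ≡ γ (+ y) * γ (+ z) * κ (+ x) * (2ℚ * ι (+ z) + 1ℚ)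
  square-γ = begin
    square (+ x) (+ y)
      ≡⟨ sym (trans (cong (square (+ x) (+ y) *_) (γκ-inv x)) (QP.*-identityʳ (square (+ x) (+ y)))) ⟩
    square (+ x) (+ y) * (g * κ (+ x) * (2ℚ * ι (+ x) + 1ℚ))
      ≡⟨ l₁ (square (+ x) (+ y)) g (κ (+ x)) (2ℚ * ι (+ x) + 1ℚ) ⟩
    square (+ x) (+ y) * (g * (2ℚ * ι (+ x) + 1ℚ)) * κ (+ x)
      ≡⟨ cong (λ o → square (+ x) (+ y) * (g * o) * κ (+ x)) (sym (odd-ℕ x)) ⟩
    square (+ x) (+ y) * (g * ι (+ (2 N.* x N.+ 1))) * κ (+ x)
      ≡⟨ cong (_* κ (+ x)) (trans (cong (_* (g * ι (+ (2 N.* x N.+ 1)))) (in-range _)) (quotient (+ ((2 N.* x N.+ 1) NC.C (2 N.* y))) (g * ι (+ (2 N.* x N.+ 1))) (γ (+ y) * γ (+ z) * ι (+ (2 N.* z N.+ 1)))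
           (choose≢0 {2 N.* x N.+ 1} {2 N.* y} (2 N.* z N.+ 1) (trans (cong (N._+ 1) (NP.*-distribˡ-+ 2 y z)) (NP.+-assoc (2 N.* y) (2 N.* z) 1))) choose²-odd)) ⟩
    γ (+ y) * γ (+ z) * ι (+ (2 N.* z N.+ 1)) * κ (+ x)
      ≡⟨ trans (cong (λ o → γ (+ y) * γ (+ z) * o * κ (+ x)) (odd-ℕ z)) (l₂ (γ (+ y) * γ (+ z)) (2ℚ * ι (+ z) + 1ℚ) (κ (+ x))) ⟩
    γ (+ y) * γ (+ z) * κ (+ x) * (2ℚ * ι (+ z) + 1ℚ) ∎
    where
    odd-ℕ : ∀ n → ι (+ (2 N.* n N.+ 1)) ≡ 2ℚ * ι (+ n) + 1ℚ
    odd-ℕ n = trans (ι-+ (+ (2 N.* n)) (+ 1)) (cong₂ _+_ (trans (cong ι (IP.pos-* 2 n)) (ι-2* (+ n))) ι-1)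
    l₁ : ∀ s g k o → s * (g * k * o) ≡ s * (g * o) * k
    l₁ = solve-∀ ring
    l₂ : ∀ a o k → a * o * k ≡ a * k * o
    l₂ = solve-∀ ring

-- The value γ(i + t) in the denominator of the first factor cancels against the numerator of the
-- second, and Adams' coefficient remains.
angle-square : ∀ i r t → angle (+ (i N.+ t)) (+ i) * square (+ (r N.+ (i N.+ t))) (+ r) ≡ α (+ i) (+ r) (+ t)
angle-square i r t = begin
  angle (+ (i N.+ t)) (+ i) * square (+ (r N.+ (i N.+ t))) (+ r)
    ≡⟨ cong (angle (+ (i N.+ t)) (+ i) *_) (square-γ r (i N.+ t)) ⟩
  angle (+ (i N.+ t)) (+ i) * (γ (+ r) * γ (+ (i N.+ t)) * κ (+ (r N.+ (i N.+ t))) * (2ℚ * ι (+ (i N.+ t)) + 1ℚ))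
    ≡⟨ l₁ (angle (+ (i N.+ t)) (+ i)) (γ (+ r)) (γ (+ (i N.+ t))) (κ (+ (r N.+ (i N.+ t)))) (2ℚ * ι (+ (i N.+ t)) + 1ℚ) ⟩
  angle (+ (i N.+ t)) (+ i) * γ (+ (i N.+ t)) * γ (+ r) * κ (+ (r N.+ (i N.+ t))) * (2ℚ * ι (+ (i N.+ t)) + 1ℚ)
    ≡⟨ cong₂ (λ u v → u * γ (+ r) * κ (+ v) * (2ℚ * ι (+ (i N.+ t)) + 1ℚ)) (angle-γ i t) (lem i r t) ⟩
  γ (+ i) * γ (+ t) * γ (+ r) * κ (+ (i N.+ r N.+ t)) * (2ℚ * ι (+ (i N.+ t)) + 1ℚ)
    ≡⟨ cong₂ (λ u v → u * κ (+ (i N.+ r N.+ t)) * (2ℚ * v + 1ℚ)) (l₂ (γ (+ i)) (γ (+ t)) (γ (+ r))) (ι-+ (+ i) (+ t)) ⟩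
  γ (+ i) * γ (+ r) * γ (+ t) * κ (+ (i N.+ r N.+ t)) * (2ℚ * (ι (+ i) + ι (+ t)) + 1ℚ) ∎
  where
  l₁ : ∀ a r g k o → a * (r * g * k * o) ≡ a * g * r * k * o
  l₁ = solve-∀ ring
  l₂ : ∀ i t r → i * t * r ≡ i * r * t
  l₂ = solve-∀ ring
  lem : ∀ i r t → r N.+ (i N.+ t) ≡ i N.+ r N.+ t
  lem = NR.solve-∀

ρ-* : ∀ x y → x ≢ + 0 → y ≢ + 0 → x I.* y ≢ + 0 → ρ (x I.* y) ≡ ρ x * ρ y
ρ-* x y x≢0 y≢0 xy≢0 = ι-cancel (x I.* y) xy≢0 (trans (ρ-inv (x I.* y) xy≢0) (sym (trans (cong (_* (ρ x * ρ y)) (ι-* x y)) (trans (l (ι x) (ι y) (ρ x) (ρ y)) (trans (cong₂ _*_ (ρ-inv x x≢0) (ρ-inv y y≢0)) refl)))))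
  where
  l : ∀ a b c d → a * b * (c * d) ≡ a * c * (b * d)
  l = solve-∀ ring

*≢0 : ∀ {x y} → x ≢ + 0 → y ≢ + 0 → x I.* y ≢ + 0
*≢0 {x} {y} x≢0 y≢0 e = go (IP.i*j≡0⇒i≡0∨j≡0 x e)
  where
  go : x ≡ + 0 ⊎ y ≡ + 0 → ⊥
  go (inj₁ p) = x≢0 p
  go (inj₂ p) = y≢0 p

h-quotient : ∀ v → v ≢ + 0 → h v ≡ ι (v I.+ + 1) * ρ v
h-quotient v v≢0 = sym (trans (cong (_* ρ v) (trans (ι-+ v (+ 1)) (cong (λ y → ι v + y) ι-1))) (by-lc (l (ι v) (ρ v)) (lc1 {c = 1ℚ} (diff0 (ρ-inv v v≢0)))))
  where
  l : ∀ v r → (v + 1ℚ) * r ≡ 1ℚ + r + 1ℚ * (v * r - 1ℚ)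
  l = solve-∀ ring

hᵒ-quotient : ∀ v → v ≢ + 0 → hᵒ v ≡ ι (v I.- + 1) * ρ v
hᵒ-quotient v v≢0 = sym (trans (cong (_* ρ v) (trans (ι-sub v (+ 1)) (cong (λ y → ι v - y) ι-1))) (by-lc (l (ι v) (ρ v)) (lc1 {c = 1ℚ} (diff0 (ρ-inv v v≢0)))))
  where
  l : ∀ v r → (v - 1ℚ) * r ≡ 1ℚ - r + 1ℚ * (v * r - 1ℚ)
  l = solve-∀ ring

-- Pairing each denominator with the numerator next to it leaves only quotients (d + 1)/d and (d -
-- 1)/d.
RR-h : ∀ x y z t w {d₁ d₂ d₃ d₄} → d₁ ≡ + 2 I.* x I.+ w I.- + 1 → d₂ ≡ + 2 I.* y I.+ w I.+ + 1 → d₃ ≡ + 2 I.* z I.+ w I.- + 2 → d₄ ≡ + 2 I.* t I.+ w →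
  d₁ ≢ + 0 → d₂ ≢ + 0 → d₃ ≢ + 0 → d₄ ≢ + 0 → RR x y z t w ≡ h d₁ * h d₃ * (hᵒ d₂ * hᵒ d₄)
RR-h x y z t w {d₁} {d₂} {d₃} {d₄} refl refl refl refl n₁ n₂ n₃ n₄ = begin
  RR x y z t w
    ≡⟨ divZ-ρ _ (d₁ I.* d₂ I.* d₃ I.* d₄) ⟩
  ι (e₁ I.* e₂ I.* e₃ I.* e₄) * ρ (d₁ I.* d₂ I.* d₃ I.* d₄)
    ≡⟨ cong₂ _*_ (trans (ι-* (e₁ I.* e₂ I.* e₃) e₄) (cong (_* ι e₄) (trans (ι-* (e₁ I.* e₂) e₃) (cong (_* ι e₃) (ι-* e₁ e₂)))))
         (trans (ρ-* (d₁ I.* d₂ I.* d₃) d₄ (*≢0 (*≢0 n₁ n₂) n₃) n₄ (*≢0 (*≢0 (*≢0 n₁ n₂) n₃) n₄)) (cong (_* ρ d₄) (trans (ρ-* (d₁ I.* d₂) d₃ (*≢0 n₁ n₂) n₃ (*≢0 (*≢0 n₁ n₂) n₃)) (cong (_* ρ d₃) (ρ-* d₁ d₂ n₁ n₂ (*≢0 n₁ n₂)))))) ⟩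
  ι e₁ * ι e₂ * ι e₃ * ι e₄ * (ρ d₁ * ρ d₂ * ρ d₃ * ρ d₄)
    ≡⟨ l (ι e₁) (ι e₂) (ι e₃) (ι e₄) (ρ d₁) (ρ d₂) (ρ d₃) (ρ d₄) ⟩
  ι e₁ * ρ d₁ * (ι e₃ * ρ d₃) * (ι e₂ * ρ d₂ * (ι e₄ * ρ d₄))
    ≡⟨ cong₂ _*_ (cong₂ _*_ (step₁ e₁ d₁ n₁ (lem₁ x w)) (step₁ e₃ d₃ n₃ (lem₃ z w))) (cong₂ _*_ (step₂ e₂ d₂ n₂ (lem₂ y w)) (step₂ e₄ d₄ n₄ refl)) ⟩
  h d₁ * h d₃ * (hᵒ d₂ * hᵒ d₄) ∎
  where
  e₁ e₂ e₃ e₄ : ℤ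
  e₁ = + 2 I.* x I.+ w
  e₂ = + 2 I.* y I.+ w
  e₃ = + 2 I.* z I.+ w I.- + 1
  e₄ = + 2 I.* t I.+ w I.- + 1
  l : ∀ a b c d p q r s → a * b * c * d * (p * q * r * s) ≡ a * p * (c * r) * (b * q * (d * s))
  l = solve-∀ ring
  step₁ : ∀ e d → d ≢ + 0 → d I.+ + 1 ≡ e → ι e * ρ d ≡ h d
  step₁ _ d n refl = sym (h-quotient d n)
  step₂ : ∀ e d → d ≢ + 0 → d I.- + 1 ≡ e → ι e * ρ d ≡ hᵒ d
  step₂ _ d n refl = sym (hᵒ-quotient d n)
  lem₁ : ∀ x w → + 2 I.* x I.+ w I.- + 1 I.+ + 1 ≡ + 2 I.* x I.+ w
  lem₁ = IR.solve-∀
  lem₂ : ∀ x w → + 2 I.* x I.+ w I.+ + 1 I.- + 1 ≡ + 2 I.* x I.+ w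
  lem₂ = IR.solve-∀
  lem₃ : ∀ x w → + 2 I.* x I.+ w I.- + 2 I.+ + 1 ≡ + 2 I.* x I.+ w I.- + 1
  lem₃ = IR.solve-∀

double-pos : ∀ n c k → + k I.+ (+ 2 I.* + n I.+ + c) ≡ + (k N.+ (2 N.* n N.+ c))
double-pos n c k = cong (λ z → + k I.+ (z I.+ + c)) (sym (IP.pos-* 2 n))

𝐁-suc : ∀ b c → 𝐁 (suc b) c ≡ + suc (2 N.* b N.+ c)
𝐁-suc b c = trans (lem (+ b) (+ c)) (double-pos b c 1)
  where
  lem : ∀ b c → + 2 I.* (+ 1 I.+ b) I.+ c I.- + 1 ≡ + 1 I.+ (+ 2 I.* b I.+ c)
  lem = IR.solve-∀

𝐀-shape : ∀ a b c → 𝐀 (a N.+ b N.+ c) b c ≡ + (2 N.* a N.+ c)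
𝐀-shape a b c = trans (lem (+ a) (+ b) (+ c)) (double-pos a c 0)
  where
  lem : ∀ a b c → (+ 2 I.* b I.+ c I.- + 1) I.+ (+ 2 I.* ((a I.+ b I.+ c I.- c I.- + 2 I.* b) I.+ + 1) I.- + 1) ≡ + 0 I.+ (+ 2 I.* a I.+ c)
  lem = IR.solve-∀

-- A second row that stays nonempty after the removal makes all four denominators positive. The last
-- argument of R is the old column length c + 1, which moves the denominators to `𝐀` and `𝐁` of the
-- smaller shape.
RR-Rfac : ∀ a b c i r → RR (+ suc a) (+ (suc a N.+ i)) (+ suc b) (+ (suc b N.+ r)) (+ suc c) ≡ Rfac (suc a N.+ suc b N.+ c) (suc b) c (+ suc i) r
RR-Rfac a b c i r = RR-h (+ suc a) (+ (suc a N.+ i)) (+ suc b) (+ (suc b N.+ r)) (+ suc c)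
  (trans 𝐀≡ (lem₁ (+ a) (+ c))) (trans (cong (λ z → z I.+ + 2 I.* + suc i) 𝐀≡) (lem₂ (+ a) (+ c) (+ i))) (lem₃ (+ b) (+ c)) (lem₄ (+ b) (+ c) (+ r))
  (suc≢0 (trans 𝐀≡ (trans (lem₅ (+ a) (+ c)) (double-pos a c 2))))
  (suc≢0 (trans (cong₂ I._+_ (trans 𝐀≡ (trans (lem₅ (+ a) (+ c)) (double-pos a c 2))) (sym (IP.pos-* 2 (suc i)))) refl))
  (suc≢0 (𝐁-suc b c))
  (suc≢0 (trans (cong₂ I._+_ (𝐁-suc b c) (sym (IP.pos-* 2 (suc r)))) refl))
  where
  𝐀≡ : 𝐀 (suc a N.+ suc b N.+ c) (suc b) c ≡ + 2 I.* + suc a I.+ + c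
  𝐀≡ = trans (𝐀-shape (suc a) (suc b) c) (sym (trans (sym (IP.+-identityˡ _)) (double-pos (suc a) c 0)))
  lem₁ : ∀ a c → + 2 I.* (+ 1 I.+ a) I.+ c ≡ + 2 I.* (+ 1 I.+ a) I.+ (+ 1 I.+ c) I.- + 1
  lem₁ = IR.solve-∀
  lem₂ : ∀ a c i → (+ 2 I.* (+ 1 I.+ a) I.+ c) I.+ + 2 I.* (+ 1 I.+ i) ≡ + 2 I.* (+ 1 I.+ a I.+ i) I.+ (+ 1 I.+ c) I.+ + 1
  lem₂ = IR.solve-∀
  lem₃ : ∀ b c → + 2 I.* (+ 1 I.+ b) I.+ c I.- + 1 ≡ + 2 I.* (+ 1 I.+ b) I.+ (+ 1 I.+ c) I.- + 2
  lem₃ = IR.solve-∀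
  lem₄ : ∀ b c r → (+ 2 I.* (+ 1 I.+ b) I.+ c I.- + 1) I.+ + 2 I.* (+ 1 I.+ r) ≡ + 2 I.* (+ 1 I.+ b I.+ r) I.+ (+ 1 I.+ c)
  lem₄ = IR.solve-∀
  lem₅ : ∀ a c → + 2 I.* (+ 1 I.+ a) I.+ c ≡ + 2 I.+ (+ 2 I.* a I.+ c)
  lem₅ = IR.solve-∀

-- Tableau sums

δ²-shift : ∀ (g : ℕ → ℕ → ℚ) b c b' c' r → r N.≤ b → g b' c' * δ² b c (b' N.+ r) c' ≡ g (b ∸ r) c * δ² (b ∸ r) c b' c'
δ²-shift g b c b' c' r r≤b = go (b' N.≟ b ∸ r) (c' N.≟ c)
  where
  vanish : ¬ (b' ≡ b ∸ r × c' ≡ c) → g b' c' * δ² b c (b' N.+ r) c' ≡ g (b ∸ r) c * δ² (b ∸ r) c b' c'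
  vanish n = trans (zero-*ʳ {x = g b' c'} (δ²-≢ {b} {c} {b' N.+ r} {c'} (λ { (p , q) → n (trans (sym (NP.m+n∸n≡m b' r)) (cong (_∸ r) p) , q) }))) (sym (zero-*ʳ {x = g (b ∸ r) c} (δ²-≢ {b ∸ r} {c} {b'} {c'} n)))
  same : ∀ {x y} → x ≡ b ∸ r → y ≡ c → g x y * δ² b c (x N.+ r) y ≡ g (b ∸ r) c * δ² (b ∸ r) c x y
  same refl refl = cong (λ e → g (b ∸ r) c * (e * [ c N.≡ᵇ c ]ᵇ)) (cong [_]ᵇ (trans (cong (N._≡ᵇ b) (NP.m∸n+n≡m r≤b)) (trans (≡ᵇ-refl b) (sym (≡ᵇ-refl (b ∸ r))))))
  go : Dec (b' ≡ b ∸ r) → Dec (c' ≡ c) → g b' c' * δ² b c (b' N.+ r) c' ≡ g (b ∸ r) c * δ² (b ∸ r) c b' c'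
  go (yes p) (yes q) = same p q
  go (no n)  _       = vanish (λ e → n (proj₁ e))
  go (yes _) (no n)  = vanish (λ e → n (proj₂ e))

∑-δ²-shift : ∀ K (ψ : ℕ → ℕ → ℕ → ℚ) b c b' c' → b N.≤ K →
  ∑ (suc K) (λ r → ψ b' c' r * δ² b c (b' N.+ r) c') ≡ ∑ (suc b) (λ r → ψ (b ∸ r) c r * δ² (b ∸ r) c b' c')
∑-δ²-shift K ψ b c b' c' b≤K = trans (∑-mono {suc b} {suc K} {λ r → ψ b' c' r * δ² b c (b' N.+ r) c'} (s≤s b≤K) (λ r b<r → zero-*ʳ {x = ψ b' c' r} (δ²-≢ {b} {c} {b' N.+ r} {c'} (λ e → NP.<⇒≢ (NP.≤-trans b<r (NP.m≤n+m r b')) (sym (proj₁ e))))))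
  (∑-cong< (suc b) (λ r r<b → δ²-shift (λ x y → ψ x y r) b c b' c' r (NP.≤-pred r<b)))

-- The chain is read backwards from its final shape: m is the size of the last strip, and (b - r ,
-- c) or (b - r , c - 1) is the shape before it was added.
F-∷ : ∀ b c m μ → b N.≤ m N.+ NL.sum μ → F b c (m ∷ μ) ≡
  ∑ (suc b) (λ r → ψ₀ m (NL.sum μ) (b ∸ r) c r * F (b ∸ r) c μ) + pred-shift (λ c' → ∑ (suc b) (λ r → ψ₁ m (NL.sum μ) (b ∸ r) c' r * F (b ∸ r) c' μ)) c
F-∷ b c m μ b≤ = trans (Z-cong μ (λ b' c' _ → cong₂ _+_ (∑-δ²-shift (bound M m) (ψ₀ m M) b c b' c' b≤K) (lowered c b' c')))
  (trans (Z-+ μ (λ b' c' → ∑ (suc b) (λ r → ψ₀ m M (b ∸ r) c r * δ² (b ∸ r) c b' c')) (low c))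
  (cong₂ _+_ (linear (ψ₀ m M) c) (Z-low c)))
  where
  M : ℕ
  M = NL.sum μ
  b≤K : b N.≤ bound M m
  b≤K = NP.≤-trans b≤ (NP.≤-trans (NP.≤-reflexive (NP.+-comm m M)) (NP.≤-trans (NP.n≤1+n (M N.+ m)) (NP.<⇒≤ (bound-spec M m))))
  low : ℕ → ℕ → ℕ → ℚ
  low c b' c' = pred-shift (λ c'' → ∑ (suc b) (λ r → ψ₁ m M (b ∸ r) c'' r * δ² (b ∸ r) c'' b' c')) c
  lowered : ∀ c b' c' → ∑ (suc (bound M m)) (λ r → ψ₁ m M b' c' r * δ² b c (b' N.+ r) (suc c')) ≡ low c b' c'
  lowered zero    b' c' = ∑-0 (suc (bound M m)) (λ r _ → zero-*ʳ {x = ψ₁ m M b' c' r} (δ²-≢ {b} {0} {b' N.+ r} {suc c'} (λ { (_ , ()) })))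
  lowered (suc c) b' c' = ∑-δ²-shift (bound M m) (ψ₁ m M) b c b' c' b≤K
  linear : ∀ (ψ : ℕ → ℕ → ℕ → ℚ) c → Z μ (λ b' c' → ∑ (suc b) (λ r → ψ (b ∸ r) c r * δ² (b ∸ r) c b' c')) ≡ ∑ (suc b) (λ r → ψ (b ∸ r) c r * F (b ∸ r) c μ)
  linear ψ c = trans (Z-∑ μ (suc b) (λ r b' c' → ψ (b ∸ r) c r * δ² (b ∸ r) c b' c')) (∑-cong (suc b) (λ r → Z-* μ (ψ (b ∸ r) c r) (δ² (b ∸ r) c)))
  Z-low : ∀ c → Z μ (low c) ≡ pred-shift (λ c' → ∑ (suc b) (λ r → ψ₁ m M (b ∸ r) c' r * F (b ∸ r) c' μ)) c
  Z-low zero    = Z-0 μ (λ _ _ _ → refl)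
  Z-low (suc c) = linear (ψ₁ m M) c

-- With the boxes outside the first row fixed, the strip size determines i, so at most one term of
-- the sum is nonzero; the last hypothesis treats the case in which no strip exists.
∑-collapse : ∀ a b s m (t : ℕ → ℚ) v → (∀ i → i N.≤ a → ¬ (i N.+ s ≡ m × b N.+ i N.≤ a) → t i ≡ 0ℚ) →
  (∀ i → i N.+ s ≡ m → b N.+ i N.≤ a → t i ≡ v) → ((∀ i → i N.+ s ≡ m → ¬ b N.+ i N.≤ a) → v ≡ 0ℚ) → ∑ (suc a) t ≡ v
∑-collapse a b s m t v off on none = go (s N.≤? m)
  where
  empty : (∀ i → i N.+ s ≡ m → ¬ b N.+ i N.≤ a) → ∑ (suc a) t ≡ v
  empty n = trans (∑-0 (suc a) (λ i i<a → off i (NP.≤-pred i<a) (λ p → n i (proj₁ p) (proj₂ p)))) (sym (none n))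
  unique : ∀ i → i N.+ s ≡ m → i ≡ m ∸ s
  unique i e = trans (sym (NP.m+n∸n≡m i s)) (cong (_∸ s) e)
  go : Dec (s N.≤ m) → ∑ (suc a) t ≡ v
  go (no n)   = empty (λ i e _ → n (subst (s N.≤_) e (NP.m≤n+m s i)))
  go (yes le) = go′ (b N.+ (m ∸ s) N.≤? a)
    where
    go′ : Dec (b N.+ (m ∸ s) N.≤ a) → ∑ (suc a) t ≡ v
    go′ (no n)   = empty (λ i e p → n (subst (λ i → b N.+ i N.≤ a) (unique i e) p))
    go′ (yes le′) = trans (∑-single (suc a) (m ∸ s) (s≤s (NP.≤-trans (NP.m≤n+m (m ∸ s) b) le′)) (λ i i<a ne → off i (NP.≤-pred i<a) (λ p → ne (unique i (proj₁ p)))))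
      (on (m ∸ s) (NP.m∸n+n≡m le) le′)

removal-off : ∀ a b c m i r c₁ → i N.≤ a → ¬ (i N.+ (r N.+ c₁) ≡ m × b N.+ i N.≤ a) → removal a b c m i r c₁ ≡ 0ℚ
removal-off a b c m i r c₁ i≤a n = zero-*ˡ ([]ᵇ-false (removable b c m i r c₁ (a ∸ i) (b ∸ r)) (λ e → n
  (≡ᵇ-true (proj₂ (∧-true {admissible (b ∸ r) c} (proj₂ (∧-true {b N.≤ᵇ a ∸ i} e)))) ,
   subst (b N.+ i N.≤_) (NP.m∸n+n≡m i≤a) (NP.+-monoˡ-≤ i (≤ᵇ-true (proj₁ (∧-true {b N.≤ᵇ a ∸ i} e)))))))

removal-on : ∀ a b c m i r c₁ → i N.+ (r N.+ c₁) ≡ m → b N.+ i N.≤ a →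
  removal a b c m i r c₁ ≡ [ admissible (b ∸ r) c ]ᵇ * stripFactor (+ a) (+ (a ∸ i)) (+ b) (+ (b ∸ r)) (+ c) i r c₁
removal-on a b c m i r c₁ refl le = cong (_* stripFactor (+ a) (+ (a ∸ i)) (+ b) (+ (b ∸ r)) (+ c) i r c₁) (cong [_]ᵇ (trans (cong₂ (λ x y → x ∧ (admissible (b ∸ r) c ∧ y)) (≤ᵇ-intro b≤) (≡ᵇ-refl (i N.+ (r N.+ c₁)))) (BP.∧-identityʳ (admissible (b ∸ r) c))))
  where
  b≤ : b N.≤ a ∸ i
  b≤ = subst (N._≤ a ∸ i) (NP.m+n∸n≡m b i) (NP.∸-monoˡ-≤ i le)

α-cong : ∀ {i i' r t t'} → i ≡ i' → t ≡ t' → α i r t ≡ α i' r t'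
α-cong refl refl = refl

angle-square-strip : ∀ t b' r i → angle (+ (t N.+ (b' N.+ r) N.+ i) I.- + (b' N.+ r)) (+ i) * square (+ (t N.+ (b' N.+ r) N.+ i) I.- + b') (+ r) ≡ α (+ i) (+ r) (+ t)
angle-square-strip t b' r i = trans (cong₂ (λ x y → angle x (+ i) * square y (+ r)) (e₁ (+ t) (+ b') (+ r) (+ i)) (e₂ (+ t) (+ b') (+ r) (+ i))) (angle-square i r t)
  where
  e₁ : ∀ t b r i → (t I.+ (b I.+ r) I.+ i) I.- (b I.+ r) ≡ i I.+ t
  e₁ = IR.solve-∀
  e₂ : ∀ t b r i → (t I.+ (b I.+ r) I.+ i) I.- b ≡ r I.+ (i I.+ t)
  e₂ = IR.solve-∀

arm-strip : ∀ t b' r c → arm (t N.+ (b' N.+ r) N.+ b' N.+ c) b' c I.- + r ≡ + t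
arm-strip t b' r c = lem (+ t) (+ b') (+ r) (+ c)
  where
  lem : ∀ t b r c → (t I.+ (b I.+ r) I.+ b I.+ c) I.- c I.- + 2 I.* b I.- r ≡ t
  lem = IR.solve-∀

stripFactor-0 : ∀ x₀ x₁ y₀ y₁ z₀ i r {A} → angle (x₀ I.- y₀) (+ i) * square (x₀ I.- y₁) (+ r) ≡ A → stripFactor x₀ x₁ y₀ y₁ z₀ i r 0 ≡ A
stripFactor-0 x₀ x₁ y₀ y₁ z₀ i r e = trans (QP.*-identityʳ (angle (x₀ I.- y₀) (+ i) * square (x₀ I.- y₁) (+ r))) e

stripFactor-1 : ∀ x₀ x₁ y₀ y₁ z₀ i r {A R} → angle (x₀ I.- y₀) (+ i) * square (x₀ I.- y₁) (+ r) ≡ A → RR x₁ x₀ y₁ y₀ z₀ ≡ R → stripFactor x₀ x₁ y₀ y₁ z₀ i r 1 ≡ A * R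
stripFactor-1 x₀ x₁ y₀ y₁ z₀ i r e₁ e₂ = cong₂ _*_ e₁ (trans (QP.*-identityʳ (RR x₁ x₀ y₁ y₀ z₀)) e₂)

stripFactor-ψ₀ : ∀ {a b m M a'} t b' r i c → b ≡ b' N.+ r → a' ≡ t N.+ b → a ≡ a' N.+ i → m ≡ i N.+ (r N.+ 0) → M ≡ a' N.+ b' N.+ c →
  stripFactor (+ a) (+ a') (+ b) (+ b') (+ c) i r 0 ≡ ψ₀ m M b' c r
stripFactor-ψ₀ {a} {b} {m} {M} {a'} t b' r i c refl refl refl refl refl = stripFactor-0 (+ a) (+ a') (+ b) (+ b') (+ c) i r {ψ₀ m M b' c r}
  (trans (angle-square-strip t b' r i) (α-cong {+ i} {+ m I.- + r} {+ r} {+ t} {arm M b' c I.- + r} (sym (lem (+ i) (+ r))) (sym (arm-strip t b' r c))))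
  where
  lem : ∀ i r → i I.+ (r I.+ + 0) I.- r ≡ i
  lem = IR.solve-∀

RR-strip : ∀ a b c i r {a'} → a ≡ suc a' → RR (+ a) (+ (a N.+ i)) (+ suc b) (+ (suc b N.+ r)) (+ suc c) ≡ Rfac (a N.+ suc b N.+ c) (suc b) c (+ suc i) r
RR-strip a b c i r {a'} e = subst (λ a → RR (+ a) (+ (a N.+ i)) (+ suc b) (+ (suc b N.+ r)) (+ suc c) ≡ Rfac (a N.+ suc b N.+ c) (suc b) c (+ suc i) r) (sym e) (RR-Rfac a' b c i r)

Rfac-strip : ∀ N b c i r → Rfac N b c (+ suc i) r ≡ Rfac N b c (+ (i N.+ (r N.+ 1)) I.- + r) r
Rfac-strip N b c i r = cong (λ I → Rfac N b c I r) {+ suc i} {+ (i N.+ (r N.+ 1)) I.- + r} (sym (lem₂ (+ i) (+ r)))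
  where
  lem₂ : ∀ i r → i I.+ (r I.+ + 1) I.- r ≡ + 1 I.+ i
  lem₂ = IR.solve-∀

α-strip : ∀ t b r i c → α (+ i) (+ r) (+ t) ≡ α (+ (i N.+ (r N.+ 1)) I.- + 1 I.- + r) (+ r) (arm (t N.+ (b N.+ r) N.+ b N.+ c) b c I.- + r)
α-strip t b r i c = α-cong {+ i} {+ (i N.+ (r N.+ 1)) I.- + 1 I.- + r} {+ r} {+ t} {arm (t N.+ (b N.+ r) N.+ b N.+ c) b c I.- + r} (sym (lem₁ (+ i) (+ r))) (sym (arm-strip t b r c))
  where
  lem₁ : ∀ i r → i I.+ (r I.+ + 1) I.- + 1 I.- r ≡ i
  lem₁ = IR.solve-∀

stripFactor-canonical : ∀ t b r i c → stripFactor (+ (t N.+ (suc b N.+ r) N.+ i)) (+ (t N.+ (suc b N.+ r))) (+ (suc b N.+ r)) (+ suc b) (+ suc c) i r 1 ≡ ψ₁ (i N.+ (r N.+ 1)) (t N.+ (suc b N.+ r) N.+ suc b N.+ c) (suc b) c r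
stripFactor-canonical t b r i c = stripFactor-1 (+ (t N.+ (suc b N.+ r) N.+ i)) (+ (t N.+ (suc b N.+ r))) (+ (suc b N.+ r)) (+ suc b) (+ suc c) i r
  (trans (angle-square-strip t (suc b) r i) (α-strip t (suc b) r i c))
  (trans (RR-strip (t N.+ (suc b N.+ r)) b c i r (NP.+-suc t (b N.+ r))) (Rfac-strip (t N.+ (suc b N.+ r) N.+ suc b N.+ c) (suc b) c i r))

ψ₁-cong : ∀ {m m' N N'} b c r → m ≡ m' → N ≡ N' → ψ₁ m N b c r ≡ ψ₁ m' N' b c r
ψ₁-cong b c r refl refl = refl

stripFactor-ψ₁ : ∀ {a b m M a'} t b' r i c → b ≡ suc b' N.+ r → a' ≡ t N.+ b → a ≡ a' N.+ i → m ≡ i N.+ (r N.+ 1) → M ≡ a' N.+ suc b' N.+ c →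
  stripFactor (+ a) (+ a') (+ b) (+ suc b') (+ suc c) i r 1 ≡ ψ₁ m M (suc b') c r
stripFactor-ψ₁ {a} {b} {m} {M} {a'} t b' r i c eb ea' ea em eM =
  trans (stripFactor-cong {x₀ = + a} {x₁ = + a'} {y₀ = + b} {y₁ = + suc b'} {z₀ = + suc c} {i = i} {r = r} {c = 1} (cong +_ (trans ea (cong (N._+ i) a'≡))) (cong +_ a'≡) (cong +_ eb) refl refl refl refl refl)
  (trans (stripFactor-canonical t b' r i c) (ψ₁-cong (suc b') c r (sym em) (sym (trans eM (cong (λ z → z N.+ suc b' N.+ c) a'≡)))))
  where
  a'≡ : a' ≡ t N.+ (suc b' N.+ r)
  a'≡ = trans ea' (cong (t N.+_) eb)

arm-size : ∀ {M} b r c {t} → arm M b c I.- + r ≡ + t → M ≡ t N.+ (b N.+ (b N.+ (c N.+ r)))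
arm-size {M} b r c q = IP.+-injective (trans (sym (lem (+ M) (+ b) (+ c) (+ r))) (cong (λ z → z I.+ (+ b I.+ (+ b I.+ (+ c I.+ + r)))) q))
  where
  lem : ∀ M b c r → (M I.- c I.- + 2 I.* b I.- r) I.+ (b I.+ (b I.+ (c I.+ r))) ≡ M
  lem = IR.solve-∀

-- Nonnegative arguments of α exhibit an actual horizontal strip, so a nonzero branching coefficient
-- always belongs to a possible removal.
strip-conditions : ∀ {a b m M} c₁ b' r c {i t} → a N.+ b N.+ (c N.+ c₁) ≡ m N.+ M → b ≡ b' N.+ r →
  + m I.- + c₁ I.- + r ≡ + i → arm M b' c I.- + r ≡ + t → i N.+ (r N.+ c₁) ≡ m × b N.+ i N.≤ a
strip-conditions {a} {b} {m} {M} c₁ b' r c {i} {t} size refl p q = m≡ , NP.≤-trans (NP.m≤m+n (b' N.+ r N.+ i) t) (NP.≤-reflexive (sym a≡))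
  where
  m≡ : i N.+ (r N.+ c₁) ≡ m
  m≡ = IP.+-injective (trans (cong (λ z → z I.+ (+ r I.+ + c₁)) (sym p)) (lem (+ m) (+ c₁) (+ r)))
    where
    lem : ∀ m c r → m I.- c I.- r I.+ (r I.+ c) ≡ m
    lem = IR.solve-∀
  a≡ : a ≡ b' N.+ r N.+ i N.+ t
  a≡ = NP.+-cancelʳ-≡ (b' N.+ r N.+ (c N.+ c₁)) a (b' N.+ r N.+ i N.+ t) (trans (sym (NP.+-assoc a (b' N.+ r) (c N.+ c₁))) (trans size (trans (cong₂ N._+_ (sym m≡) (arm-size b' r c q)) (lem i r c₁ t b' c))))
    where
    lem : ∀ i r c₁ t b c → i N.+ (r N.+ c₁) N.+ (t N.+ (b N.+ (b N.+ (c N.+ r)))) ≡ b N.+ r N.+ i N.+ t N.+ (b N.+ r N.+ (c N.+ c₁))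
    lem = NR.solve-∀

ψ₁-00 : ∀ m N r → ψ₁ m N 0 0 r ≡ 0ℚ
ψ₁-00 m N r = zero-*ʳ {x = α (+ m I.- + 1 I.- + r) (+ r) (arm N 0 0 I.- + r)} (zero-*ˡ (zero-*ʳ {x = h (𝐀 N 0 0)} h-minus-one))

F-0-suc : ∀ c μ → F 0 (suc c) μ ≡ 0ℚ
F-0-suc c μ = F-empty 0 (suc c) μ (λ { (inj₁ (_ , ()) , _) ; (inj₂ () , _) })

TabSum≡F : List ℕ → Set
TabSum≡F μ = ∀ a b c → b N.≤ a → 1 N.≤ b ⊎ c ≡ 0 → a N.+ b N.+ c ≡ NL.sum μ → tabSum a b c μ ≡ F b c μ

module _ (m : ℕ) (μ : List ℕ) (ih : TabSum≡F μ) (a b c : ℕ) (b≤a : b N.≤ a) (valid : 1 N.≤ b ⊎ c ≡ 0) (size : a N.+ b N.+ c ≡ m N.+ NL.sum μ) where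
  private
    M : ℕ
    M = NL.sum μ

  module Strip (r : ℕ) (r≤b : r N.≤ b) where
    private
      b' : ℕ
      b' = b ∸ r
      b≡ : b ≡ b' N.+ r
      b≡ = sym (NP.m∸n+n≡m r≤b)
      geometry : ∀ c₁ c' i → c ≡ c' N.+ c₁ → i N.+ (r N.+ c₁) ≡ m → b N.+ i N.≤ a →
        Σ ℕ λ t → a ∸ i ≡ t N.+ b × a ≡ (a ∸ i) N.+ i × M ≡ (a ∸ i) N.+ b' N.+ c'
      geometry c₁ c' i refl refl le = a ∸ (b N.+ i) , a'≡ , sym (NP.m∸n+n≡m i≤a) , M≡
        where
        i≤a : i N.≤ a
        i≤a = NP.≤-trans (NP.m≤n+m i b) le
        a'≡ : a ∸ i ≡ a ∸ (b N.+ i) N.+ b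
        a'≡ = trans (cong (_∸ i) (trans (sym (NP.m∸n+n≡m le)) (sym (NP.+-assoc (a ∸ (b N.+ i)) b i)))) (NP.m+n∸n≡m (a ∸ (b N.+ i) N.+ b) i)
        M≡ : M ≡ (a ∸ i) N.+ b' N.+ c'
        M≡ = NP.+-cancelˡ-≡ (i N.+ (r N.+ c₁)) M _ (trans (sym size) (trans (cong₂ (λ x y → x N.+ y N.+ (c' N.+ c₁)) (sym (NP.m∸n+n≡m i≤a)) b≡) (lem (a ∸ i) i b' r c' c₁)))
          where
          lem : ∀ a i b r c d → a N.+ i N.+ (b N.+ r) N.+ (c N.+ d) ≡ i N.+ (r N.+ d) N.+ (a N.+ b N.+ c)
          lem = NR.solve-∀
      b'≤a' : ∀ i t → a ∸ i ≡ t N.+ b → b' N.≤ a ∸ i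
      b'≤a' i t e = NP.≤-trans (NP.m∸n≤m b r) (NP.≤-trans (NP.m≤n+m b t) (NP.≤-reflexive (sym e)))

    strip₀ : ∑ (suc a) (λ i → removal a b c m i r 0 * tabSum (a ∸ i) b' c μ) ≡ ψ₀ m M b' c r * F b' c μ
    strip₀ = ∑-collapse a b (r N.+ 0) m _ _ (λ i i≤a n → zero-*ˡ (removal-off a b c m i r 0 i≤a n)) on none
      where
      on : ∀ i → i N.+ (r N.+ 0) ≡ m → b N.+ i N.≤ a → removal a b c m i r 0 * tabSum (a ∸ i) b' c μ ≡ ψ₀ m M b' c r * F b' c μ
      on i e le = trans (cong (_* tabSum (a ∸ i) b' c μ) (removal-on a b c m i r 0 e le)) (split b' c refl refl)
        where
        geo = geometry 0 c i (sym (NP.+-identityʳ c)) e le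
        good : admissible b' c ≡ true → 1 N.≤ b' ⊎ c ≡ 0 → [ admissible b' c ]ᵇ * stripFactor (+ a) (+ (a ∸ i)) (+ b) (+ b') (+ c) i r 0 * tabSum (a ∸ i) b' c μ ≡ ψ₀ m M b' c r * F b' c μ
        good ad v = cong₂ _*_ (trans (cong₂ (λ x y → [ x ]ᵇ * y) ad (stripFactor-ψ₀ (proj₁ geo) b' r i c b≡ (proj₁ (proj₂ geo)) (proj₁ (proj₂ (proj₂ geo))) (sym e) (proj₂ (proj₂ (proj₂ geo))))) (QP.*-identityˡ (ψ₀ m M b' c r)))
          (ih (a ∸ i) b' c (b'≤a' i (proj₁ geo) (proj₁ (proj₂ geo))) v (sym (proj₂ (proj₂ (proj₂ geo)))))
        split : ∀ x y → b' ≡ x → c ≡ y → [ admissible b' c ]ᵇ * stripFactor (+ a) (+ (a ∸ i)) (+ b) (+ b') (+ c) i r 0 * tabSum (a ∸ i) b' c μ ≡ ψ₀ m M b' c r * F b' c μ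
        -- The second row is emptied above a nonempty column: the removal is not admissible, and `F`
        -- is zero since no such shape exists.
        split zero (suc y) p q = trans (zero-*ˡ (zero-*ˡ (cong [_]ᵇ (cong₂ admissible p q)))) (sym (zero-*ʳ {x = ψ₀ m M b' c r} (trans (cong₂ (λ x y → F x y μ) p q) (F-0-suc y μ))))
        split zero zero    p q = good (cong₂ admissible p q) (inj₂ q)
        split (suc x) y    p q = good (cong₂ admissible p q) (inj₁ (subst (1 N.≤_) (sym p) (s≤s z≤n)))
      none : (∀ i → i N.+ (r N.+ 0) ≡ m → ¬ b N.+ i N.≤ a) → ψ₀ m M b' c r * F b' c μ ≡ 0ℚ
      none n = go (α-support (+ m I.- + r) (+ r) (arm M b' c I.- + r))
        where
        go : ψ₀ m M b' c r ≡ 0ℚ ⊎ (Σ ℕ λ i → Σ ℕ λ t → + m I.- + r ≡ + i × arm M b' c I.- + r ≡ + t) → ψ₀ m M b' c r * F b' c μ ≡ 0ℚ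
        go (inj₁ z) = zero-*ˡ z
        go (inj₂ (i , t , p , q)) = ⊥-elim (n i (proj₁ cond) (proj₂ cond))
          where
          cond = strip-conditions {a} {b} {m} {M} 0 b' r c {i} {t} (trans (cong (a N.+ b N.+_) (NP.+-identityʳ c)) size) b≡ (trans (cong (I._- + r) (m-0 (+ m))) p) q

    strip₁ : ∀ c' → c ≡ suc c' → ∑ (suc a) (λ i → removal a b c m i r 1 * tabSum (a ∸ i) b' c' μ) ≡ ψ₁ m M b' c' r * F b' c' μ
    strip₁ c' ec = ∑-collapse a b (r N.+ 1) m _ _ (λ i i≤a n → zero-*ˡ (removal-off a b c m i r 1 i≤a n)) on none
      where
      c≡ : c ≡ c' N.+ 1
      c≡ = trans ec (NP.+-comm 1 c')
      on : ∀ i → i N.+ (r N.+ 1) ≡ m → b N.+ i N.≤ a → removal a b c m i r 1 * tabSum (a ∸ i) b' c' μ ≡ ψ₁ m M b' c' r * F b' c' μ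
      on i e le = trans (cong (_* tabSum (a ∸ i) b' c' μ) (removal-on a b c m i r 1 e le)) (split b' refl)
        where
        geo = geometry 1 c' i c≡ e le
        split : ∀ x → b' ≡ x → [ admissible b' c ]ᵇ * stripFactor (+ a) (+ (a ∸ i)) (+ b) (+ b') (+ c) i r 1 * tabSum (a ∸ i) b' c' μ ≡ ψ₁ m M b' c' r * F b' c' μ
        -- The second row is emptied although the column was not empty. If the new column is empty
        -- the smaller shape does exist, but `ψ₁` vanishes there through h(-1).
        split zero p = trans (zero-*ˡ (zero-*ˡ (cong [_]ᵇ (cong₂ admissible p ec)))) (sym (right c' refl))
          where
          right : ∀ y → c' ≡ y → ψ₁ m M b' c' r * F b' c' μ ≡ 0ℚ
          right zero    q = zero-*ˡ (trans (cong₂ (λ x y → ψ₁ m M x y r) p q) (ψ₁-00 m M r))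
          right (suc y) q = zero-*ʳ {x = ψ₁ m M b' c' r} (trans (cong₂ (λ x y → F x y μ) p q) (F-0-suc y μ))
        split (suc x) p = cong₂ _*_ (trans (cong₂ _*_ (cong [_]ᵇ (cong₂ admissible p ec)) strip) (QP.*-identityˡ (ψ₁ m M b' c' r)))
          (ih (a ∸ i) b' c' (b'≤a' i (proj₁ geo) (proj₁ (proj₂ geo))) (inj₁ (subst (1 N.≤_) (sym p) (s≤s z≤n))) (sym (proj₂ (proj₂ (proj₂ geo)))))
          where
          strip : stripFactor (+ a) (+ (a ∸ i)) (+ b) (+ b') (+ c) i r 1 ≡ ψ₁ m M b' c' r
          strip = trans (cong₂ (λ x y → stripFactor (+ a) (+ (a ∸ i)) (+ b) (+ x) (+ y) i r 1) p ec)
            (trans (stripFactor-ψ₁ (proj₁ geo) x r i c' (trans b≡ (cong (N._+ r) p)) (proj₁ (proj₂ geo)) (proj₁ (proj₂ (proj₂ geo))) (sym e) (trans (proj₂ (proj₂ (proj₂ geo))) (cong (λ z → (a ∸ i) N.+ z N.+ c') p))) (cong (λ z → ψ₁ m M z c' r) (sym p)))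
      none : (∀ i → i N.+ (r N.+ 1) ≡ m → ¬ b N.+ i N.≤ a) → ψ₁ m M b' c' r * F b' c' μ ≡ 0ℚ
      none n = go (α-support (+ m I.- + 1 I.- + r) (+ r) (arm M b' c' I.- + r))
        where
        go : α (+ m I.- + 1 I.- + r) (+ r) (arm M b' c' I.- + r) ≡ 0ℚ ⊎ (Σ ℕ λ i → Σ ℕ λ t → + m I.- + 1 I.- + r ≡ + i × arm M b' c' I.- + r ≡ + t) → ψ₁ m M b' c' r * F b' c' μ ≡ 0ℚ
        go (inj₁ z) = zero-*ˡ (zero-*ˡ z)
        go (inj₂ (i , t , p , q)) = ⊥-elim (n i (proj₁ cond) (proj₂ cond))
          where
          cond = strip-conditions {a} {b} {m} {M} 1 b' r c' {i} {t} (trans (cong (a N.+ b N.+_) (sym c≡)) size) b≡ p q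

  tabSum-F-∷ : tabSum a b c (m ∷ μ) ≡ F b c (m ∷ μ)
  tabSum-F-∷ = begin
    tabSum a b c (m ∷ μ)
      ≡⟨ tabSum-∷ a b c m μ b≤a valid ⟩
    ∑ (suc a) (λ i → ∑ (suc b) (λ r → X i r + Y i r))
      ≡⟨ ∑-swap (suc a) (suc b) {λ i r → X i r + Y i r} ⟩
    ∑ (suc b) (λ r → ∑ (suc a) (λ i → X i r + Y i r))
      ≡⟨ ∑-cong (suc b) (λ r → ∑-+ (suc a) {λ i → X i r} {λ i → Y i r}) ⟩
    ∑ (suc b) (λ r → ∑ (suc a) (λ i → X i r) + ∑ (suc a) (λ i → Y i r))
      ≡⟨ ∑-+ (suc b) {λ r → ∑ (suc a) (λ i → X i r)} {λ r → ∑ (suc a) (λ i → Y i r)} ⟩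
    ∑ (suc b) (λ r → ∑ (suc a) (λ i → X i r)) + ∑ (suc b) (λ r → ∑ (suc a) (λ i → Y i r))
      ≡⟨ cong₂ _+_ (∑-cong< (suc b) (λ r r<b → Strip.strip₀ r (NP.≤-pred r<b))) (lowered c refl) ⟩
    ∑ (suc b) (λ r → ψ₀ m M (b ∸ r) c r * F (b ∸ r) c μ) + pred-shift (λ c' → ∑ (suc b) (λ r → ψ₁ m M (b ∸ r) c' r * F (b ∸ r) c' μ)) c
      ≡⟨ sym (F-∷ b c m μ (subst (b N.≤_) size (NP.≤-trans (NP.m≤n+m b a) (NP.m≤m+n (a N.+ b) c)))) ⟩
    F b c (m ∷ μ) ∎
    where
    X Y : ℕ → ℕ → ℚ
    X i r = removal a b c m i r 0 * tabSum (a ∸ i) (b ∸ r) c μ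
    Y i r = pred-shift (λ c' → removal a b c m i r 1 * tabSum (a ∸ i) (b ∸ r) c' μ) c
    lowered : ∀ d → c ≡ d → ∑ (suc b) (λ r → ∑ (suc a) (λ i → pred-shift (λ c' → removal a b c m i r 1 * tabSum (a ∸ i) (b ∸ r) c' μ) d)) ≡ pred-shift (λ c' → ∑ (suc b) (λ r → ψ₁ m M (b ∸ r) c' r * F (b ∸ r) c' μ)) d
    lowered zero    _ = ∑-0 (suc b) (λ r _ → ∑-0 (suc a) (λ i _ → refl))
    lowered (suc d) e = ∑-cong< (suc b) (λ r r<b → Strip.strip₁ r (NP.≤-pred r<b) d e)

tabSum-F : ∀ μ → TabSum≡F μ
tabSum-F []      zero zero zero _ _ _ = refl
tabSum-F (m ∷ μ) a b c b≤a v size = tabSum-F-∷ m μ (tabSum-F μ) a b c b≤a v size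

-- Triangularity and the leading coefficient

-- The number of boxes of the shape of size N with parameters (b , c) below its first k rows.
rowsBelow : ℕ → ℕ → ℕ → ℕ → ℕ
rowsBelow zero          N b c = N
rowsBelow (suc zero)    N b c = b N.+ c
rowsBelow (suc (suc k)) N b c = c ∸ k

-- A horizontal strip takes at most one box from each column, so what is left contains the old shape
-- without its first row.
rowsBelow-strip : ∀ {N M} k b c r c' {t} → arm M b c' I.- + r ≡ + t → c N.≤ b N.+ c' → c N.≤ suc c' → rowsBelow (suc k) N (b N.+ r) c N.≤ rowsBelow k M b c'
rowsBelow-strip zero b c r c' {t} q c≤ _ = NP.≤-trans (NP.+-monoʳ-≤ (b N.+ r) c≤) (NP.≤-trans (NP.m≤n+m _ t) (NP.≤-reflexive (sym (trans (arm-size b r c' q) (cong (t N.+_) (lem b c' r))))))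
  where
  lem : ∀ b c r → b N.+ (b N.+ (c N.+ r)) ≡ b N.+ r N.+ (b N.+ c)
  lem = NR.solve-∀
rowsBelow-strip (suc zero)    b c r c' q c≤ _  = c≤
rowsBelow-strip (suc (suc k)) b c r c' q _  c≤ = NP.∸-monoˡ-≤ (suc k) c≤

-- Removing a strip leaves at least as many boxes below row k as there were below row k + 1. After k
-- removals the whole remaining size, which is the sum of the later parts of μ, must be at least the
-- original number below row k.
F-triangular : ∀ μ k b c → NL.sum (drop k μ) N.< rowsBelow k (NL.sum μ) b c → F b c μ ≡ 0ℚ
F-triangular μ zero b c lt = ⊥-elim (NP.<-irrefl refl lt)
F-triangular [] (suc k) b c lt = δ²-≢ {b} {c} {0} {0} (λ e → NP.<⇒≱ lt (none k (proj₁ e) (proj₂ e)))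
  where
  none : ∀ k → 0 ≡ b → 0 ≡ c → rowsBelow (suc k) 0 b c N.≤ 0
  none zero    refl refl = z≤n
  none (suc k) refl refl = NP.≤-reflexive (NP.0∸n≡0 k)
F-triangular (m ∷ μ) (suc k) b c lt = go (b N.≤? m N.+ M)
  where
  M : ℕ
  M = NL.sum μ
  below : ∀ r c' {t} → r N.≤ b → arm M (b ∸ r) c' I.- + r ≡ + t → c N.≤ b ∸ r N.+ c' → c N.≤ suc c' → F (b ∸ r) c' μ ≡ 0ℚ
  below r c' r≤b q c≤ c≤′ = F-triangular μ k (b ∸ r) c' (NP.≤-trans lt (subst (λ b' → rowsBelow (suc k) (m N.+ M) b' c N.≤ rowsBelow k M (b ∸ r) c') (NP.m∸n+n≡m r≤b) (rowsBelow-strip {m N.+ M} {M} k (b ∸ r) c r c' q c≤ c≤′)))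
  same : ∀ r → r N.≤ b → ψ₀ m M (b ∸ r) c r * F (b ∸ r) c μ ≡ 0ℚ
  same r r≤b = case (α-support (+ m I.- + r) (+ r) (arm M (b ∸ r) c I.- + r))
    where
    case : ψ₀ m M (b ∸ r) c r ≡ 0ℚ ⊎ (Σ ℕ λ i → Σ ℕ λ t → + m I.- + r ≡ + i × arm M (b ∸ r) c I.- + r ≡ + t) → ψ₀ m M (b ∸ r) c r * F (b ∸ r) c μ ≡ 0ℚ
    case (inj₁ z) = zero-*ˡ z
    case (inj₂ (_ , _ , _ , q)) = zero-*ʳ {x = ψ₀ m M (b ∸ r) c r} (below r c r≤b q (NP.m≤n+m c (b ∸ r)) (NP.n≤1+n c))
  lower : ∀ r c' → c ≡ suc c' → r N.≤ b → ψ₁ m M (b ∸ r) c' r * F (b ∸ r) c' μ ≡ 0ℚ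
  lower r c' ec r≤b = case (α-support (+ m I.- + 1 I.- + r) (+ r) (arm M (b ∸ r) c' I.- + r)) (b ∸ r) refl c' refl
    where
    case : α (+ m I.- + 1 I.- + r) (+ r) (arm M (b ∸ r) c' I.- + r) ≡ 0ℚ ⊎ (Σ ℕ λ i → Σ ℕ λ t → + m I.- + 1 I.- + r ≡ + i × arm M (b ∸ r) c' I.- + r ≡ + t) →
      ∀ x → b ∸ r ≡ x → ∀ y → c' ≡ y → ψ₁ m M (b ∸ r) c' r * F (b ∸ r) c' μ ≡ 0ℚ
    case (inj₁ z) _ _ _ _ = zero-*ˡ (zero-*ˡ z)
    case (inj₂ _) zero p zero    q = zero-*ˡ (trans (cong₂ (λ x y → ψ₁ m M x y r) p q) (ψ₁-00 m M r))
    case (inj₂ _) zero p (suc y) q = zero-*ʳ {x = ψ₁ m M (b ∸ r) c' r} (trans (cong₂ (λ x y → F x y μ) p q) (F-0-suc y μ))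
    case (inj₂ (_ , _ , _ , q)) (suc x) p _ _ = zero-*ʳ {x = ψ₁ m M (b ∸ r) c' r} (below r c' r≤b q (subst (λ z → c N.≤ z N.+ c') (sym p) (NP.≤-trans (NP.≤-reflexive ec) (s≤s (NP.m≤n+m c' x)))) (NP.≤-reflexive ec))
  lowered : ∀ d → c ≡ d → pred-shift (λ c' → ∑ (suc b) (λ r → ψ₁ m M (b ∸ r) c' r * F (b ∸ r) c' μ)) d ≡ 0ℚ
  lowered zero    _ = refl
  lowered (suc d) e = ∑-0 (suc b) (λ r r<b → lower r d e (NP.≤-pred r<b))
  go : Dec (b N.≤ m N.+ M) → F b c (m ∷ μ) ≡ 0ℚ
  go (no n)   = F-empty b c (m ∷ μ) (λ { (_ , n' , e) → n (subst (b N.≤_) (sym e) (NP.≤-trans (NP.m≤m+n b (b N.+ 0 N.+ c)) (NP.≤-trans (NP.≤-reflexive (sym (NP.+-assoc b (b N.+ 0) c))) (NP.m≤n+m (2 N.* b N.+ c) n')))) })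
  go (yes b≤) = trans (F-∷ b c m μ b≤) (zero-sum (∑-0 (suc b) (λ r r<b → same r (NP.≤-pred r<b))) (lowered c refl))

sum-take-drop : ∀ k μ → NL.sum (take k μ) N.+ NL.sum (drop k μ) ≡ NL.sum μ
sum-take-drop k μ = trans (sym (NLP.sum-++ (take k μ) (drop k μ))) (cong NL.sum (LP.take++drop≡id k μ))

sum-ones : ∀ c → NL.sum (replicate c 1) ≡ c
sum-ones zero    = refl
sum-ones (suc c) = cong suc (sum-ones c)

sum-drop-shape : ∀ a b c → 1 N.≤ b ⊎ c ≡ 0 → ∀ k → NL.sum (drop k (shape a b c)) ≡ rowsBelow k (a N.+ b N.+ c) b c
sum-drop-shape a zero c (inj₁ ()) k
sum-drop-shape a zero c (inj₂ refl) zero = sym (trans (cong (N._+ 0) (NP.+-identityʳ a)) refl)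
sum-drop-shape a zero c (inj₂ refl) (suc zero) = refl
sum-drop-shape a zero c (inj₂ refl) (suc (suc k)) = sym (NP.0∸n≡0 k)
sum-drop-shape a (suc b) c _ zero = trans (cong (λ z → a N.+ (suc b N.+ z)) (sum-ones c)) (sym (NP.+-assoc a (suc b) c))
sum-drop-shape a (suc b) c _ (suc zero) = cong (suc b N.+_) (sum-ones c)
sum-drop-shape a (suc b) c _ (suc (suc k)) = trans (cong NL.sum (drop-ones k c)) (sum-ones (c ∸ k))
  where
  drop-ones : ∀ k c → drop k (replicate c 1) ≡ replicate (c ∸ k) 1
  drop-ones zero    c       = refl
  drop-ones (suc k) zero    = refl
  drop-ones (suc k) (suc c) = drop-ones k c

allB-false : ∀ (p : ℕ → Bool) xs → allB p xs ≡ false → Σ ℕ λ x → p x ≡ false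
allB-false p (x ∷ xs) e = go (p x) refl
  where
  go : ∀ b → p x ≡ b → Σ ℕ λ x → p x ≡ false
  go false q = x , q
  go true  q = allB-false p xs (trans (sym (cong (_∧ allB p xs) q)) e)

-- A prefix of μ that is too large leaves a tail that is too small, the totals being equal.
dom-drop : ∀ μ lam → NL.sum μ ≡ NL.sum lam → dom μ lam ≡ false → Σ ℕ λ k → NL.sum (drop k μ) N.< NL.sum (drop k lam)
dom-drop μ lam s e = k , NP.≰⇒> (λ le → taller (NP.+-cancelʳ-≤ (NL.sum (drop k lam)) _ _ (NP.≤-trans (NP.+-monoʳ-≤ (NL.sum (take k μ)) le) (NP.≤-reflexive (trans (sum-take-drop k μ) (trans s (sym (sum-take-drop k lam))))))))
  where
  found : Σ ℕ λ k → (NL.sum (take k μ) N.≤ᵇ NL.sum (take k lam)) ≡ false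
  found = allB-false (λ k → NL.sum (take k μ) N.≤ᵇ NL.sum (take k lam)) (upTo (suc (NL.sum μ N.+ NL.sum lam))) e
  k : ℕ
  k = proj₁ found
  taller : ¬ NL.sum (take k μ) N.≤ NL.sum (take k lam)
  taller le = false≢true (proj₂ found) (≤ᵇ-intro le)

F-dominance : ∀ a b c μ → 1 N.≤ b ⊎ c ≡ 0 → NL.sum μ ≡ a N.+ b N.+ c → dom μ (shape a b c) ≡ false → F b c μ ≡ 0ℚ
F-dominance a b c μ v s e = F-triangular μ k b c (NP.<-≤-trans (proj₂ witness) (NP.≤-reflexive (trans (sum-drop-shape a b c v k) (cong (λ N → rowsBelow k N b c) (sym s)))))
  where
  witness : Σ ℕ λ k → NL.sum (drop k μ) N.< NL.sum (drop k (shape a b c))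
  witness = dom-drop μ (shape a b c) (trans s (sym (sum-drop-shape a b c v 0))) e
  k : ℕ
  k = proj₁ witness

-- The leading coefficient

F-row : ∀ m → F 0 0 (m ∷ []) ≡ 1ℚ
F-row m = begin
  F 0 0 (m ∷ [])
    ≡⟨ F-∷ 0 0 m [] z≤n ⟩
  ψ₀ m 0 0 0 0 * (1ℚ * 1ℚ) + 0ℚ + 0ℚ
    ≡⟨ l (ψ₀ m 0 0 0 0) ⟩
  α (+ m I.- + 0) (+ 0) (+ 0)
    ≡⟨ value (m-0 (+ m)) ⟩
  1ℚ ∎
  where
  l : ∀ x → x * (1ℚ * 1ℚ) + 0ℚ + 0ℚ ≡ x
  l = solve-∀ ring
  l′ : ∀ g k m → g * 1ℚ * 1ℚ * k * (2ℚ * (m + 0ℚ) + 1ℚ) ≡ g * k * (2ℚ * m + 1ℚ)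
  l′ = solve-∀ ring
  e : ∀ m → m I.+ + 0 I.+ + 0 ≡ m
  e = IR.solve-∀
  subst₃ : ∀ g {o k z} → o ≡ 1ℚ → k ≡ κ (+ m) → z ≡ 0ℚ → g * o * o * k * (2ℚ * (ι (+ m) + z) + 1ℚ) ≡ g * κ (+ m) * (2ℚ * ι (+ m) + 1ℚ)
  subst₃ g refl refl refl = l′ g (κ (+ m)) (ι (+ m))
  value : ∀ {i} → i ≡ + m → α i (+ 0) (+ 0) ≡ 1ℚ
  value refl = trans (subst₃ (γ (+ m)) γ-0 (cong κ (e (+ m))) ι-0) (γκ-inv m)

-- The bracket [b + n over b] in the form of `square-γ`. For rows of lengths `suc b N.+ n` and
-- `suc b` it is the bracket in the denominator of f.
leading : ℕ → ℕ → ℚ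
leading b n = γ (+ b) * γ (+ n) * κ (+ (b N.+ n)) * (2ℚ * ι (+ n) + 1ℚ)

α-leading : ∀ b n {i t} → i ≡ + n → t ≡ + 0 → α i (+ b) t ≡ leading b n
α-leading b n refl refl = subst₃ γ-0 (cong κ (lem (+ n) (+ b))) ι-0
  where
  lem : ∀ n b → n I.+ b I.+ + 0 ≡ b I.+ n
  lem = IR.solve-∀
  l : ∀ g h k n → g * h * 1ℚ * k * (2ℚ * (n + 0ℚ) + 1ℚ) ≡ h * g * k * (2ℚ * n + 1ℚ)
  l = solve-∀ ring
  subst₃ : ∀ {o k z} → o ≡ 1ℚ → k ≡ κ (+ (b N.+ n)) → z ≡ 0ℚ → γ (+ n) * γ (+ b) * o * k * (2ℚ * (ι (+ n) + z) + 1ℚ) ≡ leading b n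
  subst₃ refl refl refl = l (γ (+ n)) (γ (+ b)) (κ (+ (b N.+ n))) (ι (+ n))

γ-h : ∀ b → γ (+ suc b) * h (+ suc (2 N.* b)) ≡ γ (+ b)
γ-h b = begin
  γ (+ suc b) * h v
    ≡⟨ cong₂ _*_ (trans (γ-+ (suc b)) (cong₂ (λ g z → g * (ι (z I.- + 1) * ρ z)) (sym (γ-+ b)) w≡)) (h-quotient v (λ ())) ⟩
  γ (+ b) * (ι v * ρ w) * (ι (v I.+ + 1) * ρ v)
    ≡⟨ cong (λ z → γ (+ b) * (ι v * ρ w) * (ι z * ρ v)) (cong +_ (NP.+-comm (suc (2 N.* b)) 1)) ⟩
  γ (+ b) * (ι v * ρ w) * (ι w * ρ v)
    ≡⟨ trans (l (γ (+ b)) (ι v) (ρ v) (ι w) (ρ w)) (cong₂ (λ x y → γ (+ b) * (x * y)) (ρ-inv v (λ ())) (ρ-inv w (λ ()))) ⟩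
  γ (+ b) * (1ℚ * 1ℚ)
    ≡⟨ QP.*-identityʳ (γ (+ b)) ⟩
  γ (+ b) ∎
  where
  v w : ℤ
  v = + suc (2 N.* b)
  w = + suc (suc (2 N.* b))
  w≡ : + 2 I.* + suc b ≡ w
  w≡ = trans (sym (IP.pos-* 2 (suc b))) (cong +_ (2*-suc b))
  l : ∀ g a b c d → g * (a * d) * (c * b) ≡ g * (a * b * (c * d))
  l = solve-∀ ring

κ-h : ∀ x → κ (+ suc x) * h (+ suc (suc (2 N.* x))) ≡ κ (+ x)
κ-h x = begin
  κ (+ suc x) * h v
    ≡⟨ cong₂ _*_ (trans (κ-+ (suc x)) (trans (cong (_* (ι (+ 2 I.* + suc x) * ρ (+ 2 I.* (+ suc x I.+ + 1) I.- + 1))) (sym (κ-+ x))) (cong₂ (λ y z → κ (+ x) * (ι y * ρ z)) v≡ w≡))) (h-quotient v (λ ())) ⟩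
  κ (+ x) * (ι v * ρ (v I.+ + 1)) * (ι (v I.+ + 1) * ρ v)
    ≡⟨ trans (l (κ (+ x)) (ι v) (ρ v) (ι (v I.+ + 1)) (ρ (v I.+ + 1))) (cong₂ (λ x' y → κ (+ x) * (x' * y)) (ρ-inv v (λ ())) (ρ-inv (v I.+ + 1) (λ ()))) ⟩
  κ (+ x) * (1ℚ * 1ℚ)
    ≡⟨ QP.*-identityʳ (κ (+ x)) ⟩
  κ (+ x) ∎
  where
  v : ℤ
  v = + suc (suc (2 N.* x))
  v≡ : + 2 I.* + suc x ≡ v
  v≡ = trans (sym (IP.pos-* 2 (suc x))) (cong +_ (2*-suc x))
  w≡ : + 2 I.* (+ suc x I.+ + 1) I.- + 1 ≡ v I.+ + 1
  w≡ = trans (lem (+ suc x)) (cong (λ z → z I.+ + 1) v≡)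
    where
    lem : ∀ y → + 2 I.* (y I.+ + 1) I.- + 1 ≡ + 2 I.* y I.+ + 1
    lem = IR.solve-∀
  l : ∀ g a b c d → g * (a * d) * (c * b) ≡ g * (a * b * (c * d))
  l = solve-∀ ring

leading-0-inv : ∀ b → leading 0 b ≡ 1ℚ
leading-0-inv b = trans (cong (λ g → g * γ (+ b) * κ (+ b) * (2ℚ * ι (+ b) + 1ℚ)) γ-0) (trans (cong (λ x → x * κ (+ b) * (2ℚ * ι (+ b) + 1ℚ)) (QP.*-identityˡ (γ (+ b)))) (γκ-inv b))

arm-lost : ∀ {M} b c r s → M ≡ s N.+ (b N.+ r) N.+ c → arm M b c I.- + r ≡ + s I.- + b
arm-lost b c r s refl = lem (+ b) (+ c) (+ r) (+ s)
  where
  lem : ∀ b c r s → s I.+ (b I.+ r) I.+ c I.- c I.- + 2 I.* b I.- r ≡ s I.- b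
  lem = IR.solve-∀

module _ (b n : ℕ) where
  private
    a : ℕ
    a = suc b N.+ n

  -- Only one last strip survives: it takes the whole second row and the overhang n of the first,
  -- leaving a single row. The two factors h then lower `leading (suc b) n` to `leading b n`.
  F-leading-0 : F (suc b) 0 (a ∷ suc b ∷ []) * hh (a N.+ suc b N.+ 0) (suc b) 0 ≡ leading b n
  F-leading-0 = begin
    F (suc b) 0 (a ∷ μ) * hh (a N.+ suc b N.+ 0) (suc b) 0
      ≡⟨ cong₂ _*_ top (cong₂ (λ x y → h x * h y) (trans (𝐀-shape a (suc b) 0) (cong +_ (trans (NP.+-identityʳ (2 N.* a)) (2*-suc (b N.+ n))))) (trans (𝐁-suc b 0) (cong (+_ ∘ suc) (NP.+-identityʳ (2 N.* b))))) ⟩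
    leading (suc b) n * (h (+ suc (suc (2 N.* (b N.+ n)))) * h (+ suc (2 N.* b)))
      ≡⟨ l (γ (+ suc b)) (γ (+ n)) (κ (+ suc (b N.+ n))) (2ℚ * ι (+ n) + 1ℚ) (h (+ suc (suc (2 N.* (b N.+ n))))) (h (+ suc (2 N.* b))) ⟩
    γ (+ suc b) * h (+ suc (2 N.* b)) * γ (+ n) * (κ (+ suc (b N.+ n)) * h (+ suc (suc (2 N.* (b N.+ n))))) * (2ℚ * ι (+ n) + 1ℚ)
      ≡⟨ cong₂ (λ x y → x * γ (+ n) * y * (2ℚ * ι (+ n) + 1ℚ)) (γ-h b) (κ-h (b N.+ n)) ⟩
    leading b n ∎
    where
    μ : List ℕ
    μ = suc b ∷ []
    M : ℕ
    M = suc b N.+ 0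
    l : ∀ g g' k o x y → g * g' * k * o * (x * y) ≡ g * y * g' * (k * x) * o
    l = solve-∀ ring
    arm≡ : ∀ r → r N.≤ suc b → arm M (suc b ∸ r) 0 I.- + r ≡ + 0 I.- + (suc b ∸ r)
    arm≡ r r≤b = arm-lost (suc b ∸ r) 0 r 0 (cong (N._+ 0) (sym (NP.m∸n+n≡m r≤b)))
    other : ∀ r → r N.< suc (suc b) → r ≢ suc b → ψ₀ a M (suc b ∸ r) 0 r * F (suc b ∸ r) 0 μ ≡ 0ℚ
    other r r<b ne = zero-*ˡ (α-0ᵗ (+ a I.- + r) (+ r) (trans (cong γ (arm≡ r (NP.≤-pred r<b))) (γ-minus (NP.m<n⇒0<n∸m (NP.≤∧≢⇒< (NP.≤-pred r<b) ne)))))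
    top : F (suc b) 0 (a ∷ μ) ≡ leading (suc b) n
    top = begin
      F (suc b) 0 (a ∷ μ)
        ≡⟨ trans (F-∷ (suc b) 0 a μ (NP.≤-trans (NP.m≤m+n (suc b) n) (NP.m≤m+n a M))) (QP.+-identityʳ (∑ (suc (suc b)) (λ r → ψ₀ a M (suc b ∸ r) 0 r * F (suc b ∸ r) 0 μ))) ⟩
      ∑ (suc (suc b)) (λ r → ψ₀ a M (suc b ∸ r) 0 r * F (suc b ∸ r) 0 μ)
        ≡⟨ ∑-single (suc (suc b)) (suc b) {λ r → ψ₀ a M (suc b ∸ r) 0 r * F (suc b ∸ r) 0 μ} NP.≤-refl other ⟩
      ψ₀ a M (suc b ∸ suc b) 0 (suc b) * F (suc b ∸ suc b) 0 μ
        ≡⟨ cong₂ _*_ (α-leading (suc b) n (lem (+ b) (+ n)) (trans (arm≡ (suc b) NP.≤-refl) (cong (λ z → + 0 I.- + z) (NP.n∸n≡0 b)))) (trans (cong (λ z → F z 0 μ) (NP.n∸n≡0 b)) (F-row (suc b))) ⟩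
      leading (suc b) n * 1ℚ
        ≡⟨ QP.*-identityʳ (leading (suc b) n) ⟩
      leading (suc b) n ∎
      where
      lem : ∀ b n → (+ 1 I.+ b I.+ n) I.- (+ 1 I.+ b) ≡ n
      lem = IR.solve-∀

  -- The last strip must take the bottom of the column, b boxes of the second row and n of the
  -- first, leaving (b + 1 , 1 , 1^c). Its own normalised coefficient is `leading 0 b` = 1, and `hh`
  -- of the full shape cancels the factors hᵒ of R.
  F-leading-suc : ∀ c → F 1 c (suc b ∷ 1 ∷ replicate c 1) * hh (suc b N.+ 1 N.+ c) 1 c ≡ leading 0 b →
    F (suc b) (suc c) (a ∷ suc b ∷ replicate (suc c) 1) * hh (a N.+ suc b N.+ suc c) (suc b) (suc c) ≡ leading b n
  F-leading-suc c ih = begin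
    F (suc b) (suc c) (a ∷ μ) * hh N (suc b) (suc c)
      ≡⟨ cong₂ _*_ top (cong₂ (λ x y → h x * h y) 𝐀≡ 𝐁≡) ⟩
    leading b n * (hh M 1 c * (hᵒ V * hᵒ W)) * F 1 c μ * (h (V I.- + 1) * h (W I.- + 1))
      ≡⟨ l (leading b n) (hh M 1 c) (hᵒ V) (hᵒ W) (F 1 c μ) (h (V I.- + 1)) (h (W I.- + 1)) ⟩
    leading b n * (F 1 c μ * hh M 1 c) * (hᵒ V * h (V I.- + 1) * (hᵒ W * h (W I.- + 1)))
      ≡⟨ cong₂ (λ x y → leading b n * x * y) (trans (cong (λ z → F 1 c μ * hh z 1 c) M≡′) (trans ih (leading-0-inv b))) (cong₂ _*_ (h-hᵒ V (suc≢0 V≡) (λ e → two≢1 (trans (sym V≡) e))) (h-hᵒ W (suc≢0 W≡) (λ e → two≢1 (trans (sym W≡) e)))) ⟩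
    leading b n * 1ℚ * (1ℚ * 1ℚ)
      ≡⟨ trans (QP.*-identityʳ (leading b n * 1ℚ)) (QP.*-identityʳ (leading b n)) ⟩
    leading b n ∎
    where
    μ : List ℕ
    μ = suc b ∷ replicate (suc c) 1
    N M : ℕ
    N = a N.+ suc b N.+ suc c
    M = NL.sum μ
    V W : ℤ
    V = 𝐀 M 1 c I.+ + 2 I.* (+ a I.- + b)
    W = 𝐁 1 c I.+ + 2 I.* + suc b
    two≢1 : ∀ {k} → + suc (suc k) ≢ + 1
    two≢1 ()
    l : ∀ s H p q f x y → s * (H * (p * q)) * f * (x * y) ≡ s * (f * H) * (p * x * (q * y))
    l = solve-∀ ring
    M≡ : M ≡ suc b N.+ suc c
    M≡ = cong (suc b N.+_) (sum-ones (suc c))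
    M≡′ : M ≡ suc b N.+ 1 N.+ c
    M≡′ = trans M≡ (sym (NP.+-assoc (suc b) 1 c))
    V≡ : V ≡ + suc (suc (2 N.* a N.+ c))
    V≡ = trans (cong (λ z → z I.+ + 2 I.* (+ a I.- + b)) (trans (cong (λ z → 𝐀 z 1 c) M≡′) (𝐀-shape (suc b) 1 c)))
      (trans (cong (λ z → z I.+ + c I.+ + 2 I.* (+ a I.- + b)) (IP.pos-* 2 (suc b)))
      (trans (lem (+ b) (+ n) (+ c)) (double-pos a c 2)))
      where
      lem : ∀ b n c → + 2 I.* (+ 1 I.+ b) I.+ c I.+ + 2 I.* ((+ 1 I.+ b I.+ n) I.- b) ≡ + 2 I.+ (+ 2 I.* (+ 1 I.+ b I.+ n) I.+ c)
      lem = IR.solve-∀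
    W≡ : W ≡ + suc (suc (2 N.* b N.+ suc c))
    W≡ = trans (lem (+ b) (+ c)) (double-pos b (suc c) 2)
      where
      lem : ∀ b c → + 2 I.* + 1 I.+ c I.- + 1 I.+ + 2 I.* (+ 1 I.+ b) ≡ + 2 I.+ (+ 2 I.* b I.+ (+ 1 I.+ c))
      lem = IR.solve-∀
    𝐀≡ : 𝐀 N (suc b) (suc c) ≡ V I.- + 1
    𝐀≡ = trans (𝐀-shape a (suc b) (suc c)) (trans (cong +_ (NP.+-suc (2 N.* a) c)) (cong (I._- + 1) (sym V≡)))
    𝐁≡ : 𝐁 (suc b) (suc c) ≡ W I.- + 1
    𝐁≡ = trans (𝐁-suc b (suc c)) (cong (I._- + 1) (sym W≡))
    b≤ : suc b N.≤ a N.+ M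
    b≤ = NP.≤-trans (NP.m≤m+n (suc b) n) (NP.m≤m+n a M)
    same : ∀ r → r N.< suc (suc b) → ψ₀ a M (suc b ∸ r) (suc c) r * F (suc b ∸ r) (suc c) μ ≡ 0ℚ
    same r r<b = go (suc b ∸ r) refl
      where
      go : ∀ x → suc b ∸ r ≡ x → ψ₀ a M (suc b ∸ r) (suc c) r * F (suc b ∸ r) (suc c) μ ≡ 0ℚ
      go zero    e = zero-*ʳ {x = ψ₀ a M (suc b ∸ r) (suc c) r} (trans (cong (λ z → F z (suc c) μ) e) (F-0-suc c μ))
      go (suc x) e = zero-*ˡ (α-0ᵗ (+ a I.- + r) (+ r) (trans (cong γ (arm-lost (suc b ∸ r) (suc c) r 0 (trans M≡ (cong (N._+ suc c) (sym (NP.m∸n+n≡m (NP.≤-pred r<b))))))) (γ-minus {0} (subst (1 N.≤_) (sym e) (s≤s z≤n)))))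
    arm≡ : ∀ r → r N.≤ suc b → arm M (suc b ∸ r) c I.- + r ≡ + 1 I.- + (suc b ∸ r)
    arm≡ r r≤b = arm-lost (suc b ∸ r) c r 1 (trans M≡ (trans (NP.+-suc (suc b) c) (cong (λ z → suc (z N.+ c)) (sym (NP.m∸n+n≡m r≤b)))))
    other : ∀ r → r N.< suc (suc b) → r ≢ b → ψ₁ a M (suc b ∸ r) c r * F (suc b ∸ r) c μ ≡ 0ℚ
    other r r<b ne = go (suc b ∸ r) refl c refl
      where
      go : ∀ x → suc b ∸ r ≡ x → ∀ y → c ≡ y → ψ₁ a M (suc b ∸ r) c r * F (suc b ∸ r) c μ ≡ 0ℚ
      go zero e zero    q = zero-*ˡ (trans (cong₂ (λ x y → ψ₁ a M x y r) e q) (ψ₁-00 a M r))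
      go zero e (suc y) q = zero-*ʳ {x = ψ₁ a M (suc b ∸ r) c r} (trans (cong₂ (λ x y → F x y μ) e q) (F-0-suc y μ))
      go (suc zero) e _ _ = ⊥-elim (ne (NP.suc-injective (trans (cong (N._+ r) (sym e)) (NP.m∸n+n≡m (NP.≤-pred r<b)))))
      go (suc (suc x)) e _ _ = zero-*ˡ (zero-*ˡ (α-0ᵗ (+ a I.- + 1 I.- + r) (+ r) (trans (cong γ (arm≡ r (NP.≤-pred r<b))) (γ-minus {1} (subst (2 N.≤_) (sym e) (s≤s (s≤s z≤n)))))))
    one : suc b ∸ b ≡ 1
    one = trans (NP.+-∸-assoc 1 (NP.≤-refl {b})) (cong suc (NP.n∸n≡0 b))
    top : F (suc b) (suc c) (a ∷ μ) ≡ leading b n * (hh M 1 c * (hᵒ V * hᵒ W)) * F 1 c μ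
    top = begin
      F (suc b) (suc c) (a ∷ μ)
        ≡⟨ F-∷ (suc b) (suc c) a μ b≤ ⟩
      ∑ (suc (suc b)) (λ r → ψ₀ a M (suc b ∸ r) (suc c) r * F (suc b ∸ r) (suc c) μ) + ∑ (suc (suc b)) (λ r → ψ₁ a M (suc b ∸ r) c r * F (suc b ∸ r) c μ)
        ≡⟨ cong₂ _+_ (∑-0 (suc (suc b)) {λ r → ψ₀ a M (suc b ∸ r) (suc c) r * F (suc b ∸ r) (suc c) μ} same) (∑-single (suc (suc b)) b {λ r → ψ₁ a M (suc b ∸ r) c r * F (suc b ∸ r) c μ} (NP.n≤1+n (suc b)) other) ⟩
      0ℚ + ψ₁ a M (suc b ∸ b) c b * F (suc b ∸ b) c μ
        ≡⟨ QP.+-identityˡ (ψ₁ a M (suc b ∸ b) c b * F (suc b ∸ b) c μ) ⟩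
      ψ₁ a M (suc b ∸ b) c b * F (suc b ∸ b) c μ
        ≡⟨ cong (λ z → ψ₁ a M z c b * F z c μ) one ⟩
      ψ₁ a M 1 c b * F 1 c μ
        ≡⟨ cong (λ z → z * Rfac M 1 c (+ a I.- + b) b * F 1 c μ) (α-leading b n (lem (+ b) (+ n)) (trans (cong (λ z → arm M z c I.- + b) (sym one)) (trans (arm≡ b (NP.n≤1+n b)) (cong (λ z → + 1 I.- + z) one)))) ⟩
      leading b n * (hh M 1 c * (hᵒ V * hᵒ W)) * F 1 c μ ∎
      where
      lem : ∀ b n → (+ 1 I.+ b I.+ n) I.- + 1 I.- b ≡ n
      lem = IR.solve-∀

-- Combined with `fPref-leading`, this shows that the leading coefficient is 1/f.
F-leading : ∀ c b n → F (suc b) c (suc b N.+ n ∷ suc b ∷ replicate c 1) * hh (suc b N.+ n N.+ suc b N.+ c) (suc b) c ≡ leading b n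
F-leading zero    b n = F-leading-0 b n
-- The shape left by the last strip has second row 1 and overhang b, which accounts for the instance
-- at `0` and `b`.
F-leading (suc c) b n = F-leading-suc b n c (F-leading c 0 b)

-- Prefactors and hook products

divQ-inverse : ∀ q → q ≢ 0ℚ → q * divZ (ℚ.↧ q) (ℚ.↥ q) ≡ 1ℚ
divQ-inverse q@(ℚ.mkℚ n d _) q≢0 = begin
  q * divZ (+ suc d) n
    ≡⟨ cong₂ _*_ (trans (sym (QP.↥p/↧p≡p q)) (divZ-ρ n (+ suc d))) (divZ-ρ (+ suc d) n) ⟩
  ι n * ρ (+ suc d) * (ι (+ suc d) * ρ n)
    ≡⟨ l (ι n) (ρ (+ suc d)) (ι (+ suc d)) (ρ n) ⟩
  ι n * ρ n * (ι (+ suc d) * ρ (+ suc d))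
    ≡⟨ cong₂ _*_ (ρ-inv n (λ e → q≢0 (QP.↥p≡0⇒p≡0 q e))) (ρ-inv (+ suc d) (λ ())) ⟩
  1ℚ * 1ℚ ∎
  where
  l : ∀ a b c d → a * b * (c * d) ≡ a * d * (c * b)
  l = solve-∀ ring

leading-inv : ∀ b n → leading b n * (κ (+ b) * (2ℚ * ι (+ b) + 1ℚ) * κ (+ n) * (γ (+ (b N.+ n)) * (2ℚ * ι (+ (b N.+ n)) + 1ℚ))) ≡ 1ℚ
leading-inv b n = trans (l (γ (+ b)) (γ (+ n)) (κ (+ (b N.+ n))) (2ℚ * ι (+ n) + 1ℚ) (κ (+ b)) (2ℚ * ι (+ b) + 1ℚ) (κ (+ n)) (γ (+ (b N.+ n))) (2ℚ * ι (+ (b N.+ n)) + 1ℚ))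
  (cong₂ _*_ (cong₂ _*_ (γκ-inv b) (γκ-inv n)) (γκ-inv (b N.+ n)))
  where
  l : ∀ gb gn kx on kb ob kn gx ox → gb * gn * kx * on * (kb * ob * kn * (gx * ox)) ≡ gb * kb * ob * (gn * kn * on) * (gx * kx * ox)
  l = solve-∀ ring

leading≢0 : ∀ b n → leading b n ≢ 0ℚ
leading≢0 b n e = absurd (trans (sym (leading-inv b n)) (zero-*ˡ e))
  where
  absurd : 1ℚ ≢ 0ℚ
  absurd ()

quotient : ℕ → ℕ → ℚ
quotient m n = ι (+ m) * ρ (+ n)

quotient-* : ∀ m n m' n' → n ≢ 0 → n' ≢ 0 → quotient (m N.* m') (n N.* n') ≡ quotient m n * quotient m' n'
quotient-* m n m' n' n≢0 n'≢0 = trans (cong₂ _*_ (ι-pos-* m m') (trans (cong ρ (IP.pos-* n n')) (ρ-* (+ n) (+ n') x y (*≢0 x y)))) (l (ι (+ m)) (ι (+ m')) (ρ (+ n)) (ρ (+ n')))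
  where
  x : + n ≢ + 0
  x e = n≢0 (IP.+-injective e)
  y : + n' ≢ + 0
  y e = n'≢0 (IP.+-injective e)
  l : ∀ a b c d → a * b * (c * d) ≡ a * c * (b * d)
  l = solve-∀ ring

h-ℕ : ∀ k → h (+ suc k) ≡ quotient (suc (suc k)) (suc k)
h-ℕ k = trans (h-quotient (+ suc k) (λ ())) (cong (λ z → ι (+ suc z) * ρ (+ suc k)) (NP.+-comm k 1))

hh-ℕ : ∀ a b c → hh (suc a N.+ suc b N.+ c) (suc b) c ≡ h (+ suc (suc (2 N.* a N.+ c))) * h (+ suc (2 N.* b N.+ c))
hh-ℕ a b c = cong₂ (λ x y → h x * h y) (trans (𝐀-shape (suc a) (suc b) c) (cong (λ z → + (z N.+ c)) (2*-suc a))) (𝐁-suc b c)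

fPref-leading : ∀ b n c → fPref (suc b N.+ n) (suc b) c * leading b n ≡ hh (suc b N.+ n N.+ suc b N.+ c) (suc b) c
fPref-leading b n c = begin
  E * divZ (ℚ.↧ S) (ℚ.↥ S) * leading b n
    ≡⟨ cong (E * divZ (ℚ.↧ S) (ℚ.↥ S) *_) (sym S≡) ⟩
  E * divZ (ℚ.↧ S) (ℚ.↥ S) * S
    ≡⟨ trans (QP.*-assoc E (divZ (ℚ.↧ S) (ℚ.↥ S)) S) (cong (E *_) (trans (QP.*-comm (divZ (ℚ.↧ S) (ℚ.↥ S)) S) (divQ-inverse S (λ e → leading≢0 b n (trans (sym S≡) e))))) ⟩
  E * 1ℚ
    ≡⟨ QP.*-identityʳ E ⟩
  E
    ≡⟨ trans (divZ-ρ (+ ((2 N.* a N.+ c N.+ 1) N.* (2 N.* suc b N.+ c))) (+ ((2 N.* a N.+ c) N.* (2 N.* suc b N.+ c ∸ 1))))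
         (cong₂ quotient (cong₂ N._*_ (trans (NP.+-comm (2 N.* a N.+ c) 1) (cong suc A≡)) B≡) (cong₂ N._*_ A≡ (cong (_∸ 1) B≡))) ⟩
  quotient (suc (suc (suc (2 N.* (b N.+ n) N.+ c))) N.* suc (suc (2 N.* b N.+ c))) (suc (suc (2 N.* (b N.+ n) N.+ c)) N.* suc (2 N.* b N.+ c))
    ≡⟨ quotient-* (suc (suc (suc (2 N.* (b N.+ n) N.+ c)))) (suc (suc (2 N.* (b N.+ n) N.+ c))) (suc (suc (2 N.* b N.+ c))) (suc (2 N.* b N.+ c)) (λ ()) (λ ()) ⟩
  quotient (suc (suc (suc (2 N.* (b N.+ n) N.+ c)))) (suc (suc (2 N.* (b N.+ n) N.+ c))) * quotient (suc (suc (2 N.* b N.+ c))) (suc (2 N.* b N.+ c))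
    ≡⟨ sym (trans (hh-ℕ (b N.+ n) b c) (cong₂ _*_ (h-ℕ (suc (2 N.* (b N.+ n) N.+ c))) (h-ℕ (2 N.* b N.+ c)))) ⟩
  hh (a N.+ suc b N.+ c) (suc b) c ∎
  where
  a : ℕ
  a = suc b N.+ n
  E S : ℚ
  E = divZ (+ ((2 N.* a N.+ c N.+ 1) N.* (2 N.* suc b N.+ c))) (+ ((2 N.* a N.+ c) N.* (2 N.* suc b N.+ c ∸ 1)))
  S = square (+ (b N.+ n)) (+ b)
  S≡ : S ≡ leading b n
  S≡ = square-γ b n
  A≡ : 2 N.* a N.+ c ≡ suc (suc (2 N.* (b N.+ n) N.+ c))
  A≡ = cong (N._+ c) (2*-suc (b N.+ n))
  B≡ : 2 N.* suc b N.+ c ≡ suc (suc (2 N.* b N.+ c))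
  B≡ = cong (N._+ c) (2*-suc b)

fPref-F : ∀ a b c → b N.≤ a → 1 N.≤ b ⊎ c ≡ 0 → fPref a b c * F b c (shape a b c) ≡ 1ℚ
fPref-F a zero c _ (inj₁ ())
fPref-F a zero .0 _ (inj₂ refl) = trans (QP.*-identityˡ (F 0 0 (a ∷ []))) (F-row a)
fPref-F a (suc b) c b≤a _ = subst (λ a → fPref a (suc b) c * F (suc b) c (shape a (suc b) c) ≡ 1ℚ) (NP.m+[n∸m]≡n b≤a) (cancel (leading b n) (fPref (suc b N.+ n) (suc b) c) (F (suc b) c (shape (suc b N.+ n) (suc b) c)) _ (leading-inv b n) (fPref-leading b n c) (F-leading c b n))
  where
  n : ℕ
  n = a ∸ suc b
  cancel : ∀ L p f X {H} → L * X ≡ 1ℚ → p * L ≡ H → f * H ≡ L → p * f ≡ 1ℚ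
  cancel L p f X {H} LX pL fH = trans (by-lc (lem L p f X) (lc1 {c = - (p * f)} (diff0 LX))) (trans (cong (λ z → f * z * X) pL) (trans (cong (_* X) fH) LX))
    where
    lem : ∀ L p f X → p * f ≡ f * (p * L) * X + (- (p * f)) * (L * X - 1ℚ)
    lem = solve-∀ ring

-- Hook products

𝚷 : ℕ → (ℕ → ℚ) → ℚ
𝚷 zero    f = 1ℚ
𝚷 (suc n) f = f 0 * 𝚷 n (f ∘ suc)

𝚷-cong : ∀ n {f g} → (∀ i → i N.< n → f i ≡ g i) → 𝚷 n f ≡ 𝚷 n g
𝚷-cong zero    e = refl
𝚷-cong (suc n) e = cong₂ _*_ (e 0 (s≤s z≤n)) (𝚷-cong n (λ i i<n → e (suc i) (s≤s i<n)))

quotient-∏ : ∀ n {F G} → (∀ i → G i ≢ 0) → quotient (∏ n F) (∏ n G) ≡ 𝚷 n (λ i → quotient (F i) (G i))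
quotient-∏ zero    nz = trans (cong₂ _*_ ι-1 refl) (trans (cong (_* ρ (+ 1)) (sym ι-1)) (ρ-inv (+ 1) (λ ())))
quotient-∏ (suc n) {F} {G} nz = trans (quotient-* (F 0) (G 0) (∏ n (F ∘ suc)) (∏ n (G ∘ suc)) (nz 0) (∏-nonzero n (λ i → nz (suc i)))) (cong (quotient (F 0) (G 0) *_) (quotient-∏ n (λ i → nz (suc i))))

-- The contribution of a box with arm a and leg l to c_λ / c'_λ.
box : ℕ → ℕ → ℚ
box a l = quotient (2 N.* a N.+ l N.+ 1) (2 N.* (1 N.+ a) N.+ l)

hookProd-∏ : ∀ g lam → hookProd g lam ≡ ∏ (length lam) (λ i → ∏ (at lam i) (λ j → g (at lam i ∸ j ∸ 1) (conjAt lam j ∸ i ∸ 1)))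
hookProd-∏ g lam = trans (product-∏ (λ i → NL.product (map (λ j → g (at lam i ∸ j ∸ 1) (conjAt lam j ∸ i ∸ 1)) (upTo (at lam i)))) id (length lam))
  (∏-cong< (length lam) (λ i _ → product-∏ (λ j → g (at lam i ∸ j ∸ 1) (conjAt lam j ∸ i ∸ 1)) id (at lam i)))

hookRow : List ℕ → ℕ → ℚ
hookRow lam i = 𝚷 (at lam i) (λ j → box (at lam i ∸ j ∸ 1) (conjAt lam j ∸ i ∸ 1))

hook-quotient : ∀ lam → divZ (+ cLam lam) (+ c'Lam lam) ≡ 𝚷 (length lam) (hookRow lam)
hook-quotient lam = trans (divZ-ρ (+ cLam lam) (+ c'Lam lam)) (trans (cong₂ quotient (hookProd-∏ (λ a l → 2 N.* a N.+ l N.+ 1) lam) (hookProd-∏ (λ a l → 2 N.* (1 N.+ a) N.+ l) lam))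
  (trans (quotient-∏ (length lam) (λ i → ∏-nonzero (at lam i) (λ j ())))
  (𝚷-cong (length lam) (λ i _ → quotient-∏ (at lam i) (λ j ())))))

-- A box contributes (d + 0)/(d + 1) with d = 2a + l + 1, the reciprocal of h(d); this lets boxes
-- cancel against `hh` and telescope along γ and κ.
box-h : ∀ a l → box a l * h (+ suc (2 N.* a N.+ l)) ≡ 1ℚ
box-h a l = begin
  box a l * h (+ suc k)
    ≡⟨ cong₂ _*_ (cong₂ quotient (NP.+-comm k 1) (cong (N._+ l) (2*-suc a))) (h-ℕ k) ⟩
  ι (+ suc k) * ρ (+ suc (suc k)) * (ι (+ suc (suc k)) * ρ (+ suc k))
    ≡⟨ lem (ι (+ suc k)) (ρ (+ suc (suc k))) (ι (+ suc (suc k))) (ρ (+ suc k)) ⟩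
  ι (+ suc k) * ρ (+ suc k) * (ι (+ suc (suc k)) * ρ (+ suc (suc k)))
    ≡⟨ cong₂ _*_ (ρ-inv (+ suc k) (λ ())) (ρ-inv (+ suc (suc k)) (λ ())) ⟩
  1ℚ * 1ℚ ∎
  where
  k : ℕ
  k = 2 N.* a N.+ l
  lem : ∀ a b c d → a * b * (c * d) ≡ a * d * (c * b)
  lem = solve-∀ ring

h-box-cancel : ∀ a l {x y} → x * h (+ suc (2 N.* a N.+ l)) ≡ y → box a l * y ≡ x
h-box-cancel a l {x} refl = trans (lem (box a l) x (h (+ suc (2 N.* a N.+ l)))) (trans (cong (x *_) (box-h a l)) (QP.*-identityʳ x))
  where
  lem : ∀ b x h → b * (x * h) ≡ x * (b * h)
  lem = solve-∀ ring

-- The factors (2a + 1)/(2a + 2) are the successive ratios of γ.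
legless-row : ∀ n → 𝚷 n (λ j → box (n ∸ j ∸ 1) 0) ≡ γ (+ n)
legless-row zero    = sym γ-0
legless-row (suc n) = trans (cong (box n 0 *_) (legless-row n)) (h-box-cancel n 0 (trans (cong (λ z → γ (+ suc n) * h (+ suc z)) (NP.+-identityʳ (2 N.* n))) (γ-h n)))

-- Boxes above the second row have leg 1 and contribute (2a + 2)/(2a + 3), the successive ratios of
-- κ; the overhang contributes γ(n). The corner box is kept out, because its leg also includes the
-- column.
first-row : ∀ b n (leg : ℕ → ℕ) → (∀ j → j N.< b → leg j ≡ 1) → (∀ j → b N.≤ j → j N.< b N.+ n → leg j ≡ 0) →
  𝚷 (b N.+ n) (λ j → box (b N.+ n ∸ j ∸ 1) (leg j)) * κ (+ n) ≡ γ (+ n) * κ (+ (b N.+ n))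
first-row zero n leg _ e₀ = cong (_* κ (+ n)) (trans (𝚷-cong n (λ j j<n → cong (box (n ∸ j ∸ 1)) (e₀ j z≤n j<n))) (legless-row n))
first-row (suc b) n leg e₁ e₀ = begin
  box (b N.+ n) (leg 0) * 𝚷 (b N.+ n) (λ j → box (b N.+ n ∸ j ∸ 1) (leg (suc j))) * κ (+ n)
    ≡⟨ trans (cong (λ l → box (b N.+ n) l * rest * κ (+ n)) (e₁ 0 (s≤s z≤n))) (QP.*-assoc (box (b N.+ n) 1) rest (κ (+ n))) ⟩
  box (b N.+ n) 1 * (rest * κ (+ n))
    ≡⟨ cong (box (b N.+ n) 1 *_) (first-row b n (leg ∘ suc) (λ j j<b → e₁ (suc j) (s≤s j<b)) (λ j b≤j j<n → e₀ (suc j) (s≤s b≤j) (s≤s j<n))) ⟩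
  box (b N.+ n) 1 * (γ (+ n) * κ (+ (b N.+ n)))
    ≡⟨ *-left-comm (box (b N.+ n) 1) (γ (+ n)) (κ (+ (b N.+ n))) ⟩
  γ (+ n) * (box (b N.+ n) 1 * κ (+ (b N.+ n)))
    ≡⟨ cong (γ (+ n) *_) (h-box-cancel (b N.+ n) 1 (trans (cong (λ z → κ (+ suc (b N.+ n)) * h (+ suc z)) (NP.+-comm (2 N.* (b N.+ n)) 1)) (κ-h (b N.+ n)))) ⟩
  γ (+ n) * κ (+ suc (b N.+ n)) ∎
  where
  rest : ℚ
  rest = 𝚷 (b N.+ n) (λ j → box (b N.+ n ∸ j ∸ 1) (leg (suc j)))

-- With arm 0 the factors are (l + 1)/(l + 2), and their product telescopes.
column : ∀ c → 𝚷 c (λ k → box 0 (c ∸ k ∸ 1)) ≡ ρ (+ suc c)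
column zero    = sym (trans (sym (QP.*-identityˡ (ρ (+ 1)))) (trans (cong (_* ρ (+ 1)) (sym ι-1)) (ρ-inv (+ 1) (λ ()))))
column (suc c) = begin
  box 0 c * 𝚷 c (λ k → box 0 (c ∸ k ∸ 1))
    ≡⟨ cong₂ _*_ (cong (λ z → quotient z (suc (suc c))) (NP.+-comm c 1)) (column c) ⟩
  ι (+ suc c) * ρ (+ suc (suc c)) * ρ (+ suc c)
    ≡⟨ lem (ι (+ suc c)) (ρ (+ suc (suc c))) (ρ (+ suc c)) ⟩
  ι (+ suc c) * ρ (+ suc c) * ρ (+ suc (suc c))
    ≡⟨ trans (cong (_* ρ (+ suc (suc c))) (ρ-inv (+ suc c) (λ ()))) (QP.*-identityˡ (ρ (+ suc (suc c)))) ⟩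
  ρ (+ suc (suc c)) ∎
  where
  lem : ∀ a b c → a * b * c ≡ a * c * b
  lem = solve-∀ ring

conjAt-∷-< : ∀ {x j} lam → j N.< x → conjAt (x ∷ lam) j ≡ suc (conjAt lam j)
conjAt-∷-< {x} {j} lam j<x with j N.<ᵇ x | <ᵇ-intro j<x
... | true | _ = refl

conjAt-∷-≥ : ∀ {x j} lam → x N.≤ j → conjAt (x ∷ lam) j ≡ conjAt lam j
conjAt-∷-≥ {x} {j} lam x≤j with j N.<ᵇ x | <ᵇ-false x≤j
... | false | _ = refl

conjAt-ones-0 : ∀ c → conjAt (replicate c 1) 0 ≡ c
conjAt-ones-0 zero    = refl
conjAt-ones-0 (suc c) = cong suc (conjAt-ones-0 c)

conjAt-ones-suc : ∀ c j → conjAt (replicate c 1) (suc j) ≡ 0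
conjAt-ones-suc zero    j = refl
conjAt-ones-suc (suc c) j = conjAt-ones-suc c j

at-ones : ∀ c k → k N.< c → at (replicate c 1) k ≡ 1
at-ones (suc c) zero    _ = refl
at-ones (suc c) (suc k) (s≤s k<c) = at-ones c k k<c

module _ (b n c : ℕ) where
  private
    a : ℕ
    a = suc b N.+ n
    lam : List ℕ
    lam = a ∷ suc b ∷ replicate c 1
    col₀ : conjAt lam 0 ≡ suc (suc c)
    col₀ = cong (suc ∘ suc) (conjAt-ones-0 c)
    col-inner : ∀ j → j N.< b → conjAt lam (suc j) ≡ 2
    col-inner j j<b = trans (conjAt-∷-< (suc b ∷ replicate c 1) (s≤s (NP.≤-trans j<b (NP.m≤m+n b n)))) (cong suc (trans (conjAt-∷-< (replicate c 1) (s≤s j<b)) (cong suc (conjAt-ones-suc c j))))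
    col-outer : ∀ j → b N.≤ j → j N.< b N.+ n → conjAt lam (suc j) ≡ 1
    col-outer j b≤j j<a = trans (conjAt-∷-< (suc b ∷ replicate c 1) (s≤s j<a)) (cong suc (trans (conjAt-∷-≥ (replicate c 1) (s≤s b≤j)) (conjAt-ones-suc c j)))
    X : ℚ
    X = 𝚷 (b N.+ n) (λ j → box (b N.+ n ∸ j ∸ 1) (conjAt lam (suc j) ∸ 0 ∸ 1))
    X-κ : X * κ (+ n) ≡ γ (+ n) * κ (+ (b N.+ n))
    X-κ = first-row b n (λ j → conjAt lam (suc j) ∸ 0 ∸ 1) (λ j j<b → cong (_∸ 1) (col-inner j j<b)) (λ j b≤j j<a → cong (_∸ 1) (col-outer j b≤j j<a))
    row₀ : hookRow lam 0 ≡ box (b N.+ n) (suc c) * X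
    row₀ = cong (λ l → box (b N.+ n) (l ∸ 0 ∸ 1) * X) col₀
    row₁ : hookRow lam 1 ≡ box b c * γ (+ b)
    row₁ = cong₂ (λ l y → box b (l ∸ 1 ∸ 1) * y) col₀ (trans (𝚷-cong b (λ j j<b → cong (λ l → box (b ∸ j ∸ 1) (l ∸ 1 ∸ 1)) (col-inner j j<b))) (legless-row b))
    row : ∀ k → k N.< c → hookRow lam (suc (suc k)) ≡ box 0 (c ∸ k ∸ 1)
    row k k<c = trans (cong (λ x → 𝚷 x (λ j → box (x ∸ j ∸ 1) (conjAt lam j ∸ suc (suc k) ∸ 1))) (at-ones c k k<c)) (trans (QP.*-identityʳ _) (cong (λ l → box 0 (l ∸ suc (suc k) ∸ 1)) col₀))

  -- The first boxes of the two upper rows have the long legs, and their factors cancel the two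
  -- factors of `hh`. What remains is given by `first-row`, `legless-row` and `column`.
  hook-quotient-shape : divZ (+ cLam lam) (+ c'Lam lam) * hh (a N.+ suc b N.+ c) (suc b) c ≡ γ (+ n) * ρ (+ suc c) * leading b n
  hook-quotient-shape = begin
    divZ (+ cLam lam) (+ c'Lam lam) * hh (a N.+ suc b N.+ c) (suc b) c
      ≡⟨ cong₂ _*_ (trans (hook-quotient lam) (trans (cong (λ k → 𝚷 (suc (suc k)) (hookRow lam)) (LP.length-replicate c)) (cong₂ _*_ row₀ (cong₂ _*_ row₁ (trans (𝚷-cong c row) (column c)))))) (trans (hh-ℕ (b N.+ n) b c) (cong (λ z → h (+ suc z) * h (+ suc (2 N.* b N.+ c))) (sym (NP.+-suc (2 N.* (b N.+ n)) c)))) ⟩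
    box (b N.+ n) (suc c) * X * (box b c * γ (+ b) * ρ (+ suc c)) * (h (+ suc (2 N.* (b N.+ n) N.+ suc c)) * h (+ suc (2 N.* b N.+ c)))
      ≡⟨ l₁ (box (b N.+ n) (suc c)) X (box b c) (γ (+ b)) (ρ (+ suc c)) (h (+ suc (2 N.* (b N.+ n) N.+ suc c))) (h (+ suc (2 N.* b N.+ c))) ⟩
    box (b N.+ n) (suc c) * h (+ suc (2 N.* (b N.+ n) N.+ suc c)) * (box b c * h (+ suc (2 N.* b N.+ c))) * (X * γ (+ b) * ρ (+ suc c))
      ≡⟨ cong₂ (λ x y → x * y * (X * γ (+ b) * ρ (+ suc c))) (box-h (b N.+ n) (suc c)) (box-h b c) ⟩
    1ℚ * 1ℚ * (X * γ (+ b) * ρ (+ suc c))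
      ≡⟨ cong (λ z → z * (X * γ (+ b) * ρ (+ suc c))) (sym (γκ-inv n)) ⟩
    γ (+ n) * κ (+ n) * (2ℚ * ι (+ n) + 1ℚ) * (X * γ (+ b) * ρ (+ suc c))
      ≡⟨ l₂ (γ (+ n)) (κ (+ n)) (2ℚ * ι (+ n) + 1ℚ) X (γ (+ b)) (ρ (+ suc c)) ⟩
    γ (+ n) * ρ (+ suc c) * (γ (+ b) * (X * κ (+ n)) * (2ℚ * ι (+ n) + 1ℚ))
      ≡⟨ trans (cong (λ z → γ (+ n) * ρ (+ suc c) * (γ (+ b) * z * (2ℚ * ι (+ n) + 1ℚ))) X-κ) (cong (λ z → γ (+ n) * ρ (+ suc c) * (z * (2ℚ * ι (+ n) + 1ℚ))) (sym (QP.*-assoc (γ (+ b)) (γ (+ n)) (κ (+ (b N.+ n)))))) ⟩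
    γ (+ n) * ρ (+ suc c) * leading b n ∎
    where
    l₁ : ∀ p x q g r u v → p * x * (q * g * r) * (u * v) ≡ p * u * (q * v) * (x * g * r)
    l₁ = solve-∀ ring
    l₂ : ∀ g k o x b r → g * k * o * (x * b * r) ≡ g * r * (b * (x * k) * o)
    l₂ = solve-∀ ring

choose-γ : ∀ n → ι (+ ((2 N.* n) NC.C n)) ≡ γ (+ n) * ι (+ (4 N.^ n))
choose-γ n = ι-cancel (+ (n N.!)) n!≢0 (ι-cancel (+ (n N.!)) n!≢0 (begin
  fact n * (fact n * ι (+ ((2 N.* n) NC.C n)))
    ≡⟨ l₁ (fact n) (ι (+ ((2 N.* n) NC.C n))) ⟩
  ι (+ ((2 N.* n) NC.C n)) * (fact n * fact n)
    ≡⟨ trans (choose-fact {2 N.* n} {n} n (cong (n N.+_) (NP.+-identityʳ n))) (sym (γ-fact n)) ⟩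
  γ (+ n) * (ι (+ even!! n) * ι (+ even!! n))
    ≡⟨ cong (λ e → γ (+ n) * (e * e)) (ι-pos-* (2 N.^ n) (n N.!)) ⟩
  γ (+ n) * (ι (+ (2 N.^ n)) * fact n * (ι (+ (2 N.^ n)) * fact n))
    ≡⟨ l₂ (γ (+ n)) (ι (+ (2 N.^ n))) (fact n) ⟩
  fact n * (fact n * (γ (+ n) * (ι (+ (2 N.^ n)) * ι (+ (2 N.^ n)))))
    ≡⟨ cong (λ z → fact n * (fact n * (γ (+ n) * z))) (trans (sym (ι-pos-* (2 N.^ n) (2 N.^ n))) (cong (ι ∘ +_) (trans (sym (NP.^-distribˡ-+-* 2 n n)) (trans (cong (2 N.^_) (cong (n N.+_) (sym (NP.+-identityʳ n)))) (sym (NP.^-*-assoc 2 2 n)))))) ⟩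
  fact n * (fact n * (γ (+ n) * ι (+ (4 N.^ n)))) ∎))
  where
  n!≢0 : + (n N.!) ≢ + 0
  n!≢0 e = N.≢-nonZero⁻¹ (n N.!) {{n NP.!≢0}} (IP.+-injective e)
  l₁ : ∀ f c → f * (f * c) ≡ c * (f * f)
  l₁ = solve-∀ ring
  l₂ : ∀ g p f → g * (p * f * (p * f)) ≡ f * (f * (g * (p * p)))
  l₂ = solve-∀ ring

qPref-γ : ∀ a b c {n} → a ∸ b ≡ n → qPref a b c ≡ γ (+ n) * ρ (+ suc c)
qPref-γ a b c refl = begin
  qPref a b c
    ≡⟨ divZ-ρ (+ ((2 N.* n) NC.C n)) (+ (4 N.^ n N.* suc c)) ⟩
  ι (+ ((2 N.* n) NC.C n)) * ρ (+ (4 N.^ n N.* suc c))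
    ≡⟨ cong₂ _*_ (choose-γ n) (trans (cong ρ (IP.pos-* (4 N.^ n) (suc c))) (ρ-* (+ (4 N.^ n)) (+ suc c) 4^≢0 (λ ()) (*≢0 4^≢0 (λ ())))) ⟩
  γ (+ n) * ι (+ (4 N.^ n)) * (ρ (+ (4 N.^ n)) * ρ (+ suc c))
    ≡⟨ l (γ (+ n)) (ι (+ (4 N.^ n))) (ρ (+ (4 N.^ n))) (ρ (+ suc c)) ⟩
  γ (+ n) * (ι (+ (4 N.^ n)) * ρ (+ (4 N.^ n))) * ρ (+ suc c)
    ≡⟨ cong (_* ρ (+ suc c)) (trans (cong (γ (+ n) *_) (ρ-inv (+ (4 N.^ n)) 4^≢0)) (QP.*-identityʳ (γ (+ n)))) ⟩
  γ (+ n) * ρ (+ suc c) ∎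
  where
  n : ℕ
  n = a ∸ b
  4^≢0 : + (4 N.^ n) ≢ + 0
  4^≢0 e = N.≢-nonZero⁻¹ (4 N.^ n) {{NP.m^n≢0 4 n}} (IP.+-injective e)
  l : ∀ g p r s → g * p * (r * s) ≡ g * (p * r) * s
  l = solve-∀ ring

-- Q and P differ by the factor c_λ / c'_λ, so this links their two prefactors; in the two-row case
-- both are compared through `leading` and `hh`.
qPref-fPref : ∀ a b c → b N.≤ a → 1 N.≤ b ⊎ c ≡ 0 → divZ (+ cLam (shape a b c)) (+ c'Lam (shape a b c)) * fPref a b c ≡ qPref a b c
qPref-fPref a zero c _ (inj₁ ())
qPref-fPref a zero .0 _ (inj₂ refl) = begin
  divZ (+ cLam (a ∷ [])) (+ c'Lam (a ∷ [])) * 1ℚ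
    ≡⟨ QP.*-identityʳ (divZ (+ cLam (a ∷ [])) (+ c'Lam (a ∷ []))) ⟩
  divZ (+ cLam (a ∷ [])) (+ c'Lam (a ∷ []))
    ≡⟨ hook-quotient (a ∷ []) ⟩
  𝚷 a (λ j → box (a ∸ j ∸ 1) (conjAt (a ∷ []) j ∸ 0 ∸ 1)) * 1ℚ
    ≡⟨ cong₂ _*_ (trans (𝚷-cong a (λ j j<a → cong (λ l → box (a ∸ j ∸ 1) (l ∸ 0 ∸ 1)) (conjAt-∷-< [] j<a))) (legless-row a)) (column 0) ⟩
  γ (+ a) * ρ (+ 1)
    ≡⟨ sym (qPref-γ a 0 0 refl) ⟩
  qPref a 0 0 ∎
qPref-fPref a (suc b) c b≤a _ = subst (λ a → divZ (+ cLam (shape a (suc b) c)) (+ c'Lam (shape a (suc b) c)) * fPref a (suc b) c ≡ qPref a (suc b) c) (NP.m+[n∸m]≡n b≤a)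
  (trans (cancel (leading b n) (fPref (suc b N.+ n) (suc b) c) (divZ (+ cLam (shape (suc b N.+ n) (suc b) c)) (+ c'Lam (shape (suc b N.+ n) (suc b) c))) _ (leading-inv b n) (fPref-leading b n c) (hook-quotient-shape b n c)) (sym (qPref-γ (suc b N.+ n) (suc b) c (NP.m+n∸m≡n (suc b) n))))
  where
  n : ℕ
  n = a ∸ suc b
  cancel : ∀ L p d X {H Q} → L * X ≡ 1ℚ → p * L ≡ H → d * H ≡ Q * L → d * p ≡ Q
  cancel L p d X {H} {Q} LX pL dH = trans (by-lc (lem₁ L p d X) (lc1 {c = - (d * p)} (diff0 LX))) (trans (cong (λ z → d * z * X) pL) (trans (cong (_* X) dH) (trans (QP.*-assoc Q L X) (trans (cong (Q *_) LX) (QP.*-identityʳ Q)))))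
    where
    lem₁ : ∀ L p d X → d * p ≡ d * (p * L) * X + (- (d * p)) * (L * X - 1ℚ)
    lem₁ = solve-∀ ring

-- Uniqueness

ι-positive : ∀ n → n ≢ 0 → 0ℚ ℚ.< ι (+ n)
ι-positive zero    n≢0 = ⊥-elim (n≢0 refl)
ι-positive (suc n) _   = subst (0ℚ ℚ.<_) (ι-ℕtoℚ (suc n)) (QP.positive⁻¹ (ℕtoℚ (suc n)) {{QP.normalize-pos (suc n) 1}})

square-positive : ∀ d → d ≡ 0ℚ ⊎ 0ℚ ℚ.< d * d
square-positive d = go (QP.<-cmp d 0ℚ)
  where
  go : Tri (d ℚ.< 0ℚ) (d ≡ 0ℚ) (0ℚ ℚ.< d) → d ≡ 0ℚ ⊎ 0ℚ ℚ.< d * d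
  go (tri≈ _ e _) = inj₁ e
  go (tri< n _ _) = inj₂ (QP.positive⁻¹ (d * d) {{QP.neg*neg⇒pos d {{ℚ.negative n}} d {{ℚ.negative n}}}})
  go (tri> _ _ p) = inj₂ (QP.positive⁻¹ (d * d) {{QP.pos*pos⇒pos d {{ℚ.positive p}} d {{ℚ.positive p}}}})

weighted-square : ∀ d n → n ≢ 0 → d ≡ 0ℚ ⊎ 0ℚ ℚ.< d * d * ι (+ n)
weighted-square d n n≢0 = go (square-positive d)
  where
  go : d ≡ 0ℚ ⊎ 0ℚ ℚ.< d * d → d ≡ 0ℚ ⊎ 0ℚ ℚ.< d * d * ι (+ n)
  go (inj₁ e) = inj₁ e
  go (inj₂ p) = inj₂ (QP.positive⁻¹ (d * d * ι (+ n)) {{QP.pos*pos⇒pos (d * d) {{ℚ.positive p}} (ι (+ n)) {{ℚ.positive (ι-positive n n≢0)}}}})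

module _ {X : Set} (d : X → ℚ) (w : X → ℕ) (w≢0 : ∀ x → w x ≢ 0) where

  squares-nonneg : ∀ xs → 0ℚ ℚ.≤ ∑L xs (λ x → d x * d x * ι (+ w x))
  squares-nonneg []       = QP.≤-refl
  squares-nonneg (x ∷ xs) = QP.+-mono-≤ (term (weighted-square (d x) (w x) (w≢0 x))) (squares-nonneg xs)
    where
    term : d x ≡ 0ℚ ⊎ 0ℚ ℚ.< d x * d x * ι (+ w x) → 0ℚ ℚ.≤ d x * d x * ι (+ w x)
    term (inj₁ e) = QP.≤-reflexive (sym (zero-*ˡ (zero-*ˡ e)))
    term (inj₂ p) = QP.<⇒≤ p

  -- A vanishing sum of positively weighted squares makes every coordinate on the list zero. The
  -- conclusion is put as the vanishing of an arbitrary linear form because that is how monomial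
  -- coefficients depend on the coordinates.
  squares-definite : ∀ xs (g : X → ℚ) → ∑L xs (λ x → d x * d x * ι (+ w x)) ≡ 0ℚ → ∑L xs (λ x → d x * g x) ≡ 0ℚ
  squares-definite []       g _ = refl
  squares-definite (x ∷ xs) g e = go (weighted-square (d x) (w x) (w≢0 x))
    where
    rest : ℚ
    rest = ∑L xs (λ x → d x * d x * ι (+ w x))
    go : d x ≡ 0ℚ ⊎ 0ℚ ℚ.< d x * d x * ι (+ w x) → d x * g x + ∑L xs (λ x → d x * g x) ≡ 0ℚ
    go (inj₁ z) = zero-sum (zero-*ˡ z) (squares-definite xs g (trans (sym (trans (cong (_+ rest) (zero-*ˡ (zero-*ˡ z))) (QP.+-identityˡ rest))) e))
    go (inj₂ p) = ⊥-elim (QP.<-irrefl (sym e) (QP.+-mono-<-≤ p (squares-nonneg xs)))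

module _ (N : ℕ) (q q' : List ℕ → ℚ) where
  private
    d : List ℕ → ℚ
    d ρ = q ρ + (- 1ℚ) * q' ρ

  mCoeff-diff : ∀ μ → mCoeff N d μ ≡ mCoeff N q μ + (- 1ℚ) * mCoeff N q' μ
  mCoeff-diff μ = trans (mCoeff-PM N d μ) (trans (∑L-cong (partitions N) (λ ρ → l (q ρ) (q' ρ) (PM ρ μ)))
    (trans (∑L-+ (partitions N) {λ ρ → q ρ * PM ρ μ} {λ ρ → (- 1ℚ) * (q' ρ * PM ρ μ)})
    (cong₂ _+_ (sym (mCoeff-PM N q μ)) (trans (∑L-*ˡ (partitions N) (- 1ℚ) {λ ρ → q' ρ * PM ρ μ}) (cong ((- 1ℚ) *_) (sym (mCoeff-PM N q' μ)))))))
    where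
    l : ∀ a b p → (a + (- 1ℚ) * b) * p ≡ a * p + (- 1ℚ) * (b * p)
    l = solve-∀ ring

  inner2-diff : ∀ e → inner2 N d e ≡ inner2 N q e + (- 1ℚ) * inner2 N q' e
  inner2-diff e = trans (inner2-∑L N d e) (trans (∑L-cong (partitions N) (λ ρ → l (q ρ) (q' ρ) (e ρ) (ι (+ norm ρ))))
    (trans (∑L-+ (partitions N) {λ ρ → q ρ * e ρ * ι (+ norm ρ)} {λ ρ → (- 1ℚ) * (q' ρ * e ρ * ι (+ norm ρ))})
    (cong₂ _+_ (sym (inner2-∑L N q e)) (trans (∑L-*ˡ (partitions N) (- 1ℚ) {λ ρ → q' ρ * e ρ * ι (+ norm ρ)}) (cong ((- 1ℚ) *_) (sym (inner2-∑L N q' e)))))))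
    where
    l : ∀ a b p n → (a + (- 1ℚ) * b) * p * n ≡ a * p * n + (- 1ℚ) * (b * p * n)
    l = solve-∀ ring

  private
    minus : ∀ {x y z : ℚ} → x ≡ z → y ≡ z → x + (- 1ℚ) * y ≡ 0ℚ
    minus {z = z} refl refl = l z
      where
      l : ∀ z → z + (- 1ℚ) * z ≡ 0ℚ
      l = solve-∀ ring
    minus⁻¹ : ∀ x y → x + (- 1ℚ) * y ≡ 0ℚ → x ≡ y
    minus⁻¹ x y e = by-lc (l x y) (lc1 {c = 1ℚ} e)
      where
      l : ∀ x y → x ≡ y + 1ℚ * (x + (- 1ℚ) * y)
      l = solve-∀ ring
    sdom-cases : ∀ ν lam → sdom ν lam ≡ false → dom ν lam ≡ false ⊎ ν ≡ lam
    sdom-cases ν lam e = go (dom ν lam) (listEq ν lam) refl refl e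
      where
      go : ∀ b b' → dom ν lam ≡ b → listEq ν lam ≡ b' → b ∧ not b' ≡ false → dom ν lam ≡ false ⊎ ν ≡ lam
      go false b'   p _  _ = inj₁ p
      go true  true _ p' _ = inj₂ (listEq-true p')
      go true  false _ _ ()

  -- The difference lies in the span of the m_ν with ν ◁ lam, so it is orthogonal to itself.
  jack-unique : ∀ lam → IsJackP2 N lam q → IsJackP2 N lam q' → ∀ μ → mCoeff N q μ ≡ mCoeff N q' μ
  jack-unique lam (lead , tri , orth) (lead' , tri' , orth') μ = minus⁻¹ (mCoeff N q μ) (mCoeff N q' μ) (trans (sym (mCoeff-diff μ)) (trans (mCoeff-PM N d μ)
    (squares-definite d norm (λ ρ e → norm≢0 ρ (cong +_ e)) (partitions N) (λ ρ → PM ρ μ) (trans (sym (inner2-∑L N d d)) (trans (inner2-diff d) (minus (orth d below) (orth' d below)))))))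
    where
    below : Below N lam d
    below ν par sd = trans (mCoeff-diff ν) (go (sdom-cases ν lam sd))
      where
      go : dom ν lam ≡ false ⊎ ν ≡ lam → mCoeff N q ν + (- 1ℚ) * mCoeff N q' ν ≡ 0ℚ
      go (inj₁ e) = minus (tri ν par e) (tri' ν par e)
      go (inj₂ e) = minus (trans (cong (mCoeff N q) e) lead) (trans (cong (mCoeff N q') e) lead')

sum-par : ∀ {N} μ → isPar N μ ≡ true → NL.sum μ ≡ N
sum-par μ e = proj₂ (proj₂ (isPar⇒ μ e))

module _ (a b c : ℕ) (b≤a : b N.≤ a) (valid : 1 N.≤ b ⊎ c ≡ 0) (positive : 1 N.≤ a N.+ b N.+ c) where
  private
    N : ℕ
    N = a N.+ b N.+ c
    lam : List ℕ
    lam = shape a b c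

  jack-rep : Rep N lam (λ μ → fPref a b c * F b c μ)
  jack-rep = Rep-* (fPref a b c) (Rep-F a b c (b≤a , valid , positive))

  jack-exists : IsJackP2 N lam (proj₁ jack-rep)
  jack-exists = trans (proj₁ (proj₂ jack-rep) lam (sum-drop-shape a b c valid 0)) (fPref-F a b c b≤a valid) ,
    (λ μ par e → trans (proj₁ (proj₂ jack-rep) μ (sum-par μ par)) (zero-*ʳ {x = fPref a b c} (F-dominance a b c μ valid (sum-par μ par) e))) ,
    proj₂ (proj₂ jack-rep)

  jack-coefficients : ∀ q → IsJackP2 N lam q → ∀ μ → isPar N μ ≡ true → mCoeff N q μ ≡ fPref a b c * tabSum a b c μ
  jack-coefficients q jack μ par = trans (jack-unique N q (proj₁ jack-rep) lam jack jack-exists μ)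
    (trans (proj₁ (proj₂ jack-rep) μ (sum-par μ par)) (cong (fPref a b c *_) (sym (tabSum-F μ a b c b≤a valid (sym (sum-par μ par))))))

  jack-dual-coefficients : ∀ q → IsJackP2 N lam q → ∀ μ → isPar N μ ≡ true → qCoeff N lam q μ ≡ qPref a b c * tabSum a b c μ
  jack-dual-coefficients q jack μ par = trans (cong (divZ (+ cLam lam) (+ c'Lam lam) *_) (jack-coefficients q jack μ par))
    (trans (sym (QP.*-assoc (divZ (+ cLam lam) (+ c'Lam lam)) (fPref a b c) (tabSum a b c μ))) (cong (_* tabSum a b c μ) (qPref-fPref a b c b≤a valid)))

theorem4 : (a b c : ℕ) → b N.≤ a → (1 N.≤ b ⊎ c ≡ 0) → 1 N.≤ a N.+ b N.+ c →
  Σ (List ℕ → ℚ) (IsJackP2 (a N.+ b N.+ c) (shape a b c))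
  × ((q : List ℕ → ℚ) → IsJackP2 (a N.+ b N.+ c) (shape a b c) q →
     (μ : List ℕ) → isPar (a N.+ b N.+ c) μ ≡ true →
       (qCoeff (a N.+ b N.+ c) (shape a b c) q μ ≡ qPref a b c * tabSum a b c μ)
       × (mCoeff (a N.+ b N.+ c) q μ ≡ fPref a b c * tabSum a b c μ))
theorem4 a b c b≤a v pos = (proj₁ (jack-rep a b c b≤a v pos) , jack-exists a b c b≤a v pos) ,
  (λ q jack μ par → jack-dual-coefficients a b c b≤a v pos q jack μ par , jack-coefficients a b c b≤a v pos q jack μ par)
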